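{- There is a universal constant $\kappa>0$ such that for all finite sets $\mathcal X,\mathcal Y$, every function $f:\mathcal X\times\mathcal Y\to\{0,1\}$, every integer $n\ge 1$ and every $C>1/\kappa$: if $\mathsf{adv}(C,f)<1/2$, then $$\mathsf{adv}\Big(\frac{\kappa C\sqrt n}{\log(Cn)},\,f^{\oplus n}\Big)<\exp(-\kappa n).$$
   Context: We write $xy$ for the pair $(x,y)$. For $f:\mathcal X\times\mathcal Y\to\{0,1\}$, $f^{\oplus n}:\mathcal X^n\times\mathcal Y^n\to\{0,1\}$ is $f^{\oplus n}(xy)=f(x_1y_1)\oplus\cdots\oplus f(x_ny_n)$. Logarithms are base 2. A randomized two-party communication protocol $\pi$: Alice receives $x$, Bob receives $y$, they have public (shared) and private randomness and exchange bits; the output $\pi(xy)$ is determined by the transcript together with the public randomness. $\|\pi\|$ denotes the communication complexity of $\pi$, i.e. the maximum number of bits exchanged (public randomness is not counted). For real $C\ge 0$ and a Boolean function $g$, $$\mathsf{adv}(C,g)=\sup_{\|\pi\|\le C}\ \inf_{xy}\ \mathbb E\big[(-1)^{\pi(xy)+g(xy)}\big],$$ where the supremum is over randomized protocols, the infimum is over all inputs, and the expectation is over the randomness of the protocol. -}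

module Defs where

open import Level using (Level; 0ℓ; _⊔_) renaming (suc to lsuc)
open import Data.Bool using (Bool; true; false; if_then_else_; _xor_)
open import Data.Fin using (Fin)
open import Data.Integer using (+_)
open import Data.Nat as ℕ using (ℕ; zero; suc)
open import Data.Product using (Σ; ∃; _×_; _,_; proj₁; proj₂)
open import Data.Rational as ℚ using (ℚ; 0ℚ; 1ℚ)
import Data.Rational.Properties as ℚ
open import Data.Vec using (Vec; []; _∷_)
open import Data.Vec.Functional using (foldr)
open import Relation.Binary.PropositionalEquality using (refl)
open import Relation.Nullary using (¬_)

private
  variable
    a b i ℓ : Level

infix  4 _≤_ _<_ _≈_
infixl 6 _+_ _-_
infixl 7 _*_ _⊗_ _÷_
infix  8 -_

-- Extended reals, as closed lower Dedekind cuts: `below q` says q ≤ x.  The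
-- double negation in `closed` makes cuts ¬¬-stable, so that suprema and infima
-- of arbitrary families exist without excluded middle.  The empty cut is -∞ and
-- the full cut is +∞.

record ℝ∞ (ℓ : Level) : Set (lsuc ℓ) where
  field
    below  : ℚ → Set ℓ
    down   : ∀ {p q} → p ℚ.≤ q → below q → below p
    closed : ∀ {q} → (∀ p → p ℚ.< q → ¬ ¬ below p) → below q

open ℝ∞ public

_≤_ : ℝ∞ a → ℝ∞ b → Set (a ⊔ b)
x ≤ y = ∀ q → below x q → below y q

_<_ : ℝ∞ a → ℝ∞ b → Set (a ⊔ b)
x < y = ¬ (y ≤ x)

_≈_ : ℝ∞ a → ℝ∞ b → Set (a ⊔ b)
x ≈ y = x ≤ y × y ≤ x

ι : ℚ → ℝ∞ 0ℓ
ι r .below  q = q ℚ.≤ r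
ι r .down     = ℚ.≤-trans
ι r .closed h = ℚ.≮⇒≥ λ r<q →
  let p , r<p , p<q = ℚ.<-dense r<q
  in h p p<q λ p≤r → ℚ.<-irrefl refl (ℚ.<-≤-trans r<p p≤r)

⨆ : {I : Set i} → (I → ℝ∞ ℓ) → ℝ∞ (i ⊔ ℓ)
⨆ x .below q = ∀ p → p ℚ.< q → ¬ ¬ (∃ λ j → below (x j) p)
⨆ x .down p≤q h r r<p = h r (ℚ.<-≤-trans r<p p≤q)
⨆ x .closed h p p<q ¬∃ =
  let r , p<r , r<q = ℚ.<-dense p<q
  in h r r<q λ g → g p p<r ¬∃

⨅ : {I : Set i} → (I → ℝ∞ ℓ) → ℝ∞ (i ⊔ ℓ)
⨅ x .below q = ∀ j → below (x j) q
⨅ x .down p≤q h j = down (x j) p≤q (h j)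
⨅ x .closed h j = closed (x j) λ p p<q ¬b → h p p<q λ g → ¬b (g j)

Finite : ℝ∞ ℓ → Set ℓ
Finite x = (∃ λ p → ι p ≤ x) × (∃ λ q → x ≤ ι q)

-- The arithmetic operations are meant for finite arguments, with no particular
-- convention at ±∞.

fromℕ : ℕ → ℝ∞ 0ℓ
fromℕ n = ι (+ n ℚ./ 1)

_+_ : ℝ∞ 0ℓ → ℝ∞ 0ℓ → ℝ∞ 0ℓ
x + y = ⨆ {I = ∃ (below x) × ∃ (below y)} λ ((p , _) , (q , _)) → ι (p ℚ.+ q)

-_ : ℝ∞ 0ℓ → ℝ∞ 0ℓ
- x = ⨅ {I = ∃ (below x)} λ (p , _) → ι (ℚ.- p)

_-_ : ℝ∞ 0ℓ → ℝ∞ 0ℓ → ℝ∞ 0ℓ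
x - y = x + (- y)

-- The product x⁺ y⁺ of the positive parts.
_⊗_ : ℝ∞ 0ℓ → ℝ∞ 0ℓ → ℝ∞ 0ℓ
x ⊗ y = ⨆ {I = ∃ (below x) × ∃ (below y)}
          λ ((p , _) , (q , _)) → ι ((0ℚ ℚ.⊔ p) ℚ.* (0ℚ ℚ.⊔ q))

_*_ : ℝ∞ 0ℓ → ℝ∞ 0ℓ → ℝ∞ 0ℓ
x * y = (x ⊗ y + (- x) ⊗ (- y)) - (x ⊗ (- y) + (- x) ⊗ y)

-- Division by y > 0.  (For y ≤ 0 the value has no meaning.)
_÷_ : ℝ∞ 0ℓ → ℝ∞ 0ℓ → ℝ∞ 0ℓ
x ÷ y = ⨆ {I = ∃ λ q → ι q * y ≤ x} λ (q , _) → ι q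

-- The square root of x ≥ 0.
√_ : ℝ∞ 0ℓ → ℝ∞ 0ℓ
√ x = ⨆ {I = ∃ λ q → ι (q ℚ.* q) ≤ x} λ (q , _) → ι q

-- qᵏ / k!
expTerm : ℚ → ℕ → ℚ
expTerm q zero    = 1ℚ
expTerm q (suc k) = expTerm q k ℚ.* (q ℚ.* (+ 1 ℚ./ suc k))

expSum : ℚ → ℕ → ℚ
expSum q zero    = 0ℚ
expSum q (suc k) = expSum q k ℚ.+ expTerm q k

-- The limit of the exponential series, written as a limit inferior so that no
-- convergence proof is needed.
expℚ : ℚ → ℝ∞ 0ℓ
expℚ q = ⨆ λ N → ⨅ λ k → ι (expSum q (N ℕ.+ k))

-- Extension from ℚ, as exp is increasing and continuous.
exp : ℝ∞ 0ℓ → ℝ∞ 0ℓ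
exp x = ⨆ {I = ∃ (below x)} λ (q , _) → expℚ q

-- Logarithms of x > 0.
ln : ℝ∞ 0ℓ → ℝ∞ 0ℓ
ln x = ⨆ {I = ∃ λ q → expℚ q ≤ x} λ (q , _) → ι q

log₂ : ℝ∞ 0ℓ → ℝ∞ 0ℓ
log₂ x = ln x ÷ ln (fromℕ 2)

∑ : ∀ {n} → (Fin n → ℝ∞ 0ℓ) → ℝ∞ 0ℓ
∑ = foldr _+_ (ι 0ℚ)

record ProbSpace : Set₁ where
  field
    size        : ℕ
    weight      : Fin size → ℝ∞ 0ℓ
    nonNegative : ∀ ω → ι 0ℚ ≤ weight ω
    total       : ∑ weight ≈ ι 1ℚ

  Outcome : Set
  Outcome = Fin size

open ProbSpace public

𝔼 : (P : ProbSpace) → (Outcome P → ℝ∞ 0ℓ) → ℝ∞ 0ℓ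
𝔼 P F = ∑ λ ω → weight P ω * F ω

data Tree (A B : Set) : Set where
  output : Bool → Tree A B
  alice  : (A → Bool) → (Bool → Tree A B) → Tree A B
  bob    : (B → Bool) → (Bool → Tree A B) → Tree A B

module _ {A B : Set} where

  run : Tree A B → A → B → Bool
  run (output c)  x y = c
  run (alice m t) x y = run (t (m x)) x y
  run (bob m t)   x y = run (t (m y)) x y

  depth : Tree A B → ℕ
  depth (output _)  = 0
  depth (alice _ t) = suc (depth (t false) ℕ.⊔ depth (t true))
  depth (bob _ t)   = suc (depth (t false) ℕ.⊔ depth (t true))

-- The public outcome selects the tree, hence both the rules of communication
-- and the labels of the leaves.  A player's messages may depend on that
-- player's own input and private outcome.
record Protocol (X Y : Set) : Set₁ where
  field
    public-coins : ProbSpace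
    alice-coins  : ProbSpace
    bob-coins    : ProbSpace
    tree : Outcome public-coins → Tree (X × Outcome alice-coins) (Y × Outcome bob-coins)

open Protocol public

‖_‖ : {X Y : Set} → Protocol X Y → ℕ
‖ π ‖ = foldr ℕ._⊔_ 0 λ ω → depth (tree π ω)

-- (-1)ᶜ
sign : Bool → ℝ∞ 0ℓ
sign c = if c then ι (ℚ.- 1ℚ) else ι 1ℚ

-- The expectation of (-1)^(π(xy) + g(xy)).
bias : {X Y : Set} → Protocol X Y → (X × Y → Bool) → X × Y → ℝ∞ 0ℓ
bias π g (x , y) =
  𝔼 (public-coins π) λ ω →
  𝔼 (alice-coins π) λ α →
  𝔼 (bob-coins π) λ β →
  sign (run (tree π ω) (x , α) (y , β) xor g (x , y))

adv : {X Y : Set} → ℝ∞ 0ℓ → (X × Y → Bool) → ℝ∞ (lsuc 0ℓ)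
adv {X} {Y} C g =
  ⨆ {I = Σ (Protocol X Y) λ π → fromℕ ‖ π ‖ ≤ C} λ (π , _) → ⨅ (bias π g)

xor-power : {X Y : Set} (n : ℕ) → (X × Y → Bool) → Vec X n × Vec Y n → Bool
xor-power zero    f ([] , [])         = false
xor-power (suc n) f (x ∷ xs , y ∷ ys) = f (x , y) xor xor-power n f (xs , ys)

-- Suppose that for every product measure μⁿ some protocol of T bits has correlation exp(-κn) with f^{⊕n}.
-- Revealing x from the right and y from the left, let A_i be the conditional expectation of
-- (-1)^{f(x_i y_i)} times the sign already chosen, given x_{>i}, y_{≤i} and the transcript.  Reweighting μⁿ by
-- |A_0| ⋯ |A_{n-1}| gives a law P of density exp(O(κn)) at most, under which the transcript determines f(x_i y_i)
-- for a typical i up to bits known to the players.  By the chain rule some coordinate i costs information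
-- O(T/n + κ) only.  To compute f(x_i y_i), the players draw (x_{>i}, y_{<i}) by correlated sampling and then the
-- transcript bit by bit, each according to a private prediction and a common threshold; the predictions
-- diverge O(√(T · T/n)) times in expectation (Cauchy–Schwarz), and each divergence is found by
-- noisy binary search with O(log T) bits.  If T is below a small multiple of n, the tree is first replaced by its best leaf.
-- All entropies are replaced by the arithmetic–geometric mean inequality, so that everything is rational,
-- and boosting turns the protocols for all μ into one protocol for f.

module Submission where

-- The two vectors are revealed in opposite directions so that each player can compute one of the
-- two signs around coordinate i. The sign chosen before i depends on x_{≥i}, y_{<i} and the
-- transcript, the next one on x_{>i}, y_{≤i} and the transcript. Once x_{>i}, y_{<i} and the
-- transcript are shared, Alice knows the former, Bob knows the latter, and together they predict
-- f(x_i y_i). Two costs must be small at the same coordinate. Drawing every transcript bit from its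
-- owner's prediction errs only because of the reweighting: over all coordinates this costs O(κn),
-- without a term for T. What T pays for, O(κn + T) in all, is the disagreement of the two
-- predictions, and it governs only the number of divergences. For T below a small multiple of n the
-- summand κn would dominate and the divergences would number about √T instead of T/√n; hence the
-- passage to a leaf. As the conclusion is a negation, real weights may be replaced by rational ones
-- under double negation.

import Algebra.Solver.Ring as Solver
import Data.Integer as ℤ
import Data.Integer.Properties as ℤ
import Data.List as List
import Data.List.Properties as List
import Data.Nat as ℕ
import Data.Nat.Properties as ℕ
import Data.Rational as ℚ
import Data.Rational.Properties as ℚ
import Data.Rational.Unnormalised as ℚᵘ
import Data.Rational.Unnormalised.Properties as ℚᵘ
import Defs as R

-- Rational arithmetic, a ring solver, finite sums and products.

module Arithmetic where

 open import Data.Bool public using (Bool; true; false; if_then_else_; _∧_; _∨_; not; _xor_)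
 open import Data.Nat public using (ℕ; zero; suc; z≤n; s≤s)
 open import Data.List public using (List; []; _∷_; length; map; _++_; cartesianProduct; cartesianProductWith; downFrom)
 open import Data.List.Membership.Propositional public using (_∈_)
 open import Data.List.Relation.Unary.Any public using (here; there)
 open import Data.Product public using (Σ; ∃; _×_; _,_; proj₁; proj₂)
 open import Data.Sum public using (_⊎_; inj₁; inj₂)
 open import Data.Empty public using (⊥; ⊥-elim)
 open import Data.Unit public using (⊤; tt)
 open import Data.Rational public using (ℚ; 0ℚ; 1ℚ; ½; _≤_; _<_)
 open import Data.Rational using (_/_; 1/_)
 open import Data.Rational.Properties public using (module ≤-Reasoning; ≤-refl; ≤-trans; ≤-reflexive; ≤-total; ≤-antisym; <⇒≤; ≰⇒>; ≮⇒≥; <-≤-trans; ≤-<-trans; _≤?_; _<?_)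
 open import Data.Maybe using (Maybe; just; nothing)
 open import Function public using (_∘_; id; case_of_)
 open import Relation.Binary.PropositionalEquality public
  using (_≡_; _≢_; refl; sym; trans; cong; cong₂; subst; subst₂; module ≡-Reasoning)
 open import Relation.Nullary public using (¬_; Dec; yes; no; does)
 open import Relation.Nullary.Decidable using (True; toWitness)
 open import Algebra.Bundles.Raw using (RawRing)
 open import Algebra.Structures using (IsCommutativeRing)
 open import Algebra.Bundles using (CommutativeRing)
 open import Algebra.Solver.Ring.AlmostCommutativeRing using (AlmostCommutativeRing; fromCommutativeRing; _-Raw-AlmostCommutative⟶_)
 open import Level using (0ℓ)

 ≡≤ : ∀ {a b c : ℚ} → a ≡ b → b ≤ c → a ≤ c
 ≡≤ refl h = h

 ≤≡ : ∀ {a b c : ℚ} → a ≤ b → b ≡ c → a ≤ c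
 ≤≡ h refl = h

 ≡≤ᴺ : ∀ {a b c : ℕ} → a ≡ b → b ℕ.≤ c → a ℕ.≤ c
 ≡≤ᴺ refl h = h

 ≤≡ᴺ : ∀ {a b c : ℕ} → a ℕ.≤ b → b ≡ c → a ℕ.≤ c
 ≤≡ᴺ h refl = h

 -- Numerical inequalities are settled by evaluation, which requires the operations to be unfolded
 -- at the place of use.
 decide : ∀ {a b : ℚ} {_ : True (a ≤? b)} → a ≤ b
 decide {_} {_} {t} = toWitness t

 infixl 6 _+_ _-_
 infixl 7 _*_
 infix  8 -_

 -- The field operations are opaque, so that unification treats them as constructors.
 opaque
  _+_ _*_ : ℚ → ℚ → ℚ
  _+_ = ℚ._+_
  _*_ = ℚ._*_

  -_ : ℚ → ℚ
  -_ = ℚ.-_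

  nat : ℕ → ℚ
  nat n = ℤ.+ n / 1

  -- Total, with value 0 at 0: an average over a null class is then 0, and `a * inv a ≤ 1ℚ` holds
  -- for every a ≥ 0.
  inv : ℚ → ℚ
  inv q with q ℚ.≟ 0ℚ
  ... | yes _  = 0ℚ
  ... | no q≢0 = (1/ q) {{ℚ.≢-nonZero q≢0}}

 _-_ : ℚ → ℚ → ℚ
 a - b = a + (- b)

 opaque
  unfolding _+_

  isCommutativeRing : IsCommutativeRing _≡_ _+_ _*_ -_ 0ℚ 1ℚ
  isCommutativeRing = ℚ.+-*-isCommutativeRing

  +≡ : ∀ a b → a + b ≡ a ℚ.+ b
  +≡ a b = refl

  *≡ : ∀ a b → a * b ≡ a ℚ.* b
  *≡ a b = refl

  -≡ : ∀ a → - a ≡ ℚ.- a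
  -≡ a = refl

  nat≡ : ∀ n → nat n ≡ ℤ.+ n / 1
  nat≡ n = refl

  nat-0 : nat 0 ≡ 0ℚ
  nat-0 = refl

  nat-1 : nat 1 ≡ 1ℚ
  nat-1 = refl

  nat-+ : ∀ m n → nat (m ℕ.+ n) ≡ nat m + nat n
  nat-+ m n = ℚ.toℚᵘ-injective (begin
   ℚ.toℚᵘ (nat (m ℕ.+ n)) ≈⟨ ℚ.toℚᵘ-fromℚᵘ (ℚᵘ.mkℚᵘ (ℤ.+ (m ℕ.+ n)) 0) ⟩
   ℚᵘ.mkℚᵘ (ℤ.+ (m ℕ.+ n)) 0 ≈⟨ ℚᵘ.*≡* (cong (ℤ._* ℤ.+ 1) (sym (cong₂ ℤ._+_ (ℤ.*-identityʳ (ℤ.+ m)) (ℤ.*-identityʳ (ℤ.+ n))))) ⟩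
   ℚᵘ.mkℚᵘ (ℤ.+ m) 0 ℚᵘ.+ ℚᵘ.mkℚᵘ (ℤ.+ n) 0 ≈⟨ ℚᵘ.+-cong (ℚ.toℚᵘ-fromℚᵘ (ℚᵘ.mkℚᵘ (ℤ.+ m) 0)) (ℚ.toℚᵘ-fromℚᵘ (ℚᵘ.mkℚᵘ (ℤ.+ n) 0)) ⟨
   ℚ.toℚᵘ (nat m) ℚᵘ.+ ℚ.toℚᵘ (nat n) ≈⟨ ℚ.toℚᵘ-homo-+ (nat m) (nat n) ⟨
   ℚ.toℚᵘ (nat m + nat n) ∎)
   where
   import Data.Rational.Unnormalised.Properties as ℚᵘ
   open ℚᵘ.≃-Reasoning

  +-mono-≤ : ∀ {a b c d} → a ≤ b → c ≤ d → a + c ≤ b + d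
  +-mono-≤ = ℚ.+-mono-≤

  +-mono-<-≤ : ∀ {a b c d} → a < b → c ≤ d → a + c < b + d
  +-mono-<-≤ = ℚ.+-mono-<-≤

  neg≤ : ∀ {a b} → a ≤ b → - b ≤ - a
  neg≤ = ℚ.neg-antimono-≤

  *≤ˡ : ∀ {a b c} → 0ℚ ≤ c → a ≤ b → c * a ≤ c * b
  *≤ˡ {c = c} h k = ℚ.*-monoˡ-≤-nonNeg c {{ℚ.nonNegative h}} k

  *<ˡ : ∀ {a b c} → 0ℚ < c → a < b → c * a < c * b
  *<ˡ {c = c} h k = ℚ.*-monoʳ-<-pos c {{ℚ.positive h}} k

  inv-0 : inv 0ℚ ≡ 0ℚ
  inv-0 = refl

  *inv : ∀ {a} → 0ℚ < a → a * inv a ≡ 1ℚ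
  *inv {a} h with a ℚ.≟ 0ℚ
  ... | yes e  = ⊥-elim (ℚ.<⇒≢ h (sym e))
  ... | no a≢0 = ℚ.*-inverseʳ a {{ℚ.≢-nonZero a≢0}}

  0<inv : ∀ {a} → 0ℚ < a → 0ℚ < inv a
  0<inv {a} h with a ℚ.≟ 0ℚ
  ... | yes e  = ⊥-elim (ℚ.<⇒≢ h (sym e))
  ... | no a≢0 = ℚ.positive⁻¹ _ {{ℚ.1/pos⇒pos a {{ℚ.positive h}}}}

  archimedean : ∀ q → ∃ λ n → q ≤ nat n
  archimedean q@(ℚ.mkℚ i d-1 _) = ℤ.∣ i ∣ , ℚ.toℚᵘ-cancel-≤ (ℚᵘ.≤-respʳ-≃ (ℚᵘ.≃-sym (ℚ.toℚᵘ-fromℚᵘ (ℚᵘ.mkℚᵘ (ℤ.+ ℤ.∣ i ∣) 0))) (ℚᵘ.*≤* lem))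
   where
   import Data.Rational.Unnormalised.Properties as ℚᵘ
   i≤ : ∀ j → j ℤ.≤ ℤ.+ ℤ.∣ j ∣
   i≤ (ℤ.+ k) = ℤ.≤-refl
   i≤ (ℤ.-[1+ k ]) = ℤ.-≤+
   lem : i ℤ.* ℤ.+ 1 ℤ.≤ ℤ.+ ℤ.∣ i ∣ ℤ.* ℤ.+ suc d-1
   lem = subst (ℤ._≤ ℤ.+ ℤ.∣ i ∣ ℤ.* ℤ.+ suc d-1) (sym (ℤ.*-identityʳ i))
    (ℤ.≤-trans (i≤ i) (subst (ℤ._≤ ℤ.+ ℤ.∣ i ∣ ℤ.* ℤ.+ suc d-1) (ℤ.*-identityʳ (ℤ.+ ℤ.∣ i ∣)) (ℤ.*-monoˡ-≤-nonNeg (ℤ.+ ℤ.∣ i ∣) (ℤ.+≤+ (s≤s z≤n)))))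

 open IsCommutativeRing isCommutativeRing public
  using (+-assoc; +-comm; +-identityˡ; +-identityʳ; *-assoc; *-comm; *-identityˡ; *-identityʳ; distribˡ; distribʳ; zeroˡ; zeroʳ)
  renaming (-‿inverseʳ to +-inverseʳ; -‿inverseˡ to +-inverseˡ)

 commutativeRing : CommutativeRing 0ℓ 0ℓ
 commutativeRing = record { isCommutativeRing = isCommutativeRing }

 private
  -- As `nat` is opaque, 0 and ±1 have clauses of their own; otherwise the constants of the solver
  -- would not reduce to the literals `0ℚ` and `1ℚ` that occur in goals.
  ⟦_⟧ℤ : ℤ.ℤ → ℚ
  ⟦ ℤ.+ 0 ⟧ℤ = 0ℚ
  ⟦ ℤ.+ 1 ⟧ℤ = 1ℚ
  ⟦ ℤ.+ suc (suc n) ⟧ℤ = nat (suc (suc n))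
  ⟦ ℤ.-[1+ 0 ] ⟧ℤ = - 1ℚ
  ⟦ ℤ.-[1+ suc n ] ⟧ℤ  = - nat (suc (suc n))

  opaque
   unfolding _+_

   ⟦⟧ℤ≡ : ∀ i → ⟦ i ⟧ℤ ≡ i / 1
   ⟦⟧ℤ≡ (ℤ.+ 0) = refl
   ⟦⟧ℤ≡ (ℤ.+ 1) = refl
   ⟦⟧ℤ≡ (ℤ.+ suc (suc n)) = refl
   ⟦⟧ℤ≡ ℤ.-[1+ 0 ] = refl
   ⟦⟧ℤ≡ ℤ.-[1+ suc n ]    = refl

   toᵘ : ∀ i → ℚ.toℚᵘ ⟦ i ⟧ℤ ℚᵘ.≃ ℚᵘ.mkℚᵘ i 0
   toᵘ i rewrite ⟦⟧ℤ≡ i = ℚ.toℚᵘ-fromℚᵘ (ℚᵘ.mkℚᵘ i 0)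

   ⟦⟧ℤ-+ : ∀ i j → ⟦ i ℤ.+ j ⟧ℤ ≡ ⟦ i ⟧ℤ + ⟦ j ⟧ℤ
   ⟦⟧ℤ-+ i j = ℚ.toℚᵘ-injective (begin
    ℚ.toℚᵘ ⟦ i ℤ.+ j ⟧ℤ ≈⟨ toᵘ (i ℤ.+ j) ⟩
    ℚᵘ.mkℚᵘ (i ℤ.+ j) 0 ≈⟨ ℚᵘ.*≡* (cong (ℤ._* ℤ.+ 1) (sym (cong₂ ℤ._+_ (ℤ.*-identityʳ i) (ℤ.*-identityʳ j)))) ⟩
    ℚᵘ.mkℚᵘ i 0 ℚᵘ.+ ℚᵘ.mkℚᵘ j 0 ≈⟨ ℚᵘ.+-cong (toᵘ i) (toᵘ j) ⟨
    ℚ.toℚᵘ ⟦ i ⟧ℤ ℚᵘ.+ ℚ.toℚᵘ ⟦ j ⟧ℤ   ≈⟨ ℚ.toℚᵘ-homo-+ ⟦ i ⟧ℤ ⟦ j ⟧ℤ ⟨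
    ℚ.toℚᵘ (⟦ i ⟧ℤ + ⟦ j ⟧ℤ) ∎)
    where
    import Data.Rational.Unnormalised.Properties as ℚᵘ
    open ℚᵘ.≃-Reasoning

   ⟦⟧ℤ-* : ∀ i j → ⟦ i ℤ.* j ⟧ℤ ≡ ⟦ i ⟧ℤ * ⟦ j ⟧ℤ
   ⟦⟧ℤ-* i j = ℚ.toℚᵘ-injective (begin
    ℚ.toℚᵘ ⟦ i ℤ.* j ⟧ℤ ≈⟨ toᵘ (i ℤ.* j) ⟩
    ℚᵘ.mkℚᵘ i 0 ℚᵘ.* ℚᵘ.mkℚᵘ j 0 ≈⟨ ℚᵘ.*-cong (toᵘ i) (toᵘ j) ⟨
    ℚ.toℚᵘ ⟦ i ⟧ℤ ℚᵘ.* ℚ.toℚᵘ ⟦ j ⟧ℤ   ≈⟨ ℚ.toℚᵘ-homo-* ⟦ i ⟧ℤ ⟦ j ⟧ℤ ⟨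
    ℚ.toℚᵘ (⟦ i ⟧ℤ * ⟦ j ⟧ℤ) ∎)
    where
    import Data.Rational.Unnormalised.Properties as ℚᵘ
    open ℚᵘ.≃-Reasoning

   ⟦⟧ℤ-neg : ∀ i → ⟦ ℤ.- i ⟧ℤ ≡ - ⟦ i ⟧ℤ
   ⟦⟧ℤ-neg i = ℚ.toℚᵘ-injective (begin
    ℚ.toℚᵘ ⟦ ℤ.- i ⟧ℤ ≈⟨ toᵘ (ℤ.- i) ⟩
    ℚᵘ.- ℚᵘ.mkℚᵘ i 0 ≈⟨ ℚᵘ.-‿cong (toᵘ i) ⟨
    ℚᵘ.- ℚ.toℚᵘ ⟦ i ⟧ℤ ≈⟨ ℚ.toℚᵘ-homo‿- ⟦ i ⟧ℤ ⟨
    ℚ.toℚᵘ (- ⟦ i ⟧ℤ) ∎)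
    where
    import Data.Rational.Unnormalised.Properties as ℚᵘ
    open ℚᵘ.≃-Reasoning

  acr : AlmostCommutativeRing 0ℓ 0ℓ
  acr = fromCommutativeRing commutativeRing

  ℤ-raw : RawRing 0ℓ 0ℓ
  ℤ-raw = CommutativeRing.rawRing ℤ.+-*-commutativeRing

  morphism : ℤ-raw -Raw-AlmostCommutative⟶ acr
  morphism = record
   { ⟦_⟧ = ⟦_⟧ℤ ; +-homo = ⟦⟧ℤ-+ ; *-homo = ⟦⟧ℤ-* ; -‿homo = ⟦⟧ℤ-neg ; 0-homo = refl ; 1-homo = refl }

  decEq : ∀ i j → Maybe (⟦ i ⟧ℤ ≡ ⟦ j ⟧ℤ)
  decEq i j with i ℤ.≟ j
  ... | yes refl = just refl
  ... | no _     = nothing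

 open Solver ℤ-raw acr morphism decEq public
  using (Polynomial; solve; _:=_; _:+_; _:*_; _:-_; :-_; con)

 :0 :1 :2 : ∀ {n} → Polynomial n
 :0 = con (ℤ.+ 0)
 :1 = con (ℤ.+ 1)
 :2 = :1 :+ :1

 private
  variable
   a b c d : ℚ

 infixr 9 _^_

 _^_ : ℚ → ℕ → ℚ
 q ^ zero  = 1ℚ
 q ^ suc n = q * q ^ n

 ⟦_⟧ : Bool → ℚ
 ⟦ true ⟧  = 1ℚ
 ⟦ false ⟧ = 0ℚ

 ≤-by : ∀ c → 0ℚ ≤ c → a + c ≡ b → a ≤ b
 ≤-by {a} c h e = subst₂ _≤_ (+-identityʳ a) e (+-mono-≤ (≤-refl {a}) h)

 ≤-by-- : 0ℚ ≤ c → b - a ≡ c → a ≤ b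
 ≤-by-- {c} {b} {a} h e = ≤-by c h (trans (cong (a +_) (sym e)) (solve 2 (λ a b → a :+ (b :- a) := b) refl a b))

 0≤- : a ≤ b → 0ℚ ≤ b - a
 0≤- {a} {b} h = subst (_≤ b - a) (+-inverseʳ a) (+-mono-≤ h (≤-refl { - a}))

 -≥0 : 0ℚ ≤ b - a → a ≤ b
 -≥0 h = ≤-by-- h refl

 -≤ : a ≤ b → c ≤ d → a - d ≤ b - c
 -≤ h k = +-mono-≤ h (neg≤ k)

 +≤ˡ : ∀ c → a ≤ b → c + a ≤ c + b
 +≤ˡ c h = +-mono-≤ (≤-refl {c}) h

 +≤ʳ : ∀ c → a ≤ b → a + c ≤ b + c
 +≤ʳ c h = +-mono-≤ h (≤-refl {c})

 ≤-by+ˡ : 0ℚ ≤ b → a ≤ a + b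
 ≤-by+ˡ h = ≤-by _ h refl

 ≤-by+ʳ : 0ℚ ≤ b → a ≤ b + a
 ≤-by+ʳ {b} {a} h = ≤-by b h (+-comm a b)

 0≤1 : 0ℚ ≤ 1ℚ
 0≤1 = ℚ.*≤* (ℤ.+≤+ z≤n)

 0<1 : 0ℚ < 1ℚ
 0<1 = ℚ.*<* (ℤ.+<+ (s≤s z≤n))

 *≤ʳ : 0ℚ ≤ c → a ≤ b → a * c ≤ b * c
 *≤ʳ {c} {a} {b} h k = subst₂ _≤_ (*-comm c a) (*-comm c b) (*≤ˡ h k)

 *≤ : 0ℚ ≤ a → a ≤ b → 0ℚ ≤ c → c ≤ d → a * c ≤ b * d
 *≤ ha hab hc hcd = ≤-trans (*≤ʳ hc hab) (*≤ˡ (≤-trans ha hab) hcd)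

 0≤+ : 0ℚ ≤ a → 0ℚ ≤ b → 0ℚ ≤ a + b
 0≤+ {a} {b} h k = subst (_≤ a + b) (+-identityˡ 0ℚ) (+-mono-≤ h k)

 0≤* : 0ℚ ≤ a → 0ℚ ≤ b → 0ℚ ≤ a * b
 0≤* {a} {b} h k = subst (_≤ a * b) (zeroʳ a) (*≤ˡ h k)

 *≤1 : 0ℚ ≤ a → a ≤ 1ℚ → 0ℚ ≤ b → b ≤ 1ℚ → a * b ≤ 1ℚ
 *≤1 {a} {b} h k h' k' = subst (a * b ≤_) (*-identityˡ 1ℚ) (*≤ h k h' k')

 0<* : 0ℚ < a → 0ℚ < b → 0ℚ < a * b
 0<* {a} {b} h k = subst (_< a * b) (zeroʳ a) (*<ˡ h k)

 0<+ˡ : 0ℚ < a → 0ℚ ≤ b → 0ℚ < a + b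
 0<+ˡ {a} {b} h k = subst (_< a + b) (+-identityˡ 0ℚ) (+-mono-<-≤ h k)

 <-irrefl : ¬ (a < a)
 <-irrefl = ℚ.<-irrefl refl

 0≤sq : ∀ a → 0ℚ ≤ a * a
 0≤sq a with ≤-total 0ℚ a
 ... | inj₁ h = 0≤* h h
 ... | inj₂ h = subst (0ℚ ≤_) (solve 1 (λ a → (:- a) :* (:- a) := a :* a) refl a) (0≤* h' h')
  where
  h' : 0ℚ ≤ - a
  h' = subst (_≤ - a) (solve 0 (:- :0 := :0) refl) (neg≤ h)

 *-cancel-≤ : 0ℚ < c → a * c ≤ b * c → a ≤ b
 *-cancel-≤ {c} {a} {b} h k with a ≤? b
 ... | yes p = p
 ... | no ¬p = ⊥-elim (<-irrefl (≤-<-trans k (subst₂ _<_ (*-comm c b) (*-comm c a) (*<ˡ h (≰⇒> ¬p)))))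

 sq-cancel-≤ : 0ℚ ≤ b → a * a ≤ b * b → a ≤ b
 sq-cancel-≤ {b} {a} hb h with a ≤? b
 ... | yes p = p
 ... | no ¬p = ⊥-elim (<-irrefl (≤-<-trans h (≤-<-trans (*≤ˡ hb (<⇒≤ b<a)) (subst (_< a * a) (*-comm a b) (*<ˡ (≤-<-trans hb b<a) b<a)))))
  where
  b<a : b < a
  b<a = ≰⇒> ¬p

 ≡0⊎0< : 0ℚ ≤ a → (a ≡ 0ℚ) ⊎ (0ℚ < a)
 ≡0⊎0< {a} h with 0ℚ <? a
 ... | yes p = inj₂ p
 ... | no ¬p = inj₁ (≤-antisym (≮⇒≥ ¬p) h)

 0≤inv : 0ℚ ≤ a → 0ℚ ≤ inv a
 0≤inv h with ≡0⊎0< h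
 ... | inj₁ refl = ≤-reflexive (sym inv-0)
 ... | inj₂ p    = <⇒≤ (0<inv p)

 *inv≤1 : 0ℚ ≤ a → a * inv a ≤ 1ℚ
 *inv≤1 h with ≡0⊎0< h
 ... | inj₁ refl = ≡≤ (zeroˡ _) 0≤1
 ... | inj₂ p    = ≤-reflexive (*inv p)

 ≡inv : 0ℚ < a → a * b ≡ 1ℚ → b ≡ inv a
 ≡inv {a} {b} h e = begin
  b ≡⟨ *-identityʳ b ⟨
  b * 1ℚ ≡⟨ cong (b *_) (*inv h) ⟨
  b * (a * inv a)   ≡⟨ solve 3 (λ a b c → b :* (a :* c) := (a :* b) :* c) refl a b (inv a) ⟩
  (a * b) * inv a   ≡⟨ cong (_* inv a) e ⟩
  1ℚ * inv a ≡⟨ *-identityˡ _ ⟩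
  inv a ∎
  where open ≡-Reasoning

 inv-* : 0ℚ < a → 0ℚ < b → inv (a * b) ≡ inv a * inv b
 inv-* {a} {b} h k = sym (≡inv (0<* h k) (trans
  (solve 4 (λ a b c d → a :* b :* (c :* d) := (a :* c) :* (b :* d)) refl a b (inv a) (inv b))
  (trans (cong₂ _*_ (*inv h) (*inv k)) (*-identityˡ 1ℚ))))

 inv-inv : 0ℚ < a → inv (inv a) ≡ a
 inv-inv {a} h = sym (≡inv (0<inv h) (trans (*-comm _ a) (*inv h)))

 inv-1 : inv 1ℚ ≡ 1ℚ
 inv-1 = sym (≡inv 0<1 (*-identityˡ 1ℚ))

 *inv-cancel : 0ℚ < b → a * b * inv b ≡ a
 *inv-cancel {b} {a} h = trans (*-assoc a b (inv b)) (trans (cong (a *_) (*inv h)) (*-identityʳ a))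

 inv*-cancel : 0ℚ < b → a * inv b * b ≡ a
 inv*-cancel {b} {a} h = trans (solve 3 (λ a b c → a :* c :* b := a :* b :* c) refl a b (inv b)) (*inv-cancel h)

 ≤*inv : 0ℚ < b → a * b ≤ c → a ≤ c * inv b
 ≤*inv {b} {a} {c} h k = subst (_≤ c * inv b) (*inv-cancel h) (*≤ʳ (<⇒≤ (0<inv h)) k)

 *inv≤ : 0ℚ < b → a ≤ c * b → a * inv b ≤ c
 *inv≤ {b} {a} {c} h k = subst (a * inv b ≤_) (*inv-cancel h) (*≤ʳ (<⇒≤ (0<inv h)) k)

 inv-anti : 0ℚ < a → a ≤ b → inv b ≤ inv a
 inv-anti {a} {b} h k = subst₂ _≤_ (*-identityˡ _) (*-identityˡ _) (*inv≤ h' (subst (1ℚ ≤_) (solve 2 (λ b c → b :* c := :1 :* c :* b) refl b (inv a)) (≤*inv h (subst (_≤ b) (sym (*-identityˡ a)) k))))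
  where
  h' : 0ℚ < b
  h' = <-≤-trans h k

 0≤⟦⟧ : ∀ b → 0ℚ ≤ ⟦ b ⟧
 0≤⟦⟧ true  = 0≤1
 0≤⟦⟧ false = ≤-refl

 ⟦⟧≤1 : ∀ b → ⟦ b ⟧ ≤ 1ℚ
 ⟦⟧≤1 true  = ≤-refl
 ⟦⟧≤1 false = 0≤1

 ⟦∧⟧ : ∀ b c → ⟦ b ∧ c ⟧ ≡ ⟦ b ⟧ * ⟦ c ⟧
 ⟦∧⟧ true  c = sym (*-identityˡ _)
 ⟦∧⟧ false c = sym (zeroˡ _)

 guard-cong : ∀ p → (p ≡ true → a ≡ b) → ⟦ p ⟧ * a ≡ ⟦ p ⟧ * b
 guard-cong true  h = cong (1ℚ *_) (h refl)
 guard-cong {a} {b} false h = trans (zeroˡ a) (sym (zeroˡ b))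

 guard-mono : ∀ p → (p ≡ true → a ≤ b) → ⟦ p ⟧ * a ≤ ⟦ p ⟧ * b
 guard-mono true  h = *≤ˡ 0≤1 (h refl)
 guard-mono {a} {b} false h = ≤-reflexive (trans (zeroˡ a) (sym (zeroˡ b)))

 nat-suc : ∀ n → nat (suc n) ≡ 1ℚ + nat n
 nat-suc n = trans (nat-+ 1 n) (cong (_+ nat n) nat-1)

 nat-* : ∀ m n → nat (m ℕ.* n) ≡ nat m * nat n
 nat-* zero n = trans nat-0 (sym (trans (cong (_* nat n) nat-0) (zeroˡ (nat n))))
 nat-* (suc m) n = begin
  nat (n ℕ.+ m ℕ.* n) ≡⟨ nat-+ n (m ℕ.* n) ⟩
  nat n + nat (m ℕ.* n) ≡⟨ cong (nat n +_) (nat-* m n) ⟩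
  nat n + nat m * nat n ≡⟨ solve 2 (λ a b → b :+ a :* b := (:1 :+ a) :* b) refl (nat m) (nat n) ⟩
  (1ℚ + nat m) * nat n ≡⟨ cong (_* nat n) (nat-suc m) ⟨
  nat (suc m) * nat n ∎
  where open ≡-Reasoning

 0≤nat : ∀ n → 0ℚ ≤ nat n
 0≤nat zero    = ≤-reflexive (sym nat-0)
 0≤nat (suc n) = subst (0ℚ ≤_) (sym (nat-suc n)) (0≤+ 0≤1 (0≤nat n))

 0<nat : ∀ n → 0ℚ < nat (suc n)
 0<nat n = subst (0ℚ <_) (sym (nat-suc n)) (0<+ˡ 0<1 (0≤nat n))

 nat-mono : ∀ {m n} → m ℕ.≤ n → nat m ≤ nat n
 nat-mono {m} h with ℕ.m≤n⇒∃[o]m+o≡n h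
 ... | o , refl = ≤-by (nat o) (0≤nat o) (sym (nat-+ m o))

 nat-cancel-≤ : ∀ {m n} → nat m ≤ nat n → m ℕ.≤ n
 nat-cancel-≤ {m} {n} h with m ℕ.≤? n
 ... | yes p = p
 ... | no ¬p = ⊥-elim (<-irrefl (<-≤-trans n<1+n (≤-trans (nat-mono (ℕ.≰⇒> ¬p)) h)))
  where
  n<1+n : nat n < nat (suc n)
  n<1+n = subst₂ _<_ (+-identityˡ (nat n)) (sym (nat-suc n)) (+-mono-<-≤ 0<1 (≤-refl {nat n}))

 private
  variable
   A B : Set

 Sum : List A → (A → ℚ) → ℚ
 Sum [] f = 0ℚ
 Sum (x ∷ xs) f = f x + Sum xs f

 Prod : List A → (A → ℚ) → ℚ
 Prod [] f = 1ℚ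
 Prod (x ∷ xs) f = f x * Prod xs f

 module _ {f g : A → ℚ} where

  Sum-cong : ∀ xs → (∀ x → f x ≡ g x) → Sum xs f ≡ Sum xs g
  Sum-cong [] h = refl
  Sum-cong (x ∷ xs) h = cong₂ _+_ (h x) (Sum-cong xs h)

  Sum-mono : ∀ xs → (∀ x → f x ≤ g x) → Sum xs f ≤ Sum xs g
  Sum-mono [] h = ≤-refl
  Sum-mono (x ∷ xs) h = +-mono-≤ (h x) (Sum-mono xs h)

  Sum-mono∈ : ∀ xs → (∀ x → x ∈ xs → f x ≤ g x) → Sum xs f ≤ Sum xs g
  Sum-mono∈ [] h = ≤-refl
  Sum-mono∈ (x ∷ xs) h = +-mono-≤ (h x (here refl)) (Sum-mono∈ xs λ y y∈ → h y (there y∈))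

  Prod-cong : ∀ xs → (∀ x → f x ≡ g x) → Prod xs f ≡ Prod xs g
  Prod-cong [] h = refl
  Prod-cong (x ∷ xs) h = cong₂ _*_ (h x) (Prod-cong xs h)

  Sum-+ : ∀ xs → Sum xs (λ x → f x + g x) ≡ Sum xs f + Sum xs g
  Sum-+ [] = sym (+-identityˡ 0ℚ)
  Sum-+ (x ∷ xs) = trans (cong (_ +_) (Sum-+ xs)) (solve 4 (λ a b c d → a :+ b :+ (c :+ d) := a :+ c :+ (b :+ d)) refl _ _ _ _)

  Sum-- : ∀ xs → Sum xs (λ x → f x - g x) ≡ Sum xs f - Sum xs g
  Sum-- [] = sym (+-inverseʳ 0ℚ)
  Sum-- (x ∷ xs) = trans (cong (_ +_) (Sum-- xs)) (solve 4 (λ a b c d → a :- b :+ (c :- d) := a :+ c :- (b :+ d)) refl _ _ _ _)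

  Prod-* : ∀ xs → Prod xs (λ x → f x * g x) ≡ Prod xs f * Prod xs g
  Prod-* [] = sym (*-identityˡ 1ℚ)
  Prod-* (x ∷ xs) = trans (cong (_ *_) (Prod-* xs)) (solve 4 (λ a b c d → a :* b :* (c :* d) := a :* c :* (b :* d)) refl _ _ _ _)

 module _ {f : A → ℚ} where

  Sum-*ˡ : ∀ c xs → Sum xs (λ x → c * f x) ≡ c * Sum xs f
  Sum-*ˡ c [] = sym (zeroʳ c)
  Sum-*ˡ c (x ∷ xs) = trans (cong (_ +_) (Sum-*ˡ c xs)) (sym (distribˡ c (f x) (Sum xs f)))

  Sum-*ʳ : ∀ c xs → Sum xs (λ x → f x * c) ≡ Sum xs f * c
  Sum-*ʳ c [] = sym (zeroˡ c)
  Sum-*ʳ c (x ∷ xs) = trans (cong (_ +_) (Sum-*ʳ c xs)) (sym (distribʳ c (f x) (Sum xs f)))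

  Sum-≥0 : ∀ xs → (∀ x → 0ℚ ≤ f x) → 0ℚ ≤ Sum xs f
  Sum-≥0 [] h = ≤-refl
  Sum-≥0 (x ∷ xs) h = 0≤+ (h x) (Sum-≥0 xs h)

  Sum-∈ : ∀ {x} xs → (∀ x → 0ℚ ≤ f x) → x ∈ xs → f x ≤ Sum xs f
  Sum-∈ (x ∷ xs) h (here refl) = ≤-by+ˡ (Sum-≥0 xs h)
  Sum-∈ (y ∷ xs) h (there x∈) = ≤-trans (Sum-∈ xs h x∈) (≤-by+ʳ (h y))

  Sum-++ : ∀ xs {ys} → Sum (xs ++ ys) f ≡ Sum xs f + Sum ys f
  Sum-++ [] = sym (+-identityˡ _)
  Sum-++ (x ∷ xs) = trans (cong (f x +_) (Sum-++ xs)) (sym (+-assoc (f x) _ _))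

  Sum-map : ∀ (g : B → A) xs → Sum (map g xs) f ≡ Sum xs (f ∘ g)
  Sum-map g [] = refl
  Sum-map g (x ∷ xs) = cong (f (g x) +_) (Sum-map g xs)

  Prod-pos : ∀ xs → (∀ x → 0ℚ < f x) → 0ℚ < Prod xs f
  Prod-pos [] h = 0<1
  Prod-pos (x ∷ xs) h = 0<* (h x) (Prod-pos xs h)

  Prod-≥0 : ∀ xs → (∀ x → 0ℚ ≤ f x) → 0ℚ ≤ Prod xs f
  Prod-≥0 [] h = 0≤1
  Prod-≥0 (x ∷ xs) h = 0≤* (h x) (Prod-≥0 xs h)

  Prod-inv : ∀ xs → (∀ x → 0ℚ < f x) → Prod xs (λ x → inv (f x)) ≡ inv (Prod xs f)
  Prod-inv [] h = sym inv-1
  Prod-inv (x ∷ xs) h = trans (cong (_ *_) (Prod-inv xs h)) (sym (inv-* (h x) (Prod-pos xs h)))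

 Sum-const : ∀ c (xs : List A) → Sum xs (λ _ → c) ≡ nat (length xs) * c
 Sum-const c [] = sym (trans (cong (_* c) nat-0) (zeroˡ c))
 Sum-const c (x ∷ xs) = trans (cong (c +_) (Sum-const c xs))
  (trans (solve 2 (λ c n → c :+ n :* c := (:1 :+ n) :* c) refl c (nat (length xs))) (cong (_* c) (sym (nat-suc (length xs)))))

 Sum-0 : ∀ (xs : List A) → Sum xs (λ _ → 0ℚ) ≡ 0ℚ
 Sum-0 xs = trans (Sum-const 0ℚ xs) (zeroʳ _)

 Sum-swap : ∀ {f : A → B → ℚ} xs ys → Sum xs (λ x → Sum ys (f x)) ≡ Sum ys (λ y → Sum xs (λ x → f x y))
 Sum-swap [] ys = sym (Sum-0 ys)
 Sum-swap {f = f} (x ∷ xs) ys = trans (cong (Sum ys (f x) +_) (Sum-swap xs ys)) (sym (Sum-+ ys))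

 Sum-× : ∀ {f : A × B → ℚ} xs ys → Sum (cartesianProduct xs ys) f ≡ Sum xs (λ x → Sum ys (λ y → f (x , y)))
 Sum-× [] ys = refl
 Sum-× {f = f} (x ∷ xs) ys = trans (Sum-++ (map (x ,_) ys)) (cong₂ _+_ (Sum-map (x ,_) ys) (Sum-× xs ys))

 Prod-swap : ∀ {f : A → B → ℚ} xs ys → Prod xs (λ x → Prod ys (f x)) ≡ Prod ys (λ y → Prod xs (λ x → f x y))
 Prod-swap {B = B} [] ys = sym (lem ys)
  where
  lem : ∀ (ys : List B) → Prod ys (λ _ → 1ℚ) ≡ 1ℚ
  lem [] = refl
  lem (y ∷ ys) = trans (*-identityˡ _) (lem ys)
 Prod-swap {f = f} (x ∷ xs) ys = trans (cong (Prod ys (f x) *_) (Prod-swap xs ys)) (sym (Prod-* ys))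

 Prod-telescope : ∀ {f : ℕ → ℚ} → (∀ n → 0ℚ < f n) → ∀ n → Prod (downFrom n) (λ i → f (suc i) * inv (f i)) ≡ f n * inv (f 0)
 Prod-telescope h zero = sym (*inv (h 0))
 Prod-telescope {f} h (suc n) = trans (cong (f (suc n) * inv (f n) *_) (Prod-telescope h n))
  (trans (solve 4 (λ a b c d → a :* b :* (c :* d) := a :* (c :* b) :* d) refl (f (suc n)) (inv (f n)) (f n) (inv (f 0)))
  (trans (cong (λ z → f (suc n) * z * inv (f 0)) (*inv (h n))) (cong (_* inv (f 0)) (*-identityʳ _))))

 two : ℚ
 two = 1ℚ + 1ℚ

 0<two : 0ℚ < two
 0<two = 0<+ˡ 0<1 0≤1

 opaque
  pos : ℚ → ℚ
  pos a with 0ℚ ≤? a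
  ... | yes _ = a
  ... | no  _ = 0ℚ

  0≤pos : ∀ a → 0ℚ ≤ pos a
  0≤pos a with 0ℚ ≤? a
  ... | yes h = h
  ... | no  _ = ≤-refl

  ≤pos : ∀ a → a ≤ pos a
  ≤pos a with 0ℚ ≤? a
  ... | yes h = ≤-refl
  ... | no  h = <⇒≤ (≰⇒> h)

  pos-lub : 0ℚ ≤ b → a ≤ b → pos a ≤ b
  pos-lub {b} {a} h k with 0ℚ ≤? a
  ... | yes _ = k
  ... | no  _ = h

  pos-cases : ∀ a → (0ℚ ≤ a × pos a ≡ a) ⊎ (a ≤ 0ℚ × pos a ≡ 0ℚ)
  pos-cases a with 0ℚ ≤? a
  ... | yes h = inj₁ (h , refl)
  ... | no  h = inj₂ (<⇒≤ (≰⇒> h) , refl)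

 pos-mono : a ≤ b → pos a ≤ pos b
 pos-mono {a} {b} h = pos-lub (0≤pos b) (≤-trans h (≤pos b))

 neg0 : - 0ℚ ≡ 0ℚ
 neg0 = solve 0 (:- :0 := :0) refl

-- Logarithmic inequalities from the arithmetic-geometric mean inequality.

module LogBounds where

 open Arithmetic
 open import Data.List.Relation.Unary.All using (All; []; _∷_)
 open import Data.List.Relation.Unary.All.Properties using (++⁺)

 private
  variable
   x y r s t : ℚ
   A : Set

 ^-nonneg : 0ℚ ≤ x → ∀ n → 0ℚ ≤ x ^ n
 ^-nonneg h zero    = 0≤1
 ^-nonneg h (suc n) = 0≤* h (^-nonneg h n)

 -- The left side is the tangent of the convex function t^(m+1) at b, evaluated at a. The step from
 -- m to m + 1 costs a times the earlier inequality and the nonnegative term b^m (m+1) (a - b)².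
 ^-tangent : ∀ {a b} → 0ℚ ≤ a → 0ℚ ≤ b → ∀ m → b ^ m * (nat (suc m) * a - nat m * b) ≤ a ^ suc m
 ^-tangent {a} {b} ha hb zero = ≤-reflexive (trans
  (cong₂ (λ u v → 1ℚ * (u * a - v * b)) nat-1 nat-0)
  (solve 2 (λ a b → :1 :* (:1 :* a :- :0 :* b) := a :* :1) refl a b))
 ^-tangent {a} {b} ha hb (suc m) = ≤-trans
  (≤-by (b ^ m * (nat (suc m) * ((a - b) * (a - b)))) (0≤* (^-nonneg hb m) (0≤* (0≤nat (suc m)) (0≤sq (a - b))))
   (trans (cong (λ z → b * b ^ m * (z * a - nat (suc m) * b) + b ^ m * (nat (suc m) * ((a - b) * (a - b)))) (nat-suc (suc m)))
   (trans (cong (λ z → b * b ^ m * ((1ℚ + z) * a - z * b) + b ^ m * (z * ((a - b) * (a - b)))) (nat-suc m))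
   (trans (solve 4 (λ a b p n → b :* p :* ((:1 :+ (:1 :+ n)) :* a :- (:1 :+ n) :* b) :+ p :* ((:1 :+ n) :* ((a :- b) :* (a :- b)))
       := a :* (p :* ((:1 :+ n) :* a :- n :* b))) refl a b (b ^ m) (nat m))
    (cong (λ z → a * (b ^ m * (z * a - nat m * b))) (sym (nat-suc m)))))))
  (*≤ˡ ha (^-tangent ha hb m))

 -- Induction on the length n of the tail. If b is the mean of the tail and m the new mean, then
 -- (n+1) m - n b is the new entry a, so that `^-tangent` reads a b^n ≤ m^(n+1).
 prod≤mean^ : ∀ {as} → All (0ℚ <_) as →
  ∃ λ m → 0ℚ < m × nat (length as) * m ≡ Sum as id × Prod as id ≤ m ^ length as
 prod≤mean^ [] = 1ℚ , 0<1 , trans (cong (_* 1ℚ) nat-0) (zeroˡ 1ℚ) , ≤-refl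
 prod≤mean^ {a ∷ as} (ha ∷ has) with prod≤mean^ has
 ... | b , hb , e , h = m , hm , em , (≤-trans (*≤ˡ (<⇒≤ ha) h) (subst (_≤ m ^ suc n) et (^-tangent (<⇒≤ hm) (<⇒≤ hb) n)))
  where
  n = length as
  m = inv (nat (suc n)) * (a + nat n * b)
  hm : 0ℚ < m
  hm = 0<* (0<inv (0<nat n)) (0<+ˡ ha (0≤* (0≤nat n) (<⇒≤ hb)))
  en : nat (suc n) * m ≡ a + nat n * b
  en = trans (solve 3 (λ x y z → x :* (y :* z) := z :* x :* y) refl (nat (suc n)) (inv (nat (suc n))) (a + nat n * b)) (*inv-cancel (0<nat n))
  em : nat (suc n) * m ≡ a + Sum as id
  em = trans en (cong (a +_) e)
  et : b ^ n * (nat (suc n) * m - nat n * b) ≡ a * b ^ n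
  et = trans (cong (λ z → b ^ n * (z - nat n * b)) en) (solve 3 (λ p a q → p :* (a :+ q :- q) := a :* p) refl (b ^ n) a (nat n * b))

 ^≤1 : 0ℚ ≤ x → x ≤ 1ℚ → ∀ n → x ^ n ≤ 1ℚ
 ^≤1 h k zero    = ≤-refl
 ^≤1 h k (suc n) = *≤1 h k (^-nonneg h n) (^≤1 h k n)

 -- If the mean were below 1, all its positive powers, and hence the product, would be below 1 as
 -- well.
 amgm : ∀ {as} → All (0ℚ <_) as → 1ℚ ≤ Prod as id → 0ℚ ≤ Sum as (_- 1ℚ)
 amgm {[]} has h = ≤-refl
 amgm {a ∷ as} has h with prod≤mean^ has
 ... | m , hm , e , k with 1ℚ ≤? m
 ... | yes q = subst (0ℚ ≤_) eq (0≤* (0≤nat n) (0≤- q))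
  where
  n = length (a ∷ as)
  eq : nat n * (m - 1ℚ) ≡ Sum (a ∷ as) (_- 1ℚ)
  eq = trans (trans (solve 2 (λ n m → n :* (m :- :1) := n :* m :- n :* :1) refl (nat n) m)
   (cong₂ _-_ e (sym (Sum-const 1ℚ (a ∷ as))))) (sym (Sum-- (a ∷ as)))
 ... | no ¬q = ⊥-elim (<-irrefl (≤-<-trans (≤-trans h (≤-trans k (≤≡ (*≤ˡ (<⇒≤ hm) (^≤1 (<⇒≤ hm) (<⇒≤ (≰⇒> ¬q)) (length as))) (*-identityʳ m)))) (≰⇒> ¬q)))

 -- Logarithms are avoided: LogLe x s certifies log x ≤ s by writing x as a product
 -- of numbers a with log a ≤ a - 1.
 record LogLe (x s : ℚ) : Set where
  field
   factors  : List ℚ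
   positive : All (0ℚ <_) factors
   product  : Prod factors id ≡ x
   bound    : Sum factors (_- 1ℚ) ≤ s

 open LogLe

 log-linear : 0ℚ < x → LogLe x (x - 1ℚ)
 log-linear {x} h = record
  { factors = x ∷ [] ; positive = h ∷ [] ; product = *-identityʳ x ; bound = ≤-reflexive (+-identityʳ _) }

 log-1 : LogLe 1ℚ 0ℚ
 log-1 = record { factors = [] ; positive = [] ; product = refl ; bound = ≤-refl }

 Prod-++ : ∀ {f : A → ℚ} xs {ys} → Prod (xs ++ ys) f ≡ Prod xs f * Prod ys f
 Prod-++ [] = sym (*-identityˡ _)
 Prod-++ {f = f} (x ∷ xs) = trans (cong (f x *_) (Prod-++ xs)) (sym (*-assoc (f x) _ _))

 log-* : LogLe x s → LogLe y t → LogLe (x * y) (s + t)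
 log-* p q = record
  { factors  = factors p ++ factors q
  ; positive = ++⁺ (positive p) (positive q)
  ; product  = trans (Prod-++ (factors p)) (cong₂ _*_ (product p) (product q))
  ; bound    = ≡≤ (Sum-++ (factors p)) (+-mono-≤ (bound p) (bound q)) }

 log-mono : s ≤ t → LogLe x s → LogLe x t
 log-mono h p = record { factors = factors p ; positive = positive p ; product = product p ; bound = ≤-trans (bound p) h }

 log-Prod : ∀ {f g : A → ℚ} xs → (∀ x → LogLe (f x) (g x)) → LogLe (Prod xs f) (Sum xs g)
 log-Prod [] h = log-1
 log-Prod (x ∷ xs) h = log-* (h x) (log-Prod xs h)

 -- This is how certificates are used: when likelihood ratios telescope to the product 1, the sum of
 -- their linear bounds cannot be negative.
 log-sound : LogLe 1ℚ s → 0ℚ ≤ s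
 log-sound p = ≤-trans (amgm (positive p) (≤-reflexive (sym (product p)))) (bound p)

 -- The saving over log r ≤ r - 1. It is quadratic at r = 1, so its mean controls the mean deviation
 -- of a likelihood ratio from 1, as relative entropy does in Pinsker's inequality.
 gap : ℚ → ℚ
 gap r = (1ℚ - r) * (1ℚ - r) * inv ((1ℚ + r) * (1ℚ + r))

 0<1+ : 0ℚ ≤ r → 0ℚ < 1ℚ + r
 0<1+ h = 0<+ˡ 0<1 h

 0≤gap : 0ℚ ≤ r → 0ℚ ≤ gap r
 0≤gap {r} h = 0≤* (0≤sq (1ℚ - r)) (0≤inv (0≤sq (1ℚ + r)))

 -- log r = log (r / ρ²) + 2 log ρ with ρ = (1 + r) / 2.
 log-gap : 0ℚ < r → LogLe r ((r - 1ℚ) - gap r)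
 log-gap {r} h = subst₂ LogLe e₁ e₂ (log-* (log-linear {r * inv (ρ * ρ)} (0<* h (0<inv hρ²))) (log-* (log-linear hρ) (log-linear hρ)))
  where
  half = inv two
  ρ = (1ℚ + r) * half
  hρ : 0ℚ < ρ
  hρ = 0<* (0<1+ (<⇒≤ h)) (0<inv 0<two)
  hρ² : 0ℚ < ρ * ρ
  hρ² = 0<* hρ hρ
  q = (1ℚ + r) * (1ℚ + r)
  hq : 0ℚ < q
  hq = 0<* (0<1+ (<⇒≤ h)) (0<1+ (<⇒≤ h))
  e₁ : r * inv (ρ * ρ) * (ρ * ρ) ≡ r
  e₁ = inv*-cancel hρ²
  2ρ : ρ + ρ ≡ 1ℚ + r
  2ρ = trans (solve 2 (λ a b → a :* b :+ a :* b := a :* :2 :* b) refl (1ℚ + r) half) (*inv-cancel 0<two)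
  4inv : inv (ρ * ρ) ≡ two * two * inv q
  4inv = sym (≡inv hρ² (trans (solve 2 (λ p i → p :* p :* (:2 :* :2 :* i) := (p :+ p) :* (p :+ p) :* i) refl ρ (inv q))
   (trans (cong (λ z → z * z * inv q) 2ρ) (*inv hq))))
  e₂ : r * inv (ρ * ρ) - 1ℚ + ((ρ - 1ℚ) + (ρ - 1ℚ)) ≡ (r - 1ℚ) - gap r
  e₂ = begin
   r * inv (ρ * ρ) - 1ℚ + ((ρ - 1ℚ) + (ρ - 1ℚ)) ≡⟨ solve 2 (λ z p → z :- :1 :+ ((p :- :1) :+ (p :- :1)) := z :- con (ℤ.+ 3) :+ (p :+ p)) refl (r * inv (ρ * ρ)) ρ ⟩
   r * inv (ρ * ρ) - nat 3 + (ρ + ρ) ≡⟨ cong₂ (λ u v → r * u - nat 3 + v) 4inv 2ρ ⟩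
   r * (two * two * inv q) - nat 3 + (1ℚ + r) ≡⟨ solve 2 (λ r i → r :* (:2 :* :2 :* i) :- con (ℤ.+ 3) :+ (:1 :+ r)
    := (r :- :1) :- ((:1 :- r) :* (:1 :- r) :* i :+ (:1 :- (:1 :+ r) :* (:1 :+ r) :* i))) refl r (inv q) ⟩
   (r - 1ℚ) - (gap r + (1ℚ - q * inv q)) ≡⟨ cong (λ z → (r - 1ℚ) - (gap r + (1ℚ - z))) (*inv hq) ⟩
   (r - 1ℚ) - (gap r + (1ℚ - 1ℚ)) ≡⟨ solve 2 (λ x g → x :- (g :+ (:1 :- :1)) := x :- g) refl (r - 1ℚ) (gap r) ⟩
   (r - 1ℚ) - gap r ∎
   where open ≡-Reasoning

 gap-intro : ∀ {y} → 0ℚ ≤ r → y * y * ((1ℚ + r) * (1ℚ + r)) ≤ nat 4 * ((1ℚ - r) * (1ℚ - r)) → y * y ≤ nat 4 * gap r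
 gap-intro {r} {y} h k = ≤≡ (≤*inv hq k) (*-assoc (nat 4) _ _)
  where
  hq : 0ℚ < (1ℚ + r) * (1ℚ + r)
  hq = 0<* (0<1+ h) (0<1+ h)

 -- For r ≤ 1 the denominator (1 + r)² is at most 4.
 gap-below : 0ℚ ≤ r → pos (1ℚ - r) * pos (1ℚ - r) ≤ nat 4 * gap r
 gap-below {r} h with pos-cases (1ℚ - r)
 ... | inj₂ (_ , e) = ≡≤ (trans (cong (λ z → z * z) e) (zeroˡ 0ℚ)) (0≤* (0≤nat 4) (0≤gap h))
 ... | inj₁ (k , e) = subst (λ z → z * z ≤ nat 4 * gap r) (sym e)
  (gap-intro h (≤-by (((1ℚ - r) * (1ℚ - r)) * ((1ℚ - r) * (nat 3 + r))) (0≤* (0≤sq (1ℚ - r)) (0≤* k (0≤+ (0≤nat 3) h)))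
   (solve 1 (λ r → (:1 :- r) :* (:1 :- r) :* ((:1 :+ r) :* (:1 :+ r)) :+ (:1 :- r) :* (:1 :- r) :* ((:1 :- r) :* (con (ℤ.+ 3) :+ r))
    := con (ℤ.+ 4) :* ((:1 :- r) :* (:1 :- r))) refl r)))

 -- For r ≥ 1 one has 1 + r ≤ 2r. The division by r is essential, because the gap stays below 1
 -- however large r is.
 gap-above : 0ℚ < r → (pos (r - 1ℚ) * inv r) * (pos (r - 1ℚ) * inv r) ≤ nat 4 * gap r
 gap-above {r} h with pos-cases (r - 1ℚ)
 ... | inj₂ (_ , e) = ≡≤ (trans (cong (λ z → z * inv r * (z * inv r)) e) (solve 1 (λ i → :0 :* i :* (:0 :* i) := :0) refl (inv r))) (0≤* (0≤nat 4) (0≤gap (<⇒≤ h)))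
 ... | inj₁ (k , e) = subst (λ z → z * inv r * (z * inv r) ≤ nat 4 * gap r) (sym e)
  (gap-intro (<⇒≤ h) (≤-by (i * i * ((r - 1ℚ) * (r - 1ℚ)) * ((r - 1ℚ) * (nat 3 * r + 1ℚ)))
     (0≤* (0≤* (0≤sq i) (0≤sq (r - 1ℚ))) (0≤* k (0≤+ (0≤* (0≤nat 3) (<⇒≤ h)) 0≤1)))
   (trans (solve 2 (λ r i → (r :- :1) :* i :* ((r :- :1) :* i) :* ((:1 :+ r) :* (:1 :+ r)) :+ i :* i :* ((r :- :1) :* (r :- :1)) :* ((r :- :1) :* (con (ℤ.+ 3) :* r :+ :1))
      := con (ℤ.+ 4) :* ((:1 :- r) :* (:1 :- r)) :* ((r :* i) :* (r :* i))) refl r i)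
    (trans (cong (λ z → nat 4 * ((1ℚ - r) * (1ℚ - r)) * (z * z)) (*inv h)) (solve 1 (λ z → z :* (:1 :* :1) := z) refl _)))))
  where i = inv r

-- Finite probability: equivalence classes, their masses, and resampling.

module Classes where

 open Arithmetic
 open LogBounds

 private
  variable
   A B : Set

 -- Boolean, because relations enter sums as indicators. Transitivity and symmetry are combined in
 -- `tr` in the form that equates the indicators of two related points.
 record Equivalence {A : Set} (E : A → A → Bool) : Set where
  field
   re : ∀ a → E a a ≡ true
   sy : ∀ a b → E a b ≡ E b a
   tr : ∀ {a b} c → E a b ≡ true → E a c ≡ E b c

 open Equivalence public

 always : A → A → Bool
 always _ _ = true

 always-equiv : Equivalence (always {A})
 always-equiv = record { re = λ _ → refl ; sy = λ _ _ → refl ; tr = λ _ _ → refl }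

 ∧-split : ∀ a {b} → (a ∧ b) ≡ true → a ≡ true × b ≡ true
 ∧-split true h = refl , h

 bool-ext : ∀ {a b} → (a ≡ true → b ≡ true) → (b ≡ true → a ≡ true) → a ≡ b
 bool-ext {true} h k = sym (h refl)
 bool-ext {false} {true}  h k = k refl
 bool-ext {false} {false} h k = refl

 _∩_ : (A → A → Bool) → (A → A → Bool) → A → A → Bool
 (E ∩ F) a b = E a b ∧ F a b

 infixr 6 _∩_

 ∩-equiv : ∀ {E F : A → A → Bool} → Equivalence E → Equivalence F → Equivalence (E ∩ F)
 ∩-equiv {E = E} e f = record
  { re = λ a → cong₂ _∧_ (re e a) (re f a)
  ; sy = λ a b → cong₂ _∧_ (sy e a b) (sy f a b)
  ; tr = λ {a} {b} c h → cong₂ _∧_ (tr e c (proj₁ (∧-split (E a b) h))) (tr f c (proj₂ (∧-split (E a b) h))) }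

 _on_ : (B → B → Bool) → (A → B) → A → A → Bool
 (E on f) a b = E (f a) (f b)

 infix 7 _on_

 on-equiv : ∀ {E : B → B → Bool} (f : A → B) → Equivalence E → Equivalence (E on f)
 on-equiv f e = record { re = λ a → re e (f a) ; sy = λ a b → sy e (f a) (f b) ; tr = λ c → tr e (f c) }

 -- `once` excludes repetitions and omissions at the same time, in the form in which sums over
 -- `values` consume it.
 record Finite (B : Set) : Set where
  field
   values    : List B
   _==_ : B → B → Bool
   ==-equiv  : Equivalence _==_
   ==-sound  : ∀ {a b} → (a == b) ≡ true → a ≡ b
   once : ∀ b → Sum values (λ v → ⟦ b == v ⟧) ≡ 1ℚ

 bool-finite : Finite Bool
 bool-finite = record
  { values = true ∷ false ∷ []
  ; _==_ = eq
  ; ==-equiv = record { re = λ { true → refl ; false → refl } ; sy = sy' ; tr = λ {a} {b} → tr' a b }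
  ; ==-sound = λ {a} {b} → so a b
  ; once = λ { true → solve 0 (:1 :+ (:0 :+ :0) := :1) refl ; false → solve 0 (:0 :+ (:1 :+ :0) := :1) refl } }
  where
  eq : Bool → Bool → Bool
  eq true  b = b
  eq false b = not b
  sy' : ∀ a b → eq a b ≡ eq b a
  sy' true  true  = refl
  sy' true  false = refl
  sy' false true  = refl
  sy' false false = refl
  so : ∀ a b → eq a b ≡ true → a ≡ b
  so true  true  h = refl
  so false false h = refl
  tr' : ∀ a b c → eq a b ≡ true → eq a c ≡ eq b c
  tr' a b c h = cong (λ z → eq z c) (so a b h)

 module Finite-lemmas {B : Set} (𝔹 : Finite B) where
  open Finite 𝔹

  ==-≡ : ∀ {a b} → a ≡ b → (a == b) ≡ true
  ==-≡ {a} refl = re ==-equiv a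

  pick : ∀ (g : B → ℚ) b → Sum values (λ v → ⟦ b == v ⟧ * g v) ≡ g b
  pick g b = trans (Sum-cong values (λ v → guard-cong (b == v) (λ h → sym (cong g (==-sound h)))))
   (trans (Sum-*ʳ (g b) values) (trans (cong (_* g b) (once b)) (*-identityˡ _)))

 module Masses {Ω : Set} (Ωs : List Ω) (w : Ω → ℚ) (w≥0 : ∀ ω → 0ℚ ≤ w ω) where

  𝔼 : (Ω → ℚ) → ℚ
  𝔼 f = Sum Ωs (λ ω → w ω * f ω)

  𝔼-cong : ∀ {f g} → (∀ ω → f ω ≡ g ω) → 𝔼 f ≡ 𝔼 g
  𝔼-cong h = Sum-cong Ωs (λ ω → cong (w ω *_) (h ω))

  𝔼-mono : ∀ {f g} → (∀ ω → f ω ≤ g ω) → 𝔼 f ≤ 𝔼 g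
  𝔼-mono h = Sum-mono Ωs (λ ω → *≤ˡ (w≥0 ω) (h ω))

  𝔼-*ˡ : ∀ c {f} → 𝔼 (λ ω → c * f ω) ≡ c * 𝔼 f
  𝔼-*ˡ c {f} = trans (Sum-cong Ωs (λ ω → solve 3 (λ a b c → a :* (b :* c) := b :* (a :* c)) refl (w ω) c (f ω))) (Sum-*ˡ c Ωs)

  𝔼-+ : ∀ {f g} → 𝔼 (λ ω → f ω + g ω) ≡ 𝔼 f + 𝔼 g
  𝔼-+ {f} {g} = trans (Sum-cong Ωs (λ ω → distribˡ (w ω) (f ω) (g ω))) (Sum-+ Ωs)

  𝔼-- : ∀ {f g} → 𝔼 (λ ω → f ω - g ω) ≡ 𝔼 f - 𝔼 g
  𝔼-- {f} {g} = trans (Sum-cong Ωs (λ ω → solve 3 (λ a b c → a :* (b :- c) := a :* b :- a :* c) refl (w ω) (f ω) (g ω))) (Sum-- Ωs)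

  𝔼-≥0 : ∀ {f} → (∀ ω → 0ℚ ≤ f ω) → 0ℚ ≤ 𝔼 f
  𝔼-≥0 h = Sum-≥0 Ωs (λ ω → 0≤* (w≥0 ω) (h ω))

  𝔼-Sum : ∀ (xs : List A) {f : A → Ω → ℚ} → 𝔼 (λ ω → Sum xs (λ x → f x ω)) ≡ Sum xs (λ x → 𝔼 (f x))
  𝔼-Sum xs {f} = trans (Sum-cong Ωs (λ ω → sym (Sum-*ˡ (w ω) xs))) (Sum-swap Ωs xs)

  mass : (Ω → Ω → Bool) → Ω → ℚ
  mass E ω = 𝔼 (λ ω' → ⟦ E ω ω' ⟧)

  0≤mass : ∀ E ω → 0ℚ ≤ mass E ω
  0≤mass E ω = 𝔼-≥0 (λ ω' → 0≤⟦⟧ (E ω ω'))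

  mass-cong : ∀ E F ω → (∀ ω' → E ω ω' ≡ F ω ω') → mass E ω ≡ mass F ω
  mass-cong E F ω h = 𝔼-cong (λ ω' → cong ⟦_⟧ (h ω'))

  mass-class : ∀ {E} → Equivalence E → ∀ {ω ω'} → E ω ω' ≡ true → mass E ω ≡ mass E ω'
  mass-class e h = 𝔼-cong (λ ω″ → cong ⟦_⟧ (tr e ω″ h))

  w≤mass : ∀ {E} → Equivalence E → ∀ {ω} → ω ∈ Ωs → w ω ≤ mass E ω
  w≤mass {E} e {ω} ω∈ = subst (_≤ mass E ω) (trans (cong (λ b → w ω * ⟦ b ⟧) (re e ω)) (*-identityʳ _))
   (Sum-∈ Ωs (λ ω' → 0≤* (w≥0 ω') (0≤⟦⟧ (E ω ω'))) ω∈)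

  module _ {B : Set} (𝔹 : Finite B) (b : Ω → B) where
   open Finite 𝔹
   open Finite-lemmas 𝔹

   -- Expectation of a product of conditional probabilities, when the value of b is
   -- resampled from the kernel k instead of from its conditional law given the class of E.
   kernel : ∀ {E} → Equivalence E → (k : Ω → B → ℚ) → (∀ ω v → 0ℚ ≤ k ω v) →
    (∀ {ω ω'} → E ω ω' ≡ true → ∀ v → k ω v ≡ k ω' v) → (∀ ω → Sum values (k ω) ≤ 1ℚ) →
    (H : Ω → ℚ) → (∀ ω → 0ℚ ≤ H ω) → (∀ {ω ω'} → E ω ω' ≡ true → H ω ≡ H ω') →
    𝔼 (λ ω → H ω * (k ω (b ω) * (mass E ω * inv (mass (E ∩ (_==_ on b)) ω)))) ≤ 𝔼 H
   kernel {E} e k k≥0 k-inv k≤1 H H≥0 H-inv = ≡≤ expand (𝔼-mono inner)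
    where
    E₁ = E ∩ (_==_ on b)
    e₁ : Equivalence E₁
    e₁ = ∩-equiv e (on-equiv b ==-equiv)

    -- The factor `mass E ω` becomes a sum over the points ω' of the class of ω, and the order of
    -- summation is exchanged; afterwards ω' fixes the class.
    expand : 𝔼 (λ ω → H ω * (k ω (b ω) * (mass E ω * inv (mass E₁ ω))))
     ≡ 𝔼 (λ ω' → 𝔼 (λ ω → ⟦ E ω ω' ⟧ * (H ω * k ω (b ω) * inv (mass E₁ ω))))
    expand = begin
     𝔼 (λ ω → H ω * (k ω (b ω) * (mass E ω * inv (mass E₁ ω))))
      ≡⟨ 𝔼-cong (λ ω → solve 4 (λ h k m i → h :* (k :* (m :* i)) := h :* k :* i :* m) refl (H ω) (k ω (b ω)) (mass E ω) (inv (mass E₁ ω))) ⟩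
     𝔼 (λ ω → H ω * k ω (b ω) * inv (mass E₁ ω) * mass E ω)
      ≡⟨ 𝔼-cong (λ ω → sym (𝔼-*ˡ (H ω * k ω (b ω) * inv (mass E₁ ω)))) ⟩
     𝔼 (λ ω → 𝔼 (λ ω' → H ω * k ω (b ω) * inv (mass E₁ ω) * ⟦ E ω ω' ⟧))
      ≡⟨ Sum-cong Ωs (λ ω → sym (Sum-*ˡ (w ω) Ωs)) ⟩
     Sum Ωs (λ ω → Sum Ωs (λ ω' → w ω * (w ω' * (H ω * k ω (b ω) * inv (mass E₁ ω) * ⟦ E ω ω' ⟧))))
      ≡⟨ Sum-swap Ωs Ωs ⟩
     Sum Ωs (λ ω' → Sum Ωs (λ ω → w ω * (w ω' * (H ω * k ω (b ω) * inv (mass E₁ ω) * ⟦ E ω ω' ⟧))))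
      ≡⟨ Sum-cong Ωs (λ ω' → trans (Sum-cong Ωs (λ ω → solve 4 (λ a b c d → a :* (b :* (c :* d)) := b :* (a :* (d :* c))) refl (w ω) (w ω') (H ω * k ω (b ω) * inv (mass E₁ ω)) ⟦ E ω ω' ⟧)) (Sum-*ˡ (w ω') Ωs)) ⟩
     𝔼 (λ ω' → 𝔼 (λ ω → ⟦ E ω ω' ⟧ * (H ω * k ω (b ω) * inv (mass E₁ ω))))   ∎
     where open ≡-Reasoning

    -- On the part of the class of ω' where b has the value v, all denominators equal the mass D of
    -- that part.
    slice : ∀ ω' v → 𝔼 (λ ω → ⟦ E ω ω' ⟧ * ⟦ b ω == v ⟧ * inv (mass E₁ ω)) ≤ 1ℚ
    slice ω' v = ≡≤ (trans (𝔼-cong step) (trans (𝔼-cong (λ ω → *-comm _ (inv D))) (trans (𝔼-*ˡ (inv D)) (*-comm (inv D) D))))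
     (*inv≤1 (𝔼-≥0 (λ ω → 0≤* (0≤⟦⟧ (E ω ω')) (0≤⟦⟧ (b ω == v)))))
     where
     D = 𝔼 (λ ω → ⟦ E ω ω' ⟧ * ⟦ b ω == v ⟧)
     same : ∀ ω → (E ω ω' ∧ (b ω == v)) ≡ true → mass E₁ ω ≡ D
     same ω h = 𝔼-cong (λ ω″ → trans (cong ⟦_⟧ (cong₂ _∧_ (trans (tr e ω″ (proj₁ (∧-split (E ω ω') h))) (sy e ω' ω″))
      (trans (tr ==-equiv (b ω″) (proj₂ (∧-split (E ω ω') h))) (sy ==-equiv v (b ω″))))) (⟦∧⟧ (E ω″ ω') (b ω″ == v)))
     step : ∀ ω → ⟦ E ω ω' ⟧ * ⟦ b ω == v ⟧ * inv (mass E₁ ω) ≡ ⟦ E ω ω' ⟧ * ⟦ b ω == v ⟧ * inv D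
     step ω = trans (cong (_* inv (mass E₁ ω)) (sym (⟦∧⟧ (E ω ω') (b ω == v))))
      (trans (guard-cong (E ω ω' ∧ (b ω == v)) (λ h → cong inv (same ω h))) (cong (_* inv D) (⟦∧⟧ (E ω ω') (b ω == v))))

    inner : ∀ ω' → 𝔼 (λ ω → ⟦ E ω ω' ⟧ * (H ω * k ω (b ω) * inv (mass E₁ ω))) ≤ H ω'
    inner ω' = begin
     𝔼 (λ ω → ⟦ E ω ω' ⟧ * (H ω * k ω (b ω) * inv (mass E₁ ω)))
      ≡⟨ 𝔼-cong (λ ω → guard-cong (E ω ω') (λ h → cong (_* inv (mass E₁ ω)) (cong₂ _*_ (H-inv h) (trans (k-inv h (b ω)) (sym (pick (k ω') (b ω))))))) ⟩
     𝔼 (λ ω → ⟦ E ω ω' ⟧ * (H ω' * Sum values (λ v → ⟦ b ω == v ⟧ * k ω' v) * inv (mass E₁ ω)))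
      ≡⟨ 𝔼-cong (λ ω → trans (solve 4 (λ a h s i → a :* (h :* s :* i) := h :* ((a :* i) :* s)) refl ⟦ E ω ω' ⟧ (H ω') _ (inv (mass E₁ ω))) (cong (H ω' *_) (sym (Sum-*ˡ _ values)))) ⟩
     𝔼 (λ ω → H ω' * Sum values (λ v → ⟦ E ω ω' ⟧ * inv (mass E₁ ω) * (⟦ b ω == v ⟧ * k ω' v)))
      ≡⟨ trans (𝔼-*ˡ (H ω')) (cong (H ω' *_) (𝔼-Sum values)) ⟩
     H ω' * Sum values (λ v → 𝔼 (λ ω → ⟦ E ω ω' ⟧ * inv (mass E₁ ω) * (⟦ b ω == v ⟧ * k ω' v)))
      ≡⟨ cong (H ω' *_) (Sum-cong values (λ v → trans (𝔼-cong (λ ω → solve 4 (λ a i d k → a :* i :* (d :* k) := k :* (a :* d :* i)) refl ⟦ E ω ω' ⟧ (inv (mass E₁ ω)) ⟦ b ω == v ⟧ (k ω' v))) (𝔼-*ˡ (k ω' v)))) ⟩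
     H ω' * Sum values (λ v → k ω' v * 𝔼 (λ ω → ⟦ E ω ω' ⟧ * ⟦ b ω == v ⟧ * inv (mass E₁ ω)))
      ≤⟨ *≤ˡ (H≥0 ω') (Sum-mono values (λ v → *≤ˡ (k≥0 ω' v) (slice ω' v))) ⟩
     H ω' * Sum values (λ v → k ω' v * 1ℚ)
      ≡⟨ cong (H ω' *_) (Sum-cong values (λ v → *-identityʳ _)) ⟩
     H ω' * Sum values (k ω')
      ≤⟨ *≤ˡ (H≥0 ω') (k≤1 ω') ⟩
     H ω' * 1ℚ
      ≡⟨ *-identityʳ _ ⟩
     H ω' ∎
     where open ≤-Reasoning

   conditional : (Ω → Ω → Bool) → Ω → B → ℚ
   conditional C ω v = 𝔼 (λ ω' → ⟦ C ω ω' ⟧ * ⟦ b ω' == v ⟧) * inv (mass C ω)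

   conditional≡ : ∀ C ω → conditional C ω (b ω) ≡ mass (C ∩ (_==_ on b)) ω * inv (mass C ω)
   conditional≡ C ω = cong (_* inv (mass C ω)) (𝔼-cong (λ ω' → sym (trans (⟦∧⟧ (C ω ω') _) (cong (λ z → ⟦ C ω ω' ⟧ * ⟦ z ⟧) (sy ==-equiv (b ω) (b ω'))))))

   -- The law of b given the coarser relation C is a kernel that is constant on the classes of E.
   -- Hence P(b | C) / P(b | E) has mean at most 1, which replaces the fact that conditioning
   -- reduces entropy. The factor H allows such ratios to be multiplied step by step.
   refine : ∀ {C E} → Equivalence C → Equivalence E → (∀ {ω ω'} → E ω ω' ≡ true → C ω ω' ≡ true) →
    (H : Ω → ℚ) → (∀ ω → 0ℚ ≤ H ω) → (∀ {ω ω'} → E ω ω' ≡ true → H ω ≡ H ω') →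
    𝔼 (λ ω → H ω * ((mass (C ∩ (_==_ on b)) ω * inv (mass C ω)) * (mass E ω * inv (mass (E ∩ (_==_ on b)) ω)))) ≤ 𝔼 H
   refine {C} {E} c e E⇒C H H≥0 H-inv = ≡≤ (𝔼-cong (λ ω → cong (λ z → H ω * (z * (mass E ω * inv (mass (E ∩ (_==_ on b)) ω)))) (sym (conditional≡ C ω))))
    (kernel e (conditional C)
     (λ ω v → 0≤* (𝔼-≥0 (λ ω' → 0≤* (0≤⟦⟧ (C ω ω')) (0≤⟦⟧ (b ω' == v)))) (0≤inv (0≤mass C ω)))
     (λ h v → cong₂ _*_ (𝔼-cong (λ ω″ → cong (λ z → ⟦ z ⟧ * ⟦ b ω″ == v ⟧) (tr c ω″ (E⇒C h)))) (cong inv (mass-class c (E⇒C h))))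
     total H H≥0 H-inv)
    where
    total : ∀ ω → Sum values (conditional C ω) ≤ 1ℚ
    total ω = ≡≤ (trans (Sum-*ʳ (inv (mass C ω)) values) (cong (_* inv (mass C ω))
     (trans (sym (𝔼-Sum values)) (𝔼-cong (λ ω' → trans (Sum-*ˡ ⟦ C ω ω' ⟧ values) (trans (cong (⟦ C ω ω' ⟧ *_) (once (b ω'))) (*-identityʳ _))))))) (*inv≤1 (0≤mass C ω))

-- Tilting a product measure by conditional biases.

module Tilting where

 open Arithmetic
 open LogBounds
 open Classes
 open import Data.List.Membership.Propositional.Properties using (∈-cartesianProduct⁺)

 sg : Bool → ℚ
 sg true  = - 1ℚ
 sg false = 1ℚ

 sg-sq : ∀ b → sg b * sg b ≡ 1ℚ
 sg-sq true  = solve 0 ((:- :1) :* (:- :1) := :1) refl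
 sg-sq false = *-identityˡ 1ℚ

 sg-xor : ∀ a b → sg (a xor b) ≡ sg a * sg b
 sg-xor true  true  = sym (sg-sq true)
 sg-xor true  false = sym (*-identityʳ _)
 sg-xor false b     = sym (*-identityˡ _)

 sg≤1 : ∀ b → sg b ≤ 1ℚ
 sg≤1 true  = ≤-trans (neg≤ 0≤1) (≡≤ neg0 0≤1)
 sg≤1 false = ≤-refl

 -1≤sg : ∀ b → - 1ℚ ≤ sg b
 -1≤sg true  = ≤-refl
 -1≤sg false = sg≤1 true

 opaque
  isNeg : ℚ → Bool
  isNeg a with 0ℚ ≤? a
  ... | yes _ = false
  ... | no _  = true

  abs-0≤ : ∀ a → 0ℚ ≤ sg (isNeg a) * a
  abs-0≤ a with 0ℚ ≤? a
  ... | yes h = ≤≡ h (sym (*-identityˡ a))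
  ... | no h  = ≡≤ (sym neg0) (≤≡ (neg≤ (<⇒≤ (≰⇒> h))) (solve 1 (λ a → :- a := (:- :1) :* a) refl a))

 abs : ℚ → ℚ
 abs a = sg (isNeg a) * a

 sg*abs : ∀ a → a * sg (isNeg a) ≡ abs a
 sg*abs a = *-comm a _

 abs-≤ : ∀ {a b} → a ≤ b → - b ≤ a → abs a ≤ b
 abs-≤ {a} {b} h k with isNeg a
 ... | false = ≡≤ (*-identityˡ a) h
 ... | true  = ≡≤ (solve 1 (λ a → (:- :1) :* a := :- a) refl a) (≤≡ (neg≤ k) (solve 1 (λ b → :- (:- b) := b) refl b))

 module Independence {𝕏 𝕐 : Set} (Xs : List 𝕏) (Ys : List 𝕐) (Xs-all : ∀ x → x ∈ Xs) (Ys-all : ∀ y → y ∈ Ys) where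

  Ω : Set
  Ω = 𝕏 × 𝕐

  Ωs : List Ω
  Ωs = cartesianProduct Xs Ys

  Ωs-all : ∀ ω → ω ∈ Ωs
  Ωs-all (x , y) = ∈-cartesianProduct⁺ (Xs-all x) (Ys-all y)

  Rectangular : (Ω → Ω → Bool) → Set
  Rectangular C = ∀ {x y x' y'} → C (x , y) (x' , y') ≡ true → C (x , y) (x , y') ≡ true

  -- W has rank at most one on a rectangular class, that is, x and y are independent there; this
  -- form avoids division.
  SwapInvariant : (Ω → Ω → Bool) → (Ω → ℚ) → Set
  SwapInvariant C W = ∀ {x y x' y'} → C (x , y) (x' , y') ≡ true → W (x , y) * W (x' , y') ≡ W (x , y') * W (x' , y)

  -- The conditional expectation of F given the class, for an unnormalised weight W.
  average : (Ω → Ω → Bool) → (Ω → ℚ) → (Ω → ℚ) → Ω → ℚ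
  average C W F ω = Sum Ωs (λ ω' → W ω' * (F ω' * ⟦ C ω ω' ⟧)) * inv (Sum Ωs (λ ω' → W ω' * ⟦ C ω ω' ⟧))

  average-inv : ∀ {C} → Equivalence C → ∀ W F {ω ω'} → C ω ω' ≡ true → average C W F ω ≡ average C W F ω'
  average-inv e W F h = cong₂ (λ a b → a * inv b)
   (Sum-cong Ωs (λ ω″ → cong (λ z → W ω″ * (F ω″ * ⟦ z ⟧)) (tr e ω″ h)))
   (Sum-cong Ωs (λ ω″ → cong (λ z → W ω″ * ⟦ z ⟧) (tr e ω″ h)))

  average-abs≤1 : ∀ {C W F} → (∀ ω → 0ℚ ≤ W ω) → (∀ ω → F ω ≤ 1ℚ) → (∀ ω → - 1ℚ ≤ F ω) → ∀ ω → abs (average C W F ω) ≤ 1ℚ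
  average-abs≤1 {C} {W} {F} W≥0 F≤1 F≥-1 ω = abs-≤
   (≤-trans (*≤ʳ (0≤inv D≥0) (Sum-mono Ωs (λ ω' → *≤ˡ (W≥0 ω') (≤≡ (*≤ʳ (0≤⟦⟧ (C ω ω')) (F≤1 ω')) (*-identityˡ _))))) (*inv≤1 D≥0))
   (≤-trans (neg≤ (*inv≤1 D≥0)) (≡≤ (solve 2 (λ d i → :- (d :* i) := (:- :1) :* d :* i) refl D (inv D))
    (*≤ʳ (0≤inv D≥0) (≡≤ (sym (Sum-*ˡ (- 1ℚ) Ωs)) (Sum-mono Ωs (λ ω' →
     ≡≤ (solve 2 (λ w c → (:- :1) :* (w :* c) := w :* ((:- :1) :* c)) refl (W ω') ⟦ C ω ω' ⟧) (*≤ˡ (W≥0 ω') (*≤ʳ (0≤⟦⟧ (C ω ω')) (F≥-1 ω')))))))))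
   where
   D = Sum Ωs (λ ω' → W ω' * ⟦ C ω ω' ⟧)
   D≥0 : 0ℚ ≤ D
   D≥0 = Sum-≥0 Ωs (λ ω' → 0≤* (W≥0 ω') (0≤⟦⟧ (C ω ω')))

  -- Within a class, x and y are independent under W; exchanging y and y' in the
  -- fourfold sum over pairs of points moves F and G to the same point.
  factor : ∀ {C} → Equivalence C → Rectangular C → ∀ {W} → (∀ ω → 0ℚ ≤ W ω) → SwapInvariant C W →
   ∀ (F G : Ω → ℚ) → (∀ {x y y'} → C (x , y) (x , y') ≡ true → F (x , y) ≡ F (x , y')) →
   (∀ {x x' y} → C (x , y) (x' , y) ≡ true → G (x , y) ≡ G (x' , y)) →
   Sum Ωs (λ ω → W ω * (F ω * G ω)) ≡ Sum Ωs (λ ω → W ω * (average C W F ω * G ω))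
  factor {C} e rect {W} W≥0 swap F G F-inv G-inv = sym (begin
   Sum Ωs (λ ω → W ω * (average C W F ω * G ω))
    ≡⟨ Sum-cong Ωs (λ ω → trans (solve 4 (λ w n i g → w :* (n :* i :* g) := (w :* g :* i) :* n) refl (W ω) _ (inv (D ω)) (G ω)) (sym (Sum-*ˡ _ Ωs))) ⟩
   Sum Ωs (λ ω → Sum Ωs (T₁ ω))
    ≡⟨ quad T₁ ⟩
   Sum Xs (λ x → Sum Xs (λ x' → Sum Ys (λ y → Sum Ys (λ y' → T₁ (x , y) (x' , y')))))
    ≡⟨ Sum-cong Xs (λ x → Sum-cong Xs (λ x' → Sum-swap Ys Ys)) ⟩
   Sum Xs (λ x → Sum Xs (λ x' → Sum Ys (λ y → Sum Ys (λ y' → T₁ (x , y') (x' , y)))))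
    ≡⟨ Sum-cong Xs (λ x → Sum-cong Xs (λ x' → Sum-cong Ys (λ y → Sum-cong Ys (λ y' → exchange x y x' y')))) ⟩
   Sum Xs (λ x → Sum Xs (λ x' → Sum Ys (λ y → Sum Ys (λ y' → T₂ (x , y) (x' , y')))))
    ≡⟨ quad T₂ ⟨
   Sum Ωs (λ ω → Sum Ωs (T₂ ω))
    ≡⟨ Sum-swap Ωs Ωs ⟩
   Sum Ωs (λ ω' → Sum Ωs (λ ω → T₂ ω ω'))
    ≡⟨ Sum-cong Ωs collect ⟩
   Sum Ωs (λ ω → W ω * (F ω * G ω)) ∎)
   where
   open ≡-Reasoning
   D : Ω → ℚ
   D ω = Sum Ωs (λ ω' → W ω' * ⟦ C ω ω' ⟧)
   T₁ T₂ : Ω → Ω → ℚ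
   T₁ ω ω' = W ω * G ω * inv (D ω) * (W ω' * (F ω' * ⟦ C ω ω' ⟧))
   T₂ ω ω' = W ω' * F ω' * G ω' * inv (D ω') * (W ω * ⟦ C ω' ω ⟧)

   quad : ∀ T → Sum Ωs (λ ω → Sum Ωs (T ω)) ≡ Sum Xs (λ x → Sum Xs (λ x' → Sum Ys (λ y → Sum Ys (λ y' → T (x , y) (x' , y')))))
   quad T = trans (Sum-× Xs Ys) (Sum-cong Xs (λ x → trans (Sum-cong Ys (λ y → Sum-× Xs Ys)) (Sum-swap Ys Xs)))

   D-inv : ∀ {ω ω'} → C ω ω' ≡ true → D ω ≡ D ω'
   D-inv h = Sum-cong Ωs (λ ω″ → cong (λ z → W ω″ * ⟦ z ⟧) (tr e ω″ h))

   flip : ∀ {ω ω'} → C ω ω' ≡ true → C ω' ω ≡ true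
   flip {ω} {ω'} h = trans (sy e ω' ω) h

   _⨾_ : ∀ {a b c} → C a b ≡ true → C b c ≡ true → C a c ≡ true
   _⨾_ {c = c} h k = trans (tr e c h) k

   cross : ∀ {x y x' y'} → C (x , y) (x' , y') ≡ true → C (x , y') (x' , y) ≡ true
   cross h = (flip (rect h) ⨾ h) ⨾ rect (flip h)

   exchange : ∀ x y x' y' → T₁ (x , y') (x' , y) ≡ T₂ (x , y) (x' , y')
   exchange x y x' y' = begin
    T₁ (x , y') (x' , y)
     ≡⟨ solve 6 (λ w g i w' f c → w :* g :* i :* (w' :* (f :* c)) := c :* ((w :* w') :* f :* g :* i)) refl
      (W (x , y')) (G (x , y')) (inv (D (x , y'))) (W (x' , y)) (F (x' , y)) ⟦ C (x , y') (x' , y) ⟧ ⟩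
    ⟦ C (x , y') (x' , y) ⟧ * ((W (x , y') * W (x' , y)) * F (x' , y) * G (x , y') * inv (D (x , y')))
     ≡⟨ guard-cong (C (x , y') (x' , y)) (λ h → cong₂ _*_ (cong₂ _*_ (cong₂ _*_ (sym (swap (cross h)))
      (F-inv (rect (flip h)))) (G-inv (rect' h))) (cong inv (D-inv (rect' h)))) ⟩
    ⟦ C (x , y') (x' , y) ⟧ * ((W (x , y) * W (x' , y')) * F (x' , y') * G (x' , y') * inv (D (x' , y')))
     ≡⟨ cong (λ b → ⟦ b ⟧ * ((W (x , y) * W (x' , y')) * F (x' , y') * G (x' , y') * inv (D (x' , y'))))
      (trans (bool-ext cross cross) (sy e (x , y) (x' , y'))) ⟩
    ⟦ C (x' , y') (x , y) ⟧ * ((W (x , y) * W (x' , y')) * F (x' , y') * G (x' , y') * inv (D (x' , y')))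
     ≡⟨ solve 6 (λ w g i w' f c → c :* ((w :* w') :* f :* g :* i) := w' :* f :* g :* i :* (w :* c)) refl
      (W (x , y)) (G (x' , y')) (inv (D (x' , y'))) (W (x' , y')) (F (x' , y')) ⟦ C (x' , y') (x , y) ⟧ ⟩
    T₂ (x , y) (x' , y') ∎
    where
    rect' : ∀ {x y x' y'} → C (x , y') (x' , y) ≡ true → C (x , y') (x' , y') ≡ true
    rect' h = h ⨾ rect (flip h)

   collect : ∀ ω' → Sum Ωs (λ ω → T₂ ω ω') ≡ W ω' * (F ω' * G ω')
   collect ω' = trans (Sum-*ˡ _ Ωs) (trans (solve 5 (λ w f g i d → w :* f :* g :* i :* d := w :* (d :* i) :* (f :* g)) refl (W ω') (F ω') (G ω') (inv (D ω')) (D ω'))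
    (cong (_* (F ω' * G ω')) absorb))
    where
    W≤D : W ω' ≤ D ω'
    W≤D = subst (_≤ D ω') (trans (cong (λ b → W ω' * ⟦ b ⟧) (re e ω')) (*-identityʳ _))
     (Sum-∈ Ωs (λ ω″ → 0≤* (W≥0 ω″) (0≤⟦⟧ (C ω' ω″))) (Ωs-all ω'))
    absorb : W ω' * (D ω' * inv (D ω')) ≡ W ω'
    absorb with ≡0⊎0< (≤-trans (W≥0 ω') W≤D)
    ... | inj₂ p = trans (cong (W ω' *_) (*inv p)) (*-identityʳ _)
    ... | inj₁ p = trans (cong (_* (D ω' * inv (D ω'))) W≡0) (trans (zeroˡ _) (sym W≡0))
     where
     W≡0 : W ω' ≡ 0ℚ
     W≡0 = ≤-antisym (subst (W ω' ≤_) p W≤D) (W≥0 ω')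

 -- suffix i relates x and x' agreeing on all coordinates ≥ i, prefix i
 -- relates y and y' agreeing on all coordinates < i, and transcript is the relation
 -- of having the same transcript; f i is the value of f at coordinate i.
 module Tilt {𝕏 𝕐 : Set} (Xs : List 𝕏) (Ys : List 𝕐) (Xs-all : ∀ x → x ∈ Xs) (Ys-all : ∀ y → y ∈ Ys)
  (suffix : ℕ → 𝕏 → 𝕏 → Bool) (prefix : ℕ → 𝕐 → 𝕐 → Bool)
  (suffix-equiv : ∀ i → Equivalence (suffix i)) (prefix-equiv : ∀ i → Equivalence (prefix i))
  (suffix-suc : ∀ i x x' → suffix i x x' ≡ true → suffix (suc i) x x' ≡ true)
  (prefix-pred : ∀ i y y' → prefix (suc i) y y' ≡ true → prefix i y y' ≡ true)
  (transcript : 𝕏 × 𝕐 → 𝕏 × 𝕐 → Bool) (transcript-equiv : Equivalence transcript)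
  (transcript-rect : ∀ {x y x' y'} → transcript (x , y) (x' , y') ≡ true → transcript (x , y) (x , y') ≡ true)
  (base : 𝕏 × 𝕐 → ℚ) (base≥0 : ∀ ω → 0ℚ ≤ base ω)
  (base-swap : ∀ i {x y x' y'} → suffix i x x' ≡ true → prefix i y y' ≡ true →
   base (x , y) * base (x' , y') ≡ base (x , y') * base (x' , y))
  (f : ℕ → 𝕏 × 𝕐 → Bool)
  (f-x : ∀ i x x' y → suffix i x x' ≡ true → f i (x , y) ≡ f i (x' , y))
  (f-y : ∀ i y y' x → prefix (suc i) y y' ≡ true → f i (x , y) ≡ f i (x , y')) where

  open Independence Xs Ys Xs-all Ys-all public

  cell : ℕ → Ω → Ω → Bool
  cell i = suffix i on proj₁ ∩ prefix i on proj₂ ∩ transcript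

  cell-equiv : ∀ i → Equivalence (cell i)
  cell-equiv i = ∩-equiv (on-equiv proj₁ (suffix-equiv i)) (∩-equiv (on-equiv proj₂ (prefix-equiv i)) transcript-equiv)

  cell-parts : ∀ i {x y x' y'} → cell i (x , y) (x' , y') ≡ true →
   suffix i x x' ≡ true × prefix i y y' ≡ true × transcript (x , y) (x' , y') ≡ true
  cell-parts i {x} {y} {x'} {y'} h with ∧-split (suffix i x x') h
  ... | h₁ , h₂ with ∧-split (prefix i y y') h₂
  ... | h₃ , h₄ = h₁ , h₃ , h₄

  cell-intro : ∀ i {x y x' y'} → suffix i x x' ≡ true → prefix i y y' ≡ true → transcript (x , y) (x' , y') ≡ true →
   cell i (x , y) (x' , y') ≡ true
  cell-intro i h₁ h₂ h₃ = cong₂ _∧_ h₁ (cong₂ _∧_ h₂ h₃)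

  cell-rect : ∀ i → Rectangular (cell i)
  cell-rect i {x} h with cell-parts i h
  ... | h₁ , h₂ , h₃ = cell-intro i (re (suffix-equiv i) x) h₂ (transcript-rect h₃)

  mutual
   weight : ℕ → Ω → ℚ
   weight zero    ω = base ω
   weight (suc i) ω = weight i ω * abs (bias i ω)

   -- At 0 no sign has been chosen. In general `guess i` is constant on the classes of `cell i`,
   -- which is what makes it computable by one of the players.
   guess : ℕ → Ω → Bool
   guess zero    ω = false
   guess (suc i) ω = isNeg (bias i ω)

   bias : ℕ → Ω → ℚ
   bias i = average (cell (suc i)) (weight i) (λ ω → sg (f i ω) * sg (guess i ω))

  weight≥0 : ∀ i ω → 0ℚ ≤ weight i ω
  weight≥0 zero    ω = base≥0 ω
  weight≥0 (suc i) ω = 0≤* (weight≥0 i ω) (abs-0≤ (bias i ω))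

  bias-inv : ∀ i {ω ω'} → cell (suc i) ω ω' ≡ true → bias i ω ≡ bias i ω'
  bias-inv i = average-inv (cell-equiv (suc i)) (weight i) _

  guess-inv : ∀ i {ω ω'} → cell i ω ω' ≡ true → guess i ω ≡ guess i ω'
  guess-inv zero    h = refl
  guess-inv (suc i) h = cong isNeg (bias-inv i h)

  abs-bias≤1 : ∀ i ω → abs (bias i ω) ≤ 1ℚ
  abs-bias≤1 i = average-abs≤1 {cell (suc i)} (weight≥0 i)
   (λ ω → ≡≤ (sym (sg-xor (f i ω) (guess i ω))) (sg≤1 (f i ω xor guess i ω)))
   (λ ω → ≤≡ (-1≤sg (f i ω xor guess i ω)) (sg-xor (f i ω) (guess i ω)))

  weight-Prod : ∀ n ω → weight n ω ≡ base ω * Prod (downFrom n) (λ i → abs (bias i ω))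
  weight-Prod zero    ω = sym (*-identityʳ _)
  weight-Prod (suc n) ω = trans (cong (_* abs (bias n ω)) (weight-Prod n ω)) (solve 3 (λ a b c → a :* b :* c := a :* (c :* b)) refl _ _ _)

  suffix-≤ : ∀ k {i x x'} → suffix i x x' ≡ true → suffix (k ℕ.+ i) x x' ≡ true
  suffix-≤ zero    h = h
  suffix-≤ (suc k) h = suffix-suc _ _ _ (suffix-≤ k h)

  prefix-≤ : ∀ k {i y y'} → prefix (k ℕ.+ i) y y' ≡ true → prefix i y y' ≡ true
  prefix-≤ zero    h = h
  prefix-≤ (suc k) h = prefix-≤ k (prefix-pred _ _ _ h)

  -- In a later cell y is fixed below the index of that cell, so an earlier `bias` does not change
  -- when y is replaced by y'. It acts as a function of x alone, and such a factor is compatible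
  -- with exchanging y and y'.
  weight-swap : ∀ i k → SwapInvariant (cell (k ℕ.+ i)) (weight i)
  weight-swap zero    k h with cell-parts (k ℕ.+ 0) h
  ... | h₁ , h₂ , h₃ = base-swap (k ℕ.+ 0) h₁ h₂
  weight-swap (suc i) k {x} {y} {x'} {y'} h = begin
   weight i (x , y) * abs (bias i (x , y)) * (weight i (x' , y') * abs (bias i (x' , y')))
    ≡⟨ solve 4 (λ a b c d → a :* b :* (c :* d) := a :* c :* (b :* d)) refl _ _ _ _ ⟩
   weight i (x , y) * weight i (x' , y') * (abs (bias i (x , y)) * abs (bias i (x' , y')))
    ≡⟨ cong₂ _*_ (weight-swap i (suc k) (subst (λ j → cell j (x , y) (x' , y') ≡ true) (ℕ.+-suc k i) h))
     (cong₂ (λ a b → abs a * abs b) (bias-inv i (low h)) (bias-inv i (low (trans (sy (cell-equiv (k ℕ.+ suc i)) (x' , y') (x , y)) h)))) ⟩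
   weight i (x , y') * weight i (x' , y) * (abs (bias i (x , y')) * abs (bias i (x' , y)))
    ≡⟨ solve 4 (λ a b c d → a :* c :* (b :* d) := a :* b :* (c :* d)) refl _ _ _ _ ⟩
   weight i (x , y') * abs (bias i (x , y')) * (weight i (x' , y) * abs (bias i (x' , y))) ∎
   where
   open ≡-Reasoning
   low : ∀ {x y x' y'} → cell (k ℕ.+ suc i) (x , y) (x' , y') ≡ true → cell (suc i) (x , y) (x , y') ≡ true
   low {x} h with cell-parts (k ℕ.+ suc i) h
   ... | h₁ , h₂ , h₃ = cell-intro (suc i) (re (suffix-equiv (suc i)) x) (prefix-≤ k h₂) (transcript-rect h₃)

  -- In a class of `cell (suc i)` the entry y_i is fixed, so the two signs depend on x only, while G
  -- depends on y only. By independence the signs may be replaced by their average.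
  peel : ∀ i (G : Ω → ℚ) → (∀ {x x' y} → cell (suc i) (x , y) (x' , y) ≡ true → G (x , y) ≡ G (x' , y)) →
   Sum Ωs (λ ω → weight i ω * (sg (f i ω) * sg (guess i ω) * G ω)) ≡ Sum Ωs (λ ω → weight i ω * (bias i ω * G ω))
  peel i G G-inv = factor (cell-equiv (suc i)) (cell-rect (suc i)) (weight≥0 i) (weight-swap i 1) _ G
   (λ {x} {y} {y'} h → let h₁ , h₂ , h₃ = cell-parts (suc i) h in
     cong₂ (λ a b → sg a * sg b) (f-y _ _ _ x h₂) (guess-inv i (cell-intro i (re (suffix-equiv i) x) (prefix-pred _ _ _ h₂) h₃))) G-inv

  rest : ℕ → ℕ → Ω → ℚ
  rest zero    i ω = 1ℚ
  rest (suc k) i ω = sg (f i ω) * rest k (suc i) ω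

  rest-x : ∀ k i {x x'} y → suffix i x x' ≡ true → rest k i (x , y) ≡ rest k i (x' , y)
  rest-x zero    i y h = refl
  rest-x (suc k) i y h = cong₂ _*_ (cong sg (f-x _ _ _ y h)) (rest-x k (suc i) y (suffix-suc _ _ _ h))

  module _ (o : Ω → Bool) (o-inv : ∀ {ω ω'} → transcript ω ω' ≡ true → o ω ≡ o ω') where

   -- Every step moves the absolute value of the bias into the weight and keeps its sign as the next
   -- guess; what remains at the end is a sign, which is at most 1. With i = 0 this bounds the
   -- correlation of a protocol by the total weight, the normaliser of the tilted law.
   total : ∀ k i → Sum Ωs (λ ω → weight i ω * (sg (guess i ω) * (rest k i ω * sg (o ω)))) ≤ Sum Ωs (weight (k ℕ.+ i))
   total zero i = Sum-mono Ωs (λ ω → ≤≡ (*≤ˡ (weight≥0 i ω) (≡≤ (trans (cong (sg (guess i ω) *_) (*-identityˡ _)) (sym (sg-xor (guess i ω) (o ω)))) (sg≤1 (guess i ω xor o ω)))) (*-identityʳ _))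
   total (suc k) i = begin
    Sum Ωs (λ ω → weight i ω * (sg (guess i ω) * (sg (f i ω) * rest k (suc i) ω * sg (o ω))))
     ≡⟨ Sum-cong Ωs (λ ω → cong (weight i ω *_) (solve 4 (λ g s r o → g :* (s :* r :* o) := s :* g :* (r :* o)) refl _ _ _ _)) ⟩
    Sum Ωs (λ ω → weight i ω * (sg (f i ω) * sg (guess i ω) * (rest k (suc i) ω * sg (o ω))))
     ≡⟨ peel i _ (λ {x} {x'} {y} h → let h₁ , h₂ , h₃ = cell-parts (suc i) h in cong₂ (λ a b → a * sg b) (rest-x k (suc i) y h₁) (o-inv h₃)) ⟩
    Sum Ωs (λ ω → weight i ω * (bias i ω * (rest k (suc i) ω * sg (o ω))))
     ≡⟨ Sum-cong Ωs (λ ω → trans (cong (λ z → weight i ω * (z * (rest k (suc i) ω * sg (o ω)))) (bias≡ ω)) (solve 4 (λ w a s r → w :* (a :* s :* r) := w :* a :* (s :* r)) refl _ _ _ _)) ⟩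
    Sum Ωs (λ ω → weight (suc i) ω * (sg (guess (suc i) ω) * (rest k (suc i) ω * sg (o ω))))
     ≤⟨ total k (suc i) ⟩
    Sum Ωs (weight (k ℕ.+ suc i))
     ≡⟨ cong (λ j → Sum Ωs (weight j)) (ℕ.+-suc k i) ⟩
    Sum Ωs (weight (suc k ℕ.+ i)) ∎
    where
    open ≤-Reasoning
    bias≡ : ∀ ω → bias i ω ≡ abs (bias i ω) * sg (isNeg (bias i ω))
    bias≡ ω = sym (trans (solve 2 (λ s a → s :* a :* s := (s :* s) :* a) refl _ _) (trans (cong (_* bias i ω) (sg-sq (isNeg (bias i ω)))) (*-identityˡ _)))

  tail : ℕ → ℕ → Ω → ℚ
  tail zero    i ω = 1ℚ
  tail (suc k) i ω = tail k i ω * abs (bias (k ℕ.+ i) ω)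

  weight-tail : ∀ k i ω → weight (k ℕ.+ i) ω ≡ weight i ω * tail k i ω
  weight-tail zero    i ω = sym (*-identityʳ _)
  weight-tail (suc k) i ω = trans (cong (_* abs (bias (k ℕ.+ i) ω)) (weight-tail k i ω)) (*-assoc _ _ _)

  tail-inv : ∀ k i {x x' y} → cell (suc i) (x , y) (x' , y) ≡ true → tail k i (x , y) ≡ tail k i (x' , y)
  tail-inv zero    i h = refl
  tail-inv (suc k) i {x} {x'} {y} h with cell-parts (suc i) h
  ... | h₁ , h₂ , h₃ = cong₂ _*_ (tail-inv k i h) (cong abs (bias-inv (k ℕ.+ i)
   (cell-intro (suc (k ℕ.+ i)) (subst (λ j → suffix j x x' ≡ true) (ℕ.+-suc k i) (suffix-≤ k h₁)) (re (prefix-equiv (suc (k ℕ.+ i))) y) h₃)))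

  -- The factors of the final weight with index i or higher depend only on y within a class of
  -- `cell (suc i)`, so peeling remains possible under that weight. Under the tilted law the two
  -- guesses thus predict f_i with the mean of |`bias i`| as their advantage.
  agreement : ∀ k i →
   Sum Ωs (λ ω → weight (k ℕ.+ i) ω * (sg (f i ω) * sg (guess i ω) * sg (guess (suc i) ω))) ≡ Sum Ωs (λ ω → weight (k ℕ.+ i) ω * abs (bias i ω))
  agreement k i = begin
   Sum Ωs (λ ω → weight (k ℕ.+ i) ω * (sg (f i ω) * sg (guess i ω) * sg (guess (suc i) ω)))
    ≡⟨ Sum-cong Ωs (λ ω → trans (cong (_* (sg (f i ω) * sg (guess i ω) * sg (guess (suc i) ω))) (weight-tail k i ω)) (solve 4 (λ w t a b → w :* t :* (a :* b) := w :* (a :* (t :* b))) refl _ _ _ _)) ⟩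
   Sum Ωs (λ ω → weight i ω * (sg (f i ω) * sg (guess i ω) * (tail k i ω * sg (guess (suc i) ω))))
    ≡⟨ peel i _ (λ h → cong₂ (λ a b → a * sg b) (tail-inv k i h) (guess-inv (suc i) h)) ⟩
   Sum Ωs (λ ω → weight i ω * (bias i ω * (tail k i ω * sg (guess (suc i) ω))))
    ≡⟨ Sum-cong Ωs (λ ω → trans (solve 4 (λ w a t s → w :* (a :* (t :* s)) := w :* t :* (s :* a)) refl _ _ _ _) (cong (_* abs (bias i ω)) (sym (weight-tail k i ω)))) ⟩
   Sum Ωs (λ ω → weight (k ℕ.+ i) ω * abs (bias i ω)) ∎
   where open ≡-Reasoning

-- Likelihood ratios of the coordinates and their budgets.

module InformationCost where

 open Arithmetic
 open LogBounds
 open Classes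
 open import Data.Bool.Properties using (∧-assoc; ∧-comm; ∧-identityʳ)

 private
  variable
   A : Set

 Prod-pos∈ : ∀ {f : A → ℚ} xs → (∀ x → x ∈ xs → 0ℚ < f x) → 0ℚ < Prod xs f
 Prod-pos∈ [] h = 0<1
 Prod-pos∈ (x ∷ xs) h = 0<* (h x (here refl)) (Prod-pos∈ xs (λ y y∈ → h y (there y∈)))

 Prod-pos⁻ : ∀ {f : A → ℚ} xs → (∀ x → 0ℚ ≤ f x) → 0ℚ < Prod xs f → ∀ {x} → x ∈ xs → 0ℚ < f x
 Prod-pos⁻ {f = f} (x ∷ xs) h p (here refl) with ≡0⊎0< (h x)
 ... | inj₂ q = q
 ... | inj₁ e = ⊥-elim (<-irrefl (subst (0ℚ <_) (trans (cong (_* Prod xs f) e) (zeroˡ _)) p))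
 Prod-pos⁻ {f = f} (x ∷ xs) h p (there y∈) with ≡0⊎0< (Prod-≥0 xs h)
 ... | inj₂ q = Prod-pos⁻ xs h q y∈
 ... | inj₁ e = ⊥-elim (<-irrefl (subst (0ℚ <_) (trans (cong (f x *_) e) (zeroʳ _)) p))

 log-Prod∈ : ∀ {f g : A → ℚ} xs → (∀ x → x ∈ xs → LogLe (f x) (g x)) → LogLe (Prod xs f) (Sum xs g)
 log-Prod∈ [] h = log-1
 log-Prod∈ (x ∷ xs) h = log-* (h x (here refl)) (log-Prod∈ xs (λ y y∈ → h y (there y∈)))

 factorˡ : ∀ {a b} → 0ℚ ≤ a → 0ℚ ≤ b → 0ℚ < a * b → 0ℚ < a
 factorˡ {b = b} ha hb h with ≡0⊎0< ha
 ... | inj₂ q = q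
 ... | inj₁ refl = ⊥-elim (<-irrefl (subst (0ℚ <_) (zeroˡ b) h))

 factorʳ : ∀ {a b} → 0ℚ ≤ a → 0ℚ ≤ b → 0ℚ < a * b → 0ℚ < b
 factorʳ {a} {b} ha hb h = factorˡ hb ha (subst (0ℚ <_) (*-comm a b) h)

 quotient-cancel : ∀ {a b c} → 0ℚ < a → 0ℚ < b → 0ℚ < c → (a * inv c) * inv (b * inv c) ≡ a * inv b
 quotient-cancel {a} {b} {c} ha hb hc = begin
  (a * inv c) * inv (b * inv c) ≡⟨ cong ((a * inv c) *_) (trans (inv-* hb (0<inv hc)) (cong (inv b *_) (inv-inv hc))) ⟩
  (a * inv c) * (inv b * c) ≡⟨ solve 4 (λ a b c d → (a :* d) :* (b :* c) := a :* b :* (c :* d)) refl a (inv b) c (inv c) ⟩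
  a * inv b * (c * inv c) ≡⟨ cong (a * inv b *_) (*inv hc) ⟩
  a * inv b * 1ℚ ≡⟨ *-identityʳ _ ⟩
  a * inv b ∎
  where open ≡-Reasoning

 inv-quotient : ∀ {a b} → 0ℚ < a → 0ℚ < b → inv (a * inv b) ≡ inv a * b
 inv-quotient ha hb = trans (inv-* ha (0<inv hb)) (cong (inv _ *_) (inv-inv hb))

 -- Tails are compared first, so that one more bit is a conjunct on the right and `hist-suc` holds
 -- by computation.
 _==ᴸ_ : List Bool → List Bool → Bool
 [] ==ᴸ [] = true
 [] ==ᴸ (b ∷ bs) = false
 (a ∷ as) ==ᴸ [] = false
 (a ∷ as) ==ᴸ (b ∷ bs) = (as ==ᴸ bs) ∧ Finite._==_ bool-finite a b

 ==ᴸ-sound : ∀ as bs → (as ==ᴸ bs) ≡ true → as ≡ bs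
 ==ᴸ-sound [] [] h = refl
 ==ᴸ-sound (a ∷ as) (b ∷ bs) h with ∧-split (as ==ᴸ bs) h
 ... | h₁ , h₂ = cong₂ _∷_ (Finite.==-sound bool-finite h₂) (==ᴸ-sound as bs h₁)

 ==ᴸ-equiv : Equivalence _==ᴸ_
 ==ᴸ-equiv = record { re = re' ; sy = sy' ; tr = λ {as} {bs} cs h → cong (_==ᴸ cs) (==ᴸ-sound as bs h) }
  where
  re' : ∀ as → (as ==ᴸ as) ≡ true
  re' [] = refl
  re' (a ∷ as) = cong₂ _∧_ (re' as) (re (Finite.==-equiv bool-finite) a)
  sy' : ∀ as bs → (as ==ᴸ bs) ≡ (bs ==ᴸ as)
  sy' [] [] = refl
  sy' [] (b ∷ bs) = refl
  sy' (a ∷ as) [] = refl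
  sy' (a ∷ as) (b ∷ bs) = cong₂ _∧_ (sy' as bs) (sy (Finite.==-equiv bool-finite) a b)

 historyOf : {Ω : Set} → (ℕ → Ω → Bool) → ℕ → Ω → List Bool
 historyOf m zero    ω = []
 historyOf m (suc t) ω = m t ω ∷ historyOf m t ω

 -- A probability w on n pairs (x i, y i) together with the T bits m t of a transcript.
 -- suffix i compares the coordinates ≥ i of x, prefix i the coordinates < i of y; w has
 -- density Z⁻¹ ∏ β i with respect to the n-th power of μ.  Histories are listed latest bit first.
 record Experiment : Set₁ where
  field
   Ω X Y   : Set
   Ωs : List Ω
   w : Ω → ℚ
   w≥0     : ∀ ω → 0ℚ ≤ w ω
   Ωs-all  : ∀ ω → ω ∈ Ωs
   w-total : Sum Ωs w ≡ 1ℚ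
   𝕏 : Finite X
   𝕐 : Finite Y
   n T     : ℕ
   x : ℕ → Ω → X
   y : ℕ → Ω → Y
   suffix prefix : ℕ → Ω → Ω → Bool
   suffix-equiv  : ∀ i → Equivalence (suffix i)
   prefix-equiv  : ∀ i → Equivalence (prefix i)
   suffix-suc    : ∀ i ω ω' → suffix i ω ω' ≡ suffix (suc i) ω ω' ∧ Finite._==_ 𝕏 (x i ω) (x i ω')
   prefix-suc    : ∀ i ω ω' → prefix (suc i) ω ω' ≡ prefix i ω ω' ∧ Finite._==_ 𝕐 (y i ω) (y i ω')
   suffix-n : ∀ ω ω' → suffix n ω ω' ≡ true
   prefix-0 : ∀ ω ω' → prefix 0 ω ω' ≡ true
   m : ℕ → Ω → Bool
   owner : List Bool → Bool

  history : ℕ → Ω → List Bool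
  history = historyOf m

  hist : ℕ → Ω → Ω → Bool
  hist t = _==ᴸ_ on history t

  speaker : ℕ → Ω → Bool
  speaker t ω = owner (history t ω)

  field
   alice-speaks : ∀ t {ω ω'} → speaker t ω ≡ true → suffix 0 ω ω' ≡ true → hist t ω ω' ≡ true → m t ω ≡ m t ω'
   bob-speaks   : ∀ t {ω ω'} → speaker t ω ≡ false → prefix n ω ω' ≡ true → hist t ω ω' ≡ true → m t ω ≡ m t ω'
   point : ∀ ω → Sum Ωs (λ ω' → w ω' * ⟦ suffix 0 ω ω' ∧ prefix n ω ω' ∧ hist T ω ω' ⟧) ≡ w ω
   μ : X → Y → ℚ
   μ≥0 : ∀ a b → 0ℚ ≤ μ a b
   μ-total : Sum (Finite.values 𝕏) (λ a → Sum (Finite.values 𝕐) (μ a)) ≡ 1ℚ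
   β : ℕ → Ω → ℚ
   β≥0 : ∀ i ω → 0ℚ ≤ β i ω
   Z⁻¹ lam : ℚ
   Z⁻¹≥0 : 0ℚ ≤ Z⁻¹
   Z-log : LogLe Z⁻¹ lam
   density : ∀ ω → w ω ≡ Z⁻¹ * (Prod (downFrom n) (λ i → μ (x i ω) (y i ω)) * Prod (downFrom n) (λ i → β i ω))

  hist-equiv : ∀ t → Equivalence (hist t)
  hist-equiv t = on-equiv (history t) ==ᴸ-equiv

  hist-suc : ∀ t ω ω' → hist (suc t) ω ω' ≡ hist t ω ω' ∧ Finite._==_ bool-finite (m t ω) (m t ω')
  hist-suc t ω ω' = refl

  hist-0 : ∀ ω ω' → hist 0 ω ω' ≡ true
  hist-0 ω ω' = refl

  speaker-inv : ∀ t {ω ω'} → hist t ω ω' ≡ true → speaker t ω ≡ speaker t ω'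
  speaker-inv t {ω} {ω'} h = cong owner (==ᴸ-sound (history t ω) (history t ω') h)

 module Information (E : Experiment) where

  open Experiment E
  open Masses Ωs w w≥0 public
  private
   module 𝕏 = Finite 𝕏
   module 𝕐 = Finite 𝕐
   module 𝟚 = Finite bool-finite

  μX : X → ℚ
  μX a = Sum 𝕐.values (μ a)

  μY : Y → ℚ
  μY b = Sum 𝕏.values (λ a → μ a b)

  μX≥0 : ∀ a → 0ℚ ≤ μX a
  μX≥0 a = Sum-≥0 𝕐.values (μ≥0 a)

  μY≥0 : ∀ b → 0ℚ ≤ μY b
  μY≥0 b = Sum-≥0 𝕏.values (λ a → μ≥0 a b)

  -- With x_{>i}, y_{<i} and t bits of the transcript shared, `G i t` is what Alice knows,
  -- `G (suc i) t` what Bob knows, and `K i t` what they know together.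
  G K : ℕ → ℕ → Ω → Ω → Bool
  G i t = suffix i ∩ prefix i ∩ hist t
  K i t = suffix i ∩ prefix (suc i) ∩ hist t

  G-equiv : ∀ i t → Equivalence (G i t)
  G-equiv i t = ∩-equiv (suffix-equiv i) (∩-equiv (prefix-equiv i) (hist-equiv t))

  K-equiv : ∀ i t → Equivalence (K i t)
  K-equiv i t = ∩-equiv (suffix-equiv i) (∩-equiv (prefix-equiv (suc i)) (hist-equiv t))

  g k : ℕ → ℕ → Ω → ℚ
  g i t = mass (G i t)
  k i t = mass (K i t)

  0≤g : ∀ i t ω → 0ℚ ≤ g i t ω
  0≤g i t = 0≤mass (G i t)

  0≤k : ∀ i t ω → 0ℚ ≤ k i t ω
  0≤k i t = 0≤mass (K i t)

  -- `r₁` is Alice's probability of the next bit divided by its probability given the knowledge of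
  -- both players; `r₂` is the same for Bob.
  own-ratio oth-ratio r₁ r₂ : ℕ → ℕ → Ω → ℚ
  r₁ i t ω = (g i (suc t) ω * inv (g i t ω)) * (k i t ω * inv (k i (suc t) ω))
  r₂ i t ω = (g (suc i) (suc t) ω * inv (g (suc i) t ω)) * (k i t ω * inv (k i (suc t) ω))
  own-ratio i t ω = if speaker t ω then r₁ i t ω else r₂ i t ω
  oth-ratio i t ω = if speaker t ω then r₂ i t ω else r₁ i t ω

  path-ratio : ℕ → Ω → ℚ
  path-ratio i ω = Prod (downFrom T) (λ t → own-ratio i t ω)

  PX PY : ℕ → Ω → ℚ
  PX i = mass (always ∩ (𝕏._==_ on x i))
  PY i = mass (always ∩ (𝕐._==_ on y i))

  -- Ratios of mean at most 1. `sX` compares the laws of x_i under μ and under w, `vX` the law of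
  -- y_i given x_i under μ with its law under w given x_{≥i} and y_{<i}, and `eX` the law of x_i
  -- under w with its law given x_{>i}. The versions for Y exchange the players and the directions.
  sX sY vX vY eX eY : ℕ → Ω → ℚ
  sX i ω = μX (x i ω) * (mass always ω * inv (PX i ω))
  sY i ω = μY (y i ω) * (mass always ω * inv (PY i ω))
  vX i ω = (μ (x i ω) (y i ω) * inv (μX (x i ω))) * (g i 0 ω * inv (k i 0 ω))
  vY i ω = (μ (x i ω) (y i ω) * inv (μY (y i ω))) * (g (suc i) 0 ω * inv (k i 0 ω))
  eX i ω = (PX i ω * inv (mass always ω)) * (mass (suffix (suc i)) ω * inv (mass (suffix i) ω))
  eY i ω = (PY i ω * inv (mass always ω)) * (mass (prefix i) ω * inv (mass (prefix (suc i)) ω))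

  L : ℕ → Ω → Ω → Bool
  L i = suffix 0 ∩ prefix i ∩ hist T

  -- `u` compares the laws of y_i after the transcript, given x_{≥i} and given all of x. Its product
  -- over i contributes the factor 1/w(ω), against which the density of w cancels.
  l u : ℕ → Ω → ℚ
  l i = mass (L i)
  u i ω = (k i T ω * inv (g i T ω)) * (l i ω * inv (l (suc i) ω))

  private
   suffix-step : ∀ {i ω ω'} → suffix i ω ω' ≡ true → suffix (suc i) ω ω' ≡ true
   suffix-step {i} {ω} {ω'} h = proj₁ (∧-split (suffix (suc i) ω ω') (trans (sym (suffix-suc i ω ω')) h))

   suffix-x : ∀ {i ω ω'} → suffix i ω ω' ≡ true → x i ω ≡ x i ω'
   suffix-x {i} {ω} {ω'} h = 𝕏.==-sound (proj₂ (∧-split (suffix (suc i) ω ω') (trans (sym (suffix-suc i ω ω')) h)))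

   suffix-0 : ∀ i {ω ω'} → suffix 0 ω ω' ≡ true → suffix i ω ω' ≡ true
   suffix-0 zero    h = h
   suffix-0 (suc i) h = suffix-step {i} (suffix-0 i h)

   prefix-step : ∀ {i ω ω'} → prefix (suc i) ω ω' ≡ true → prefix i ω ω' ≡ true
   prefix-step {i} {ω} {ω'} h = proj₁ (∧-split (prefix i ω ω') (trans (sym (prefix-suc i ω ω')) h))

   prefix-y : ∀ {i ω ω'} → prefix (suc i) ω ω' ≡ true → y i ω ≡ y i ω'
   prefix-y {i} {ω} {ω'} h = 𝕐.==-sound (proj₂ (∧-split (prefix i ω ω') (trans (sym (prefix-suc i ω ω')) h)))

   hist-step : ∀ t {ω ω'} → hist (suc t) ω ω' ≡ true → hist t ω ω' ≡ true
   hist-step t {ω} {ω'} h = proj₁ (∧-split (hist t ω ω') (trans (sym (hist-suc t ω ω')) h))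

   parts : ∀ a b c → (a ∧ b ∧ c) ≡ true → a ≡ true × b ≡ true × c ≡ true
   parts true true c h = refl , refl , h

   assoc₄ : ∀ a b c d → a ∧ b ∧ (c ∧ d) ≡ (a ∧ b ∧ c) ∧ d
   assoc₄ true  b c d = sym (∧-assoc b c d)
   assoc₄ false b c d = refl

   swap₄ : ∀ a b c d → a ∧ (b ∧ d) ∧ c ≡ (a ∧ b ∧ c) ∧ d
   swap₄ false b     c d = refl
   swap₄ true  true  c d = ∧-comm d c
   swap₄ true  false c d = refl

   swap₃ : ∀ a b c d → (a ∧ d) ∧ b ∧ c ≡ (a ∧ b ∧ c) ∧ d
   swap₃ true  b c d = ∧-comm d (b ∧ c)
   swap₃ false b c d = refl

  G-hist : ∀ i t ω → mass (G i t ∩ (𝟚._==_ on m t)) ω ≡ g i (suc t) ω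
  G-hist i t ω = mass-cong (G i t ∩ (𝟚._==_ on m t)) (G i (suc t)) ω (λ ω' → sym (trans (cong (λ z → suffix i ω ω' ∧ prefix i ω ω' ∧ z) (hist-suc t ω ω')) (assoc₄ (suffix i ω ω') (prefix i ω ω') (hist t ω ω') _)))

  K-hist : ∀ i t ω → mass (K i t ∩ (𝟚._==_ on m t)) ω ≡ k i (suc t) ω
  K-hist i t ω = mass-cong (K i t ∩ (𝟚._==_ on m t)) (K i (suc t)) ω (λ ω' → sym (trans (cong (λ z → suffix i ω ω' ∧ prefix (suc i) ω ω' ∧ z) (hist-suc t ω ω')) (assoc₄ (suffix i ω ω') (prefix (suc i) ω ω') (hist t ω ω') _)))

  G-y : ∀ i t ω → mass (G i t ∩ (𝕐._==_ on y i)) ω ≡ k i t ω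
  G-y i t ω = mass-cong (G i t ∩ (𝕐._==_ on y i)) (K i t) ω (λ ω' → sym (trans (cong (λ z → suffix i ω ω' ∧ z ∧ hist t ω ω') (prefix-suc i ω ω')) (swap₄ (suffix i ω ω') (prefix i ω ω') (hist t ω ω') _)))

  G-x : ∀ i t ω → mass (G (suc i) t ∩ (𝕏._==_ on x i)) ω ≡ k i t ω
  G-x i t ω = mass-cong (G (suc i) t ∩ (𝕏._==_ on x i)) (K i t) ω (λ ω' → sym (trans (cong (λ z → z ∧ prefix (suc i) ω ω' ∧ hist t ω ω') (suffix-suc i ω ω')) (swap₃ (suffix (suc i) ω ω') (prefix (suc i) ω ω') (hist t ω ω') _)))

  L-y : ∀ i ω → mass (L i ∩ (𝕐._==_ on y i)) ω ≡ l (suc i) ω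
  L-y i ω = mass-cong (L i ∩ (𝕐._==_ on y i)) (L (suc i)) ω (λ ω' → sym (trans (cong (λ z → suffix 0 ω ω' ∧ z ∧ hist T ω ω') (prefix-suc i ω ω')) (swap₄ (suffix 0 ω ω') (prefix i ω ω') (hist T ω ω') _)))

  G-parts : ∀ i t {ω ω'} → G i t ω ω' ≡ true → suffix i ω ω' ≡ true × prefix i ω ω' ≡ true × hist t ω ω' ≡ true
  G-parts i t {ω} {ω'} h = parts (suffix i ω ω') (prefix i ω ω') (hist t ω ω') h

  K-parts : ∀ i t {ω ω'} → K i t ω ω' ≡ true → suffix i ω ω' ≡ true × prefix (suc i) ω ω' ≡ true × hist t ω ω' ≡ true
  K-parts i t {ω} {ω'} h = parts (suffix i ω ω') (prefix (suc i) ω ω') (hist t ω ω') h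

  K⇒G : ∀ i t {ω ω'} → K i t ω ω' ≡ true → G i t ω ω' ≡ true
  K⇒G i t h with K-parts i t h
  ... | a , b , c = cong₂ _∧_ a (cong₂ _∧_ (prefix-step {i} b) c)

  K⇒G' : ∀ i t {ω ω'} → K i t ω ω' ≡ true → G (suc i) t ω ω' ≡ true
  K⇒G' i t h with K-parts i t h
  ... | a , b , c = cong₂ _∧_ (suffix-step {i} a) (cong₂ _∧_ b c)

  K-step : ∀ i t {ω ω'} → K i (suc t) ω ω' ≡ true → K i t ω ω' ≡ true
  K-step i t h with K-parts i (suc t) h
  ... | a , b , c = cong₂ _∧_ a (cong₂ _∧_ b (hist-step t c))

  K-hist-part : ∀ i t {ω ω'} → K i t ω ω' ≡ true → hist t ω ω' ≡ true
  K-hist-part i t h = proj₂ (proj₂ (K-parts i t h))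

  r₁-inv : ∀ i t {ω ω'} → K i (suc t) ω ω' ≡ true → r₁ i t ω ≡ r₁ i t ω'
  r₁-inv i t h = cong₂ _*_ (cong₂ (λ a b → a * inv b) (mass-class (G-equiv i (suc t)) (K⇒G i (suc t) h)) (mass-class (G-equiv i t) (K⇒G i t (K-step i t h))))
   (cong₂ (λ a b → a * inv b) (mass-class (K-equiv i t) (K-step i t h)) (mass-class (K-equiv i (suc t)) h))

  r₂-inv : ∀ i t {ω ω'} → K i (suc t) ω ω' ≡ true → r₂ i t ω ≡ r₂ i t ω'
  r₂-inv i t h = cong₂ _*_ (cong₂ (λ a b → a * inv b) (mass-class (G-equiv (suc i) (suc t)) (K⇒G' i (suc t) h)) (mass-class (G-equiv (suc i) t) (K⇒G' i t (K-step i t h))))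
   (cong₂ (λ a b → a * inv b) (mass-class (K-equiv i t) (K-step i t h)) (mass-class (K-equiv i (suc t)) h))

  module Expectations where

   resample-r₁ : ∀ i t (H : Ω → ℚ) → (∀ ω → 0ℚ ≤ H ω) → (∀ {ω ω'} → K i t ω ω' ≡ true → H ω ≡ H ω') → 𝔼 (λ ω → H ω * r₁ i t ω) ≤ 𝔼 H
   resample-r₁ i t H H≥0 H-inv = ≡≤ (𝔼-cong (λ ω → cong (H ω *_) (cong₂ (λ a b → (a * inv (g i t ω)) * (k i t ω * inv b)) (sym (G-hist i t ω)) (sym (K-hist i t ω)))))
    (refine bool-finite (m t) (G-equiv i t) (K-equiv i t) (K⇒G i t) H H≥0 H-inv)

   resample-r₂ : ∀ i t (H : Ω → ℚ) → (∀ ω → 0ℚ ≤ H ω) → (∀ {ω ω'} → K i t ω ω' ≡ true → H ω ≡ H ω') → 𝔼 (λ ω → H ω * r₂ i t ω) ≤ 𝔼 H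
   resample-r₂ i t H H≥0 H-inv = ≡≤ (𝔼-cong (λ ω → cong (H ω *_) (cong₂ (λ a b → (a * inv (g (suc i) t ω)) * (k i t ω * inv b)) (sym (G-hist (suc i) t ω)) (sym (K-hist i t ω)))))
    (refine bool-finite (m t) (G-equiv (suc i) t) (K-equiv i t) (K⇒G' i t) H H≥0 H-inv)

   𝔼1 : 𝔼 (λ _ → 1ℚ) ≡ 1ℚ
   𝔼1 = trans (Sum-cong Ωs (λ ω → *-identityʳ (w ω))) w-total

   Mean≤1 : (Ω → ℚ) → Set
   Mean≤1 f = 𝔼 f ≤ 1ℚ

   from-H : ∀ {f} → 𝔼 (λ ω → 1ℚ * f ω) ≤ 𝔼 (λ _ → 1ℚ) → Mean≤1 f
   from-H {f} h = ≡≤ (𝔼-cong (λ ω → sym (*-identityˡ (f ω)))) (≤≡ h 𝔼1)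

   mean-r₁ : ∀ i t → Mean≤1 (r₁ i t)
   mean-r₁ i t = from-H (resample-r₁ i t (λ _ → 1ℚ) (λ _ → 0≤1) (λ _ → refl))

   mean-r₂ : ∀ i t → Mean≤1 (r₂ i t)
   mean-r₂ i t = from-H (resample-r₂ i t (λ _ → 1ℚ) (λ _ → 0≤1) (λ _ → refl))

   r₁≥0 : ∀ i t ω → 0ℚ ≤ r₁ i t ω
   r₁≥0 i t ω = 0≤* (0≤* (0≤g i (suc t) ω) (0≤inv (0≤g i t ω))) (0≤* (0≤k i t ω) (0≤inv (0≤k i (suc t) ω)))

   r₂≥0 : ∀ i t ω → 0ℚ ≤ r₂ i t ω
   r₂≥0 i t ω = 0≤* (0≤* (0≤g (suc i) (suc t) ω) (0≤inv (0≤g (suc i) t ω))) (0≤* (0≤k i t ω) (0≤inv (0≤k i (suc t) ω)))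

   own≥0 : ∀ i t ω → 0ℚ ≤ own-ratio i t ω
   own≥0 i t ω with speaker t ω
   ... | true  = r₁≥0 i t ω
   ... | false = r₂≥0 i t ω

   -- The partial products form a supermartingale. Who speaks next is determined by the history, so
   -- the last factor can be resampled separately on the two events that Alice or that Bob speaks.
   mean-path : ∀ i → Mean≤1 (path-ratio i)
   mean-path i = ≤≡ (go T) 𝔼1
    where
    W : ℕ → Ω → ℚ
    W t ω = Prod (downFrom t) (λ t → own-ratio i t ω)
    W≥0 : ∀ t ω → 0ℚ ≤ W t ω
    W≥0 t ω = Prod-≥0 (downFrom t) (λ t → own≥0 i t ω)
    own-inv : ∀ t {ω ω'} → K i (suc t) ω ω' ≡ true → own-ratio i t ω ≡ own-ratio i t ω'
    own-inv t {ω} {ω'} h rewrite speaker-inv t {ω} {ω'} (K-hist-part i t (K-step i t h)) = cong₂ (λ a b → if speaker t ω' then a else b) (r₁-inv i t h) (r₂-inv i t h)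
    W-inv : ∀ t {ω ω'} → K i t ω ω' ≡ true → W t ω ≡ W t ω'
    W-inv zero    h = refl
    W-inv (suc t) h = cong₂ _*_ (own-inv t h) (W-inv t (K-step i t h))
    split : ∀ t ω → W (suc t) ω ≡ (W t ω * ⟦ speaker t ω ⟧) * r₁ i t ω + (W t ω * ⟦ not (speaker t ω) ⟧) * r₂ i t ω
    split t ω with speaker t ω
    ... | true  = solve 3 (λ r w s → r :* w := w :* :1 :* r :+ w :* :0 :* s) refl _ _ _
    ... | false = solve 3 (λ r w s → r :* w := w :* :0 :* s :+ w :* :1 :* r) refl _ _ _
    merge : ∀ t ω → W t ω * ⟦ speaker t ω ⟧ + W t ω * ⟦ not (speaker t ω) ⟧ ≡ W t ω
    merge t ω with speaker t ω
    ... | true  = solve 1 (λ w → w :* :1 :+ w :* :0 := w) refl _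
    ... | false = solve 1 (λ w → w :* :0 :+ w :* :1 := w) refl _
    go : ∀ t → 𝔼 (W t) ≤ 𝔼 (λ _ → 1ℚ)
    go zero    = ≤-refl
    go (suc t) = begin
     𝔼 (W (suc t)) ≡⟨ trans (𝔼-cong (split t)) 𝔼-+ ⟩
     𝔼 (λ ω → (W t ω * ⟦ speaker t ω ⟧) * r₁ i t ω) + 𝔼 (λ ω → (W t ω * ⟦ not (speaker t ω) ⟧) * r₂ i t ω)
      ≤⟨ +-mono-≤ (resample-r₁ i t _ (λ ω → 0≤* (W≥0 t ω) (0≤⟦⟧ (speaker t ω))) (λ h → cong₂ (λ a b → a * ⟦ b ⟧) (W-inv t h) (speaker-inv t (K-hist-part i t h))))
       (resample-r₂ i t _ (λ ω → 0≤* (W≥0 t ω) (0≤⟦⟧ (not (speaker t ω)))) (λ h → cong₂ (λ a b → a * ⟦ not b ⟧) (W-inv t h) (speaker-inv t (K-hist-part i t h)))) ⟩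
     𝔼 (λ ω → W t ω * ⟦ speaker t ω ⟧) + 𝔼 (λ ω → W t ω * ⟦ not (speaker t ω) ⟧)
      ≡⟨ trans (sym 𝔼-+) (𝔼-cong (merge t)) ⟩
     𝔼 (W t) ≤⟨ go t ⟩
     𝔼 (λ _ → 1ℚ) ∎
     where open ≤-Reasoning

   mean-u : ∀ i → Mean≤1 (u i)
   mean-u i = from-H (≡≤ (𝔼-cong (λ ω → cong (1ℚ *_) (cong₂ (λ a b → (a * inv (g i T ω)) * (l i ω * inv b)) (sym (G-y i T ω)) (sym (L-y i ω)))))
    (refine 𝕐 (y i) (G-equiv i T) (∩-equiv (suffix-equiv 0) (∩-equiv (prefix-equiv i) (hist-equiv T)))
     (λ {ω} {ω'} h → let a , b , c = parts (suffix 0 ω ω') (prefix i ω ω') (hist T ω ω') h in cong₂ _∧_ (suffix-0 i a) (cong₂ _∧_ b c)) (λ _ → 1ℚ) (λ _ → 0≤1) (λ _ → refl)))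

   mean-vX : ∀ i → Mean≤1 (vX i)
   mean-vX i = from-H (≡≤ (𝔼-cong (λ ω → cong (λ z → 1ℚ * ((μ (x i ω) (y i ω) * inv (μX (x i ω))) * (g i 0 ω * inv z))) (sym (G-y i 0 ω))))
    (kernel 𝕐 (y i) (G-equiv i 0) (λ ω v → μ (x i ω) v * inv (μX (x i ω))) (λ ω v → 0≤* (μ≥0 _ v) (0≤inv (μX≥0 _)))
     (λ {ω} {ω'} h v → cong (λ a → μ a v * inv (μX a)) (suffix-x {i} (proj₁ (G-parts i 0 h))))
     (λ ω → ≡≤ (Sum-*ʳ (inv (μX (x i ω))) 𝕐.values) (*inv≤1 (μX≥0 (x i ω)))) (λ _ → 1ℚ) (λ _ → 0≤1) (λ _ → refl)))

   mean-vY : ∀ i → Mean≤1 (vY i)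
   mean-vY i = from-H (≡≤ (𝔼-cong (λ ω → cong (λ z → 1ℚ * ((μ (x i ω) (y i ω) * inv (μY (y i ω))) * (g (suc i) 0 ω * inv z))) (sym (G-x i 0 ω))))
    (kernel 𝕏 (x i) (G-equiv (suc i) 0) (λ ω v → μ v (y i ω) * inv (μY (y i ω))) (λ ω v → 0≤* (μ≥0 v _) (0≤inv (μY≥0 _)))
     (λ {ω} {ω'} h v → cong (λ b → μ v b * inv (μY b)) (prefix-y {i} (proj₁ (proj₂ (G-parts (suc i) 0 h)))))
     (λ ω → ≡≤ (Sum-*ʳ (inv (μY (y i ω))) 𝕏.values) (*inv≤1 (μY≥0 (y i ω)))) (λ _ → 1ℚ) (λ _ → 0≤1) (λ _ → refl)))

   mean-sX : ∀ i → Mean≤1 (sX i)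
   mean-sX i = from-H (kernel 𝕏 (x i) always-equiv (λ _ v → μX v) (λ _ v → μX≥0 v) (λ _ v → refl) (λ _ → ≤-reflexive μ-total) (λ _ → 1ℚ) (λ _ → 0≤1) (λ _ → refl))

   mean-sY : ∀ i → Mean≤1 (sY i)
   mean-sY i = from-H (kernel 𝕐 (y i) always-equiv (λ _ v → μY v) (λ _ v → μY≥0 v) (λ _ v → refl) (λ _ → ≤-reflexive (trans (Sum-swap 𝕐.values 𝕏.values) μ-total)) (λ _ → 1ℚ) (λ _ → 0≤1) (λ _ → refl))

   mean-eX : ∀ i → Mean≤1 (eX i)
   mean-eX i = from-H (≡≤ (𝔼-cong (λ ω → cong (λ z → 1ℚ * ((PX i ω * inv (mass always ω)) * (mass (suffix (suc i)) ω * inv z))) (mass-cong (suffix i) (suffix (suc i) ∩ (𝕏._==_ on x i)) ω (λ ω' → suffix-suc i ω ω'))))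
    (refine 𝕏 (x i) always-equiv (suffix-equiv (suc i)) (λ _ → refl) (λ _ → 1ℚ) (λ _ → 0≤1) (λ _ → refl)))

   mean-eY : ∀ i → Mean≤1 (eY i)
   mean-eY i = from-H (≡≤ (𝔼-cong (λ ω → cong (λ z → 1ℚ * ((PY i ω * inv (mass always ω)) * (mass (prefix i) ω * inv z))) (mass-cong (prefix (suc i)) (prefix i ∩ (𝕐._==_ on y i)) ω (λ ω' → prefix-suc i ω ω'))))
    (refine 𝕐 (y i) always-equiv (prefix-equiv i) (λ _ → refl) (λ _ → 1ℚ) (λ _ → 0≤1) (λ _ → refl)))

   -- A transcript bit has at most one bit of entropy: E [1 / P(m t | class)] ≤ 2.
   mean-bit : ∀ i t → 𝔼 (λ ω → g i t ω * inv (g i (suc t) ω)) ≤ two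
   mean-bit i t = ≡≤ (trans (𝔼-cong step) (𝔼-*ˡ two)) (≤≡ (*≤ˡ (<⇒≤ 0<two) half) (*-identityʳ two))
    where
    step : ∀ ω → g i t ω * inv (g i (suc t) ω) ≡ two * (1ℚ * (inv two * (g i t ω * inv (mass (G i t ∩ (𝟚._==_ on m t)) ω))))
    step ω = trans (cong (λ z → g i t ω * inv z) (sym (G-hist i t ω)))
     (sym (trans (solve 3 (λ a b z → a :* (:1 :* (b :* z)) := (a :* b) :* z) refl two (inv two) _) (trans (cong (_* (g i t ω * inv (mass (G i t ∩ (𝟚._==_ on m t)) ω))) (*inv 0<two)) (*-identityˡ _))))
    half : 𝔼 (λ ω → 1ℚ * (inv two * (g i t ω * inv (mass (G i t ∩ (𝟚._==_ on m t)) ω)))) ≤ 1ℚ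
    half = ≤≡ (kernel bool-finite (m t) (G-equiv i t) (λ _ _ → inv two) (λ _ _ → 0≤inv (<⇒≤ 0<two)) (λ _ _ → refl)
     (λ _ → ≤-reflexive (trans (solve 1 (λ h → h :+ (h :+ :0) := :2 :* h) refl (inv two)) (*inv 0<two))) (λ _ → 1ℚ) (λ _ → 0≤1) (λ _ → refl)) 𝔼1

   mean-excess : ∀ {f} → Mean≤1 f → 𝔼 (λ ω → f ω - 1ℚ) ≤ 0ℚ
   mean-excess {f} h = ≡≤ (trans 𝔼-- (cong (λ z → 𝔼 f - z) 𝔼1)) (≤≡ (+≤ʳ (- 1ℚ) h) (+-inverseʳ 1ℚ))

   mean-sharp : ∀ {f} → Mean≤1 f → 𝔼 (λ ω → (f ω - 1ℚ) - gap (f ω)) ≤ - 𝔼 (λ ω → gap (f ω))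
   mean-sharp {f} h = ≡≤ 𝔼-- (≤≡ (+≤ʳ (- 𝔼 (λ ω → gap (f ω))) (mean-excess h)) (+-identityˡ _))

  open Expectations public

  private
   N TT : List ℕ
   N  = downFrom n
   TT = downFrom T

  module Pointwise (ω : Ω) (w>0 : 0ℚ < w ω) where

   mass>0 : ∀ {E} → Equivalence E → 0ℚ < mass E ω
   mass>0 e = <-≤-trans w>0 (w≤mass e (Ωs-all ω))

   g>0 : ∀ i t → 0ℚ < g i t ω
   g>0 i t = mass>0 (G-equiv i t)

   k>0 : ∀ i t → 0ℚ < k i t ω
   k>0 i t = mass>0 (K-equiv i t)

   l>0 : ∀ i → 0ℚ < l i ω
   l>0 i = mass>0 (∩-equiv (suffix-equiv 0) (∩-equiv (prefix-equiv i) (hist-equiv T)))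

   1>0 : 0ℚ < mass always ω
   1>0 = mass>0 always-equiv

   PX>0 : ∀ i → 0ℚ < PX i ω
   PX>0 i = mass>0 (∩-equiv always-equiv (on-equiv (x i) 𝕏.==-equiv))

   PY>0 : ∀ i → 0ℚ < PY i ω
   PY>0 i = mass>0 (∩-equiv always-equiv (on-equiv (y i) 𝕐.==-equiv))

   Πμ Πβ ΠμX ΠμY : ℚ
   Πμ  = Prod N (λ i → μ (x i ω) (y i ω))
   Πβ  = Prod N (λ i → β i ω)
   ΠμX = Prod N (λ i → μX (x i ω))
   ΠμY = Prod N (λ i → μY (y i ω))

   Πμ≥0 : 0ℚ ≤ Πμ
   Πμ≥0 = Prod-≥0 N (λ i → μ≥0 _ _)

   Πβ≥0 : 0ℚ ≤ Πβ
   Πβ≥0 = Prod-≥0 N (λ i → β≥0 i ω)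

   w'>0 : 0ℚ < Z⁻¹ * (Πμ * Πβ)
   w'>0 = subst (0ℚ <_) (density ω) w>0

   ΠΠ>0 : 0ℚ < Πμ * Πβ
   ΠΠ>0 = factorʳ Z⁻¹≥0 (0≤* Πμ≥0 Πβ≥0) w'>0

   μ>0 : ∀ {i} → i ∈ N → 0ℚ < μ (x i ω) (y i ω)
   μ>0 = Prod-pos⁻ N (λ i → μ≥0 _ _) (factorˡ Πμ≥0 Πβ≥0 ΠΠ>0)

   β>0 : ∀ {i} → i ∈ N → 0ℚ < β i ω
   β>0 = Prod-pos⁻ N (λ i → β≥0 i ω) (factorʳ Πμ≥0 Πβ≥0 ΠΠ>0)

   μX>0 : ∀ {i} → i ∈ N → 0ℚ < μX (x i ω)
   μX>0 {i} i∈ = <-≤-trans (μ>0 i∈) (≡≤ (sym (Finite-lemmas.pick 𝕐 (μ (x i ω)) (y i ω)))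
    (Sum-mono 𝕐.values (λ v → ≤≡ (*≤ʳ (μ≥0 _ v) (⟦⟧≤1 (y i ω 𝕐.== v))) (*-identityˡ _))))

   μY>0 : ∀ {i} → i ∈ N → 0ℚ < μY (y i ω)
   μY>0 {i} i∈ = <-≤-trans (μ>0 i∈) (≡≤ (sym (Finite-lemmas.pick 𝕏 (λ a → μ a (y i ω)) (x i ω)))
    (Sum-mono 𝕏.values (λ v → ≤≡ (*≤ʳ (μ≥0 v _) (⟦⟧≤1 (x i ω 𝕏.== v))) (*-identityˡ _))))

   -- The inverse of `Φ t` is P(x, t bits) times the product of all P(y_i | x_{≥i}, y_{<i}, t bits).
   -- The same construction with the players exchanged gives the same number: `Φ≡` telescopes `g i`
   -- against `g (suc i)`.
   ρ ρ' Φ : ℕ → ℚ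
   ρ  t = Prod N (λ i → g i t ω * inv (k i t ω))
   ρ' t = Prod N (λ i → g (suc i) t ω * inv (k i t ω))
   Φ  t = ρ t * inv (g 0 t ω)

   ρ>0 : ∀ t → 0ℚ < ρ t
   ρ>0 t = Prod-pos N (λ i → 0<* (g>0 i t) (0<inv (k>0 i t)))

   ρ'>0 : ∀ t → 0ℚ < ρ' t
   ρ'>0 t = Prod-pos N (λ i → 0<* (g>0 (suc i) t) (0<inv (k>0 i t)))

   Φ>0 : ∀ t → 0ℚ < Φ t
   Φ>0 t = 0<* (ρ>0 t) (0<inv (g>0 0 t))

   Φ≡ : ∀ t → Φ t ≡ ρ' t * inv (g n t ω)
   Φ≡ t = sym (trans (cong (_* inv (g n t ω)) ρ'≡) (trans (solve 4 (λ a b c d → a :* (b :* c) :* d := a :* c :* (b :* d)) refl (ρ t) (g n t ω) (inv (g 0 t ω)) (inv (g n t ω)))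
      (trans (cong (Φ t *_) (*inv (g>0 n t))) (*-identityʳ _))))
    where
    ρ'≡ : ρ' t ≡ ρ t * (g n t ω * inv (g 0 t ω))
    ρ'≡ = trans (Prod-cong N (λ i → sym (trans (solve 4 (λ a b c d → (a :* b) :* (c :* d) := (c :* b) :* (a :* d)) refl (g i t ω) (inv (k i t ω)) (g (suc i) t ω) (inv (g i t ω)))
       (trans (cong (g (suc i) t ω * inv (k i t ω) *_) (*inv (g>0 i t))) (*-identityʳ _)))))
     (trans (Prod-* N) (cong (ρ t *_) (Prod-telescope (λ i → g>0 i t) n)))

   Prod-r₁ : ∀ t → Prod N (λ i → r₁ i t ω) ≡ ρ (suc t) * inv (ρ t)
   Prod-r₁ t = trans (Prod-cong N (λ i → trans (solve 4 (λ a b c d → (a :* b) :* (c :* d) := (a :* d) :* (b :* c)) refl (g i (suc t) ω) (inv (g i t ω)) (k i t ω) (inv (k i (suc t) ω)))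
      (cong (g i (suc t) ω * inv (k i (suc t) ω) *_) (sym (inv-quotient (g>0 i t) (k>0 i t))))))
    (trans (Prod-* N) (cong (ρ (suc t) *_) (Prod-inv N (λ i → 0<* (g>0 i t) (0<inv (k>0 i t))))))

   Prod-r₂ : ∀ t → Prod N (λ i → r₂ i t ω) ≡ ρ' (suc t) * inv (ρ' t)
   Prod-r₂ t = trans (Prod-cong N (λ i → trans (solve 4 (λ a b c d → (a :* b) :* (c :* d) := (a :* d) :* (b :* c)) refl (g (suc i) (suc t) ω) (inv (g (suc i) t ω)) (k i t ω) (inv (k i (suc t) ω)))
      (cong (g (suc i) (suc t) ω * inv (k i (suc t) ω) *_) (sym (inv-quotient (g>0 (suc i) t) (k>0 i t))))))
    (trans (Prod-* N) (cong (ρ' (suc t) *_) (Prod-inv N (λ i → 0<* (g>0 (suc i) t) (0<inv (k>0 i t))))))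

   extend : ∀ t {ω'} → hist t ω ω' ≡ true → m t ω ≡ m t ω' → hist (suc t) ω ω' ≡ true
   extend t {ω'} h e = trans (hist-suc t ω ω') (cong₂ _∧_ h (Finite-lemmas.==-≡ bool-finite e))

   -- Her bit is a function of x and the history, so it refines nothing in `G 0 t`, which fixes all
   -- of x.
   alice-const : ∀ t → speaker t ω ≡ true → g 0 (suc t) ω ≡ g 0 t ω
   alice-const t h = mass-cong (G 0 (suc t)) (G 0 t) ω (λ ω' → bool-ext
    (λ e → let a , b , c = G-parts 0 (suc t) e in cong₂ _∧_ a (cong₂ _∧_ b (hist-step t c)))
    (λ e → let a , b , c = G-parts 0 t e in cong₂ _∧_ a (cong₂ _∧_ b (extend t c (alice-speaks t h a c)))))

   bob-const : ∀ t → speaker t ω ≡ false → g n (suc t) ω ≡ g n t ω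
   bob-const t h = mass-cong (G n (suc t)) (G n t) ω (λ ω' → bool-ext
    (λ e → let a , b , c = G-parts n (suc t) e in cong₂ _∧_ a (cong₂ _∧_ b (hist-step t c)))
    (λ e → let a , b , c = G-parts n t e in cong₂ _∧_ a (cong₂ _∧_ b (extend t c (bob-speaks t h b c)))))

   -- For a bit of Alice Φ is read as ρ divided by `g 0`, for a bit of Bob as ρ' divided by `g n`;
   -- in both cases the denominator does not change with the bit. This is why no entropy of the
   -- transcript enters the cost of following the owners' predictions.
   Prod-own : ∀ t → Prod N (λ i → own-ratio i t ω) ≡ Φ (suc t) * inv (Φ t)
   Prod-own t with speaker t ω in eq
   ... | true  = trans (Prod-r₁ t) (sym (trans (cong (λ z → ρ (suc t) * inv z * inv (Φ t)) (alice-const t eq)) (quotient-cancel (ρ>0 (suc t)) (ρ>0 t) (g>0 0 t))))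
   ... | false = trans (Prod-r₂ t) (sym (trans (cong₂ (λ a b → a * inv b) (Φ≡ (suc t)) (Φ≡ t))
    (trans (cong (λ z → ρ' (suc t) * inv z * inv (ρ' t * inv (g n t ω))) (bob-const t eq)) (quotient-cancel (ρ'>0 (suc t)) (ρ'>0 t) (g>0 n t)))))

   Prod-path : Prod N (λ i → path-ratio i ω) ≡ Φ T * inv (Φ 0)
   Prod-path = trans (Prod-swap N TT) (trans (Prod-cong TT Prod-own) (Prod-telescope Φ>0 T))

   -- The second factors telescope between `l 0`, which is P(x, transcript), and `l n`, the
   -- probability of x, y and the transcript; the latter is w(ω) by `point`.
   Prod-u : Prod N (λ i → u i ω) ≡ inv (Φ T) * inv (w ω)
   Prod-u = begin
    Prod N (λ i → u i ω)
     ≡⟨ Prod-* N ⟩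
    Prod N (λ i → k i T ω * inv (g i T ω)) * Prod N (λ i → l i ω * inv (l (suc i) ω))
     ≡⟨ cong₂ _*_ (trans (Prod-cong N (λ i → trans (*-comm _ _) (sym (inv-quotient (g>0 i T) (k>0 i T))))) (Prod-inv N (λ i → 0<* (g>0 i T) (0<inv (k>0 i T)))))
      (trans (Prod-cong N (λ i → trans (*-comm _ _) (sym (inv-quotient (l>0 (suc i)) (l>0 i))))) (trans (Prod-inv N (λ i → 0<* (l>0 (suc i)) (0<inv (l>0 i)))) (cong inv (Prod-telescope l>0 n)))) ⟩
    inv (ρ T) * inv (l n ω * inv (l 0 ω))
     ≡⟨ cong (inv (ρ T) *_) (trans (inv-quotient (l>0 n) (l>0 0)) (cong (λ z → inv z * l 0 ω) (point ω))) ⟩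
    inv (ρ T) * (inv (w ω) * g 0 T ω)
     ≡⟨ solve 3 (λ a b c → a :* (b :* c) := (a :* c) :* b) refl _ _ _ ⟩
    inv (ρ T) * g 0 T ω * inv (w ω)
     ≡⟨ cong (_* inv (w ω)) (inv-quotient (ρ>0 T) (g>0 0 T)) ⟨
    inv (Φ T) * inv (w ω) ∎
    where open ≡-Reasoning

   ΠμX>0 : 0ℚ < ΠμX
   ΠμX>0 = Prod-pos∈ N (λ i i∈ → μX>0 i∈)

   ΠμY>0 : 0ℚ < ΠμY
   ΠμY>0 = Prod-pos∈ N (λ i i∈ → μY>0 i∈)

   always≡1 : mass always ω ≡ 1ℚ
   always≡1 = 𝔼1

   -- The marginal of x_i under w cancels between `sX` and `eX`, and what is left of `eX` telescopes
   -- to 1/P(x).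
   Prod-seX : Prod N (λ i → sX i ω * eX i ω) ≡ ΠμX * inv (g 0 0 ω)
   Prod-seX = begin
    Prod N (λ i → sX i ω * eX i ω)
     ≡⟨ Prod-cong N (λ i → trans (solve 7 (λ m a P p i s t → (m :* (a :* p)) :* ((P :* i) :* (s :* t)) := (m :* (s :* t)) :* ((a :* i) :* (P :* p))) refl _ (mass always ω) (PX i ω) _ _ _ _)
      (trans (cong (μX (x i ω) * (mass (suffix (suc i)) ω * inv (mass (suffix i) ω)) *_) (trans (cong₂ _*_ (*inv 1>0) (*inv (PX>0 i))) (*-identityˡ 1ℚ))) (*-identityʳ _))) ⟩
    Prod N (λ i → μX (x i ω) * (mass (suffix (suc i)) ω * inv (mass (suffix i) ω)))
     ≡⟨ trans (Prod-* N) (cong (ΠμX *_) (Prod-telescope (λ i → mass>0 (suffix-equiv i)) n)) ⟩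
    ΠμX * (mass (suffix n) ω * inv (mass (suffix 0) ω))
     ≡⟨ cong (ΠμX *_) (trans (cong₂ (λ a b → a * inv b) (trans (mass-cong (suffix n) always ω (suffix-n ω)) always≡1)
      (mass-cong (suffix 0) (G 0 0) ω (λ ω' → sym (trans (cong (suffix 0 ω ω' ∧_) (cong₂ _∧_ (prefix-0 ω ω') (hist-0 ω ω'))) (∧-identityʳ _))))) (*-identityˡ _)) ⟩
    ΠμX * inv (g 0 0 ω) ∎
    where open ≡-Reasoning

   Prod-seY : Prod N (λ i → sY i ω * eY i ω) ≡ ΠμY * inv (g n 0 ω)
   Prod-seY = begin
    Prod N (λ i → sY i ω * eY i ω)
     ≡⟨ Prod-cong N (λ i → trans (solve 7 (λ m a P p i s t → (m :* (a :* p)) :* ((P :* i) :* (s :* t)) := (m :* (s :* t)) :* ((a :* i) :* (P :* p))) refl _ (mass always ω) (PY i ω) _ _ _ _)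
      (trans (cong (μY (y i ω) * (mass (prefix i) ω * inv (mass (prefix (suc i)) ω)) *_) (trans (cong₂ _*_ (*inv 1>0) (*inv (PY>0 i))) (*-identityˡ 1ℚ))) (*-identityʳ _))) ⟩
    Prod N (λ i → μY (y i ω) * (mass (prefix i) ω * inv (mass (prefix (suc i)) ω)))
     ≡⟨ trans (Prod-* N) (cong (ΠμY *_) (trans (Prod-cong N (λ i → trans (*-comm _ _) (sym (inv-quotient (mass>0 (prefix-equiv (suc i))) (mass>0 (prefix-equiv i))))))
      (trans (Prod-inv N (λ i → 0<* (mass>0 (prefix-equiv (suc i))) (0<inv (mass>0 (prefix-equiv i))))) (trans (cong inv (Prod-telescope (λ i → mass>0 (prefix-equiv i)) n)) (inv-quotient (mass>0 (prefix-equiv n)) (mass>0 (prefix-equiv 0))))))) ⟩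
    ΠμY * (inv (mass (prefix n) ω) * mass (prefix 0) ω)
     ≡⟨ cong (ΠμY *_) (trans (cong₂ (λ a b → inv b * a) (trans (mass-cong (prefix 0) always ω (prefix-0 ω)) always≡1)
      (mass-cong (prefix n) (G n 0) ω (λ ω' → sym (trans (cong₂ (λ a b → a ∧ (prefix n ω ω' ∧ b)) (suffix-n ω ω') (hist-0 ω ω')) (∧-identityʳ _))))) (*-identityʳ _)) ⟩
    ΠμY * inv (g n 0 ω) ∎
    where open ≡-Reasoning

   Prod-vX : Prod N (λ i → vX i ω) ≡ (Πμ * inv ΠμX) * ρ 0
   Prod-vX = trans (Prod-* N) (cong (_* ρ 0) (trans (Prod-* N) (cong (Πμ *_) Prod-invX)))
    where
    Prod-invX : Prod N (λ i → inv (μX (x i ω))) ≡ inv ΠμX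
    Prod-invX = go N (λ i → μX>0)
     where
     go : ∀ xs → (∀ i → i ∈ xs → 0ℚ < μX (x i ω)) → Prod xs (λ i → inv (μX (x i ω))) ≡ inv (Prod xs (λ i → μX (x i ω)))
     go [] h = sym inv-1
     go (i ∷ xs) h = trans (cong (_ *_) (go xs (λ j j∈ → h j (there j∈)))) (sym (inv-* (h i (here refl)) (Prod-pos∈ xs (λ j j∈ → h j (there j∈)))))

   Prod-vY : Prod N (λ i → vY i ω) ≡ (Πμ * inv ΠμY) * ρ' 0
   Prod-vY = trans (Prod-* N) (cong (_* ρ' 0) (trans (Prod-* N) (cong (Πμ *_) Prod-invY)))
    where
    Prod-invY : Prod N (λ i → inv (μY (y i ω))) ≡ inv ΠμY
    Prod-invY = go N (λ i → μY>0)
     where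
     go : ∀ xs → (∀ i → i ∈ xs → 0ℚ < μY (y i ω)) → Prod xs (λ i → inv (μY (y i ω))) ≡ inv (Prod xs (λ i → μY (y i ω)))
     go [] h = sym inv-1
     go (i ∷ xs) h = trans (cong (_ *_) (go xs (λ j j∈ → h j (there j∈)))) (sym (inv-* (h i (here refl)) (Prod-pos∈ xs (λ j j∈ → h j (there j∈)))))

   -- The likelihood ratios multiply to exactly 1 wherever w is positive. The letters c, d, M stand
   -- for `ρ 0`, `g 0 0`, `ΠμX` or for `ρ' 0`, `g n 0`, `ΠμY`.
   balance : ∀ {c d M} → 0ℚ < c → 0ℚ < d → 0ℚ < M → Φ 0 ≡ c * inv d →
    (Φ T * inv (Φ 0)) * (inv (Φ T) * inv (w ω)) * ((M * inv d) * ((Πμ * inv M) * c) * Πβ * Z⁻¹) ≡ 1ℚ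
   balance {c} {d} {M} hc hd hM e = begin
    (Φ T * inv (Φ 0)) * (inv (Φ T) * inv (w ω)) * ((M * inv d) * ((Πμ * inv M) * c) * Πβ * Z⁻¹)
     ≡⟨ cong (λ z → (Φ T * z) * (inv (Φ T) * inv (w ω)) * ((M * inv d) * ((Πμ * inv M) * c) * Πβ * Z⁻¹)) (trans (cong inv e) (inv-quotient hc hd)) ⟩
    (Φ T * (inv c * d)) * (inv (Φ T) * inv (w ω)) * ((M * inv d) * ((Πμ * inv M) * c) * Πβ * Z⁻¹)
     ≡⟨ solve 12 (λ a A c C d D m M p q z W → (a :* (C :* d)) :* (A :* W) :* ((m :* D) :* ((p :* M) :* c) :* q :* z)
      := ((a :* A) :* (c :* C) :* ((d :* D) :* (m :* M))) :* ((z :* (p :* q)) :* W)) refl (Φ T) _ c _ d _ M _ Πμ Πβ Z⁻¹ (inv (w ω)) ⟩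
    ((Φ T * inv (Φ T)) * (c * inv c) * ((d * inv d) * (M * inv M))) * ((Z⁻¹ * (Πμ * Πβ)) * inv (w ω))
     ≡⟨ cong₂ _*_ (cong₂ _*_ (cong₂ _*_ (*inv (Φ>0 T)) (*inv hc)) (cong₂ _*_ (*inv hd) (*inv hM))) (trans (cong (_* inv (w ω)) (sym (density ω))) (*inv w>0)) ⟩
    (1ℚ * 1ℚ * (1ℚ * 1ℚ)) * 1ℚ
     ≡⟨ solve 0 ((:1 :* :1 :* (:1 :* :1)) :* :1 := :1) refl ⟩
    1ℚ ∎
    where open ≡-Reasoning

   -- Here one player's prediction is used for all bits. The quotient `d * inv b` that remains is
   -- the inverse probability of the transcript given the whole input of that player.
   balance' : ∀ {a b c d M} → 0ℚ < a → 0ℚ < b → 0ℚ < c → 0ℚ < d → 0ℚ < M → Φ T ≡ a * inv b →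
    (a * inv c) * (inv (Φ T) * inv (w ω)) * ((M * inv d) * ((Πμ * inv M) * c) * Πβ * Z⁻¹) * (d * inv b) ≡ 1ℚ
   balance' {a} {b} {c} {d} {M} ha hb hc hd hM e = begin
    (a * inv c) * (inv (Φ T) * inv (w ω)) * ((M * inv d) * ((Πμ * inv M) * c) * Πβ * Z⁻¹) * (d * inv b)
     ≡⟨ cong (λ z → (a * inv c) * (z * inv (w ω)) * ((M * inv d) * ((Πμ * inv M) * c) * Πβ * Z⁻¹) * (d * inv b)) (trans (cong inv e) (inv-quotient ha hb)) ⟩
    (a * inv c) * (inv a * b * inv (w ω)) * ((M * inv d) * ((Πμ * inv M) * c) * Πβ * Z⁻¹) * (d * inv b)
     ≡⟨ solve 14 (λ a A b B c C d D m M p q z W → (a :* C) :* (A :* b :* W) :* ((m :* D) :* ((p :* M) :* c) :* q :* z) :* (d :* B)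
      := ((a :* A) :* (b :* B) :* (c :* C) :* ((d :* D) :* (m :* M))) :* ((z :* (p :* q)) :* W)) refl a _ b _ c _ d _ M _ Πμ Πβ Z⁻¹ (inv (w ω)) ⟩
    ((a * inv a) * (b * inv b) * (c * inv c) * ((d * inv d) * (M * inv M))) * ((Z⁻¹ * (Πμ * Πβ)) * inv (w ω))
     ≡⟨ cong₂ _*_ (cong₂ _*_ (cong₂ _*_ (cong₂ _*_ (*inv ha) (*inv hb)) (*inv hc)) (cong₂ _*_ (*inv hd) (*inv hM))) (trans (cong (_* inv (w ω)) (sym (density ω))) (*inv w>0)) ⟩
    (1ℚ * 1ℚ * 1ℚ * (1ℚ * 1ℚ)) * 1ℚ
     ≡⟨ solve 0 ((:1 :* :1 :* :1 :* (:1 :* :1)) :* :1 := :1) refl ⟩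
    1ℚ ∎
    where open ≡-Reasoning

   r₁>0 : ∀ i t → 0ℚ < r₁ i t ω
   r₁>0 i t = 0<* (0<* (g>0 i (suc t)) (0<inv (g>0 i t))) (0<* (k>0 i t) (0<inv (k>0 i (suc t))))

   r₂>0 : ∀ i t → 0ℚ < r₂ i t ω
   r₂>0 i t = 0<* (0<* (g>0 (suc i) (suc t)) (0<inv (g>0 (suc i) t))) (0<* (k>0 i t) (0<inv (k>0 i (suc t))))

   own>0 : ∀ i t → 0ℚ < own-ratio i t ω
   own>0 i t with speaker t ω
   ... | true  = r₁>0 i t
   ... | false = r₂>0 i t

   log-u : ∀ i → LogLe (u i ω) (u i ω - 1ℚ)
   log-u i = log-linear (0<* (0<* (k>0 i T) (0<inv (g>0 i T))) (0<* (l>0 i) (0<inv (l>0 (suc i)))))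

   log-path : ∀ i → LogLe (path-ratio i ω) ((path-ratio i ω - 1ℚ) - gap (path-ratio i ω))
   log-path i = log-gap (Prod-pos TT (own>0 i))

   priorX priorY : ℚ
   priorX = Sum N (λ i → ((sX i ω - 1ℚ) - gap (sX i ω)) + (eX i ω - 1ℚ)) + Sum N (λ i → (vX i ω - 1ℚ) - gap (vX i ω)) + Sum N (λ i → β i ω - 1ℚ) + lam
   priorY = Sum N (λ i → ((sY i ω - 1ℚ) - gap (sY i ω)) + (eY i ω - 1ℚ)) + Sum N (λ i → (vY i ω - 1ℚ) - gap (vY i ω)) + Sum N (λ i → β i ω - 1ℚ) + lam

   log-priorX : LogLe ((ΠμX * inv (g 0 0 ω)) * ((Πμ * inv ΠμX) * ρ 0) * Πβ * Z⁻¹) priorX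
   log-priorX = subst (λ z → LogLe z priorX) (cong₂ (λ a b → a * b * Πβ * Z⁻¹) Prod-seX Prod-vX)
    (log-* (log-* (log-* (log-Prod∈ N (λ i i∈ → log-* (log-gap (0<* (μX>0 i∈) (0<* 1>0 (0<inv (PX>0 i)))))
       (log-linear (0<* (0<* (PX>0 i) (0<inv 1>0)) (0<* (mass>0 (suffix-equiv (suc i))) (0<inv (mass>0 (suffix-equiv i))))))))
     (log-Prod∈ N (λ i i∈ → log-gap (0<* (0<* (μ>0 i∈) (0<inv (μX>0 i∈))) (0<* (g>0 i 0) (0<inv (k>0 i 0)))))))
     (log-Prod∈ N (λ i i∈ → log-linear (β>0 i∈)))) Z-log)

   log-priorY : LogLe ((ΠμY * inv (g n 0 ω)) * ((Πμ * inv ΠμY) * ρ' 0) * Πβ * Z⁻¹) priorY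
   log-priorY = subst (λ z → LogLe z priorY) (cong₂ (λ a b → a * b * Πβ * Z⁻¹) Prod-seY Prod-vY)
    (log-* (log-* (log-* (log-Prod∈ N (λ i i∈ → log-* (log-gap (0<* (μY>0 i∈) (0<* 1>0 (0<inv (PY>0 i)))))
       (log-linear (0<* (0<* (PY>0 i) (0<inv 1>0)) (0<* (mass>0 (prefix-equiv i)) (0<inv (mass>0 (prefix-equiv (suc i)))))))))
     (log-Prod∈ N (λ i i∈ → log-gap (0<* (0<* (μ>0 i∈) (0<inv (μY>0 i∈))) (0<* (g>0 (suc i) 0) (0<inv (k>0 i 0)))))))
     (log-Prod∈ N (λ i i∈ → log-linear (β>0 i∈)))) Z-log)

   pathSum uSum : ℚ
   pathSum = Sum N (λ i → (path-ratio i ω - 1ℚ) - gap (path-ratio i ω))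
   uSum = Sum N (λ i → u i ω - 1ℚ)

   balance-path-X : 0ℚ ≤ pathSum + uSum + priorX
   balance-path-X = log-sound (subst (λ z → LogLe z (pathSum + uSum + priorX)) (balance (ρ>0 0) (g>0 0 0) ΠμX>0 refl)
    (log-* (log-* (subst (λ z → LogLe z pathSum) Prod-path (log-Prod N log-path)) (subst (λ z → LogLe z uSum) Prod-u (log-Prod N log-u))) log-priorX))

   balance-path-Y : 0ℚ ≤ pathSum + uSum + priorY
   balance-path-Y = log-sound (subst (λ z → LogLe z (pathSum + uSum + priorY)) (balance (ρ'>0 0) (g>0 n 0) ΠμY>0 (Φ≡ 0))
    (log-* (log-* (subst (λ z → LogLe z pathSum) Prod-path (log-Prod N log-path)) (subst (λ z → LogLe z uSum) Prod-u (log-Prod N log-u))) log-priorY))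

   stepSum : (ℕ → ℕ → Ω → ℚ) → ℚ
   stepSum r = Sum TT (λ t → Sum N (λ i → (r i t ω - 1ℚ) - gap (r i t ω)))

   bitSum : ℕ → ℚ
   bitSum j = Sum TT (λ t → g j t ω * inv (g j (suc t) ω) - 1ℚ)

   log-bits : ∀ j → LogLe (g j 0 ω * inv (g j T ω)) (bitSum j)
   log-bits j = subst (λ z → LogLe z (bitSum j)) eq (log-Prod TT (λ t → log-linear (0<* (g>0 j t) (0<inv (g>0 j (suc t))))))
    where
    eq : Prod TT (λ t → g j t ω * inv (g j (suc t) ω)) ≡ g j 0 ω * inv (g j T ω)
    eq = trans (Prod-cong TT (λ t → trans (*-comm _ _) (sym (inv-quotient (g>0 j (suc t)) (g>0 j t)))))
     (trans (Prod-inv TT (λ t → 0<* (g>0 j (suc t)) (0<inv (g>0 j t)))) (trans (cong inv (Prod-telescope (g>0 j) T)) (trans (inv-quotient (g>0 j T) (g>0 j 0)) (*-comm _ _))))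

   balance-r₁ : 0ℚ ≤ stepSum r₁ + uSum + priorX + bitSum 0
   balance-r₁ = log-sound (subst (λ z → LogLe z (stepSum r₁ + uSum + priorX + bitSum 0)) (balance' (ρ>0 T) (g>0 0 T) (ρ>0 0) (g>0 0 0) ΠμX>0 refl)
    (log-* (log-* (log-* (subst (λ z → LogLe z (stepSum r₁)) (trans (Prod-cong TT Prod-r₁) (Prod-telescope ρ>0 T))
     (log-Prod TT (λ t → log-Prod N (λ i → log-gap (r₁>0 i t))))) (subst (λ z → LogLe z uSum) Prod-u (log-Prod N log-u))) log-priorX) (log-bits 0)))

   balance-r₂ : 0ℚ ≤ stepSum r₂ + uSum + priorY + bitSum n
   balance-r₂ = log-sound (subst (λ z → LogLe z (stepSum r₂ + uSum + priorY + bitSum n)) (balance' (ρ'>0 T) (g>0 n T) (ρ'>0 0) (g>0 n 0) ΠμY>0 (Φ≡ T))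
    (log-* (log-* (log-* (subst (λ z → LogLe z (stepSum r₂)) (trans (Prod-cong TT Prod-r₂) (Prod-telescope ρ'>0 T))
     (log-Prod TT (λ t → log-Prod N (λ i → log-gap (r₂>0 i t))))) (subst (λ z → LogLe z uSum) Prod-u (log-Prod N log-u))) log-priorY) (log-bits n)))

  𝔼-nonneg-if : ∀ f → (∀ ω → 0ℚ < w ω → 0ℚ ≤ f ω) → 0ℚ ≤ 𝔼 f
  𝔼-nonneg-if f h = Sum-≥0 Ωs step
   where
   step : ∀ ω → 0ℚ ≤ w ω * f ω
   step ω with ≡0⊎0< (w≥0 ω)
   ... | inj₁ e = ≤-reflexive (sym (trans (cong (_* f ω) e) (zeroˡ _)))
   ... | inj₂ p = 0≤* (w≥0 ω) (h ω p)

  private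
   𝔼-Sum≤ : ∀ {A : Set} (xs : List A) (F : A → Ω → ℚ) (b : A → ℚ) → (∀ a → 𝔼 (F a) ≤ b a) → 𝔼 (λ ω → Sum xs (λ a → F a ω)) ≤ Sum xs b
   𝔼-Sum≤ xs F b h = ≡≤ (𝔼-Sum xs) (Sum-mono xs h)

   𝔼-+≤ : ∀ {f g a b} → 𝔼 f ≤ a → 𝔼 g ≤ b → 𝔼 (λ ω → f ω + g ω) ≤ a + b
   𝔼-+≤ h k = ≡≤ 𝔼-+ (+-mono-≤ h k)

   𝔼-const : ∀ c → 𝔼 (λ _ → c) ≤ c
   𝔼-const c = ≤-reflexive (trans (Sum-*ʳ c Ωs) (trans (cong (_* c) w-total) (*-identityˡ c)))

   𝔼gap : (Ω → ℚ) → ℚ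
   𝔼gap f = 𝔼 (λ ω → gap (f ω))

  β-loss : ℕ → ℚ
  β-loss i = 𝔼 (λ ω → 1ℚ - β i ω)

  𝔼gap-nonneg : ∀ {f : Ω → ℚ} → (∀ ω → 0ℚ ≤ f ω) → 0ℚ ≤ 𝔼 (λ ω → gap (f ω))
  𝔼gap-nonneg h = 𝔼-≥0 (λ ω → 0≤gap (h ω))

  private
   𝔼-βX : ∀ i → 𝔼 (λ ω → β i ω - 1ℚ) ≤ - β-loss i
   𝔼-βX i = ≤-reflexive (trans (𝔼-cong (λ ω → solve 1 (λ b → b :- :1 := (:- :1) :* (:1 :- b)) refl (β i ω))) (trans (𝔼-*ˡ (- 1ℚ)) (solve 1 (λ b → (:- :1) :* b := :- b) refl _)))

   prior-bound : ∀ (s e v : ℕ → Ω → ℚ) → (∀ i → Mean≤1 (s i)) → (∀ i → Mean≤1 (e i)) → (∀ i → Mean≤1 (v i)) →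
    𝔼 (λ ω → Sum N (λ i → ((s i ω - 1ℚ) - gap (s i ω)) + (e i ω - 1ℚ)) + Sum N (λ i → (v i ω - 1ℚ) - gap (v i ω)) + Sum N (λ i → β i ω - 1ℚ) + lam)
    ≤ lam - Sum N (λ i → 𝔼gap (s i) + 𝔼gap (v i) + β-loss i)
   prior-bound s e v hs he hv = ≤≡
    (𝔼-+≤ (𝔼-+≤ (𝔼-+≤ (𝔼-Sum≤ N _ (λ i → - 𝔼gap (s i) + 0ℚ) (λ i → 𝔼-+≤ (mean-sharp (hs i)) (mean-excess (he i))))
     (𝔼-Sum≤ N _ (λ i → - 𝔼gap (v i)) (λ i → mean-sharp (hv i)))) (𝔼-Sum≤ N _ (λ i → - β-loss i) 𝔼-βX)) (𝔼-const lam))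
    (trans (cong (_+ lam) (trans (cong (_+ Sum N (λ i → - β-loss i)) (sym (Sum-+ N))) (sym (Sum-+ N))))
     (trans (cong (_+ lam) (trans (Sum-cong N (λ i → solve 3 (λ a b c → :- a :+ :0 :+ (:- b) :+ (:- c) := (:- :1) :* (a :+ b :+ c)) refl _ _ _)) (Sum-*ˡ (- 1ℚ) N)))
      (solve 2 (λ a l → (:- :1) :* a :+ l := l :- a) refl _ lam)))

   u-bound : 𝔼 (λ ω → Sum N (λ i → u i ω - 1ℚ)) ≤ 0ℚ
   u-bound = ≤≡ (𝔼-Sum≤ N _ (λ _ → 0ℚ) (λ i → mean-excess (mean-u i))) (Sum-0 N)

   transfer : ∀ {a b c} → 0ℚ ≤ - a + 0ℚ + (b - c) → a + c ≤ b
   transfer {a} {b} {c} h = ≤-by-- h (solve 3 (λ a b c → b :- (a :+ c) := :- a :+ :0 :+ (b :- c)) refl a b c)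

   path-bound : 𝔼 (λ ω → Sum N (λ i → (path-ratio i ω - 1ℚ) - gap (path-ratio i ω))) ≤ - Sum N (λ i → 𝔼gap (path-ratio i))
   path-bound = ≤≡ (𝔼-Sum≤ N _ (λ i → - 𝔼gap (path-ratio i)) (λ i → mean-sharp (mean-path i))) neg-Sum
    where
    neg-Sum : Sum N (λ i → - 𝔼gap (path-ratio i)) ≡ - Sum N (λ i → 𝔼gap (path-ratio i))
    neg-Sum = trans (Sum-cong N (λ i → solve 1 (λ a → :- a := (:- :1) :* a) refl _)) (trans (Sum-*ˡ (- 1ℚ) N) (solve 1 (λ a → (:- :1) :* a := :- a) refl _))

   step-bound : ∀ (r : ℕ → ℕ → Ω → ℚ) → (∀ i t → Mean≤1 (r i t)) →
    𝔼 (λ ω → Sum TT (λ t → Sum N (λ i → (r i t ω - 1ℚ) - gap (r i t ω)))) ≤ - Sum N (λ i → Sum TT (λ t → 𝔼gap (r i t)))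
   step-bound r h = ≤≡ (𝔼-Sum≤ TT _ (λ t → Sum N (λ i → - 𝔼gap (r i t))) (λ t → 𝔼-Sum≤ N _ (λ i → - 𝔼gap (r i t)) (λ i → mean-sharp (h i t))))
    (trans (Sum-swap TT N) (trans (Sum-cong N (λ i → trans (Sum-cong TT (λ t → solve 1 (λ a → :- a := (:- :1) :* a) refl _)) (Sum-*ˡ (- 1ℚ) TT)))
     (trans (Sum-*ˡ (- 1ℚ) N) (solve 1 (λ a → (:- :1) :* a := :- a) refl _))))

   bit-bound : ∀ j → 𝔼 (λ ω → Sum TT (λ t → g j t ω * inv (g j (suc t) ω) - 1ℚ)) ≤ Sum TT (λ _ → 1ℚ)
   bit-bound j = 𝔼-Sum≤ TT _ (λ _ → 1ℚ) (λ t → ≡≤ (trans 𝔼-- (cong (λ z → 𝔼 (λ ω → g j t ω * inv (g j (suc t) ω)) - z) 𝔼1))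
    (≤≡ (+≤ʳ (- 1ℚ) (mean-bit j t)) (solve 0 (:2 :- :1 := :1) refl)))

  lossX lossY : ℕ → ℚ
  lossX i = 𝔼 (λ ω → gap (sX i ω)) + 𝔼 (λ ω → gap (vX i ω)) + β-loss i
  lossY i = 𝔼 (λ ω → gap (sY i ω)) + 𝔼 (λ ω → gap (vY i ω)) + β-loss i

  -- The expectation of `balance-path-X`. The ratios have mean at most 1, so the gaps and the loss
  -- of β are paid for by `lam`, the bound for log Z⁻¹, alone.
  budget-path-X : Sum N (λ i → 𝔼 (λ ω → gap (path-ratio i ω))) + Sum N lossX ≤ lam
  budget-path-X = transfer (≤-trans (𝔼-nonneg-if _ (λ ω p → Pointwise.balance-path-X ω p))
   (𝔼-+≤ (𝔼-+≤ path-bound u-bound) (prior-bound sX eX vX mean-sX mean-eX mean-vX)))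

  budget-path-Y : Sum N (λ i → 𝔼 (λ ω → gap (path-ratio i ω))) + Sum N lossY ≤ lam
  budget-path-Y = transfer (≤-trans (𝔼-nonneg-if _ (λ ω p → Pointwise.balance-path-Y ω p))
   (𝔼-+≤ (𝔼-+≤ path-bound u-bound) (prior-bound sY eY vY mean-sY mean-eY mean-vY)))

  private
   transfer' : ∀ {a b c d} → 0ℚ ≤ - a + 0ℚ + (b - c) + d → a + c ≤ b + d
   transfer' {a} {b} {c} {d} h = ≤-by-- h (solve 4 (λ a b c d → b :+ d :- (a :+ c) := :- a :+ :0 :+ (b :- c) :+ d) refl a b c d)

  -- Alice now predicts Bob's bits as well; by `mean-bit` the surprise of each bit given x costs at
  -- most 1, which is the additional T.
  budget-r₁ : Sum N (λ i → Sum TT (λ t → 𝔼 (λ ω → gap (r₁ i t ω)))) + Sum N lossX ≤ lam + Sum TT (λ _ → 1ℚ)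
  budget-r₁ = transfer' (≤-trans (𝔼-nonneg-if _ (λ ω p → Pointwise.balance-r₁ ω p))
   (𝔼-+≤ (𝔼-+≤ (𝔼-+≤ (step-bound r₁ mean-r₁) u-bound) (prior-bound sX eX vX mean-sX mean-eX mean-vX)) (bit-bound 0)))

  budget-r₂ : Sum N (λ i → Sum TT (λ t → 𝔼 (λ ω → gap (r₂ i t ω)))) + Sum N lossY ≤ lam + Sum TT (λ _ → 1ℚ)
  budget-r₂ = transfer' (≤-trans (𝔼-nonneg-if _ (λ ω p → Pointwise.balance-r₂ ω p))
   (𝔼-+≤ (𝔼-+≤ (𝔼-+≤ (step-bound r₂ mean-r₂) u-bound) (prior-bound sY eY vY mean-sY mean-eY mean-vY)) (bit-bound n)))

-- Public-coin programs and their derandomisation.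

module Programs where

 open Arithmetic
 open Classes
 open import Defs using (Tree; output; alice; bob; run; depth)

 private
  variable
   A R : Set

 opaque
  mean : List A → (A → ℚ) → ℚ
  mean xs f = inv (nat (length xs)) * Sum xs f

  mean≡ : ∀ (xs : List A) f → mean xs f ≡ inv (nat (length xs)) * Sum xs f
  mean≡ xs f = refl

 NonEmpty : List A → Set
 NonEmpty xs = 0ℚ < nat (length xs)

 module _ (xs : List A) (xs≠[] : NonEmpty xs) where

  0≤1/len : 0ℚ ≤ inv (nat (length xs))
  0≤1/len = <⇒≤ (0<inv xs≠[])

  mean-mono : ∀ {f g : A → ℚ} → (∀ x → f x ≤ g x) → mean xs f ≤ mean xs g
  mean-mono h = subst₂ _≤_ (sym (mean≡ xs _)) (sym (mean≡ xs _)) (*≤ˡ 0≤1/len (Sum-mono xs h))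

  mean-const : ∀ c → mean xs (λ _ → c) ≡ c
  mean-const c = trans (trans (mean≡ xs _) (cong (inv (nat (length xs)) *_) (Sum-const c xs)))
   (trans (solve 3 (λ i n c → i :* (n :* c) := (n :* i) :* c) refl _ _ _) (trans (cong (_* c) (*inv xs≠[])) (*-identityˡ c)))

  mean-≥0 : ∀ {f : A → ℚ} → (∀ x → 0ℚ ≤ f x) → 0ℚ ≤ mean xs f
  mean-≥0 h = subst (0ℚ ≤_) (sym (mean≡ xs _)) (0≤* 0≤1/len (Sum-≥0 xs h))

  mean-≤ : ∀ {f : A → ℚ} {c} → (∀ x → f x ≤ c) → mean xs f ≤ c
  mean-≤ {c = c} h = ≤≡ (mean-mono h) (mean-const c)

  mean-≥ : ∀ {f : A → ℚ} {c} → (∀ x → c ≤ f x) → c ≤ mean xs f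
  mean-≥ {c = c} h = ≡≤ (sym (mean-const c)) (mean-mono h)

  above-mean : ∀ (f : A → ℚ) → ∃ λ x → mean xs f ≤ f x
  above-mean f with go xs
   where
   go : ∀ ys → (∃ λ x → mean xs f ≤ f x) ⊎ (∀ y → y ∈ ys → f y < mean xs f)
   go [] = inj₂ λ y ()
   go (y ∷ ys) with mean xs f ≤? f y | go ys
   ... | yes h | _ = inj₁ (y , h)
   ... | no h  | inj₁ k = inj₁ k
   ... | no h  | inj₂ k = inj₂ λ { z (here refl) → ≰⇒> h ; z (there z∈) → k z z∈ }
  ... | inj₁ h = h
  ... | inj₂ h = ⊥-elim (<-irrefl (<-≤-trans (lt xs xs≠[] h) (≤-reflexive eq)))
   where
   m = mean xs f
   lt : ∀ ys → NonEmpty ys → (∀ y → y ∈ ys → f y < m) → Sum ys f < Sum ys (λ _ → m)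
   lt [] p k = ⊥-elim (<-irrefl (subst (0ℚ <_) nat-0 p))
   lt (y ∷ ys) p k = +-mono-<-≤ (k y (here refl)) (Sum-mono∈ ys (λ z z∈ → <⇒≤ (k z (there z∈))))
   eq : Sum xs (λ _ → m) ≡ Sum xs f
   eq = trans (Sum-const m xs) (trans (cong (nat (length xs) *_) (mean≡ xs f)) (trans (solve 3 (λ n i s → n :* (i :* s) := s :* n :* i) refl _ _ _) (*inv-cancel xs≠[])))

 mean-cong : ∀ (xs : List A) {f g : A → ℚ} → (∀ x → f x ≡ g x) → mean xs f ≡ mean xs g
 mean-cong xs h = trans (mean≡ xs _) (trans (cong (inv (nat (length xs)) *_) (Sum-cong xs h)) (sym (mean≡ xs _)))

 -- Protocols in continuation form. As continuations see only public data, a message can depend only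
 -- on its sender's input, the coins and the earlier messages.
 data Prog (X Y : Set) : Set₁ where
  out   : Bool → Prog X Y
  rand  : {R : Set} (rs : List R) → NonEmpty rs → (R → Prog X Y) → Prog X Y
  tellA : (X → Bool) → (Bool → Prog X Y) → Prog X Y
  tellB : (Y → Bool) → (Bool → Prog X Y) → Prog X Y

 module Protocols {X Y : Set} (target : X → Y → Bool) where

  hit : Bool → X → Y → ℚ
  hit b x y = ⟦ not (b xor target x y) ⟧

  val : Prog X Y → X → Y → ℚ
  val (out b) x y = hit b x y
  val (rand rs _ k) x y = mean rs (λ r → val (k r) x y)
  val (tellA m k)   x y = val (k (m x)) x y
  val (tellB m k)   x y = val (k (m y)) x y

  0≤val : ∀ p x y → 0ℚ ≤ val p x y
  0≤val (out b) x y = 0≤⟦⟧ (not (b xor target x y))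
  0≤val (rand rs h k) x y = mean-≥0 rs h (λ r → 0≤val (k r) x y)
  0≤val (tellA m k)   x y = 0≤val (k (m x)) x y
  0≤val (tellB m k)   x y = 0≤val (k (m y)) x y

  val≤1 : ∀ p x y → val p x y ≤ 1ℚ
  val≤1 (out b) x y = ⟦⟧≤1 (not (b xor target x y))
  val≤1 (rand rs h k) x y = mean-≤ rs h (λ r → val≤1 (k r) x y)
  val≤1 (tellA m k)   x y = val≤1 (k (m x)) x y
  val≤1 (tellB m k)   x y = val≤1 (k (m y)) x y

  -- A predicate instead of a maximum, because a random choice continues with a function on an
  -- arbitrary type.
  Cost : Prog X Y → ℕ → Set
  Cost (out b) c = ⊤
  Cost (rand rs _ k) c = ∀ r → Cost (k r) c
  Cost (tellA m k)   zero    = ⊥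
  Cost (tellA m k)   (suc c) = ∀ b → Cost (k b) c
  Cost (tellB m k)   zero    = ⊥
  Cost (tellB m k)   (suc c) = ∀ b → Cost (k b) c

  Cost-mono : ∀ p {c d} → c ℕ.≤ d → Cost p c → Cost p d
  Cost-mono (out b) h k = tt
  Cost-mono (rand rs _ f) h k = λ r → Cost-mono (f r) h (k r)
  Cost-mono (tellA m f) {suc c} (s≤s h) k = λ b → Cost-mono (f b) h (k b)
  Cost-mono (tellB m f) {suc c} (s≤s h) k = λ b → Cost-mono (f b) h (k b)

  module _ (Xs : List X) (Ys : List Y) where

   total : (X → Y → ℚ) → (X → Y → ℚ) → ℚ
   total ν f = Sum Xs (λ x → Sum Ys (λ y → ν x y * f x y))

   split-total : ∀ ν (s : X → Y → Bool) f → total ν f ≡ total (λ x y → ν x y * ⟦ s x y ⟧) f + total (λ x y → ν x y * ⟦ not (s x y) ⟧) f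
   split-total ν s f = trans (Sum-cong Xs (λ x → trans (Sum-cong Ys (λ y → step x y)) (Sum-+ Ys))) (Sum-+ Xs)
    where
    step : ∀ x y → ν x y * f x y ≡ ν x y * ⟦ s x y ⟧ * f x y + ν x y * ⟦ not (s x y) ⟧ * f x y
    step x y with s x y
    ... | true  = solve 2 (λ a b → a :* b := a :* :1 :* b :+ a :* :0 :* b) refl _ _
    ... | false = solve 2 (λ a b → a :* b := a :* :0 :* b :+ a :* :1 :* b) refl _ _

   total-choose : ∀ ν (s : X → Y → Bool) (f : Bool → X → Y → ℚ) → total ν (λ x y → f (s x y) x y)
    ≡ total (λ x y → ν x y * ⟦ s x y ⟧) (f true) + total (λ x y → ν x y * ⟦ not (s x y) ⟧) (f false)
   total-choose ν s f = trans (split-total ν s _) (cong₂ _+_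
    (Sum-cong Xs λ x → Sum-cong Ys λ y → pick₁ x y) (Sum-cong Xs λ x → Sum-cong Ys λ y → pick₂ x y))
    where
    pick₁ : ∀ x y → ν x y * ⟦ s x y ⟧ * f (s x y) x y ≡ ν x y * ⟦ s x y ⟧ * f true x y
    pick₁ x y with s x y
    ... | true  = refl
    ... | false = solve 3 (λ a b c → a :* :0 :* b := a :* :0 :* c) refl _ _ _
    pick₂ : ∀ x y → ν x y * ⟦ not (s x y) ⟧ * f (s x y) x y ≡ ν x y * ⟦ not (s x y) ⟧ * f false x y
    pick₂ x y with s x y
    ... | true  = solve 3 (λ a b c → a :* :0 :* b := a :* :0 :* c) refl _ _ _
    ... | false = refl

   total-mean : ∀ ν (rs : List R) (f : R → X → Y → ℚ) → total ν (λ x y → mean rs (λ r → f r x y)) ≡ mean rs (λ r → total ν (f r))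
   total-mean ν rs f = begin
    total ν (λ x y → mean rs (λ r → f r x y))
     ≡⟨ Sum-cong Xs (λ x → trans (Sum-cong Ys (λ y → trans (cong (ν x y *_) (mean≡ rs _)) (trans (solve 3 (λ a i s → a :* (i :* s) := i :* (a :* s)) refl (ν x y) i _) (cong (i *_) (sym (Sum-*ˡ (ν x y) rs)))))) (trans (Sum-*ˡ i Ys) (cong (i *_) (Sum-swap Ys rs)))) ⟩
    Sum Xs (λ x → i * Sum rs (λ r → Sum Ys (λ y → ν x y * f r x y)))
     ≡⟨ trans (Sum-*ˡ i Xs) (trans (cong (i *_) (Sum-swap Xs rs)) (sym (mean≡ rs _))) ⟩
    mean rs (λ r → total ν (f r)) ∎
    where
    open ≡-Reasoning
    i = inv (nat (length rs))

   -- A random choice is replaced by its best outcome, and a message splits ν into two parts that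
   -- are treated separately. The parts have no fixed total, so the claim is made for arbitrary ν.
   derandomise : ∀ p {c} → Cost p c → ∀ ν →
    ∃ λ (t : Tree X Y) → depth t ℕ.≤ c × total ν (val p) ≤ total ν (λ x y → hit (run t x y) x y)
   derandomise (out b) h ν = output b , z≤n , ≤-refl
   derandomise (rand rs ne k) h ν with above-mean rs ne (λ r → total ν (val (k r)))
   ... | r , le with derandomise (k r) (h r) ν
   ... | t , d , le' = t , d , ≡≤ (total-mean ν rs (λ r → val (k r))) (≤-trans le le')
   derandomise (tellA m k) {suc c} h ν
    with derandomise (k true) (h true) (λ x y → ν x y * ⟦ m x ⟧) | derandomise (k false) (h false) (λ x y → ν x y * ⟦ not (m x) ⟧)
   ... | t₁ , d₁ , l₁ | t₀ , d₀ , l₀ = alice m next , s≤s (ℕ.⊔-lub d₀ d₁) ,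
    ≡≤ (total-choose ν (λ x y → m x) (λ b → val (k b)))
     (≤≡ (+-mono-≤ l₁ l₀) (sym (total-choose ν (λ x y → m x) (λ b x y → hit (run (next b) x y) x y))))
    where
    next : Bool → Tree X Y
    next true  = t₁
    next false = t₀
   derandomise (tellB m k) {suc c} h ν
    with derandomise (k true) (h true) (λ x y → ν x y * ⟦ m y ⟧) | derandomise (k false) (h false) (λ x y → ν x y * ⟦ not (m y) ⟧)
   ... | t₁ , d₁ , l₁ | t₀ , d₀ , l₀ = bob m next , s≤s (ℕ.⊔-lub d₀ d₁) ,
    ≡≤ (total-choose ν (λ x y → m y) (λ b → val (k b)))
     (≤≡ (+-mono-≤ l₁ l₀) (sym (total-choose ν (λ x y → m y) (λ b x y → hit (run (next b) x y) x y))))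
    where
    next : Bool → Tree X Y
    next true  = t₁
    next false = t₀

-- Finding the first difference of two strings by hashing.

module NoisySearch where

 open Arithmetic
 open LogBounds
 open Classes
 open Programs
 open import Data.Nat using (⌊_/2⌋; ⌈_/2⌉)
 open import Data.Vec using (Vec; []; _∷_)
 open import Data.Bool using (T)

 coins : List Bool
 coins = true ∷ false ∷ []

 coins-nonempty : NonEmpty coins
 coins-nonempty = 0<nat 1

 ½' : ℚ
 ½' = inv (nat 2)

 mean-coins : ∀ f → mean coins f ≡ ½' * (f true + f false)
 mean-coins f = trans (mean≡ coins f) (cong (λ z → ½' * (f true + z)) (+-identityʳ _))

 ½+½ : ½' + ½' ≡ 1ℚ
 ½+½ = trans (solve 1 (λ h → h :+ h := con (ℤ.+ 2) :* h) refl ½') (*inv (0<nat 1))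

 0≤½' : 0ℚ ≤ ½'
 0≤½' = <⇒≤ (0<inv (0<nat 1))

 half-sum : ∀ a → ½' * (a + a) ≡ a
 half-sum a = trans (solve 2 (λ h a → h :* (a :+ a) := (h :+ h) :* a) refl ½' a) (trans (cong (_* a) ½+½) (*-identityˡ a))

 EV : ∀ d → (Vec Bool d → ℚ) → ℚ
 EV zero    F = F []
 EV (suc d) F = mean coins (λ b → EV d (λ v → F (b ∷ v)))

 EV-cong : ∀ d {F G} → (∀ v → F v ≡ G v) → EV d F ≡ EV d G
 EV-cong zero    h = h []
 EV-cong (suc d) h = mean-cong coins (λ b → EV-cong d (λ v → h (b ∷ v)))

 EV-const : ∀ d c → EV d (λ _ → c) ≡ c
 EV-const zero    c = refl
 EV-const (suc d) c = trans (mean-cong coins (λ _ → EV-const d c)) (mean-const coins coins-nonempty c)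

 EV-+ : ∀ d F G → EV d (λ v → F v + G v) ≡ EV d F + EV d G
 EV-+ zero    F G = refl
 EV-+ (suc d) F G = trans (mean-coins _) (trans (cong₂ (λ a b → ½' * (a + b)) (EV-+ d (λ v → F (true ∷ v)) (λ v → G (true ∷ v))) (EV-+ d (λ v → F (false ∷ v)) (λ v → G (false ∷ v))))
  (trans (solve 5 (λ h a b c d → h :* (a :+ b :+ (c :+ d)) := h :* (a :+ c) :+ h :* (b :+ d)) refl ½' _ _ _ _)
   (sym (cong₂ _+_ (mean-coins _) (mean-coins _)))))

 -- For random r, the parity of a random subset of the first q bits.
 dot : ∀ {d} → ℕ → Vec Bool d → Vec Bool d → Bool
 dot zero    r a = false
 dot (suc q) [] [] = false
 dot (suc q) (r ∷ rs) (a ∷ as) = (r ∧ a) xor dot q rs as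

 firstDiff : ∀ {d} → Vec Bool d → Vec Bool d → ℕ
 firstDiff [] [] = 0
 firstDiff (a ∷ as) (b ∷ bs) = if a xor b then 0 else suc (firstDiff as bs)

 firstDiff≤ : ∀ {d} (a b : Vec Bool d) → firstDiff a b ℕ.≤ d
 firstDiff≤ [] [] = z≤n
 firstDiff≤ (a ∷ as) (b ∷ bs) with a xor b
 ... | true  = z≤n
 ... | false = s≤s (firstDiff≤ as bs)

 xor-same : ∀ a b → (a xor b) ≡ false → a ≡ b
 xor-same true  true  h = refl
 xor-same false false h = refl

 dot-same : ∀ {d} q (r a b : Vec Bool d) → q ℕ.≤ firstDiff a b → dot q r a ≡ dot q r b
 dot-same zero    r a b h = refl
 dot-same (suc q) [] [] [] h = refl
 dot-same (suc q) (r ∷ rs) (a ∷ as) (b ∷ bs) h with a xor b in eq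
 dot-same (suc q) (r ∷ rs) (a ∷ as) (b ∷ bs) (s≤s h) | false = cong₂ (λ z w → (r ∧ z) xor w) (xor-same a b eq) (dot-same q rs as bs h)

 xor-self : ∀ a → (a xor a) ≡ false
 xor-self true  = refl
 xor-self false = refl

 flip-sum : ∀ (F : Bool → ℚ) z → F (not z) + F z ≡ F true + F false
 flip-sum F true  = +-comm _ _
 flip-sum F false = refl

 xor-cancel : ∀ r p p' → ((r xor p) xor (r xor p')) ≡ (p xor p')
 xor-cancel true  true  true  = refl
 xor-cancel true  true  false = refl
 xor-cancel true  false true  = refl
 xor-cancel true  false false = refl
 xor-cancel false p     p'    = refl

 xor-flip : ∀ a b p p' → (a xor b) ≡ true → ((a xor p) xor (b xor p')) ≡ not (p xor p')
 xor-flip true  false true  true  h = refl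
 xor-flip true  false true  false h = refl
 xor-flip true  false false true  h = refl
 xor-flip true  false false false h = refl
 xor-flip false true  true  p'    h = refl
 xor-flip false true  false true  h = refl
 xor-flip false true  false false h = refl

 -- At the first position where a and b differ, the random bit flips the sum of the two parities
 -- whatever the later positions contribute, so this sum is a fair coin.
 dot-diff : ∀ {d} q (a b : Vec Bool d) (F : Bool → ℚ) → firstDiff a b ℕ.< q → firstDiff a b ℕ.< d →
  EV d (λ r → F (dot q r a xor dot q r b)) ≡ mean coins F
 dot-diff {zero}  q [] [] F h ()
 dot-diff {suc d} (suc q) (a ∷ as) (b ∷ bs) F h k with a xor b in eq
 ... | true = begin
  mean coins (λ r → EV d (λ rs → F (((r ∧ a) xor dot q rs as) xor ((r ∧ b) xor dot q rs bs))))
   ≡⟨ mean-coins _ ⟩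
  ½' * (EV d (λ rs → F ((a xor dot q rs as) xor (b xor dot q rs bs))) + EV d (λ rs → F (dot q rs as xor dot q rs bs)))
   ≡⟨ cong (λ z → ½' * (z + EV d (λ rs → F (dot q rs as xor dot q rs bs)))) (EV-cong d (λ rs → cong F (xor-flip a b (dot q rs as) (dot q rs bs) eq))) ⟩
  ½' * (EV d (λ rs → F (not (dot q rs as xor dot q rs bs))) + EV d (λ rs → F (dot q rs as xor dot q rs bs)))
   ≡⟨ cong (½' *_) (trans (sym (EV-+ d (λ rs → F (not (dot q rs as xor dot q rs bs))) (λ rs → F (dot q rs as xor dot q rs bs)))) (trans (EV-cong d (λ rs → flip-sum F _)) (EV-const d _))) ⟩
  ½' * (F true + F false)
   ≡⟨ mean-coins F ⟨
  mean coins F ∎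
  where open ≡-Reasoning
 dot-diff {suc d} (suc q) (a ∷ as) (b ∷ bs) F (s≤s h) (s≤s k) | false =
  trans (mean-cong coins (λ r → trans (EV-cong d (λ rs → cong F (trans (cong (λ z → ((r ∧ a) xor dot q rs as) xor ((r ∧ z) xor dot q rs bs)) (sym (xor-same a b eq))) (xor-cancel (r ∧ a) (dot q rs as) (dot q rs bs))))) (dot-diff q as bs F h k)))
   (mean-const coins coins-nonempty _)

 module Search {X Y : Set} (target : X → Y → Bool) where

  open Protocols target

  randVec : ∀ d → (Vec Bool d → Prog X Y) → Prog X Y
  randVec zero    k = k []
  randVec (suc d) k = rand coins coins-nonempty (λ b → randVec d (λ v → k (b ∷ v)))

  val-randVec : ∀ d k x y → val (randVec d k) x y ≡ EV d (λ v → val (k v) x y)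
  val-randVec zero    k x y = refl
  val-randVec (suc d) k x y = mean-cong coins (λ b → val-randVec d (λ v → k (b ∷ v)) x y)

  cost-randVec : ∀ d k {c} → (∀ v → Cost (k v) c) → Cost (randVec d k) c
  cost-randVec zero    k h = h []
  cost-randVec (suc d) k h = λ b → cost-randVec d _ (λ v → h (b ∷ v))

  module _ {d : ℕ} (gA : X → Vec Bool d) (gB : Y → Vec Bool d) where

   hash : ℕ → (Bool → Prog X Y) → Prog X Y
   hash q k = randVec d (λ r → tellA (λ x → dot q r (gA x)) (λ a → tellB (λ y → dot q r (gB y)) (λ b → k (a xor b))))

   hashes : ℕ → ℕ → (Bool → Prog X Y) → Prog X Y
   hashes zero    q k = k false
   hashes (suc j) q k = hash q (λ c → if c then k true else hashes j q k)

   -- Asks whether the first difference is below q; the answer yes is never wrong.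
   -- The strings count as different at position d.
   test : ℕ → (Bool → Prog X Y) → Prog X Y
   test q k with d ℕ.<? q
   ... | yes _ = k true
   ... | no  _ = hashes 3 q k

   cost-hash : ∀ q k {c} → (∀ b → Cost (k b) c) → Cost (hash q k) (2 ℕ.+ c)
   cost-hash q k h = cost-randVec d _ (λ r a b → h (a xor b))

   cost-test : ∀ q k {c} → (∀ b → Cost (k b) c) → Cost (test q k) (6 ℕ.+ c)
   cost-test q k {c} h with d ℕ.<? q
   ... | yes _ = Cost-mono (k true) (ℕ.m≤n+m c 6) (h true)
   ... | no  _ = cost-hash q _ (step 4 (cost-hash q _ (step 2 (cost-hash q _ (step 0 (h false))))))
    where
    step : ∀ e {p} → Cost p (e ℕ.+ c) → ∀ b → Cost (if b then k true else p) (e ℕ.+ c)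
    step e hp true  = Cost-mono (k true) (ℕ.m≤n+m c e) (h true)
    step e hp false = hp

   module _ (x : X) (y : Y) where

    j : ℕ
    j = firstDiff (gA x) (gB y)

    ⟨_⟩ : Prog X Y → ℚ
    ⟨ p ⟩ = val p x y

    hash-same : ∀ q k → q ℕ.≤ j → ⟨ hash q k ⟩ ≡ ⟨ k false ⟩
    hash-same q k h = trans (val-randVec d _ x y) (trans (EV-cong d (λ r → cong (λ b → ⟨ k b ⟩)
     (trans (cong (_xor dot q r (gB y)) (dot-same q r (gA x) (gB y) h)) (xor-self (dot q r (gB y)))))) (EV-const d _))

    hash-diff : ∀ q k → j ℕ.< q → j ℕ.< d → ⟨ hash q k ⟩ ≡ ½' * (⟨ k true ⟩ + ⟨ k false ⟩)
    hash-diff q k h h' = trans (val-randVec d _ x y) (trans (dot-diff q (gA x) (gB y) (λ b → ⟨ k b ⟩) h h') (mean-coins _))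

    hashes-same : ∀ m q k → q ℕ.≤ j → ⟨ hashes m q k ⟩ ≡ ⟨ k false ⟩
    hashes-same zero    q k h = refl
    hashes-same (suc m) q k h = trans (hash-same q (λ c → if c then k true else hashes m q k) h) (hashes-same m q k h)

    -- Each hash detects the difference with probability 1/2. The numbers u and v are the losses of
    -- the continuation after the right and after the wrong answer; measuring losses there lets them
    -- compose along a program.
    hashes-diff : ∀ m q k → j ℕ.< q → j ℕ.< d → ∀ {D u v} → D - u ≤ ⟨ k true ⟩ → D - v ≤ ⟨ k false ⟩ →
     D - (u + (v - u) * ½' ^ m) ≤ ⟨ hashes m q k ⟩
    hashes-diff zero    q k h h' {D} {u} {v} hu hv = ≡≤ (solve 3 (λ D u v → D :- (u :+ (v :- u) :* :1) := D :- v) refl D u v) hv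
    hashes-diff (suc m) q k h h' {D} {u} {v} hu hv = ≡≤ eq
     (≤≡ (*≤ˡ 0≤½' (+-mono-≤ hu (hashes-diff m q k h h' {D} {u} {v} hu hv))) (sym (hash-diff q (λ c → if c then k true else hashes m q k) h h')))
     where
     eq : D - (u + (v - u) * (½' * ½' ^ m)) ≡ ½' * (D - u + (D - (u + (v - u) * ½' ^ m)))
     eq = trans (solve 4 (λ D u v p → D :- (u :+ (v :- u) :* p) := D :- u :- (v :- u) :* p) refl D u v _)
      (trans (cong (λ z → z - (v - u) * (½' * ½' ^ m)) (sym (half-sum (D - u))))
       (solve 5 (λ h D u v p → h :* (D :- u :+ (D :- u)) :- (v :- u) :* (h :* p) := h :* (D :- u :+ (D :- (u :+ (v :- u) :* p)))) refl ½' D u v (½' ^ m)))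

    e : ℚ
    e = ½' ^ 3

    0≤e : 0ℚ ≤ e
    0≤e = ^-nonneg 0≤½' 3

    test-same : ∀ q k → q ℕ.≤ j → ⟨ test q k ⟩ ≡ ⟨ k false ⟩
    test-same q k h with d ℕ.<? q
    ... | yes p = ⊥-elim (ℕ.<⇒≱ p (ℕ.≤-trans h (firstDiff≤ (gA x) (gB y))))
    ... | no  _ = hashes-same 3 q k h

    test-diff : ∀ q k → j ℕ.< q → ∀ {D u v} → u ≤ v → D - u ≤ ⟨ k true ⟩ → D - v ≤ ⟨ k false ⟩ → D - (u + (v - u) * e) ≤ ⟨ test q k ⟩
    test-diff q k h {D} {u} {v} u≤v hu hv with d ℕ.<? q
    ... | yes p = ≤-trans (-≤ ≤-refl (≤-by ((v - u) * e) (0≤* (0≤- u≤v) 0≤e) refl)) hu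
    ... | no ¬p = hashes-diff 3 q k h (ℕ.<-≤-trans h (ℕ.≮⇒≥ ¬p)) {D} {u} {v} hu hv

    test-any : ∀ q k {D v} → (∀ b → D - v ≤ ⟨ k b ⟩) → D - v ≤ ⟨ test q k ⟩
    test-any q k {D} {v} h with q ℕ.≤? j
    ... | yes p = ≤≡ (h false) (sym (test-same q k p))
    ... | no ¬p = ≡≤ (solve 3 (λ D v e → D :- v := D :- (v :+ (v :- v) :* e)) refl D v e) (test-diff q k (ℕ.≰⇒> ¬p) {D} {v} {v} ≤-refl (h true) (h false))

   module Descent (L : ℕ) where

    Interval : Set
    Interval = ℕ × ℕ

    width : Interval → ℕ
    width (lo , hi) = hi ℕ.∸ lo

    top : List Interval → Interval
    top [] = 0 , 2 ℕ.^ L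
    top (i ∷ _) = i

    pop : List Interval → List Interval
    pop [] = []
    pop (_ ∷ s) = s

    mid : Interval → ℕ
    mid (lo , hi) = lo ℕ.+ ⌊ hi ℕ.∸ lo /2⌋

    -- The three answers say whether the first difference is below the lower end, below the upper
    -- end and below the middle of the top interval.
    next : List Interval → Bool → Bool → Bool → List Interval
    next s true  b     c     = pop s
    next s false false c     = pop s
    next s false true  true  = (proj₁ (top s) , mid (top s)) ∷ s
    next s false true  false = (mid (top s) , proj₂ (top s)) ∷ s

    -- At depth L an interval has width at most 1 and is its own right half, so further correct
    -- steps only add copies of it, which errors must pop before they can do harm. The answer is
    -- read at depth L.
    answer : List Interval → ℕ
    answer [] = 0
    answer (i ∷ s) = if L ℕ.≤ᵇ length s then answer s else proj₁ i

    -- Binary search with backtracking: s is the stack of nested intervals under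
    -- consideration, popped when its top is found not to contain the first difference.
    search : ℕ → List Interval → (ℕ → Prog X Y) → Prog X Y
    search zero    s k = k (answer s)
    search (suc n) s k = test (proj₁ (top s)) λ a → test (proj₂ (top s)) λ b → test (mid (top s)) λ c → search n (next s a b c) k

    cost-search : ∀ n s k {c} → (∀ i → Cost (k i) c) → Cost (search n s k) (n ℕ.* 18 ℕ.+ c)
    cost-search zero    s k h = h (answer s)
    cost-search (suc n) s k h = cost-test (proj₁ (top s)) _ (λ a → cost-test (proj₂ (top s)) _ (λ b → cost-test (mid (top s)) _ (λ c → cost-search n (next s a b c) k h)))

    data Valid : List Interval → Set where
     root  : Valid []
     left  : ∀ {s} → Valid s → Valid ((proj₁ (top s) , mid (top s)) ∷ s)
     right : ∀ {s} → Valid s → Valid ((mid (top s) , proj₂ (top s)) ∷ s)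

    valid-next : ∀ {s} → Valid s → ∀ a b c → Valid (next s a b c)
    valid-next v false true true  = left v
    valid-next v false true false = right v
    valid-next v false false c = valid-pop v
     where
     valid-pop : ∀ {s} → Valid s → Valid (pop s)
     valid-pop root = root
     valid-pop (left v)  = v
     valid-pop (right v) = v
    valid-next root true b c = root
    valid-next (left v)  true b c = v
    valid-next (right v) true b c = v

    ordered : ∀ {s} → Valid s → proj₁ (top s) ℕ.≤ proj₂ (top s)
    mid≤ : ∀ {s} → Valid s → mid (top s) ℕ.≤ proj₂ (top s)
    mid≤ {s} v = ≤≡ᴺ (ℕ.+-monoʳ-≤ (proj₁ (top s)) (ℕ.⌊n/2⌋≤n _)) (ℕ.m+[n∸m]≡n (ordered v))
    ordered root = z≤n
    ordered (left {s} v)  = ℕ.m≤m+n (proj₁ (top s)) _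
    ordered (right v)     = mid≤ v

    half-width : ∀ {m w} → w ℕ.≤ 2 ℕ.^ suc m → ⌈ w /2⌉ ℕ.≤ 2 ℕ.^ m
    half-width {m} h = ≤≡ᴺ (ℕ.⌈n/2⌉-mono (≤≡ᴺ h (cong (2 ℕ.^ m ℕ.+_) (ℕ.+-identityʳ _)))) (sym (ℕ.n≡⌈n+n/2⌉ (2 ℕ.^ m)))

    right-width : ∀ lo hi → lo ℕ.≤ hi → hi ℕ.∸ mid (lo , hi) ≡ ⌈ hi ℕ.∸ lo /2⌉
    right-width lo hi h = trans (sym (ℕ.∸-+-assoc hi lo _)) (trans (cong (ℕ._∸ ⌊ w /2⌋) (sym (trans (ℕ.+-comm ⌈ w /2⌉ ⌊ w /2⌋) (ℕ.⌊n/2⌋+⌈n/2⌉≡n w)))) (ℕ.m+n∸n≡m ⌈ w /2⌉ ⌊ w /2⌋))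
     where w = hi ℕ.∸ lo

    narrow : ∀ {s} → Valid s → ∀ {m} → length s ℕ.+ m ≡ L → width (top s) ℕ.≤ 2 ℕ.^ m
    narrow root refl = ℕ.≤-refl
    narrow (left {s} v) {m} e = ≡≤ᴺ (ℕ.m+n∸m≡n (proj₁ (top s)) _) (ℕ.≤-trans (ℕ.⌊n/2⌋≤⌈n/2⌉ _) (half-width {m} (narrow v (trans (ℕ.+-suc (length s) m) e))))
    narrow (right {s} v) {m} e = ≡≤ᴺ (right-width _ _ (ordered v)) (half-width {m} (narrow v (trans (ℕ.+-suc (length s) m) e)))

    module _ (x : X) (y : Y) (j<M : j x y ℕ.< 2 ℕ.^ L) where

     private
      J = j x y
      D⟨_⟩ = λ p → val p x y

     Good : Interval → Set
     Good (lo , hi) = lo ℕ.≤ J × J ℕ.< hi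

     good? : ∀ i → Dec (Good i)
     good? (lo , hi) with lo ℕ.≤? J | J ℕ.<? hi
     ... | yes a | yes b = yes (a , b)
     ... | no a  | _     = no (λ h → a (proj₁ h))
     ... | yes _ | no b  = no (λ h → b (proj₂ h))

     e₀ ρ : ℚ
     e₀ = ½' ^ 3
     ρ = 1ℚ - e₀

     opaque
      unfolding _+_

      -- If one test can err, with probability 1/8, the mean weight is multiplied by at most 1/2 +
      -- 3/2 · 1/8 = 11/16; if two can, by at most 109/128. Both are below ρ = 7/8.
      rate₁ : ½' + (two - ½') * e₀ ≤ ρ
      rate₁ = decide

      rate₂ : (½' + (two - ½') * e₀) + (two - (½' + (two - ½') * e₀)) * e₀ ≤ ρ
      rate₂ = decide

      ½≤ρ : ½' ≤ ρ
      ½≤ρ = decide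

      rate≤2 : ½' + (two - ½') * e₀ ≤ two
      rate≤2 = decide

      ½≤two : ½' ≤ two
      ½≤two = decide

      0≤ρ : 0ℚ ≤ ρ
      0≤ρ = decide

     -- The potential: a correct step pops a bad interval or pushes a good one and thereby halves
     -- the weight, a wrong step at most doubles it.
     scale : Interval → ℚ
     scale i with good? i
     ... | yes _ = ½'
     ... | no _  = two

     scale≤2 : ∀ i → scale i ≤ two
     scale≤2 i with good? i
     ... | no _  = ≤-refl
     ... | yes _ = ½≤two

     scale-good : ∀ i → Good i → scale i ≡ ½'
     scale-good i h with good? i
     ... | yes _ = refl
     ... | no k  = ⊥-elim (k h)

     scale-bad : ∀ i → ¬ Good i → scale i ≡ two
     scale-bad i h with good? i
     ... | no _  = refl
     ... | yes k = ⊥-elim (h k)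

     weight : List Interval → ℚ
     weight [] = 1ℚ
     weight (i ∷ s) = scale i * weight s

     0<½' : 0ℚ < ½'
     0<½' = 0<inv (0<nat 1)

     0<scale : ∀ i → 0ℚ < scale i
     0<scale i with good? i
     ... | yes _ = 0<½'
     ... | no _  = 0<two

     0≤weight : ∀ s → 0ℚ ≤ weight s
     0≤weight [] = 0≤1
     0≤weight (i ∷ s) = 0≤* (<⇒≤ (0<scale i)) (0≤weight s)

     2½ : two * ½' ≡ 1ℚ
     2½ = trans (solve 1 (λ h → :2 :* h := h :+ h) refl ½') ½+½

     ½≤scale : ∀ i → ½' ≤ scale i
     ½≤scale i with good? i
     ... | yes _ = ≤-refl
     ... | no _  = ½≤two

     pop-weight : ∀ s → weight (pop s) ≤ two * weight s
     pop-weight [] = ≤-by 1ℚ 0≤1 (solve 0 (:1 :+ :1 := :2 :* :1) refl)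
     pop-weight (i ∷ s) = ≡≤ (trans (sym (*-identityˡ _)) (cong (_* weight s) (sym 2½)))
      (≤≡ (*≤ʳ (0≤weight s) (*≤ˡ (<⇒≤ 0<two) (½≤scale i))) (*-assoc two (scale i) (weight s)))

     next-weight : ∀ s a b c → weight (next s a b c) ≤ two * weight s
     next-weight s true  b     c     = pop-weight s
     next-weight s false false c     = pop-weight s
     next-weight s false true  true  = *≤ʳ (0≤weight s) (scale≤2 (proj₁ (top s) , mid (top s)))
     next-weight s false true  false = *≤ʳ (0≤weight s) (scale≤2 (mid (top s) , proj₂ (top s)))

     goods : List Interval → ℕ
     goods [] = 0
     goods (i ∷ s) with good? i
     ... | yes _ = suc (goods s)
     ... | no _  = goods s

     goods≤ : ∀ s → goods s ℕ.≤ length s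
     goods≤ [] = z≤n
     goods≤ (i ∷ s) with good? i
     ... | yes _ = s≤s (goods≤ s)
     ... | no _  = ℕ.m≤n⇒m≤1+n (goods≤ s)

     parent-good : ∀ {i s} → Valid (i ∷ s) → Good i → Good (top s)
     parent-good (left v) (a , b) = a , ℕ.<-≤-trans b (mid≤ v)
     parent-good (right {s} v)   (a , b) = ℕ.≤-trans (ℕ.m≤m+n (proj₁ (top s)) _) a , b

     all-good : ∀ {s} → Valid s → Good (top s) → goods s ≡ length s
     all-good {[]} v g = refl
     all-good {i ∷ s} v g with good? i
     ... | no k  = ⊥-elim (k g)
     ... | yes _ = cong suc (all-good (tail v) (parent-good v g))
      where
      tail : ∀ {i s} → Valid (i ∷ s) → Valid s
      tail (left v)  = v
      tail (right v) = v

     tail-valid : ∀ {i s} → Valid (i ∷ s) → Valid s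
     tail-valid (left v)  = v
     tail-valid (right v) = v

     singleton : ∀ i → Good i → width i ℕ.≤ 1 → proj₁ i ≡ J
     singleton (lo , hi) (a , b) w = ℕ.≤-antisym a (ℕ.≤-pred (ℕ.≤-trans b (ℕ.≤-trans (ℕ.m≤n+m∸n hi lo) (≤≡ᴺ (ℕ.+-monoʳ-≤ lo w) (ℕ.+-comm lo 1)))))

     -- The intervals on the stack are nested, so the good ones lie at its bottom. If there are at
     -- least L of them, the one at depth L is good and has width at most 1.
     answer-correct : ∀ {s} → Valid s → L ℕ.≤ goods s → answer s ≡ J
     answer-correct {[]} root h = sym (ℕ.n<1⇒n≡0 (subst (λ m → J ℕ.< 2 ℕ.^ m) (ℕ.n≤0⇒n≡0 h) j<M))
     answer-correct {i ∷ s} v h with L ℕ.≤ᵇ length s in eq | good? i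
     ... | true  | no _  = answer-correct (tail-valid v) h
     ... | true  | yes g = answer-correct (tail-valid v) (≤≡ᴺ (ℕ.≤ᵇ⇒≤ L (length s) (subst T (sym eq) tt)) (sym (all-good (tail-valid v) (parent-good v g))))
     ... | false | no _  = ⊥-elim (subst T eq (ℕ.≤⇒≤ᵇ (ℕ.≤-trans h (goods≤ s))))
     ... | false | yes g = singleton i g (narrow v (trans (ℕ.+-identityʳ _) (ℕ.≤-antisym (ℕ.≰⇒> (λ k → subst T eq (ℕ.≤⇒≤ᵇ k))) (ℕ.≤-trans h (s≤s (goods≤ s))))))

     weight-goods : ∀ s → ½' ^ goods s ≤ weight s
     weight-goods [] = ≤-refl
     weight-goods (i ∷ s) with good? i
     ... | yes _ = *≤ˡ 0≤½' (weight-goods s)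
     ... | no _  = ≤-trans (weight-goods s) (≤≡ (≤-by+ˡ (0≤weight s)) (solve 1 (λ w → w :+ w := :2 :* w) refl _))

     ½^-anti : ∀ {m n} → m ℕ.≤ n → ½' ^ n ≤ ½' ^ m
     ½^-anti {n = n} z≤n = ^≤1 0≤½' (≤-by ½' 0≤½' ½+½) n
     ½^-anti (s≤s h) = *≤ˡ 0≤½' (½^-anti h)

     2^½^ : ∀ m → two ^ m * ½' ^ m ≡ 1ℚ
     2^½^ zero    = *-identityˡ 1ℚ
     2^½^ (suc m) = trans (solve 4 (λ a b c d → a :* b :* (c :* d) := (a :* c) :* (b :* d)) refl two (two ^ m) ½' (½' ^ m)) (trans (cong₂ _*_ 2½ (2^½^ m)) (*-identityˡ 1ℚ))

     loss : ℕ → List Interval → ℚ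
     loss n s = ρ ^ n * two ^ L * weight s

     -- The mean weight shrinks by ρ in every step. If fewer than L intervals are good at the end,
     -- the weight is at least 2^-L, so the loss is at least 1 and the claim is void.
     search-correct : ∀ n {s} → Valid s → ∀ k → D⟨ k J ⟩ - loss n s ≤ D⟨ search n s k ⟩
     search-correct zero {s} v k with L ℕ.≤? goods s
     ... | yes h = ≤≡ (-≤ ≤-refl (0≤* (0≤* 0≤1 (^-nonneg (<⇒≤ 0<two) L)) (0≤weight s))) (trans (solve 1 (λ a → a :- :0 := a) refl _) (cong (λ i → D⟨ k i ⟩) (sym (answer-correct v h))))
     ... | no h  = ≤-trans (-≤ (val≤1 (k J) x y) big) (≡≤ (+-inverseʳ 1ℚ) (0≤val (k (answer s)) x y))
      where
      big : 1ℚ ≤ loss 0 s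
      big = ≡≤ (sym (2^½^ L)) (≤≡ (*≤ˡ (^-nonneg (<⇒≤ 0<two) L) (≤-trans (½^-anti (ℕ.<⇒≤ (ℕ.≰⇒> h))) (weight-goods s))) (solve 2 (λ a b → a :* b := :1 :* a :* b) refl _ _))
     search-correct (suc n) {s} v k = ≤-trans (-≤ ≤-refl (≤-reflexive (solve 4 (λ r p t w → p :* t :* w :* r := r :* p :* t :* w) refl ρ (ρ ^ n) (two ^ L) (weight s)))) result
      where
      D = D⟨ k J ⟩
      C = ρ ^ n * two ^ L
      w = weight s
      C≥0 : 0ℚ ≤ C
      C≥0 = 0≤* (^-nonneg 0≤ρ n) (^-nonneg (<⇒≤ 0<two) L)
      Cw≥0 : 0ℚ ≤ C * w
      Cw≥0 = 0≤* C≥0 (0≤weight s)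
      branch : Bool → Bool → Bool → Prog X Y
      branch a b c = search n (next s a b c) k
      lo = proj₁ (top s)
      hi = proj₂ (top s)
      r₁ = ½' + (two - ½') * e₀

      weaken : ∀ {r r' p} → r ≤ r' → D - C * w * r ≤ p → D - C * w * r' ≤ p
      weaken h q = ≤-trans (-≤ ≤-refl (*≤ˡ Cw≥0 h)) q

      to : ∀ a b c {r} → weight (next s a b c) ≤ r * w → D - C * w * r ≤ D⟨ branch a b c ⟩
      to a b c {r} h = ≤-trans (-≤ ≤-refl (≤≡ (*≤ˡ C≥0 h) (solve 3 (λ c r w → c :* (r :* w) := c :* w :* r) refl C r w))) (search-correct n (valid-next v a b c) k)

      any : ∀ a b c → D - C * w * two ≤ D⟨ branch a b c ⟩
      any a b c = to a b c (next-weight s a b c)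

      mix : ∀ q (K : Bool → Prog X Y) → J ℕ.< q → ∀ {r r'} → r ≤ r' → D - C * w * r ≤ D⟨ K true ⟩ → D - C * w * r' ≤ D⟨ K false ⟩ →
       D - C * w * (r + (r' - r) * e₀) ≤ D⟨ test q K ⟩
      mix q K h {r} {r'} r≤r' ht hf = ≡≤ (solve 5 (λ D c r r' e → D :- c :* (r :+ (r' :- r) :* e) := D :- (c :* r :+ (c :* r' :- c :* r) :* e)) refl D (C * w) r r' e₀)
       (test-diff x y q K h (*≤ˡ Cw≥0 r≤r') ht hf)

      same : ∀ q (K : Bool → Prog X Y) → q ℕ.≤ J → ∀ {p} → p ≤ D⟨ K false ⟩ → p ≤ D⟨ test q K ⟩
      same q K h hp = ≤≡ hp (sym (test-same x y q K h))

      halved : ¬ Good (top s) → weight (pop s) ≤ ½' * w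
      halved ¬g = go s ¬g
       where
       go : ∀ s → ¬ Good (top s) → weight (pop s) ≤ ½' * weight s
       go [] ¬g = ⊥-elim (¬g (z≤n , j<M))
       go (i ∷ s) ¬g = ≤-reflexive (sym (trans (cong (λ z → ½' * (z * weight s)) (scale-bad i ¬g))
        (trans (solve 3 (λ h t w → h :* (t :* w) := (t :* h) :* w) refl ½' two (weight s)) (trans (cong (_* weight s) 2½) (*-identityˡ _)))))

      result : D - C * w * ρ ≤ D⟨ search (suc n) s k ⟩
      result with good? (top s)
      -- The test of the lower end is certain to be right, as the answer yes is never wrong; those
      -- of the upper end and of the middle may err.
      ... | yes (g₁ , g₂) = weaken rate₂ (same lo _ g₁ (mix hi _ g₂ rate≤2 inner (test-any x y (mid (top s)) _ (any false false))))
       where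
       inner : D - C * w * r₁ ≤ D⟨ test (mid (top s)) (branch false true) ⟩
       inner with mid (top s) ℕ.≤? J
       ... | yes h = same (mid (top s)) _ h (weaken ½≤r₁ (to false true false (≤-reflexive (cong (_* w) (scale-good _ (h , g₂))))))
        where
        ½≤r₁ : ½' ≤ r₁
        ½≤r₁ = ≤-by+ˡ (0≤* (0≤- ½≤two) (^-nonneg 0≤½' 3))
       ... | no h = mix (mid (top s)) _ (ℕ.≰⇒> h) ½≤two (to false true true (≤-reflexive (cong (_* w) (scale-good _ (g₁ , ℕ.≰⇒> h))))) (any false true false)
      ... | no ¬g with lo ℕ.≤? J
      ... | no h  = weaken rate₁ (mix lo _ (ℕ.≰⇒> h) ½≤two
       (test-any x y hi _ (λ b → test-any x y (mid (top s)) _ (λ c → to true b c (halved ¬g))))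
       (test-any x y hi _ (λ b → test-any x y (mid (top s)) _ (any false b))))
      ... | yes h = weaken ½≤ρ (same lo _ h (same hi _ (ℕ.≮⇒≥ (λ k → ¬g (h , k))) (test-any x y (mid (top s)) _ (λ c → to false false c (halved ¬g)))))

-- Joint simulation of a transcript from one divergence to the next.

module RoundByRound where

 open Arithmetic
 open LogBounds
 open Classes
 open Programs
 open NoisySearch
 open import Data.Vec using (Vec; []; _∷_)
 open import Data.Bool.Properties using (T-≡)
 open import Function.Bundles using (Equivalence)

 coin-weight : ℚ → Bool → ℚ
 coin-weight p true  = p
 coin-weight p false = 1ℚ - p

 allVecs : ∀ d → List (Vec Bool d)
 allVecs zero    = [] ∷ []
 allVecs (suc d) = map (true ∷_) (allVecs d) ++ map (false ∷_) (allVecs d)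

 Sum-allVecs : ∀ d (f : Vec Bool (suc d) → ℚ) → Sum (allVecs (suc d)) f ≡ Sum coins (λ c → Sum (allVecs d) (λ p → f (c ∷ p)))
 Sum-allVecs d f = trans (Sum-++ (map (true ∷_) (allVecs d))) (cong₂ _+_ (Sum-map (true ∷_) (allVecs d)) (trans (Sum-map (false ∷_) (allVecs d)) (sym (+-identityʳ _))))

 <ᵇ-true : ∀ {m n} → m ℕ.< n → (m ℕ.<ᵇ n) ≡ true
 <ᵇ-true {m} {n} h = Equivalence.to T-≡ (ℕ.<⇒<ᵇ h)

 <ᵇ-false : ∀ {m n} → n ℕ.≤ m → (m ℕ.<ᵇ n) ≡ false
 <ᵇ-false {m} {n} h with m ℕ.<ᵇ n in eq
 ... | false = refl
 ... | true  = ⊥-elim (ℕ.<⇒≱ (ℕ.<ᵇ⇒< m n (Equivalence.from T-≡ eq)) h)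

 count-below : ∀ N k → k ℕ.≤ N → Sum (downFrom N) (λ u → ⟦ u ℕ.<ᵇ k ⟧) ≡ nat k
 count-below zero    zero z≤n = sym nat-0
 count-below (suc N) k h with ℕ.m≤n⇒m<n∨m≡n h
 ... | inj₁ (s≤s k≤N) = trans (cong₂ _+_ (cong ⟦_⟧ (<ᵇ-false k≤N)) (count-below N k k≤N)) (+-identityˡ _)
 ... | inj₂ refl = trans (cong₂ _+_ (cong ⟦_⟧ (<ᵇ-true (ℕ.n<1+n N))) (trans (Sum-mono-≡ N) (count-below N N ℕ.≤-refl))) (sym (nat-suc N))
  where
  Sum-mono-≡ : ∀ N → Sum (downFrom N) (λ u → ⟦ u ℕ.<ᵇ suc N ⟧) ≡ Sum (downFrom N) (λ u → ⟦ u ℕ.<ᵇ N ⟧)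
  Sum-mono-≡ N = go N N ℕ.≤-refl
   where
   go : ∀ m N → m ℕ.≤ N → Sum (downFrom m) (λ u → ⟦ u ℕ.<ᵇ suc N ⟧) ≡ Sum (downFrom m) (λ u → ⟦ u ℕ.<ᵇ N ⟧)
   go zero    N h = refl
   go (suc m) N h = cong₂ _+_ (cong ⟦_⟧ (trans (<ᵇ-true (ℕ.m≤n⇒m≤1+n h)) (sym (<ᵇ-true h)))) (go m N (ℕ.≤-trans (ℕ.n≤1+n m) h))

 module Thresholds (N : ℕ) (N>0 : 0ℚ < nat (length (downFrom N))) (N≡ : nat (length (downFrom N)) ≡ nat N) where

  fraction : ℕ → ℚ
  fraction k = nat k * inv (nat N)

  private
   nN : 0ℚ < nat N
   nN = subst (0ℚ <_) N≡ N>0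

  0≤fraction : ∀ k → 0ℚ ≤ fraction k
  0≤fraction k = 0≤* (0≤nat k) (0≤inv (<⇒≤ nN))

  fraction≤1 : ∀ {k} → k ℕ.≤ N → fraction k ≤ 1ℚ
  fraction≤1 {k} h = *inv≤ nN (≤≡ (nat-mono h) (sym (*-identityˡ _)))

  mean-below : ∀ k → k ℕ.≤ N → mean (downFrom N) (λ u → ⟦ u ℕ.<ᵇ k ⟧) ≡ fraction k
  mean-below k h = trans (mean≡ (downFrom N) _) (trans (cong₂ (λ a b → inv a * b) N≡ (count-below N k h)) (*-comm _ _))

  mean-affine : ∀ (f g : ℕ → ℚ) p q r → mean (downFrom N) (λ u → p + f u * q + g u * r) ≡ p + mean (downFrom N) f * q + mean (downFrom N) g * r
  mean-affine f g p q r = trans (mean≡ (downFrom N) _) (trans (cong (i *_) (trans (Sum-+ (downFrom N)) (cong₂ _+_ (trans (Sum-+ (downFrom N)) (cong₂ _+_ (Sum-const p (downFrom N)) (Sum-*ʳ q (downFrom N)))) (Sum-*ʳ r (downFrom N)))))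
   (trans (solve 7 (λ i n p F q G r → i :* (n :* p :+ F :* q :+ G :* r) := (n :* i) :* p :+ (i :* F) :* q :+ (i :* G) :* r) refl i (nat (length (downFrom N))) p (Sum (downFrom N) f) q (Sum (downFrom N) g) r)
    (trans (cong (λ z → z * p + (i * Sum (downFrom N) f) * q + (i * Sum (downFrom N) g) * r) (*inv N>0))
     (cong₂ (λ a b → a + b * r) (cong₂ (λ a b → a + b * q) (*-identityˡ p) (sym (mean≡ (downFrom N) f))) (sym (mean≡ (downFrom N) g))))))
   where i = inv (nat (length (downFrom N)))

  fraction-mono : ∀ {k l} → k ℕ.≤ l → fraction k ≤ fraction l
  fraction-mono h = *≤ʳ (0≤inv (<⇒≤ nN)) (nat-mono h)

  pos-neg : ∀ {a b} → a ≤ b → pos (a - b) ≡ 0ℚ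
  pos-neg {a} {b} h = ≤-antisym (pos-lub ≤-refl (≤≡ (+≤ʳ (- b) h) (+-inverseʳ b))) (0≤pos _)

  pos-id : ∀ {a} → 0ℚ ≤ a → pos a ≡ a
  pos-id h = ≤-antisym (pos-lub h ≤-refl) (≤pos _)

  -- The minimum of a and b, written so that it and the excess of a over b visibly add up to a.
  keep : ℚ → ℚ → ℚ
  keep a b = a - pos (a - b)

  keep-≤ : ∀ {a b} → a ≤ b → keep a b ≡ a
  keep-≤ {a} h = trans (cong (λ z → a - z) (pos-neg h)) (solve 1 (λ a → a :- :0 := a) refl a)

  keep-≥ : ∀ {a b} → b ≤ a → keep a b ≡ b
  keep-≥ {a} {b} h = trans (cong (λ z → a - z) (pos-id (0≤- h))) (solve 2 (λ a b → a :- (a :- b) := b) refl a b)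

  1-mono : ∀ {a b} → a ≤ b → 1ℚ - b ≤ 1ℚ - a
  1-mono h = -≤ ≤-refl h

  -- The law of the pair of bits obtained from one common threshold: the bits agree
  -- except with probability |a - b|.
  threshold-law : ∀ {j k} → j ℕ.≤ N → k ℕ.≤ N → ∀ (F : Bool → Bool → ℚ) →
   mean (downFrom N) (λ u → F (u ℕ.<ᵇ j) (u ℕ.<ᵇ k)) ≡
   Sum coins (λ c → keep (coin-weight (fraction j) c) (coin-weight (fraction k) c) * F c c
    + pos (coin-weight (fraction j) c - coin-weight (fraction k) c) * F c (not c))
  threshold-law {j} {k} hj hk F with ℕ.≤-total j k
  ... | inj₁ j≤k = trans (mean-cong (downFrom N) point) (trans (mean-affine _ _ (F false false) (F true true - F false true) (F false true - F false false))
     (trans (cong₂ (λ a b → F false false + a * (F true true - F false true) + b * (F false true - F false false)) (mean-below j hj) (mean-below k hk))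
     (sym (trans (cong₂ _+_ (cong₂ (λ a b → a * F true true + b * F true false) (keep-≤ a≤b) (pos-neg a≤b))
                           (cong (_+ 0ℚ) (cong₂ (λ a b → a * F false false + b * F false true) (keep-≥ (1-mono a≤b)) (pos-id (0≤- (1-mono a≤b))))))
      (solve 6 (λ a b tt tf ft ff → a :* tt :+ :0 :* tf :+ ((:1 :- b) :* ff :+ (:1 :- a :- (:1 :- b)) :* ft :+ :0)
       := ff :+ a :* (tt :- ft) :+ b :* (ft :- ff)) refl a b (F true true) (F true false) (F false true) (F false false))))))
   where
   a = fraction j
   b = fraction k
   a≤b : a ≤ b
   a≤b = fraction-mono j≤k
   point : ∀ u → F (u ℕ.<ᵇ j) (u ℕ.<ᵇ k) ≡ F false false + ⟦ u ℕ.<ᵇ j ⟧ * (F true true - F false true) + ⟦ u ℕ.<ᵇ k ⟧ * (F false true - F false false)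
   point u with u ℕ.<ᵇ j in ej | u ℕ.<ᵇ k in ek
   ... | true  | true  = solve 3 (λ tt ft ff → tt := ff :+ :1 :* (tt :- ft) :+ :1 :* (ft :- ff)) refl _ _ _
   ... | false | true  = solve 3 (λ tt ft ff → ft := ff :+ :0 :* (tt :- ft) :+ :1 :* (ft :- ff)) refl _ _ _
   ... | false | false = solve 3 (λ tt ft ff → ff := ff :+ :0 :* (tt :- ft) :+ :0 :* (ft :- ff)) refl _ _ _
   ... | true  | false with trans (sym ek) (<ᵇ-true (ℕ.<-≤-trans (ℕ.<ᵇ⇒< u j (Equivalence.from T-≡ ej)) j≤k))
   ... | ()
  ... | inj₂ k≤j = trans (mean-cong (downFrom N) point) (trans (mean-affine _ _ (F false false) (F true false - F false false) (F true true - F true false))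
     (trans (cong₂ (λ a b → F false false + a * (F true false - F false false) + b * (F true true - F true false)) (mean-below j hj) (mean-below k hk))
     (sym (trans (cong₂ _+_ (cong₂ (λ a b → a * F true true + b * F true false) (keep-≥ b≤a) (pos-id (0≤- b≤a)))
                           (cong (_+ 0ℚ) (cong₂ (λ a b → a * F false false + b * F false true) (keep-≤ (1-mono b≤a)) (pos-neg (1-mono b≤a)))))
      (solve 6 (λ a b tt tf ft ff → b :* tt :+ (a :- b) :* tf :+ ((:1 :- a) :* ff :+ :0 :* ft :+ :0)
       := ff :+ a :* (tf :- ff) :+ b :* (tt :- tf)) refl a b (F true true) (F true false) (F false true) (F false false))))))
   where
   a = fraction j
   b = fraction k
   b≤a : b ≤ a
   b≤a = fraction-mono k≤j
   point : ∀ u → F (u ℕ.<ᵇ j) (u ℕ.<ᵇ k) ≡ F false false + ⟦ u ℕ.<ᵇ j ⟧ * (F true false - F false false) + ⟦ u ℕ.<ᵇ k ⟧ * (F true true - F true false)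
   point u with u ℕ.<ᵇ j in ej | u ℕ.<ᵇ k in ek
   ... | true  | true  = solve 3 (λ tt tf ff → tt := ff :+ :1 :* (tf :- ff) :+ :1 :* (tt :- tf)) refl _ _ _
   ... | true  | false = solve 3 (λ tt tf ff → tf := ff :+ :1 :* (tf :- ff) :+ :0 :* (tt :- tf)) refl _ _ _
   ... | false | false = solve 3 (λ tt tf ff → ff := ff :+ :0 :* (tf :- ff) :+ :0 :* (tt :- tf)) refl _ _ _
   ... | false | true with trans (sym ej) (<ᵇ-true (ℕ.<-≤-trans (ℕ.<ᵇ⇒< u k (Equivalence.from T-≡ ek)) k≤j))
   ... | ()

 data Thr : ℕ → Set where
  tip  : Thr 0
  node : ∀ {d} → ℕ → Thr d → Thr d → Thr (suc d)

 path : ∀ {d} → (List Bool → ℕ) → List Bool → Thr d → Vec Bool d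
 path k v tip = []
 path k v (node u l r) with u ℕ.<ᵇ k v
 ... | true  = true ∷ path k (true ∷ v) l
 ... | false = false ∷ path k (false ∷ v) r

 -- At the first divergence the bit of the owner of the node is kept. The other player knows it to
 -- be the negation of the own bit, so no further communication is needed.
 move : ∀ {d} → (List Bool → Bool) → List Bool → Vec Bool d → ℕ → List Bool
 move mine v [] j = v
 move mine v (a ∷ g) zero    = (if mine v then a else not a) ∷ v
 move mine v (a ∷ g) (suc j) = move mine (a ∷ v) g j

 leaf : ∀ {d} → List Bool → Vec Bool d → List Bool
 leaf v [] = v
 leaf v (c ∷ p) = leaf (c ∷ v) p

 -- The chain of true transcript bits for fixed inputs; kA and kB are the numerators of
 -- the two players' predictions, and a path has a mark where the two predictions diverge.
 module Chain (N : ℕ) (N>0 : 0ℚ < nat (length (downFrom N))) (N≡ : nat (length (downFrom N)) ≡ nat N)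
  (owner : List Bool → Bool) (answer : Bool) (kA kB : List Bool → ℕ) (kA≤N : ∀ v → kA v ℕ.≤ N) (kB≤N : ∀ v → kB v ℕ.≤ N)
  (oA oB : List Bool → Bool) where

  open Thresholds N N>0 N≡

  pA pB : List Bool → ℚ
  pA v = fraction (kA v)
  pB v = fraction (kB v)

  own oth stay mark : List Bool → Bool → ℚ
  own  v c = coin-weight (if owner v then pA v else pB v) c
  oth  v c = coin-weight (if owner v then pB v else pA v) c
  stay v c = keep (own v c) (oth v c)
  mark v c = pos (own v c - oth v c) * inv (own v c)

  success : List Bool → ℚ
  success v = ⟦ not ((oA v xor oB v) xor answer) ⟧

  -- The success probability with R rounds left if every search is exact: the path follows the
  -- owners' predictions, and each divergence uses up a round. Running out of rounds counts as
  -- failure.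
  LB : ℕ → ℕ → List Bool → ℚ
  LB R zero    v = success v
  LB zero    (suc d) v = 0ℚ
  LB (suc R) (suc d) v = Sum coins (λ c → stay v c * LB (suc R) d (c ∷ v) + pos (own v c - oth v c) * LB R d (c ∷ v))

  path-weight : ∀ {d} → List Bool → Vec Bool d → ℚ
  path-weight v [] = 1ℚ
  path-weight v (c ∷ p) = own v c * path-weight (c ∷ v) p

  -- The success probability given the path, each step of which is a divergence with probability
  -- `mark`, independently of the others.
  ψ : ∀ {d} → ℕ → List Bool → Vec Bool d → ℚ
  ψ R v [] = success v
  ψ zero    v (c ∷ p) = 0ℚ
  ψ (suc R) v (c ∷ p) = (1ℚ - mark v c) * ψ (suc R) (c ∷ v) p + mark v c * ψ R (c ∷ v) p

  marks : ∀ {d} → List Bool → Vec Bool d → ℚ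
  marks v [] = 0ℚ
  marks v (c ∷ p) = mark v c + marks (c ∷ v) p

  coin-≥0 : ∀ {p} → 0ℚ ≤ p → p ≤ 1ℚ → ∀ c → 0ℚ ≤ coin-weight p c
  coin-≥0 h k true  = h
  coin-≥0 h k false = 0≤- k

  0≤own : ∀ v c → 0ℚ ≤ own v c
  0≤own v c with owner v
  ... | true  = coin-≥0 (0≤fraction _) (fraction≤1 (kA≤N v)) c
  ... | false = coin-≥0 (0≤fraction _) (fraction≤1 (kB≤N v)) c

  0≤oth : ∀ v c → 0ℚ ≤ oth v c
  0≤oth v c with owner v
  ... | true  = coin-≥0 (0≤fraction _) (fraction≤1 (kB≤N v)) c
  ... | false = coin-≥0 (0≤fraction _) (fraction≤1 (kA≤N v)) c

  0≤mark : ∀ v c → 0ℚ ≤ mark v c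
  0≤mark v c = 0≤* (0≤pos _) (0≤inv (0≤own v c))

  pos≤own : ∀ v c → pos (own v c - oth v c) ≤ own v c
  pos≤own v c = pos-lub (0≤own v c) (≤-by (oth v c) (0≤oth v c) (solve 2 (λ a b → a :- b :+ b := a) refl _ _))

  mark≤1 : ∀ v c → mark v c ≤ 1ℚ
  mark≤1 v c = ≤-trans (*≤ʳ (0≤inv (0≤own v c)) (pos≤own v c)) (*inv≤1 (0≤own v c))

  own*mark : ∀ v c → own v c * mark v c ≡ pos (own v c - oth v c)
  own*mark v c with ≡0⊎0< (0≤own v c)
  ... | inj₂ p = trans (solve 3 (λ o p i → o :* (p :* i) := p :* o :* i) refl (own v c) (pos (own v c - oth v c)) (inv (own v c))) (*inv-cancel p)
  ... | inj₁ e = trans (trans (cong (_* mark v c) e) (zeroˡ _)) (sym (≤-antisym (subst (pos (own v c - oth v c) ≤_) e (pos≤own v c)) (0≤pos _)))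

  0≤ψ : ∀ {d} R v (p : Vec Bool d) → 0ℚ ≤ ψ R v p
  0≤ψ R v [] = 0≤⟦⟧ (not ((oA v xor oB v) xor answer))
  0≤ψ zero    v (c ∷ p) = ≤-refl
  0≤ψ (suc R) v (c ∷ p) = 0≤+ (0≤* (0≤- (mark≤1 v c)) (0≤ψ (suc R) (c ∷ v) p)) (0≤* (0≤mark v c) (0≤ψ R (c ∷ v) p))

  LB-paths : ∀ R d v → LB R d v ≡ Sum (allVecs d) (λ p → path-weight v p * ψ R v p)
  LB-paths R zero    v = solve 1 (λ s → s := :1 :* s :+ :0) refl _
  LB-paths zero    (suc d) v = sym (trans (Sum-allVecs d _) (trans (Sum-cong coins (λ c → trans (Sum-cong (allVecs d) (λ p → zeroʳ (path-weight v (c ∷ p)))) (Sum-0 (allVecs d)))) (Sum-0 coins)))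
  LB-paths (suc R) (suc d) v = trans (Sum-cong coins term) (sym (Sum-allVecs d _))
   where
   term : ∀ c → stay v c * LB (suc R) d (c ∷ v) + pos (own v c - oth v c) * LB R d (c ∷ v) ≡
    Sum (allVecs d) (λ p → own v c * path-weight (c ∷ v) p * ((1ℚ - mark v c) * ψ (suc R) (c ∷ v) p + mark v c * ψ R (c ∷ v) p))
   term c = begin
    stay v c * LB (suc R) d (c ∷ v) + pos (own v c - oth v c) * LB R d (c ∷ v)
     ≡⟨ cong₂ _+_ (cong₂ _*_ (cong (λ z → own v c - z) (sym (own*mark v c))) (LB-paths (suc R) d (c ∷ v))) (cong₂ _*_ (sym (own*mark v c)) (LB-paths R d (c ∷ v))) ⟩
    (own v c - own v c * mark v c) * Sum (allVecs d) (λ p → path-weight (c ∷ v) p * ψ (suc R) (c ∷ v) p) + own v c * mark v c * Sum (allVecs d) (λ p → path-weight (c ∷ v) p * ψ R (c ∷ v) p)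
     ≡⟨ trans (cong₂ _+_ (sym (Sum-*ˡ _ (allVecs d))) (sym (Sum-*ˡ _ (allVecs d)))) (sym (Sum-+ (allVecs d))) ⟩
    Sum (allVecs d) (λ p → (own v c - own v c * mark v c) * (path-weight (c ∷ v) p * ψ (suc R) (c ∷ v) p) + own v c * mark v c * (path-weight (c ∷ v) p * ψ R (c ∷ v) p))
     ≡⟨ Sum-cong (allVecs d) (λ p → solve 5 (λ o m w a b → (o :- o :* m) :* (w :* a) :+ o :* m :* (w :* b) := o :* w :* ((:1 :- m) :* a :+ m :* b)) refl (own v c) (mark v c) (path-weight (c ∷ v) p) _ _) ⟩
    Sum (allVecs d) (λ p → own v c * path-weight (c ∷ v) p * ((1ℚ - mark v c) * ψ (suc R) (c ∷ v) p + mark v c * ψ R (c ∷ v) p)) ∎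
    where open ≡-Reasoning

  0≤marks : ∀ {d} v (p : Vec Bool d) → 0ℚ ≤ marks v p
  0≤marks v [] = ≤-refl
  0≤marks v (c ∷ p) = 0≤+ (0≤mark v c) (0≤marks (c ∷ v) p)

  -- Markov's inequality for the number of divergences along a path.
  few-marks : ∀ {d} R v (p : Vec Bool d) → nat R * (success (leaf v p) - ψ R v p) ≤ marks v p
  few-marks R v [] = ≤-reflexive (trans (cong (nat R *_) (+-inverseʳ _)) (zeroʳ _))
  few-marks zero    v (c ∷ p) = ≡≤ (trans (cong (_* (success (leaf (c ∷ v) p) - 0ℚ)) nat-0) (zeroˡ _)) (0≤marks v (c ∷ p))
  few-marks (suc R) v (c ∷ p) = begin
   nat (suc R) * (s - ((1ℚ - m) * a + m * b))
    ≡⟨ cong (_* (s - ((1ℚ - m) * a + m * b))) (nat-suc R) ⟩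
   (1ℚ + nat R) * (s - ((1ℚ - m) * a + m * b))
    ≡⟨ solve 5 (λ n s m a b → (:1 :+ n) :* (s :- ((:1 :- m) :* a :+ m :* b)) := (:1 :- m) :* ((:1 :+ n) :* (s :- a)) :+ m :* ((s :- b) :+ n :* (s :- b))) refl (nat R) s m a b ⟩
   (1ℚ - m) * ((1ℚ + nat R) * (s - a)) + m * ((s - b) + nat R * (s - b))
    ≤⟨ +-mono-≤ (*≤ˡ (0≤- (mark≤1 v c)) (subst (λ z → z * (s - a) ≤ M) (nat-suc R) (few-marks (suc R) (c ∷ v) p)))
     (*≤ˡ (0≤mark v c) (+-mono-≤ (≤≡ (-≤ (⟦⟧≤1 (not ((oA w xor oB w) xor answer))) (0≤ψ R (c ∷ v) p)) (solve 0 (:1 :- :0 := :1) refl)) (few-marks R (c ∷ v) p))) ⟩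
   (1ℚ - m) * M + m * (1ℚ + M)
    ≡⟨ solve 2 (λ m M → (:1 :- m) :* M :+ m :* (:1 :+ M) := m :+ M) refl m M ⟩
   m + M ∎
   where
   open ≤-Reasoning
   m = mark v c
   a = ψ (suc R) (c ∷ v) p
   b = ψ R (c ∷ v) p
   M = marks (c ∷ v) p
   w = leaf (c ∷ v) p
   s = success w

 module Rounds {X Y : Set} (target : X → Y → Bool)
  (N : ℕ) (N>0 : 0ℚ < nat (length (downFrom N))) (N≡ : nat (length (downFrom N)) ≡ nat N)
  (owner : List Bool → Bool) (L S : ℕ)
  (KA : X → List Bool → ℕ) (KB : Y → List Bool → ℕ) (KA≤N : ∀ x v → KA x v ℕ.≤ N) (KB≤N : ∀ y v → KB y v ℕ.≤ N)
  (outA : X → List Bool → Bool) (outB : Y → List Bool → Bool) where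

  open Protocols target
  open Search target
  open Thresholds N N>0 N≡

  randThr : ∀ d → (Thr d → Prog X Y) → Prog X Y
  randThr zero    k = k tip
  randThr (suc d) k = rand (downFrom N) N>0 λ u → randThr d λ l → randThr d λ r → k (node u l r)

  ET : ∀ d → (Thr d → ℚ) → ℚ
  ET zero    F = F tip
  ET (suc d) F = mean (downFrom N) λ u → ET d λ l → ET d λ r → F (node u l r)

  ET-cong : ∀ d {F G} → (∀ t → F t ≡ G t) → ET d F ≡ ET d G
  ET-cong zero    h = h tip
  ET-cong (suc d) h = mean-cong (downFrom N) λ u → ET-cong d λ l → ET-cong d λ r → h (node u l r)

  val-randThr : ∀ d k x y → val (randThr d k) x y ≡ ET d (λ t → val (k t) x y)
  val-randThr zero    k x y = refl
  val-randThr (suc d) k x y = mean-cong (downFrom N) λ u → trans (val-randThr d _ x y) (ET-cong d λ l → val-randThr d _ x y)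

  ET-mono : ∀ d {F G} → (∀ t → F t ≤ G t) → ET d F ≤ ET d G
  ET-mono zero    h = h tip
  ET-mono (suc d) h = mean-mono (downFrom N) N>0 λ u → ET-mono d λ l → ET-mono d λ r → h (node u l r)

  ET-const : ∀ d c → ET d (λ _ → c) ≡ c
  ET-const zero    c = refl
  ET-const (suc d) c = trans (mean-cong (downFrom N) λ u → trans (ET-cong d λ l → ET-const d c) (ET-const d c)) (mean-const (downFrom N) N>0 c)

  mean-shift : ∀ (f : ℕ → ℚ) c → mean (downFrom N) (λ u → f u - c) ≡ mean (downFrom N) f - c
  mean-shift f c = trans (mean-cong (downFrom N) (λ u → solve 2 (λ a c → a :- c := :- c :+ a :* :1 :+ a :* :0) refl (f u) c))
   (trans (mean-affine f f (- c) 1ℚ 0ℚ) (solve 2 (λ a c → :- c :+ a :* :1 :+ a :* :0 := a :- c) refl _ c))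

  ET-shift : ∀ d F c → ET d (λ t → F t - c) ≡ ET d F - c
  ET-shift zero    F c = refl
  ET-shift (suc d) F c = trans (mean-cong (downFrom N) λ u → trans (ET-cong d λ l → ET-shift d _ c) (ET-shift d _ c)) (mean-shift _ c)

  cost-randThr : ∀ d k {c} → (∀ t → Cost (k t) c) → Cost (randThr d k) c
  cost-randThr zero    k h = h tip
  cost-randThr (suc d) k h = λ u → cost-randThr d _ λ l → cost-randThr d _ λ r → h (node u l r)

  -- The histories are functions of the inputs because each player keeps a private copy. At the
  -- actual inputs the copies agree, which is the invariant of `sim-correct`.
  sim : ℕ → ℕ → (X → List Bool) → (Y → List Bool) → Prog X Y
  sim R zero    vA vB = tellA (λ x → outA x (vA x)) λ a → tellB (λ y → outB y (vB y)) λ b → out (a xor b)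
  sim zero    (suc d) vA vB = out false
  sim (suc R) (suc d) vA vB = randThr (suc d) λ t →
   Descent.search (λ x → path (KA x) (vA x) t) (λ y → path (KB y) (vB y) t) L S [] λ j →
    sim R (d ℕ.∸ j) (λ x → move owner (vA x) (path (KA x) (vA x) t) j) (λ y → move (not ∘ owner) (vB y) (path (KB y) (vB y) t) j)

  cost-sim : ∀ R d vA vB → Cost (sim R d vA vB) (R ℕ.* (S ℕ.* 18) ℕ.+ 2)
  cost-sim R zero    vA vB = Cost-mono (sim 0 zero vA vB) (ℕ.m≤n+m 2 (R ℕ.* (S ℕ.* 18))) (λ a b → tt)
  cost-sim zero    (suc d) vA vB = tt
  cost-sim (suc R) (suc d) vA vB = cost-randThr (suc d) _ λ t →
   subst (Cost _) (sym (ℕ.+-assoc (S ℕ.* 18) (R ℕ.* (S ℕ.* 18)) 2)) (Descent.cost-search (λ x → path (KA x) (vA x) t) (λ y → path (KB y) (vB y) t) L S [] _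
    (λ j → cost-sim R (d ℕ.∸ j) (λ x → move owner (vA x) (path (KA x) (vA x) t) j) (λ y → move (not ∘ owner) (vB y) (path (KB y) (vB y) t) j)))

  module _ (x : X) (y : Y) where

   open Chain N N>0 N≡ owner (target x y) (KA x) (KB y) (KA≤N x) (KB≤N y) (outA x) (outB y)

   after : ∀ {d} → ℕ → List Bool → Vec Bool d → Vec Bool d → ℚ
   after R v [] [] = LB R 0 v
   after {suc d} R v (a ∷ g) (b ∷ h) = if a xor b then LB R d ((if owner v then a else b) ∷ v) else after R (a ∷ v) g h

   first-move : ∀ {d} R v (g h : Vec Bool (suc d)) →
    (move (not ∘ owner) v h (firstDiff g h) ≡ move owner v g (firstDiff g h)) ×
    (after R v g h ≡ LB R (d ℕ.∸ firstDiff g h) (move owner v g (firstDiff g h)))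
   first-move {zero} R v (true ∷ []) (true ∷ []) = refl , refl
   first-move {zero} R v (false ∷ []) (false ∷ []) = refl , refl
   first-move {zero} R v (true ∷ []) (false ∷ []) with owner v
   ... | true  = refl , refl
   ... | false = refl , refl
   first-move {zero} R v (false ∷ []) (true ∷ []) with owner v
   ... | true  = refl , refl
   ... | false = refl , refl
   first-move {suc d} R v (true ∷ g) (true ∷ h) = first-move R (true ∷ v) g h
   first-move {suc d} R v (false ∷ g) (false ∷ h) = first-move R (false ∷ v) g h
   first-move {suc d} R v (true ∷ g) (false ∷ h) with owner v
   ... | true  = refl , refl
   ... | false = refl , refl
   first-move {suc d} R v (false ∷ g) (true ∷ h) with owner v
   ... | true  = refl , refl
   ... | false = refl , refl

   -- Induction along the tree of thresholds, with `threshold-law` for the joint law of the two bits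
   -- at a node: if they agree the round goes on below, otherwise it ends with the owner's bit.
   round : ∀ R d v → ET d (λ t → after R v (path (KA x) v t) (path (KB y) v t)) ≡ LB (suc R) d v
   round R zero    v = refl
   round R (suc d) v = trans (mean-cong (downFrom N) split) (combine (owner v) refl)
    where
    E : Bool → ℚ
    E c = ET d (λ t → after R (c ∷ v) (path (KA x) (c ∷ v) t) (path (KB y) (c ∷ v) t))

    F : Bool → Bool → ℚ
    F a b = if a xor b then LB R d ((if owner v then a else b) ∷ v) else E a

    split : ∀ u → ET d (λ l → ET d (λ r → after R v (path (KA x) v (node u l r)) (path (KB y) v (node u l r)))) ≡ F (u ℕ.<ᵇ KA x v) (u ℕ.<ᵇ KB y v)
    split u with u ℕ.<ᵇ KA x v | u ℕ.<ᵇ KB y v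
    ... | true  | true  = ET-cong d λ l → ET-const d _
    ... | false | false = ET-const d _
    ... | true  | false = trans (ET-cong d λ l → ET-const d _) (ET-const d _)
    ... | false | true  = trans (ET-cong d λ l → ET-const d _) (ET-const d _)

    combine : ∀ o → owner v ≡ o → mean (downFrom N) (λ u → F (u ℕ.<ᵇ KA x v) (u ℕ.<ᵇ KB y v)) ≡ LB (suc R) (suc d) v
    combine true  e = trans (threshold-law (KA≤N x v) (KB≤N y v) F) (Sum-cong coins λ c → terms c)
     where
     terms : ∀ c → keep (coin-weight (pA v) c) (coin-weight (pB v) c) * F c c + pos (coin-weight (pA v) c - coin-weight (pB v) c) * F c (not c)
      ≡ stay v c * LB (suc R) d (c ∷ v) + pos (own v c - oth v c) * LB R d (c ∷ v)
     terms true rewrite e = cong₂ _+_ (cong (keep (coin-weight (pA v) true) (coin-weight (pB v) true) *_) (round R d (true ∷ v))) refl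
     terms false rewrite e = cong₂ _+_ (cong (keep (coin-weight (pA v) false) (coin-weight (pB v) false) *_) (round R d (false ∷ v))) refl
    combine false e = trans (threshold-law (KB≤N y v) (KA≤N x v) (λ b a → F a b)) (Sum-cong coins λ c → terms c)
     where
     terms : ∀ c → keep (coin-weight (pB v) c) (coin-weight (pA v) c) * F c c + pos (coin-weight (pB v) c - coin-weight (pA v) c) * F (not c) c
      ≡ stay v c * LB (suc R) d (c ∷ v) + pos (own v c - oth v c) * LB R d (c ∷ v)
     terms true rewrite e = cong₂ _+_ (cong (keep (coin-weight (pB v) true) (coin-weight (pA v) true) *_) (round R d (true ∷ v))) refl
     terms false rewrite e = cong₂ _+_ (cong (keep (coin-weight (pB v) false) (coin-weight (pA v) false) *_) (round R d (false ∷ v))) refl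

   ε : ℚ
   ε = (1ℚ - ½' ^ 3) ^ S * two ^ L

   sim-correct : ∀ R d vA vB → vB y ≡ vA x → d ℕ.< 2 ℕ.^ L → LB R d (vA x) - nat R * ε ≤ val (sim R d vA vB) x y
   sim-correct R zero vA vB e h = ≤≡ (≤-by (nat R * ε) (0≤* (0≤nat R) ε≥0) (solve 2 (λ a b → a :- b :+ b := a) refl _ _))
    (cong (λ z → hit (outA x (vA x) xor outB y z) x y) (sym e))
    where
    ε≥0 : 0ℚ ≤ ε
    ε≥0 = 0≤* (^-nonneg (Descent.0≤ρ {0} (λ _ → []) (λ _ → []) 0 x y (s≤s z≤n)) S) (^-nonneg (<⇒≤ 0<two) L)
   sim-correct zero (suc d) vA vB e h = ≡≤ (trans (cong (λ z → 0ℚ - z * ε) nat-0) (solve 1 (λ e → :0 :- :0 :* e := :0) refl ε)) (0≤⟦⟧ (not (false xor target x y)))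
   sim-correct (suc R) (suc d) vA vB e h = begin
    LB (suc R) (suc d) (vA x) - nat (suc R) * ε
     ≡⟨ cong₂ (λ a b → a - b * ε) (sym (round R (suc d) (vA x))) (nat-suc R) ⟩
    ET (suc d) (λ t → after R (vA x) (gA t) (path (KB y) (vA x) t)) - (1ℚ + nat R) * ε
     ≡⟨ ET-shift (suc d) (λ t → after R (vA x) (gA t) (path (KB y) (vA x) t)) ((1ℚ + nat R) * ε) ⟨
    ET (suc d) (λ t → after R (vA x) (gA t) (path (KB y) (vA x) t) - (1ℚ + nat R) * ε)
     ≤⟨ ET-mono (suc d) step ⟩
    ET (suc d) (λ t → val (body t) x y)
     ≡⟨ val-randThr (suc d) body x y ⟨
    val (sim (suc R) (suc d) vA vB) x y ∎
    where
    open ≤-Reasoning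
    gA : Thr (suc d) → Vec Bool (suc d)
    gA t = path (KA x) (vA x) t
    rest : Thr (suc d) → ℕ → Prog X Y
    rest t j = sim R (d ℕ.∸ j) (λ x → move owner (vA x) (path (KA x) (vA x) t) j) (λ y → move (not ∘ owner) (vB y) (path (KB y) (vB y) t) j)
    body : Thr (suc d) → Prog X Y
    body t = Descent.search (λ x → path (KA x) (vA x) t) (λ y → path (KB y) (vB y) t) L S [] (rest t)
    step : ∀ t → after R (vA x) (gA t) (path (KB y) (vA x) t) - (1ℚ + nat R) * ε ≤ val (body t) x y
    step t = ≡≤ (solve 3 (λ a r e → a :- (:1 :+ r) :* e := a :- r :* e :- e :* :1) refl (after R (vA x) (gA t) (path (KB y) (vA x) t)) (nat R) ε)
     (≤-trans (+≤ʳ (- (ε * 1ℚ)) inner) (Descent.search-correct _ _ L x y bound S (Descent.root) (rest t)))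
     where
     gB : Vec Bool (suc d)
     gB = path (KB y) (vB y) t
     J = firstDiff (gA t) gB
     bound : J ℕ.< 2 ℕ.^ L
     bound = ℕ.≤-<-trans (firstDiff≤ (gA t) gB) h
     moved : move (not ∘ owner) (vB y) gB J ≡ move owner (vA x) (gA t) J
     moved = trans (cong (λ v → move (not ∘ owner) v gB J) e) (proj₁ (first-move R (vA x) (gA t) gB))
     after≡ : after R (vA x) (gA t) (path (KB y) (vA x) t) ≡ LB R (d ℕ.∸ J) (move owner (vA x) (gA t) J)
     after≡ = trans (cong (λ v → after R (vA x) (gA t) (path (KB y) v t)) (sym e)) (proj₂ (first-move R (vA x) (gA t) gB))
     inner : after R (vA x) (gA t) (path (KB y) (vA x) t) - nat R * ε ≤ val (rest t J) x y
     inner = ≡≤ (cong (λ z → z - nat R * ε) after≡)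
      (sim-correct R (d ℕ.∸ J) _ _ moved (ℕ.≤-<-trans (ℕ.≤-trans (ℕ.m∸n≤m d J) (ℕ.n≤1+n d)) h))

-- Correlated sampling with finitely many attempts.

module CorrelatedSampling where

 open Arithmetic
 open LogBounds
 open Classes
 open Programs
 open NoisySearch
 open RoundByRound

 1≤length : ∀ {A : Set} (xs : List A) → NonEmpty xs → 1ℚ ≤ nat (length xs)
 1≤length [] h = ⊥-elim (<-irrefl (subst (0ℚ <_) nat-0 h))
 1≤length (x ∷ xs) h = ≤≡ (≤-by+ˡ (0≤nat (length xs))) (sym (nat-suc (length xs)))

 module Correlated {X Y Ω : Set} (target : X → Y → Bool)
  (N : ℕ) (N>0 : 0ℚ < nat (length (downFrom N))) (N≡ : nat (length (downFrom N)) ≡ nat N)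
  (Ωs : List Ω) (Ωs-ne : NonEmpty Ωs) (default : Ω)
  (αA : X → Ω → ℕ) (αB : Y → Ω → ℕ) (αA≤N : ∀ x ζ → αA x ζ ℕ.≤ N) (αB≤N : ∀ y ζ → αB y ζ ℕ.≤ N) where

  open Protocols target
  open Thresholds N N>0 N≡

  pick : (Ω → ℕ) → List (Ω × ℕ) → Ω
  pick α [] = default
  pick α ((ζ , u) ∷ s) = if u ℕ.<ᵇ α ζ then ζ else pick α s

  draw : ℕ → (List (Ω × ℕ) → Prog X Y) → Prog X Y
  draw zero    k = k []
  draw (suc J) k = rand Ωs Ωs-ne λ ζ → rand (downFrom N) N>0 λ u → draw J λ s → k ((ζ , u) ∷ s)

  ED : ℕ → (List (Ω × ℕ) → ℚ) → ℚ
  ED zero    G = G []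
  ED (suc J) G = mean Ωs λ ζ → mean (downFrom N) λ u → ED J λ s → G ((ζ , u) ∷ s)

  val-draw : ∀ J k x y → val (draw J k) x y ≡ ED J (λ s → val (k s) x y)
  val-draw zero    k x y = refl
  val-draw (suc J) k x y = mean-cong Ωs λ ζ → mean-cong (downFrom N) λ u → val-draw J _ x y

  cost-draw : ∀ J k {c} → (∀ s → Cost (k s) c) → Cost (draw J k) c
  cost-draw zero    k h = h []
  cost-draw (suc J) k h = λ ζ u → cost-draw J _ (λ s → h ((ζ , u) ∷ s))

  ED-≥ : ∀ J {G c} → (∀ s → c ≤ G s) → c ≤ ED J G
  ED-≥ zero    h = h []
  ED-≥ (suc J) h = mean-≥ Ωs Ωs-ne λ ζ → mean-≥ (downFrom N) N>0 λ u → ED-≥ J λ s → h ((ζ , u) ∷ s)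

  correlated : ℕ → ((X → Ω) → (Y → Ω) → Prog X Y) → Prog X Y
  correlated J k = draw J λ s → k (λ x → pick (αA x) s) (λ y → pick (αB y) s)

  -- Here a + b - min(a, b) is the maximum of a and b, the probability that some player accepts.
  keep-dual : ∀ a b → keep (1ℚ - a) (1ℚ - b) ≡ 1ℚ - (a + b - keep a b)
  keep-dual a b with ≤-total a b
  ... | inj₁ h = trans (keep-≥ (1-mono h)) (trans (solve 2 (λ a b → :1 :- b := :1 :- (a :+ b :- a)) refl a b) (cong (λ z → 1ℚ - (a + b - z)) (sym (keep-≤ h))))
  ... | inj₂ h = trans (keep-≤ (1-mono h)) (trans (solve 2 (λ a b → :1 :- a := :1 :- (a :+ b :- b)) refl a b) (cong (λ z → 1ℚ - (a + b - z)) (sym (keep-≥ h))))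

  keep≤ˡ : ∀ a b → keep a b ≤ a
  keep≤ˡ a b = ≤-by (pos (a - b)) (0≤pos _) (solve 2 (λ a p → a :- p :+ p := a) refl a _)

  keep≤ʳ : ∀ a b → keep a b ≤ b
  keep≤ʳ a b = ≤≡ (-≤ ≤-refl (≤pos (a - b))) (solve 2 (λ a b → a :- (a :- b) := b) refl a b)

  0≤keep : ∀ {a b} → 0ℚ ≤ a → 0ℚ ≤ b → 0ℚ ≤ keep a b
  0≤keep {a} {b} ha hb with ≤-total a b
  ... | inj₁ h = subst (0ℚ ≤_) (sym (keep-≤ h)) ha
  ... | inj₂ h = subst (0ℚ ≤_) (sym (keep-≥ h)) hb

  private
   n = nat (length Ωs)
   κ = inv n
   κ≥0 : 0ℚ ≤ κ
   κ≥0 = <⇒≤ (0<inv Ωs-ne)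

  decay : ℚ
  decay = 1ℚ - ½' * inv (nat (length Ωs))

  0≤decay : 0ℚ ≤ decay
  0≤decay = 0≤- (*≤1 0≤½' (≤-by ½' 0≤½' ½+½) κ≥0 κ≤1)
   where
   κ≤1 : κ ≤ 1ℚ
   κ≤1 = ≤≡ (≡≤ (sym (*-identityˡ κ)) (*≤ʳ κ≥0 (1≤length Ωs Ωs-ne))) (*inv Ωs-ne)

  module _ (x : X) (y : Y) (F : Ω → ℚ) (F≤1 : ∀ ζ → F ζ ≤ 1ℚ)
   (A≤1 : Sum Ωs (λ ζ → fraction (αA x ζ)) ≤ 1ℚ) (B≤1 : Sum Ωs (λ ζ → fraction (αB y ζ)) ≤ 1ℚ) where

   private
    a b q : Ω → ℚ
    a ζ = fraction (αA x ζ)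
    b ζ = fraction (αB y ζ)
    q ζ = keep (a ζ) (b ζ)
    A = Sum Ωs a
    B = Sum Ωs b
    M = Sum Ωs q
    S = Sum Ωs (λ ζ → q ζ * F ζ)

   0≤q : ∀ ζ → 0ℚ ≤ q ζ
   0≤q ζ = 0≤keep (0≤fraction (αA x ζ)) (0≤fraction (αB y ζ))

   -- Let S and M be the two sums and A, B the total densities. The first sample accepted by anyone
   -- succeeds with probability at least S/(A + B - M) ≥ S/(2 - M) ≥ S + M - 1. The last bound is
   -- taken because it is linear and can be averaged over the inputs.
   θ : ℚ
   θ = Sum Ωs (λ ζ → keep (fraction (αA x ζ)) (fraction (αB y ζ)) * F ζ) + Sum Ωs (λ ζ → keep (fraction (αA x ζ)) (fraction (αB y ζ))) - 1ℚ

   S≤M : S ≤ M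
   S≤M = Sum-mono Ωs (λ ζ → ≤≡ (*≤ˡ (0≤q ζ) (F≤1 ζ)) (*-identityʳ _))

   M≤A : M ≤ A
   M≤A = Sum-mono Ωs (λ ζ → keep≤ˡ (a ζ) (b ζ))

   M≤B : M ≤ B
   M≤B = Sum-mono Ωs (λ ζ → keep≤ʳ (a ζ) (b ζ))

   M≤1 : M ≤ 1ℚ
   M≤1 = ≤-trans M≤A A≤1

   recurrence : ∀ e → mean Ωs (λ ζ → q ζ * F ζ + (1ℚ - (a ζ + b ζ - q ζ)) * e) ≡ κ * S + (1ℚ - κ * (A + B - M)) * e
   recurrence e = trans (mean≡ Ωs _) (trans (cong (κ *_) (trans (Sum-+ Ωs) (cong (S +_) (trans (Sum-*ʳ e Ωs) (cong (_* e)
      (trans (Sum-- Ωs) (cong₂ _-_ (trans (Sum-const 1ℚ Ωs) (*-identityʳ n)) (trans (Sum-- Ωs) (cong (λ z → z - M) (Sum-+ Ωs))))))))))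
    (trans (solve 5 (λ k s n h e → k :* (s :+ (n :- h) :* e) := k :* s :+ (n :* k :- k :* h) :* e) refl κ S n (A + B - M) e)
     (cong (λ z → κ * S + (z - κ * (A + B - M)) * e) (*inv Ωs-ne))))

   drift : 0ℚ ≤ θ → κ * (A + B - M) * θ ≤ κ * S
   drift hθ = ≡≤ (*-assoc κ _ θ) (*≤ˡ κ≥0 (≤-trans (*≤ʳ hθ (-≤ (+-mono-≤ A≤1 B≤1) (≤-refl {M})))
    (≤-by ((1ℚ - M) * ((1ℚ - S) + (1ℚ - M))) (0≤* (0≤- M≤1) (0≤+ (0≤- (≤-trans S≤M M≤1)) (0≤- M≤1)))
     (solve 2 (λ M S → (:2 :- M) :* (S :+ M :- :1) :+ (:1 :- M) :* ((:1 :- S) :+ (:1 :- M)) := S) refl M S))))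

   -- From θ ≥ 0 follows 2M ≥ S + M ≥ 1, so A + B - M ≥ M ≥ 1/2: an attempt is accepted by some
   -- player with probability at least 1/2 divided by the number of points.
   speed : 0ℚ ≤ θ → 1ℚ - decay ≤ κ * (A + B - M)
   speed hθ = ≡≤ (solve 2 (λ h k → :1 :- (:1 :- h :* k) := k :* h) refl ½' κ) (*≤ˡ κ≥0 (≤-trans half≤M
      (≤-by ((A - M) + (B - M)) (0≤+ (0≤- M≤A) (0≤- M≤B)) (solve 3 (λ A B M → M :+ ((A :- M) :+ (B :- M)) := A :+ B :- M) refl A B M))))
    where
    1≤2M : 1ℚ ≤ M + M
    1≤2M = ≤-trans (≤-by θ hθ (solve 2 (λ M S → :1 :+ (S :+ M :- :1) := S :+ M) refl M S)) (+≤ʳ M S≤M)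
    half≤M : ½' ≤ M
    half≤M = ≡≤ (sym (*-identityʳ ½')) (≤≡ (*≤ˡ 0≤½' 1≤2M) (half-sum M))

   -- Induction on the attempts. One that nobody accepts leaves the situation unchanged, and one
   -- that only a single player accepts is counted as 0.
   converge : ∀ J {G} → (∀ s → 0ℚ ≤ G s) → (∀ s ζ → pick (αA x) s ≡ ζ → pick (αB y) s ≡ ζ → F ζ ≤ G s) →
    0ℚ ≤ θ → θ * (1ℚ - decay ^ J) ≤ ED J G
   converge zero    h₀ h hθ = ≡≤ (solve 1 (λ t → t :* (:1 :- :1) := :0) refl θ) (h₀ [])
   converge (suc J) {G} h₀ h hθ = begin
    θ * (1ℚ - decay * decay ^ J)
     ≤⟨ ≤-by ((κ * S - H * θ) + θ * t * (H - (1ℚ - decay))) (0≤+ (0≤- (drift hθ)) (0≤* (0≤* hθ (^-nonneg 0≤decay J)) (0≤- (speed hθ))))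
      (solve 5 (λ kS θ H d t → θ :* (:1 :- d :* t) :+ ((kS :- H :* θ) :+ θ :* t :* (H :- (:1 :- d))) := kS :+ (:1 :- H) :* (θ :* (:1 :- t))) refl (κ * S) θ H decay t) ⟩
    κ * S + (1ℚ - H) * e
     ≡⟨ recurrence e ⟨
    mean Ωs (λ ζ → q ζ * F ζ + (1ℚ - (a ζ + b ζ - q ζ)) * e)
     ≡⟨ mean-cong Ωs law ⟩
    mean Ωs (λ ζ → mean (downFrom N) (λ u → O ζ (u ℕ.<ᵇ αA x ζ) (u ℕ.<ᵇ αB y ζ)))
     ≤⟨ mean-mono Ωs Ωs-ne (λ ζ → mean-mono (downFrom N) N>0 (λ u → outcome ζ u)) ⟩
    ED (suc J) G ∎
    where
    open ≤-Reasoning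
    t = decay ^ J
    e = θ * (1ℚ - t)
    H = κ * (A + B - M)
    O : Ω → Bool → Bool → ℚ
    O ζ true  true  = F ζ
    O ζ false false = e
    O ζ true  false = 0ℚ
    O ζ false true  = 0ℚ
    law : ∀ ζ → q ζ * F ζ + (1ℚ - (a ζ + b ζ - q ζ)) * e ≡ mean (downFrom N) (λ u → O ζ (u ℕ.<ᵇ αA x ζ) (u ℕ.<ᵇ αB y ζ))
    law ζ = sym (trans (threshold-law (αA≤N x ζ) (αB≤N y ζ) (O ζ)) (trans (solve 6 (λ a p f k p' e → a :* f :+ p :* :0 :+ (k :* e :+ p' :* :0 :+ :0) := a :* f :+ k :* e) refl _ _ _ _ _ _)
     (cong (λ z → q ζ * F ζ + z * e) (keep-dual (a ζ) (b ζ)))))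
    outcome : ∀ ζ u → O ζ (u ℕ.<ᵇ αA x ζ) (u ℕ.<ᵇ αB y ζ) ≤ ED J (λ s → G ((ζ , u) ∷ s))
    outcome ζ u with u ℕ.<ᵇ αA x ζ in eA | u ℕ.<ᵇ αB y ζ in eB
    ... | true  | true  = ED-≥ J (λ s → h ((ζ , u) ∷ s) ζ (cong (λ b → if b then ζ else pick (αA x) s) eA) (cong (λ b → if b then ζ else pick (αB y) s) eB))
    ... | true  | false = ED-≥ J (λ s → h₀ ((ζ , u) ∷ s))
    ... | false | true  = ED-≥ J (λ s → h₀ ((ζ , u) ∷ s))
    ... | false | false = converge J (λ s → h₀ ((ζ , u) ∷ s))
     (λ s ζ' e₁ e₂ → h ((ζ , u) ∷ s) ζ' (trans (cong (λ b → if b then ζ else pick (αA x) s) eA) e₁) (trans (cong (λ b → if b then ζ else pick (αB y) s) eB) e₂)) hθ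

   -- Holenstein's correlated sampling: the players agree on ζ with probability about
   -- the smaller of their two densities.
   correlated-sampling : ∀ J k → (∀ zA zB ζ → zA x ≡ ζ → zB y ≡ ζ → F ζ ≤ val (k zA zB) x y) →
    θ - decay ^ J ≤ val (correlated J k) x y
   correlated-sampling J k h with 0ℚ ≤? θ
   ... | no ¬p = ≤-trans (≤≡ (-≤ (<⇒≤ (≰⇒> ¬p)) (^-nonneg 0≤decay J)) (solve 0 (:0 :- :0 := :0) refl)) (0≤val (correlated J k) x y)
   ... | yes p = ≤-trans (≤-by ((1ℚ - θ) * t) (0≤* (0≤- θ≤1) (^-nonneg 0≤decay J)) (solve 2 (λ θ t → θ :- t :+ (:1 :- θ) :* t := θ :* (:1 :- t)) refl θ t))
    (≤≡ (converge J (λ s → 0≤val (k _ _) x y) (λ s ζ e₁ e₂ → h _ _ ζ e₁ e₂) p) (sym (val-draw J _ x y)))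
    where
    t = decay ^ J
    θ≤1 : θ ≤ 1ℚ
    θ≤1 = ≤≡ (+≤ʳ (- 1ℚ) (+-mono-≤ (≤-trans S≤M M≤1) M≤1)) (solve 0 (:1 :+ :1 :- :1 := :1) refl)

-- Simulating the tilted law around one coordinate.

module CoordinateSimulation where

 open Arithmetic
 open LogBounds
 open Classes
 open InformationCost
 open Programs
 open NoisySearch
 open RoundByRound
 open CorrelatedSampling
 open import Data.Vec using (Vec; []; _∷_)
 open import Data.List.Membership.Propositional.Properties using (∈-map⁺; ∈-++⁺ˡ; ∈-++⁺ʳ; ∈-cartesianProduct⁺; ∈-map⁻)
 open import Data.Bool.Properties using (∧-assoc)

 private
  variable
   A : Set

 finite-∈ : ∀ {B} (𝔹 : Finite B) b → b ∈ Finite.values 𝔹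
 finite-∈ 𝔹 b = go values (λ e → <-irrefl (subst (_< 1ℚ) (trans (sym e) (once b)) 0<1))
  where
  open Finite 𝔹
  go : ∀ vs → ¬ (Sum vs (λ v → ⟦ b == v ⟧) ≡ 0ℚ) → b ∈ vs
  go [] h = ⊥-elim (h refl)
  go (v ∷ vs) h with b == v in eq
  ... | true  = here (==-sound eq)
  ... | false = there (go vs (λ e → h (trans (+-identityˡ _) e)))

 Integral : ℕ → ℚ → Set
 Integral N q = ∃ λ k → nat k ≡ q * nat N

 opaque
  unfolding _+_

  clear-denominator : ∀ q → 0ℚ ≤ q → Integral (ℚ.↧ₙ q) q
  clear-denominator q@(ℚ.mkℚ (ℤ.+ k) d-1 _) h = k , ℚ.toℚᵘ-injective (begin
   ℚ.toℚᵘ (nat k) ≈⟨ ℚ.toℚᵘ-fromℚᵘ (ℚᵘ.mkℚᵘ (ℤ.+ k) 0) ⟩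
   ℚᵘ.mkℚᵘ (ℤ.+ k) 0 ≈⟨ ℚᵘ.*≡* (trans (cong (λ z → ℤ.+ k ℤ.* ℤ.+ suc z) (ℕ.*-identityʳ d-1)) (sym (ℤ.*-identityʳ (ℤ.+ k ℤ.* ℤ.+ suc d-1)))) ⟩
   ℚ.toℚᵘ q ℚᵘ.* ℚᵘ.mkℚᵘ (ℤ.+ suc d-1) 0 ≈⟨ ℚᵘ.*-congˡ {ℚ.toℚᵘ q} (ℚ.toℚᵘ-fromℚᵘ (ℚᵘ.mkℚᵘ (ℤ.+ suc d-1) 0)) ⟨
   ℚ.toℚᵘ q ℚᵘ.* ℚ.toℚᵘ (nat (suc d-1)) ≈⟨ ℚ.toℚᵘ-homo-* q (nat (suc d-1)) ⟨
   ℚ.toℚᵘ (q * nat (suc d-1)) ∎)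
   where open ℚᵘ.≃-Reasoning
  clear-denominator (ℚ.mkℚ ℤ.-[1+ k ] d-1 _) (ℚ.*≤* ())

 -- Bounded by n on all of ℚ, so that a prediction for any history yields an admissible threshold,
 -- and exact at the integers in range.
 floor : ℕ → ℚ → ℕ
 floor zero    q = 0
 floor (suc n) q with nat (suc n) ≤? q
 ... | yes _ = suc n
 ... | no _  = floor n q

 floor≤ : ∀ n q → floor n q ℕ.≤ n
 floor≤ zero    q = z≤n
 floor≤ (suc n) q with nat (suc n) ≤? q
 ... | yes _ = ℕ.≤-refl
 ... | no _  = ℕ.m≤n⇒m≤1+n (floor≤ n q)

 floor≡ : ∀ n {k} → k ℕ.≤ n → floor n (nat k) ≡ k
 floor≡ zero z≤n = refl
 floor≡ (suc n) {k} h with nat (suc n) ≤? nat k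
 ... | yes p = ℕ.≤-antisym (nat-cancel-≤ p) h
 ... | no ¬p with ℕ.m≤n⇒m<n∨m≡n h
 ... | inj₁ (s≤s h') = floor≡ n h'
 ... | inj₂ refl     = ⊥-elim (¬p ≤-refl)

 numer : ℕ → ℚ → ℕ
 numer N q = floor N (q * nat N)

 numer≤ : ∀ N q → numer N q ℕ.≤ N
 numer≤ N q = floor≤ N (q * nat N)

 numer≡ : ∀ {N q} → 0ℚ < nat N → q ≤ 1ℚ → Integral N q → nat (numer N q) ≡ q * nat N
 numer≡ {N} {q} hN h (k , e) = trans (cong nat (trans (cong (floor N) (sym e)) (floor≡ N k≤N))) e
  where
  k≤N : k ℕ.≤ N
  k≤N = nat-cancel-≤ (≡≤ e (≤≡ (*≤ʳ (<⇒≤ hN) h) (*-identityˡ _)))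

 Integral-* : ∀ {N q} M → Integral N q → Integral (N ℕ.* M) q
 Integral-* {N} {q} M (k , e) = k ℕ.* M , trans (nat-* k M) (trans (cong (_* nat M) e) (trans (*-assoc q (nat N) (nat M)) (cong (q *_) (sym (nat-* N M)))))

 -- The finitely many probabilities of the simulation become multiples of 1/N, so that uniform
 -- thresholds below N realise them without rounding.
 common-denominator : ∀ qs → (∀ q → q ∈ qs → 0ℚ ≤ q) → ∃ λ N → ∀ q → q ∈ qs → Integral (suc N) q
 common-denominator [] h = 0 , λ q ()
 common-denominator (q ∷ qs) h with common-denominator qs (λ p p∈ → h p (there p∈))
 ... | N , k = ℕ.pred (suc N ℕ.* ℚ.↧ₙ q) , λ
  { p (here refl) → subst (λ M → Integral M p) (trans (ℕ.*-comm (ℚ.↧ₙ q) (suc N)) (sym (suc-pred q))) (Integral-* (suc N) (clear-denominator q (h q (here refl))))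
  ; p (there p∈)  → subst (λ M → Integral M p) (sym (suc-pred q)) (Integral-* (ℚ.↧ₙ q) (k p p∈)) }
  where
  suc-pred : ∀ q → suc (ℕ.pred (suc N ℕ.* ℚ.↧ₙ q)) ≡ suc N ℕ.* ℚ.↧ₙ q
  suc-pred (ℚ.mkℚ _ d-1 _) = refl

 length-downFrom : ∀ n → length (downFrom n) ≡ n
 length-downFrom zero    = refl
 length-downFrom (suc n) = cong suc (length-downFrom n)

 listsOf : ℕ → List (List Bool)
 listsOf zero    = [] ∷ []
 listsOf (suc t) = map (true ∷_) (listsOf t) ++ map (false ∷_) (listsOf t)

 listsOf-all : ∀ v → v ∈ listsOf (length v)
 listsOf-all [] = here refl
 listsOf-all (true ∷ v)  = ∈-++⁺ˡ (∈-map⁺ (true ∷_) (listsOf-all v))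
 listsOf-all (false ∷ v) = ∈-++⁺ʳ (map (true ∷_) (listsOf (length v))) (∈-map⁺ (false ∷_) (listsOf-all v))

 listsBelow : ℕ → List (List Bool)
 listsBelow zero    = []
 listsBelow (suc t) = listsOf t ++ listsBelow t

 listsBelow-all : ∀ {T} v → length v ℕ.< T → v ∈ listsBelow T
 listsBelow-all {suc T} v (s≤s h) with ℕ.m≤n⇒m<n∨m≡n h
 ... | inj₁ k = ∈-++⁺ʳ (listsOf T) (listsBelow-all v k)
 ... | inj₂ e = ∈-++⁺ˡ (subst (λ t → v ∈ listsOf t) e (listsOf-all v))

 allVecs-all : ∀ {d} (p : Vec Bool d) → p ∈ allVecs d
 allVecs-all [] = here refl
 allVecs-all (true ∷ p)  = ∈-++⁺ˡ (∈-map⁺ (true ∷_) (allVecs-all p))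
 allVecs-all (false ∷ p) = ∈-++⁺ʳ (map (true ∷_) (allVecs _)) (∈-map⁺ (false ∷_) (allVecs-all p))

 -- Transfers a function of points to the data that a player has: g is read off at some point
 -- compatible with the data, and the choice does not matter where g is constant on such points.
 findBit : (A → Bool) → (A → Bool) → List A → Bool
 findBit p g [] = false
 findBit p g (a ∷ as) = if p a then g a else findBit p g as

 findBit≡ : ∀ p g {b} (as : List A) {a} → a ∈ as → p a ≡ true → (∀ a → p a ≡ true → g a ≡ b) → findBit p g as ≡ b
 findBit≡ p g (a ∷ as) a∈ h k with p a in eq
 ... | true = k a eq
 findBit≡ p g (a ∷ as) (here refl) h k | false with trans (sym eq) h
 ... | ()
 findBit≡ p g (a ∷ as) (there a∈)  h k | false = findBit≡ p g as a∈ h k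

 one-minus : ∀ {a b} → 0ℚ ≤ a → 0ℚ ≤ b → 1ℚ - (pos (1ℚ - a) + pos (1ℚ - b)) ≤ a * b
 one-minus {a} {b} ha hb = ≤-trans
  (≤-by (p * q) (0≤* (0≤pos _) (0≤pos _)) (solve 2 (λ p q → :1 :- (p :+ q) :+ p :* q := (:1 :- p) :* (:1 :- q)) refl p q))
  (*≤ (0≤- (p≤1 ha)) (1-p≤ a) (0≤- (p≤1 hb)) (1-p≤ b))
  where
  p = pos (1ℚ - a)
  q = pos (1ℚ - b)
  p≤1 : ∀ {a} → 0ℚ ≤ a → pos (1ℚ - a) ≤ 1ℚ
  p≤1 {a} h = pos-lub 0≤1 (≤-by a h (solve 1 (λ a → :1 :- a :+ a := :1) refl a))
  1-p≤ : ∀ a → 1ℚ - pos (1ℚ - a) ≤ a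
  1-p≤ a = ≤≡ (-≤ ≤-refl (≤pos (1ℚ - a))) (solve 1 (λ a → :1 :- (:1 :- a) := a) refl a)

 one-minus-loss : ∀ {r W l} → 0ℚ ≤ r → 0ℚ ≤ W → 0ℚ ≤ l → 1ℚ - l ≤ r → 1ℚ - (l + pos (1ℚ - W)) ≤ r * W
 one-minus-loss {r} {W} {l} hr hW hl h = ≤-trans (-≤ ≤-refl (+≤ʳ (pos (1ℚ - W)) (pos-lub hl (≤-by-- (0≤- h) (solve 2 (λ r l → l :- (:1 :- r) := r :- (:1 :- l)) refl r l))))) (one-minus hr hW)

 -- c is the probability of the bit given both inputs, a c the owner's prediction and b c the other
 -- player's. A divergence requires that b is too small or a too large compared with 1; the common
 -- factor c cancels.
 mark-bound : ∀ {a b c} → 0ℚ < a → 0ℚ < b → 0ℚ < c → pos (a * c - b * c) * inv (a * c) ≤ pos (1ℚ - b) + pos (a - 1ℚ) * inv a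
 mark-bound {a} {b} {c} ha hb hc with pos-cases (a * c - b * c)
 ... | inj₂ (_ , e) = ≡≤ (trans (cong (_* inv (a * c)) e) (zeroˡ _)) (0≤+ (0≤pos _) (0≤* (0≤pos _) (<⇒≤ (0<inv ha))))
 ... | inj₁ (_ , e) = ≡≤ (trans (cong₂ _*_ e (inv-* ha hc)) reduce) (split (≤-total 1ℚ a))
  where
  i = inv a
  i≥0 = <⇒≤ (0<inv ha)
  reduce : (a * c - b * c) * (i * inv c) ≡ 1ℚ - b * i
  reduce = trans (solve 5 (λ a b c i j → (a :* c :- b :* c) :* (i :* j) := (c :* j) :* (a :* i :- b :* i)) refl a b c i (inv c))
   (trans (cong₂ (λ u v → u * (v - b * i)) (*inv hc) (*inv ha)) (*-identityˡ _))
  split : (1ℚ ≤ a) ⊎ (a ≤ 1ℚ) → 1ℚ - b * i ≤ pos (1ℚ - b) + pos (a - 1ℚ) * i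
  split (inj₁ h) = ≡≤ eq (+-mono-≤ (≤-trans (*≤ʳ i≥0 (≤pos (1ℚ - b))) (≤≡ (*≤ˡ (0≤pos _) i≤1) (*-identityʳ _))) (*≤ʳ i≥0 (≤pos (a - 1ℚ))))
   where
   i≤1 : i ≤ 1ℚ
   i≤1 = ≤≡ (inv-anti 0<1 h) inv-1
   eq : 1ℚ - b * i ≡ (1ℚ - b) * i + (a - 1ℚ) * i
   eq = trans (cong (λ z → z - b * i) (sym (*inv ha))) (solve 3 (λ a b i → a :* i :- b :* i := (:1 :- b) :* i :+ (a :- :1) :* i) refl a b i)
  split (inj₂ h) = ≤-trans (-≤ ≤-refl b≤bi) (≤-trans (≤pos _) (≤-by+ˡ (0≤* (0≤pos _) i≥0)))
   where
   1≤i : 1ℚ ≤ i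
   1≤i = ≡≤ (sym inv-1) (inv-anti ha h)
   b≤bi : b ≤ b * i
   b≤bi = ≡≤ (sym (*-identityʳ b)) (*≤ˡ (<⇒≤ hb) 1≤i)

 module Simulation (E : Experiment) (i : ℕ) (i∈ : i ∈ downFrom (Experiment.n E))
  (target : Experiment.X E → Experiment.Y E → Bool) (guessA guessB : Experiment.Ω E → Bool)
  (guessA-inv : ∀ {ω ω'} → Information.G E i (Experiment.T E) ω ω' ≡ true → guessA ω ≡ guessA ω')
  (guessB-inv : ∀ {ω ω'} → Information.G E (suc i) (Experiment.T E) ω ω' ≡ true → guessB ω ≡ guessB ω')
  (default : Experiment.Ω E) (R : ℕ) (J L S : ℕ) (T<2^L : Experiment.T E ℕ.< 2 ℕ.^ L) where

  open Experiment E
  open Information E hiding (L)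
  private
   module 𝕏 = Finite 𝕏
   module 𝕐 = Finite 𝕐

  ξ : Ω → X
  ξ = x i

  η : Ω → Y
  η = y i

  zrel : Ω → Ω → Bool
  zrel = suffix (suc i) ∩ prefix i

  zrel-equiv : Equivalence zrel
  zrel-equiv = ∩-equiv (suffix-equiv (suc i)) (prefix-equiv i)

  -- ζ ranges over Ω and stands for its class of zrel, the coordinates shared by the players.
  nodeA : List Bool → X → Ω → ℚ
  nodeA v a ζ = 𝔼 (λ ω → ⟦ (a 𝕏.== ξ ω) ∧ zrel ζ ω ∧ (v ==ᴸ history (length v) ω) ⟧)

  nodeB : List Bool → Y → Ω → ℚ
  nodeB v b ζ = 𝔼 (λ ω → ⟦ (b 𝕐.== η ω) ∧ zrel ζ ω ∧ (v ==ᴸ history (length v) ω) ⟧)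

  0≤nodeA : ∀ v a ζ → 0ℚ ≤ nodeA v a ζ
  0≤nodeA v a ζ = 𝔼-≥0 (λ ω → 0≤⟦⟧ ((a 𝕏.== ξ ω) ∧ zrel ζ ω ∧ (v ==ᴸ history (length v) ω)))

  0≤nodeB : ∀ v a ζ → 0ℚ ≤ nodeB v a ζ
  0≤nodeB v b ζ = 𝔼-≥0 (λ ω → 0≤⟦⟧ ((b 𝕐.== η ω) ∧ zrel ζ ω ∧ (v ==ᴸ history (length v) ω)))

  length-history : ∀ t ω → length (history t ω) ≡ t
  length-history zero    ω = refl
  length-history (suc t) ω = cong suc (length-history t ω)

  private
   shuffleA : ∀ e s p h → e ∧ (s ∧ p) ∧ h ≡ (s ∧ e) ∧ p ∧ h
   shuffleA true  true  p h = refl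
   shuffleA true  false p h = refl
   shuffleA false true  p h = refl
   shuffleA false false p h = refl

   shuffleB : ∀ e s p h → e ∧ (s ∧ p) ∧ h ≡ s ∧ (p ∧ e) ∧ h
   shuffleB true  true  true  h = refl
   shuffleB true  true  false h = refl
   shuffleB true  false p     h = refl
   shuffleB false true  true  h = refl
   shuffleB false true  false h = refl
   shuffleB false false p     h = refl

  zrel-swap : ∀ {ω ζ} ω' → zrel ω ζ ≡ true → zrel ζ ω' ≡ zrel ω ω'
  zrel-swap ω' h = sym (tr zrel-equiv ω' h)

  bitsA : ∀ t {ω ζ} ω' → zrel ω ζ ≡ true → ((ξ ω 𝕏.== ξ ω') ∧ zrel ζ ω' ∧ (history t ω ==ᴸ history (length (history t ω)) ω')) ≡ G i t ω ω'
  bitsA t {ω} {ζ} ω' h = trans (cong₂ (λ a b → (ξ ω 𝕏.== ξ ω') ∧ a ∧ (history t ω ==ᴸ history b ω')) (zrel-swap {ω} {ζ} ω' h) (length-history t ω))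
   (trans (shuffleA (ξ ω 𝕏.== ξ ω') (suffix (suc i) ω ω') (prefix i ω ω') (hist t ω ω')) (cong (λ z → z ∧ prefix i ω ω' ∧ hist t ω ω') (sym (suffix-suc i ω ω'))))

  bitsB : ∀ t {ω ζ} ω' → zrel ω ζ ≡ true → ((η ω 𝕐.== η ω') ∧ zrel ζ ω' ∧ (history t ω ==ᴸ history (length (history t ω)) ω')) ≡ G (suc i) t ω ω'
  bitsB t {ω} {ζ} ω' h = trans (cong₂ (λ a b → (η ω 𝕐.== η ω') ∧ a ∧ (history t ω ==ᴸ history b ω')) (zrel-swap {ω} {ζ} ω' h) (length-history t ω))
   (trans (shuffleB (η ω 𝕐.== η ω') (suffix (suc i) ω ω') (prefix i ω ω') (hist t ω ω')) (cong (λ z → suffix (suc i) ω ω' ∧ z ∧ hist t ω ω') (sym (prefix-suc i ω ω'))))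

  nodeA≡ : ∀ t {ω ζ} → zrel ω ζ ≡ true → nodeA (history t ω) (ξ ω) ζ ≡ g i t ω
  nodeA≡ t {ω} {ζ} h = 𝔼-cong (λ ω' → cong ⟦_⟧ (bitsA t {ω} {ζ} ω' h))

  nodeB≡ : ∀ t {ω ζ} → zrel ω ζ ≡ true → nodeB (history t ω) (η ω) ζ ≡ g (suc i) t ω
  nodeB≡ t {ω} {ζ} h = 𝔼-cong (λ ω' → cong ⟦_⟧ (bitsB t {ω} {ζ} ω' h))

  private
   two-way : ∀ e h b → ⟦ e ∧ (h ∧ Finite._==_ bool-finite true b) ⟧ + ⟦ e ∧ (h ∧ Finite._==_ bool-finite false b) ⟧ ≡ ⟦ e ∧ h ⟧
   two-way false h     b     = +-identityˡ 0ℚ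
   two-way true  false b     = +-identityˡ 0ℚ
   two-way true  true  true  = +-identityʳ 1ℚ
   two-way true  true  false = +-identityˡ 1ℚ

  nodeA-split : ∀ v a ζ → nodeA (true ∷ v) a ζ + nodeA (false ∷ v) a ζ ≡ nodeA v a ζ
  nodeA-split v a ζ = trans (sym 𝔼-+) (𝔼-cong (λ ω → trans (cong₂ _+_ (cong ⟦_⟧ (sym (∧-assoc (a 𝕏.== ξ ω) (zrel ζ ω) _))) (cong ⟦_⟧ (sym (∧-assoc (a 𝕏.== ξ ω) (zrel ζ ω) _))))
   (trans (two-way ((a 𝕏.== ξ ω) ∧ zrel ζ ω) (v ==ᴸ history (length v) ω) (m (length v) ω)) (cong ⟦_⟧ (∧-assoc (a 𝕏.== ξ ω) (zrel ζ ω) _)))))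

  nodeB-split : ∀ v b ζ → nodeB (true ∷ v) b ζ + nodeB (false ∷ v) b ζ ≡ nodeB v b ζ
  nodeB-split v b ζ = trans (sym 𝔼-+) (𝔼-cong (λ ω → trans (cong₂ _+_ (cong ⟦_⟧ (sym (∧-assoc (b 𝕐.== η ω) (zrel ζ ω) _))) (cong ⟦_⟧ (sym (∧-assoc (b 𝕐.== η ω) (zrel ζ ω) _))))
   (trans (two-way ((b 𝕐.== η ω) ∧ zrel ζ ω) (v ==ᴸ history (length v) ω) (m (length v) ω)) (cong ⟦_⟧ (∧-assoc (b 𝕐.== η ω) (zrel ζ ω) _)))))

  predictA : X → Ω → List Bool → ℚ
  predictA a ζ v = nodeA (true ∷ v) a ζ * inv (nodeA v a ζ)

  predictB : Y → Ω → List Bool → ℚ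
  predictB b ζ v = nodeB (true ∷ v) b ζ * inv (nodeB v b ζ)

  0≤predictA : ∀ a ζ v → 0ℚ ≤ predictA a ζ v
  0≤predictA a ζ v = 0≤* (0≤nodeA (true ∷ v) a ζ) (0≤inv (0≤nodeA v a ζ))

  0≤predictB : ∀ b ζ v → 0ℚ ≤ predictB b ζ v
  0≤predictB b ζ v = 0≤* (0≤nodeB (true ∷ v) b ζ) (0≤inv (0≤nodeB v b ζ))

  predictA≤1 : ∀ a ζ v → predictA a ζ v ≤ 1ℚ
  predictA≤1 a ζ v = ≤-trans (*≤ʳ (0≤inv (0≤nodeA v a ζ)) (≤≡ (≤-by+ˡ (0≤nodeA (false ∷ v) a ζ)) (nodeA-split v a ζ))) (*inv≤1 (0≤nodeA v a ζ))

  predictB≤1 : ∀ b ζ v → predictB b ζ v ≤ 1ℚ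
  predictB≤1 b ζ v = ≤-trans (*≤ʳ (0≤inv (0≤nodeB v b ζ)) (≤≡ (≤-by+ˡ (0≤nodeB (false ∷ v) b ζ)) (nodeB-split v b ζ))) (*inv≤1 (0≤nodeB v b ζ))

  private
   complement : ∀ {a b c} → 0ℚ < c → a + b ≡ c → 1ℚ - a * inv c ≡ b * inv c
   complement {a} {b} {c} hc e = trans (cong (λ z → z - a * inv c) (sym (*inv hc))) (trans (cong (λ z → z * inv c - a * inv c) (sym e))
    (solve 3 (λ a b j → (a :+ b) :* j :- a :* j := b :* j) refl a b (inv c)))

  weightA≡ : ∀ t {ω ζ} → zrel ω ζ ≡ true → 0ℚ < w ω → coin-weight (predictA (ξ ω) ζ (history t ω)) (m t ω) ≡ g i (suc t) ω * inv (g i t ω)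
  weightA≡ t {ω} {ζ} h w>0 with m t ω in eq | nodeA≡ (suc t) {ω} {ζ} h
  ... | true  | e = cong₂ (λ a b → a * inv b) e (nodeA≡ t {ω} {ζ} h)
  ... | false | e = trans (complement (subst (0ℚ <_) (sym (nodeA≡ t {ω} {ζ} h)) (Pointwise.g>0 ω w>0 i t)) (nodeA-split (history t ω) (ξ ω) ζ)) (cong₂ (λ a b → a * inv b) e (nodeA≡ t {ω} {ζ} h))

  weightB≡ : ∀ t {ω ζ} → zrel ω ζ ≡ true → 0ℚ < w ω → coin-weight (predictB (η ω) ζ (history t ω)) (m t ω) ≡ g (suc i) (suc t) ω * inv (g (suc i) t ω)
  weightB≡ t {ω} {ζ} h w>0 with m t ω in eq | nodeB≡ (suc t) {ω} {ζ} h
  ... | true  | e = cong₂ (λ a b → a * inv b) e (nodeB≡ t {ω} {ζ} h)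
  ... | false | e = trans (complement (subst (0ℚ <_) (sym (nodeB≡ t {ω} {ζ} h)) (Pointwise.g>0 ω w>0 (suc i) t)) (nodeB-split (history t ω) (η ω) ζ)) (cong₂ (λ a b → a * inv b) e (nodeB≡ t {ω} {ζ} h))

  marginX : X → ℚ
  marginX a = 𝔼 (λ ω → ⟦ a 𝕏.== ξ ω ⟧)

  marginY : Y → ℚ
  marginY b = 𝔼 (λ ω → ⟦ b 𝕐.== η ω ⟧)

  -- Points are sampled although only their classes under `zrel` matter; `share` spreads the
  -- probability of a class over its points.
  share : Ω → ℚ
  share ζ = w ζ * inv (mass zrel ζ)

  0≤share : ∀ ζ → 0ℚ ≤ share ζ
  0≤share ζ = 0≤* (w≥0 ζ) (0≤inv (0≤mass zrel ζ))

  posteriorA : X → Ω → ℚ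
  posteriorA a ζ = nodeA [] a ζ * inv (marginX a)

  posteriorB : Y → Ω → ℚ
  posteriorB b ζ = nodeB [] b ζ * inv (marginY b)

  0≤marginX : ∀ a → 0ℚ ≤ marginX a
  0≤marginX a = 𝔼-≥0 (λ ω → 0≤⟦⟧ (a 𝕏.== ξ ω))

  0≤marginY : ∀ b → 0ℚ ≤ marginY b
  0≤marginY b = 𝔼-≥0 (λ ω → 0≤⟦⟧ (b 𝕐.== η ω))

  0≤posteriorA : ∀ a ζ → 0ℚ ≤ posteriorA a ζ
  0≤posteriorA a ζ = 0≤* (0≤nodeA [] a ζ) (0≤inv (0≤marginX a))

  0≤posteriorB : ∀ b ζ → 0ℚ ≤ posteriorB b ζ
  0≤posteriorB b ζ = 0≤* (0≤nodeB [] b ζ) (0≤inv (0≤marginY b))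

  densityA : X → Ω → ℚ
  densityA a ζ = posteriorA a ζ * share ζ

  densityB : Y → Ω → ℚ
  densityB b ζ = posteriorB b ζ * share ζ

  share-total : ∀ ω → Sum Ωs (λ ζ → ⟦ zrel ω ζ ⟧ * share ζ) ≡ mass zrel ω * inv (mass zrel ω)
  share-total ω = trans (Sum-cong Ωs (λ ζ → trans (guard-cong (zrel ω ζ) (λ h → cong (λ z → w ζ * inv z) (sym (mass-class zrel-equiv h)))) (solve 3 (λ a b c → a :* (b :* c) := b :* a :* c) refl _ _ _))) (Sum-*ʳ (inv (mass zrel ω)) Ωs)

  share-total≤1 : ∀ ω → Sum Ωs (λ ζ → ⟦ zrel ω ζ ⟧ * share ζ) ≤ 1ℚ
  share-total≤1 ω = ≡≤ (share-total ω) (*inv≤1 (0≤mass zrel ω))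

  private
   density-total : ∀ (p : Ω → Bool) → Sum Ωs (λ ζ → 𝔼 (λ ω → ⟦ p ω ∧ zrel ζ ω ∧ true ⟧) * inv (𝔼 (λ ω → ⟦ p ω ⟧)) * share ζ) ≤ 1ℚ
   density-total p = ≡≤ eq (≤-trans (*≤ʳ (0≤inv (𝔼-≥0 (λ ω → 0≤⟦⟧ (p ω)))) (𝔼-mono (λ ω → ≤≡ (*≤ˡ (0≤⟦⟧ (p ω)) (share-total≤1 ω)) (*-identityʳ _)))) (*inv≤1 (𝔼-≥0 (λ ω → 0≤⟦⟧ (p ω)))))
    where
    M = inv (𝔼 (λ ω → ⟦ p ω ⟧))
    eq : Sum Ωs (λ ζ → 𝔼 (λ ω → ⟦ p ω ∧ zrel ζ ω ∧ true ⟧) * M * share ζ) ≡ 𝔼 (λ ω → ⟦ p ω ⟧ * Sum Ωs (λ ζ → ⟦ zrel ω ζ ⟧ * share ζ)) * M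
    eq = trans (Sum-cong Ωs (λ ζ → trans (solve 3 (λ a b c → a :* b :* c := c :* a :* b) refl _ M (share ζ)) (cong (_* M) (sym (𝔼-*ˡ (share ζ))))))
     (trans (Sum-*ʳ M Ωs) (cong (_* M) (trans (sym (𝔼-Sum Ωs)) (𝔼-cong (λ ω → trans (Sum-cong Ωs (λ ζ → trans (cong (share ζ *_) (trans (⟦∧⟧ (p ω) (zrel ζ ω ∧ true)) (cong (⟦ p ω ⟧ *_) (trans (⟦∧⟧ (zrel ζ ω) true) (trans (*-identityʳ _) (cong ⟦_⟧ (sy zrel-equiv ζ ω)))))))
      (solve 3 (λ s a b → s :* (a :* b) := a :* (b :* s)) refl (share ζ) ⟦ p ω ⟧ ⟦ zrel ω ζ ⟧))) (Sum-*ˡ ⟦ p ω ⟧ Ωs))))))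

  densityA-total : ∀ a → Sum Ωs (densityA a) ≤ 1ℚ
  densityA-total a = density-total (λ ω → a 𝕏.== ξ ω)

  densityB-total : ∀ b → Sum Ωs (densityB b) ≤ 1ℚ
  densityB-total b = density-total (λ ω → b 𝕐.== η ω)

  0≤densityA : ∀ a ζ → 0ℚ ≤ densityA a ζ
  0≤densityA a ζ = 0≤* (0≤posteriorA a ζ) (0≤share ζ)

  0≤densityB : ∀ b ζ → 0ℚ ≤ densityB b ζ
  0≤densityB b ζ = 0≤* (0≤posteriorB b ζ) (0≤share ζ)

  private
   args-A = cartesianProduct 𝕏.values Ωs
   args-B = cartesianProduct 𝕐.values Ωs
   probabilities : List ℚ
   probabilities = map (λ (a , ζ) → densityA a ζ) args-A ++ map (λ (b , ζ) → densityB b ζ) args-B ++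
    map (λ ((a , ζ) , v) → predictA a ζ v) (cartesianProduct args-A (listsBelow T)) ++
    map (λ ((b , ζ) , v) → predictB b ζ v) (cartesianProduct args-B (listsBelow T))

   ∈-A : ∀ a ζ → (a , ζ) ∈ args-A
   ∈-A a ζ = ∈-cartesianProduct⁺ (finite-∈ 𝕏 a) (Ωs-all ζ)

   ∈-B : ∀ b ζ → (b , ζ) ∈ args-B
   ∈-B b ζ = ∈-cartesianProduct⁺ (finite-∈ 𝕐 b) (Ωs-all ζ)

   ∈-map-≥0 : ∀ {A : Set} (f : A → ℚ) xs → (∀ a → 0ℚ ≤ f a) → ∀ {q} → q ∈ map f xs → 0ℚ ≤ q
   ∈-map-≥0 f xs h q∈ with ∈-map⁻ f q∈
   ... | a , _ , refl = h a

   open import Data.List.Membership.Propositional.Properties using (∈-++⁻)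

   probabilities≥0 : ∀ q → q ∈ probabilities → 0ℚ ≤ q
   probabilities≥0 q q∈ with ∈-++⁻ (map (λ (a , ζ) → densityA a ζ) args-A) q∈
   ... | inj₁ h = ∈-map-≥0 _ args-A (λ (a , ζ) → 0≤densityA a ζ) h
   ... | inj₂ h with ∈-++⁻ (map (λ (b , ζ) → densityB b ζ) args-B) h
   ... | inj₁ k = ∈-map-≥0 _ args-B (λ (b , ζ) → 0≤densityB b ζ) k
   ... | inj₂ k with ∈-++⁻ (map (λ ((a , ζ) , v) → predictA a ζ v) (cartesianProduct args-A (listsBelow T))) k
   ... | inj₁ l = ∈-map-≥0 _ (cartesianProduct args-A (listsBelow T)) (λ ((a , ζ) , v) → 0≤predictA a ζ v) l
   ... | inj₂ l = ∈-map-≥0 _ (cartesianProduct args-B (listsBelow T)) (λ ((b , ζ) , v) → 0≤predictB b ζ v) l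

  N : ℕ
  N = suc (proj₁ (common-denominator probabilities probabilities≥0))

  private
   integral : ∀ q → q ∈ probabilities → Integral N q
   integral = proj₂ (common-denominator probabilities probabilities≥0)

  N≡ : nat (length (downFrom N)) ≡ nat N
  N≡ = cong nat (length-downFrom N)

  N>0 : 0ℚ < nat (length (downFrom N))
  N>0 = subst (0ℚ <_) (sym N≡) (0<nat _)

  open Thresholds N N>0 N≡

  fraction-numer : ∀ {q} → 0ℚ ≤ q → q ≤ 1ℚ → q ∈ probabilities → fraction (numer N q) ≡ q
  fraction-numer {q} h k q∈ = trans (cong (_* inv (nat N)) (numer≡ (0<nat _) k (integral q q∈))) (*inv-cancel (0<nat _))

  αA : X → Ω → ℕ
  αA a ζ = numer N (densityA a ζ)

  αB : Y → Ω → ℕ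
  αB b ζ = numer N (densityB b ζ)

  fraction-αA : ∀ a ζ → fraction (αA a ζ) ≡ densityA a ζ
  fraction-αA a ζ = fraction-numer (0≤densityA a ζ) (≤-trans (Sum-∈ Ωs (0≤densityA a) (Ωs-all ζ)) (densityA-total a)) (∈-++⁺ˡ (∈-map⁺ _ (∈-A a ζ)))

  fraction-αB : ∀ b ζ → fraction (αB b ζ) ≡ densityB b ζ
  fraction-αB b ζ = fraction-numer (0≤densityB b ζ) (≤-trans (Sum-∈ Ωs (0≤densityB b) (Ωs-all ζ)) (densityB-total b))
   (∈-++⁺ʳ (map (λ (a , ζ) → densityA a ζ) args-A) (∈-++⁺ˡ (∈-map⁺ _ (∈-B b ζ))))

  kA : X → Ω → List Bool → ℕ
  kA a ζ v = numer N (predictA a ζ v)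

  kB : Y → Ω → List Bool → ℕ
  kB b ζ v = numer N (predictB b ζ v)

  fraction-kA : ∀ a ζ v → length v ℕ.< T → fraction (kA a ζ v) ≡ predictA a ζ v
  fraction-kA a ζ v h = fraction-numer (0≤predictA a ζ v) (predictA≤1 a ζ v)
   (∈-++⁺ʳ (map (λ (a , ζ) → densityA a ζ) args-A) (∈-++⁺ʳ (map (λ (b , ζ) → densityB b ζ) args-B)
    (∈-++⁺ˡ (∈-map⁺ _ (∈-cartesianProduct⁺ (∈-A a ζ) (listsBelow-all v h))))))

  fraction-kB : ∀ b ζ v → length v ℕ.< T → fraction (kB b ζ v) ≡ predictB b ζ v
  fraction-kB b ζ v h = fraction-numer (0≤predictB b ζ v) (predictB≤1 b ζ v)
   (∈-++⁺ʳ (map (λ (a , ζ) → densityA a ζ) args-A) (∈-++⁺ʳ (map (λ (b , ζ) → densityB b ζ) args-B)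
    (∈-++⁺ʳ (map (λ ((a , ζ) , v) → predictA a ζ v) (cartesianProduct args-A (listsBelow T))) (∈-map⁺ _ (∈-cartesianProduct⁺ (∈-B b ζ) (listsBelow-all v h))))))

  oA : X → Ω → List Bool → Bool
  oA a ζ v = findBit (λ ω → (a 𝕏.== ξ ω) ∧ zrel ζ ω ∧ (v ==ᴸ history (length v) ω)) guessA Ωs

  oB : Y → Ω → List Bool → Bool
  oB b ζ v = findBit (λ ω → (b 𝕐.== η ω) ∧ zrel ζ ω ∧ (v ==ᴸ history (length v) ω)) guessB Ωs

  oA≡ : ∀ {ω ζ} → zrel ω ζ ≡ true → oA (ξ ω) ζ (history T ω) ≡ guessA ω
  oA≡ {ω} {ζ} h = findBit≡ _ guessA Ωs (Ωs-all ω) (trans (bitsA T {ω} {ζ} ω h) (re (G-equiv i T) ω))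
   (λ ω' e → sym (guessA-inv (trans (sym (bitsA T {ω} {ζ} ω' h)) e)))

  oB≡ : ∀ {ω ζ} → zrel ω ζ ≡ true → oB (η ω) ζ (history T ω) ≡ guessB ω
  oB≡ {ω} {ζ} h = findBit≡ _ guessB Ωs (Ωs-all ω) (trans (bitsB T {ω} {ζ} ω h) (re (G-equiv (suc i) T) ω))
   (λ ω' e → sym (guessB-inv (trans (sym (bitsB T {ω} {ζ} ω' h)) e)))

  pathFrom : ℕ → ∀ d → Ω → Vec Bool d
  pathFrom t zero    ω = []
  pathFrom t (suc d) ω = m t ω ∷ pathFrom (suc t) d ω

  leaf-history : ∀ t d ω → leaf (history t ω) (pathFrom t d ω) ≡ history (d ℕ.+ t) ω
  leaf-history t zero    ω = refl
  leaf-history t (suc d) ω = trans (leaf-history (suc t) d ω) (cong (λ s → history s ω) (ℕ.+-suc d t))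

  leaf-history₀ : ∀ d ω → leaf [] (pathFrom 0 d ω) ≡ history d ω
  leaf-history₀ d ω = trans (leaf-history 0 d ω) (cong (λ s → history s ω) (ℕ.+-identityʳ d))

  module Tuples (t : ℕ) where

   private
    Sum4 : (X → Y → Ω → Vec Bool t → ℚ) → ℚ
    Sum4 F = Sum 𝕏.values (λ a → Sum 𝕐.values (λ b → Sum Ωs (λ ζ → Sum (allVecs t) (F a b ζ))))

    Sum4-mono : ∀ {F F' : X → Y → Ω → Vec Bool t → ℚ} → (∀ a b ζ p → F a b ζ p ≤ F' a b ζ p) → Sum4 F ≤ Sum4 F'
    Sum4-mono h = Sum-mono 𝕏.values λ a → Sum-mono 𝕐.values λ b → Sum-mono Ωs λ ζ → Sum-mono (allVecs t) (h a b ζ)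

    Sum4-𝔼 : ∀ (F : X → Y → Ω → Vec Bool t → Ω → ℚ) → 𝔼 (λ ω → Sum4 (λ a b ζ p → F a b ζ p ω)) ≡ Sum4 (λ a b ζ p → 𝔼 (F a b ζ p))
    Sum4-𝔼 F = trans (𝔼-Sum 𝕏.values) (Sum-cong 𝕏.values λ a → trans (𝔼-Sum 𝕐.values) (Sum-cong 𝕐.values λ b → trans (𝔼-Sum Ωs) (Sum-cong Ωs λ ζ → 𝔼-Sum (allVecs t))))

    match : X → Y → Ω → Vec Bool t → Ω → Bool
    match a b ζ p ω = (a 𝕏.== ξ ω) ∧ (b 𝕐.== η ω) ∧ zrel ζ ω ∧ (leaf [] p ==ᴸ history t ω)

    match-parts : ∀ a b ζ p ω → match a b ζ p ω ≡ true →
     (a 𝕏.== ξ ω) ≡ true × (b 𝕐.== η ω) ≡ true × zrel ζ ω ≡ true × (leaf [] p ==ᴸ history t ω) ≡ true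
    match-parts a b ζ p ω h with ∧-split (a 𝕏.== ξ ω) h
    ... | h₁ , h₂ with ∧-split (b 𝕐.== η ω) h₂
    ... | h₃ , h₄ with ∧-split (zrel ζ ω) h₄
    ... | h₅ , h₆ = h₁ , h₃ , h₅ , h₆

    shuffle : ∀ e f s q h → e ∧ f ∧ (s ∧ q) ∧ h ≡ (s ∧ e) ∧ (q ∧ f) ∧ h
    shuffle true  true  true  true  h = refl
    shuffle true  true  true  false h = refl
    shuffle true  true  false q     h = refl
    shuffle true  false true  true  h = refl
    shuffle true  false true  false h = refl
    shuffle true  false false q     h = refl
    shuffle false f     true  q     h = refl
    shuffle false f     false q     h = refl

    match-class : ∀ a b ζ p ω → match a b ζ p ω ≡ true → ∀ ω' → K i t ω ω' ≡ match a b ζ p ω'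
    match-class a b ζ p ω h ω' with match-parts a b ζ p ω h
    ... | h₁ , h₂ , h₃ , h₄ = trans (cong₂ (λ u v → u ∧ v ∧ hist t ω ω') (suffix-suc i ω ω') (prefix-suc i ω ω'))
     (trans (sym (shuffle (ξ ω 𝕏.== ξ ω') (η ω 𝕐.== η ω') (suffix (suc i) ω ω') (prefix i ω ω') (hist t ω ω')))
      (cong₂ _∧_ (sym (tr 𝕏.==-equiv (ξ ω') h₁)) (cong₂ _∧_ (sym (tr 𝕐.==-equiv (η ω') h₂)) (cong₂ _∧_ (sym (tr zrel-equiv ω' h₃)) (sym (tr ==ᴸ-equiv {leaf [] p} {history t ω} (history t ω') h₄))))))

    once≤1 : ∀ a b ζ p → 𝔼 (λ ω → ⟦ match a b ζ p ω ⟧ * inv (k i t ω)) ≤ 1ℚ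
    once≤1 a b ζ p = ≡≤ (trans (𝔼-cong (λ ω → trans (guard-cong (match a b ζ p ω) (λ h → cong inv (𝔼-cong (λ ω' → cong ⟦_⟧ (match-class a b ζ p ω h ω'))))) (*-comm _ (inv D)))) (trans (𝔼-*ˡ (inv D)) (*-comm _ D)))
     (*inv≤1 (𝔼-≥0 (λ ω → 0≤⟦⟧ (match a b ζ p ω))))
     where D = 𝔼 (λ ω → ⟦ match a b ζ p ω ⟧)

   -- Distinct tuples (a , b , class of ζ , p) are disjoint events, of probability k i t.
   sum-over-tuples : ∀ (H : X → Y → Ω → Vec Bool t → ℚ) (B : Ω → ℚ) → (∀ a b ζ p → 0ℚ ≤ H a b ζ p) →
    (∀ ω → 0ℚ < w ω → ∀ ζ → zrel ω ζ ≡ true → B ω ≤ H (ξ ω) (η ω) ζ (pathFrom 0 t ω)) →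
    𝔼 (λ ω → inv (k i t ω) * B ω) ≤
    Sum 𝕏.values (λ a → Sum 𝕐.values (λ b → Sum Ωs (λ ζ → Sum (allVecs t) (λ p → H a b ζ p * share ζ))))
   sum-over-tuples H B H≥0 hB = begin
    𝔼 (λ ω → inv (k i t ω) * B ω)
     ≤⟨ Sum-mono Ωs point≤ ⟩
    𝔼 (λ ω → Sum4 (λ a b ζ p → H a b ζ p * share ζ * (⟦ match a b ζ p ω ⟧ * inv (k i t ω))))
     ≡⟨ Sum4-𝔼 (λ a b ζ p ω → H a b ζ p * share ζ * (⟦ match a b ζ p ω ⟧ * inv (k i t ω))) ⟩
    Sum4 (λ a b ζ p → 𝔼 (λ ω → H a b ζ p * share ζ * (⟦ match a b ζ p ω ⟧ * inv (k i t ω))))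
     ≤⟨ Sum4-mono (λ a b ζ p → ≡≤ (𝔼-*ˡ (H a b ζ p * share ζ)) (≤≡ (*≤ˡ (Hs≥0 a b ζ p) (once≤1 a b ζ p)) (*-identityʳ _))) ⟩
    Sum4 (λ a b ζ p → H a b ζ p * share ζ) ∎
    where
    open ≤-Reasoning
    Hs≥0 : ∀ a b ζ p → 0ℚ ≤ H a b ζ p * share ζ
    Hs≥0 a b ζ p = 0≤* (H≥0 a b ζ p) (0≤share ζ)
    term≥0 : ∀ ω a b ζ p → 0ℚ ≤ H a b ζ p * share ζ * (⟦ match a b ζ p ω ⟧ * inv (k i t ω))
    term≥0 ω a b ζ p = 0≤* (Hs≥0 a b ζ p) (0≤* (0≤⟦⟧ (match a b ζ p ω)) (0≤inv (0≤k i t ω)))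
    single : ∀ ω → 0ℚ < w ω → inv (k i t ω) * B ω ≤ Sum4 (λ a b ζ p → H a b ζ p * share ζ * (⟦ match a b ζ p ω ⟧ * inv (k i t ω)))
    single ω w>0 = begin
     inv (k i t ω) * B ω
      ≡⟨ trans (cong (inv (k i t ω) * B ω *_) (trans (share-total ω) (*inv (Pointwise.mass>0 ω w>0 zrel-equiv)))) (*-identityʳ _) ⟨
     inv (k i t ω) * B ω * Sum Ωs (λ ζ → ⟦ zrel ω ζ ⟧ * share ζ)
      ≡⟨ Sum-*ˡ _ Ωs ⟨
     Sum Ωs (λ ζ → inv (k i t ω) * B ω * (⟦ zrel ω ζ ⟧ * share ζ))
      ≤⟨ Sum-mono Ωs (λ ζ → ≤-trans (term ζ) (Sum-∈ (allVecs t) (term≥0 ω (ξ ω) (η ω) ζ) (allVecs-all (pathFrom 0 t ω)))) ⟩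
     Sum Ωs (λ ζ → Sum (allVecs t) (λ p → H (ξ ω) (η ω) ζ p * share ζ * (⟦ match (ξ ω) (η ω) ζ p ω ⟧ * inv (k i t ω))))
      ≤⟨ Sum-∈ 𝕐.values (λ b → Sum-≥0 Ωs (λ ζ → Sum-≥0 (allVecs t) (term≥0 ω (ξ ω) b ζ))) (finite-∈ 𝕐 (η ω)) ⟩
     Sum 𝕐.values (λ b → Sum Ωs (λ ζ → Sum (allVecs t) (λ p → H (ξ ω) b ζ p * share ζ * (⟦ match (ξ ω) b ζ p ω ⟧ * inv (k i t ω)))))
      ≤⟨ Sum-∈ 𝕏.values (λ a → Sum-≥0 𝕐.values (λ b → Sum-≥0 Ωs (λ ζ → Sum-≥0 (allVecs t) (term≥0 ω a b ζ)))) (finite-∈ 𝕏 (ξ ω)) ⟩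
     Sum4 (λ a b ζ p → H a b ζ p * share ζ * (⟦ match a b ζ p ω ⟧ * inv (k i t ω))) ∎
     where
     term : ∀ ζ → inv (k i t ω) * B ω * (⟦ zrel ω ζ ⟧ * share ζ) ≤ H (ξ ω) (η ω) ζ (pathFrom 0 t ω) * share ζ * (⟦ match (ξ ω) (η ω) ζ (pathFrom 0 t ω) ω ⟧ * inv (k i t ω))
     term ζ = ≡≤ (solve 4 (λ j b z s → j :* b :* (z :* s) := z :* (b :* s :* j)) refl (inv (k i t ω)) (B ω) ⟦ zrel ω ζ ⟧ (share ζ))
      (≤≡ (guard-mono (zrel ω ζ) (λ h → *≤ʳ (0≤inv (0≤k i t ω)) (*≤ʳ (0≤share ζ) (hB ω w>0 ζ h))))
      (trans (solve 4 (λ j b z s → z :* (b :* s :* j) := b :* s :* (z :* j)) refl (inv (k i t ω)) (H (ξ ω) (η ω) ζ (pathFrom 0 t ω)) ⟦ zrel ω ζ ⟧ (share ζ)) (cong (λ z → H (ξ ω) (η ω) ζ (pathFrom 0 t ω) * share ζ * (⟦ z ⟧ * inv (k i t ω))) matched)))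
      where
      matched : zrel ω ζ ≡ match (ξ ω) (η ω) ζ (pathFrom 0 t ω) ω
      matched = sym (trans (cong₂ _∧_ (re 𝕏.==-equiv (ξ ω)) (cong₂ _∧_ (re 𝕐.==-equiv (η ω)) (cong₂ _∧_ (sy zrel-equiv ζ ω) (trans (cong (_==ᴸ history t ω) (leaf-history₀ t ω)) (re ==ᴸ-equiv (history t ω)))))) (∧-identityʳ (zrel ω ζ)))
       where open import Data.Bool.Properties using (∧-identityʳ)
    point≤ : ∀ ω → w ω * (inv (k i t ω) * B ω) ≤ w ω * Sum4 (λ a b ζ p → H a b ζ p * share ζ * (⟦ match a b ζ p ω ⟧ * inv (k i t ω)))
    point≤ ω with ≡0⊎0< (w≥0 ω)
    ... | inj₂ p = *≤ˡ (w≥0 ω) (single ω p)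
    ... | inj₁ e = ≤-reflexive (trans (cong (_* (inv (k i t ω) * B ω)) e) (trans (zeroˡ _) (sym (trans (cong (_* Sum4 (λ a b ζ p → H a b ζ p * share ζ * (⟦ match a b ζ p ω ⟧ * inv (k i t ω)))) e) (zeroˡ _)))))

  open Protocols target

  default-nonempty : NonEmpty Ωs
  default-nonempty = nonempty Ωs (Ωs-all default)
   where
   nonempty : ∀ (xs : List Ω) → default ∈ xs → NonEmpty xs
   nonempty (x ∷ xs) h = 0<nat (length xs)

  open Correlated target N N>0 N≡ Ωs default-nonempty default αA αB (λ a ζ → numer≤ N (densityA a ζ)) (λ b ζ → numer≤ N (densityB b ζ))

  simulate : (X → Ω) → (Y → Ω) → Prog X Y
  simulate zA zB = Rounds.sim target N N>0 N≡ owner L S (λ a → kA a (zA a)) (λ b → kB b (zB b))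
   (λ a v → numer≤ N (predictA a (zA a) v)) (λ b v → numer≤ N (predictB b (zB b) v)) (λ a → oA a (zA a)) (λ b → oB b (zB b)) R T (λ _ → []) (λ _ → [])

  protocol : Prog X Y
  protocol = correlated J simulate

  cost-protocol : Cost protocol (R ℕ.* (S ℕ.* 18) ℕ.+ 2)
  cost-protocol = cost-draw J _ (λ s → let zA = λ a → pick (αA a) s ; zB = λ b → pick (αB b) s in
    Rounds.cost-sim target N N>0 N≡ owner L S (λ a → kA a (zA a)) (λ b → kB b (zB b))
     (λ a v → numer≤ N (predictA a (zA a) v)) (λ b v → numer≤ N (predictB b (zB b) v)) (λ a → oA a (zA a)) (λ b → oB b (zB b)) R T (λ _ → []) (λ _ → []))

  module C (a : X) (b : Y) (ζ : Ω) = Chain N N>0 N≡ owner (target a b) (kA a ζ) (kB b ζ) (λ v → numer≤ N (predictA a ζ v)) (λ v → numer≤ N (predictB b ζ v)) (oA a ζ) (oB b ζ)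

  ε : ℚ
  ε = (1ℚ - ½' ^ 3) ^ S * two ^ L

  0≤ε : 0ℚ ≤ ε
  0≤ε = 0≤* (^-nonneg (0≤- (^≤1 0≤½' (≤-by ½' 0≤½' ½+½) 3)) S) (^-nonneg (<⇒≤ 0<two) L)

  LBζ : X → Y → Ω → ℚ
  LBζ a b ζ = C.LB a b ζ R T []

  simulate-correct : ∀ a b zA zB ζ → zA a ≡ ζ → zB b ≡ ζ → LBζ a b ζ - nat R * ε ≤ val (simulate zA zB) a b
  simulate-correct a b zA zB ζ e₁ e₂ = subst₂ (λ ζ₁ ζ₂ → Chain.LB N N>0 N≡ owner (target a b) (kA a ζ₁) (kB b ζ₂) (λ v → numer≤ N (predictA a ζ₁ v)) (λ v → numer≤ N (predictB b ζ₂ v)) (oA a ζ₁) (oB b ζ₂) R T [] - nat R * ε ≤ val (simulate zA zB) a b) e₁ e₂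
   (Rounds.sim-correct target N N>0 N≡ owner L S (λ a → kA a (zA a)) (λ b → kB b (zB b))
    (λ a v → numer≤ N (predictA a (zA a) v)) (λ b v → numer≤ N (predictB b (zB b) v)) (λ a → oA a (zA a)) (λ b → oB b (zB b)) a b R T (λ _ → []) (λ _ → []) refl T<2^L)

  common : X → Y → Ω → ℚ
  common a b ζ = keep (densityA a ζ) (densityB b ζ)

  common-total : ∀ a b → Sum Ωs (common a b) ≤ 1ℚ
  common-total a b = ≤-trans (Sum-mono Ωs (λ ζ → keep≤ˡ (densityA a ζ) (densityB b ζ))) (densityA-total a)

  slack : ℚ
  slack = nat R * ε + decay ^ J

  -- Correlated sampling, with the success of the simulation after subtracting the search errors as
  -- its F. Since the common density has total at most 1, these errors are charged at most once.
  protocol-correct : ∀ a b → Sum Ωs (λ ζ → common a b ζ * LBζ a b ζ) + Sum Ωs (common a b) - 1ℚ - slack ≤ val protocol a b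
  protocol-correct a b = ≤-trans step (correlated-sampling a b F F≤1
     (≡≤ (Sum-cong Ωs (fraction-αA a)) (densityA-total a)) (≡≤ (Sum-cong Ωs (fraction-αB b)) (densityB-total b)) J simulate
     (λ zA zB ζ e₁ e₂ → simulate-correct a b zA zB ζ e₁ e₂))
   where
   F : Ω → ℚ
   F ζ = LBζ a b ζ - nat R * ε
   F≤1 : ∀ ζ → F ζ ≤ 1ℚ
   F≤1 ζ = ≤-trans (simulate-correct a b (λ _ → ζ) (λ _ → ζ) ζ refl refl) (val≤1 (simulate (λ _ → ζ) (λ _ → ζ)) a b)
   Rε≥0 : 0ℚ ≤ nat R * ε
   Rε≥0 = 0≤* (0≤nat R) 0≤ε
   keep≡ : ∀ ζ → keep (fraction (αA a ζ)) (fraction (αB b ζ)) ≡ common a b ζ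
   keep≡ ζ = cong₂ keep (fraction-αA a ζ) (fraction-αB b ζ)
   M = Sum Ωs (common a b)
   Q = Sum Ωs (λ ζ → common a b ζ * LBζ a b ζ)
   step : Q + M - 1ℚ - slack ≤ Sum Ωs (λ ζ → keep (fraction (αA a ζ)) (fraction (αB b ζ)) * F ζ) + Sum Ωs (λ ζ → keep (fraction (αA a ζ)) (fraction (αB b ζ))) - 1ℚ - decay ^ J
   step = ≤≡ (≤-by ((1ℚ - M) * (nat R * ε)) (0≤* (0≤- (common-total a b)) Rε≥0)
      (solve 5 (λ Q M o r d → Q :+ M :- :1 :- (r :+ d) :+ (:1 :- M) :* r := (Q :- M :* r) :+ M :- :1 :- d) refl Q M 1ℚ (nat R * ε) (decay ^ J)))
    (cong₂ (λ u v → u + v - 1ℚ - decay ^ J)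
     (trans (cong (λ z → Q - z) (sym (Sum-*ʳ (nat R * ε) Ωs))) (trans (sym (Sum-- Ωs)) (Sum-cong Ωs (λ ζ → trans (solve 3 (λ o l r → o :* l :- o :* r := o :* (l :- r)) refl (common a b ζ) (LBζ a b ζ) (nat R * ε)) (cong (_* F ζ) (sym (keep≡ ζ)))))))
     (Sum-cong Ωs (λ ζ → sym (keep≡ ζ))))

  keep-scale : ∀ {s} → 0ℚ ≤ s → ∀ a b → keep (a * s) (b * s) ≡ keep a b * s
  keep-scale {s} hs a b with ≤-total a b
  ... | inj₁ h = trans (keep-≤ (*≤ʳ hs h)) (cong (_* s) (sym (keep-≤ h)))
  ... | inj₂ h = trans (keep-≥ (*≤ʳ hs h)) (cong (_* s) (sym (keep-≥ h)))

  𝔼-mono-if : ∀ {f g} → (∀ ω → 0ℚ < w ω → f ω ≤ g ω) → 𝔼 f ≤ 𝔼 g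
  𝔼-mono-if {f} {g} h = -≥0 (subst (0ℚ ≤_) 𝔼-- (𝔼-nonneg-if (λ ω → g ω - f ω) (λ ω p → 0≤- (h ω p))))

  Post : X → Y → Ω → ℚ
  Post a b ζ = keep (posteriorA a ζ) (posteriorB b ζ)

  0≤Post : ∀ a b ζ → 0ℚ ≤ Post a b ζ
  0≤Post a b ζ = 0≤keep (0≤posteriorA a ζ) (0≤posteriorB b ζ)

  common≡ : ∀ a b ζ → common a b ζ ≡ Post a b ζ * share ζ
  common≡ a b ζ = keep-scale (0≤share ζ) (posteriorA a ζ) (posteriorB b ζ)

  agree : Ω → ℚ
  agree ω = μ (ξ ω) (η ω) * keep (g i 0 ω * inv (PX i ω)) (g (suc i) 0 ω * inv (PY i ω))

  Post≡ : ∀ {ω ζ} → zrel ω ζ ≡ true → μ (ξ ω) (η ω) * Post (ξ ω) (η ω) ζ ≡ agree ω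
  Post≡ {ω} {ζ} h = cong (μ (ξ ω) (η ω) *_) (cong₂ keep (cong (_* inv (PX i ω)) (nodeA≡ 0 {ω} {ζ} h)) (cong (_* inv (PY i ω)) (nodeB≡ 0 {ω} {ζ} h)))

  lossZ lossPath : Ω → ℚ
  lossZ ω = (pos (1ℚ - vX i ω) + pos (1ℚ - sX i ω)) + (pos (1ℚ - vY i ω) + pos (1ℚ - sY i ω))
  lossPath ω = pos (1ℚ - path-ratio i ω)

  0≤lossZ : ∀ ω → 0ℚ ≤ lossZ ω
  0≤lossZ ω = 0≤+ (0≤+ (0≤pos _) (0≤pos _)) (0≤+ (0≤pos _) (0≤pos _))

  bits : Ω → ℚ
  bits ω = ⟦ not ((guessA ω xor guessB ω) xor target (ξ ω) (η ω)) ⟧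

  divergence : ℕ → Ω → ℚ
  divergence t ω = pos (1ℚ - oth-ratio i t ω) + pos (own-ratio i t ω - 1ℚ) * inv (own-ratio i t ω)

  divergences : Ω → ℚ
  divergences ω = Sum (downFrom T) (λ t → divergence t ω)

  -- By `few-marks` a lower bound for `ψ` along the true path of ω.
  good : Ω → ℚ
  good ω = pos (bits ω - divergences ω * inv (nat R))

  module At (ω : Ω) (w>0 : 0ℚ < w ω) where

   open Pointwise ω w>0

   -- Let z be the shared x_{>i}, y_{<i}. The product of `vX` and `sX` is μ(x_i, y_i) P(z | x_i) /
   -- P(x_i, y_i, z), because the marginal of μ cancels; similarly for Y. The minimum of the two is
   -- what correlated sampling achieves.
   agree-ratio : inv (k i 0 ω) * agree ω ≡ keep (vX i ω * sX i ω) (vY i ω * sY i ω)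
   agree-ratio = trans (solve 3 (λ j m q → j :* (m :* q) := q :* (m :* j)) refl (inv (k i 0 ω)) (μ (ξ ω) (η ω)) _)
    (trans (sym (keep-scale (0≤* (μ≥0 (ξ ω) (η ω)) (<⇒≤ (0<inv (k>0 i 0)))) _ _))
     (cong₂ keep (sym (eq (μX>0 i∈))) (sym (eq' (μY>0 i∈)))))
    where
    open ≡-Reasoning
    eq : 0ℚ < μX (ξ ω) → vX i ω * sX i ω ≡ (g i 0 ω * inv (PX i ω)) * (μ (ξ ω) (η ω) * inv (k i 0 ω))
    eq h = trans (solve 7 (λ m q G κ M o p → (m :* q) :* (G :* κ) :* (M :* (o :* p)) := (M :* q) :* o :* ((G :* p) :* (m :* κ))) refl (μ (ξ ω) (η ω)) (inv (μX (ξ ω))) (g i 0 ω) (inv (k i 0 ω)) (μX (ξ ω)) (mass always ω) (inv (PX i ω)))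
     (trans (cong₂ (λ u v → u * v * ((g i 0 ω * inv (PX i ω)) * (μ (ξ ω) (η ω) * inv (k i 0 ω)))) (*inv h) always≡1) (solve 1 (λ z → :1 :* :1 :* z := z) refl _))
    eq' : 0ℚ < μY (η ω) → vY i ω * sY i ω ≡ (g (suc i) 0 ω * inv (PY i ω)) * (μ (ξ ω) (η ω) * inv (k i 0 ω))
    eq' h = trans (solve 7 (λ m q G κ M o p → (m :* q) :* (G :* κ) :* (M :* (o :* p)) := (M :* q) :* o :* ((G :* p) :* (m :* κ))) refl (μ (ξ ω) (η ω)) (inv (μY (η ω))) (g (suc i) 0 ω) (inv (k i 0 ω)) (μY (η ω)) (mass always ω) (inv (PY i ω)))
     (trans (cong₂ (λ u v → u * v * ((g (suc i) 0 ω * inv (PY i ω)) * (μ (ξ ω) (η ω) * inv (k i 0 ω)))) (*inv h) always≡1) (solve 1 (λ z → :1 :* :1 :* z := z) refl _))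

   private
    vX≥0 : 0ℚ ≤ vX i ω
    vX≥0 = <⇒≤ (0<* (0<* (μ>0 i∈) (0<inv (μX>0 i∈))) (0<* (g>0 i 0) (0<inv (k>0 i 0))))
    vY≥0 : 0ℚ ≤ vY i ω
    vY≥0 = <⇒≤ (0<* (0<* (μ>0 i∈) (0<inv (μY>0 i∈))) (0<* (g>0 (suc i) 0) (0<inv (k>0 i 0))))
    sX≥0 : 0ℚ ≤ sX i ω
    sX≥0 = <⇒≤ (0<* (μX>0 i∈) (0<* 1>0 (0<inv (PX>0 i))))
    sY≥0 : 0ℚ ≤ sY i ω
    sY≥0 = <⇒≤ (0<* (μY>0 i∈) (0<* 1>0 (0<inv (PY>0 i))))

   agree-bound : 1ℚ - lossZ ω ≤ inv (k i 0 ω) * agree ω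
   agree-bound = ≤≡ (either (≤-total (vX i ω * sX i ω) (vY i ω * sY i ω))) (sym agree-ratio)
    where
    lX = pos (1ℚ - vX i ω) + pos (1ℚ - sX i ω)
    lY = pos (1ℚ - vY i ω) + pos (1ℚ - sY i ω)
    either : (vX i ω * sX i ω ≤ vY i ω * sY i ω) ⊎ (vY i ω * sY i ω ≤ vX i ω * sX i ω) → 1ℚ - lossZ ω ≤ keep (vX i ω * sX i ω) (vY i ω * sY i ω)
    either (inj₁ h) = ≤-trans (-≤ ≤-refl (≤-by+ˡ {lY} {lX} (0≤+ (0≤pos _) (0≤pos _)))) (≤≡ (one-minus vX≥0 sX≥0) (sym (keep-≤ h)))
    either (inj₂ h) = ≤-trans (-≤ ≤-refl (≤-by+ʳ {lX} {lY} (0≤+ (0≤pos _) (0≤pos _)))) (≤≡ (one-minus vY≥0 sY≥0) (sym (keep-≥ h)))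

   step : ℕ → ℚ
   step t = k i (suc t) ω * inv (k i t ω)

   step>0 : ∀ t → 0ℚ < step t
   step>0 t = 0<* (k>0 i (suc t)) (0<inv (k>0 i t))

   unstep : ∀ z t → z * (k i t ω * inv (k i (suc t) ω)) * step t ≡ z
   unstep z t = trans (solve 5 (λ z a b c d → z :* (a :* b) :* (c :* d) := z :* ((a :* d) :* (c :* b))) refl z (k i t ω) (inv (k i (suc t) ω)) (k i (suc t) ω) (inv (k i t ω)))
    (trans (cong (z *_) (trans (cong₂ _*_ (*inv (k>0 i t)) (*inv (k>0 i (suc t)))) (*-identityˡ 1ℚ))) (*-identityʳ z))

   module Class (ζ : Ω) (h : zrel ω ζ ≡ true) where

    private
     module D = C (ξ ω) (η ω) ζ

    pA≡ : ∀ t → t ℕ.< T → coin-weight (D.pA (history t ω)) (m t ω) ≡ r₁ i t ω * step t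
    pA≡ t t<T = trans (cong (λ z → coin-weight z (m t ω)) (fraction-kA (ξ ω) ζ (history t ω) (subst (ℕ._< T) (sym (length-history t ω)) t<T)))
     (trans (weightA≡ t {ω} {ζ} h w>0) (sym (unstep _ t)))

    pB≡ : ∀ t → t ℕ.< T → coin-weight (D.pB (history t ω)) (m t ω) ≡ r₂ i t ω * step t
    pB≡ t t<T = trans (cong (λ z → coin-weight z (m t ω)) (fraction-kB (η ω) ζ (history t ω) (subst (ℕ._< T) (sym (length-history t ω)) t<T)))
     (trans (weightB≡ t {ω} {ζ} h w>0) (sym (unstep _ t)))

    own≡ : ∀ t → t ℕ.< T → D.own (history t ω) (m t ω) ≡ own-ratio i t ω * step t
    own≡ t t<T with owner (history t ω)
    ... | true  = pA≡ t t<T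
    ... | false = pB≡ t t<T

    oth≡ : ∀ t → t ℕ.< T → D.oth (history t ω) (m t ω) ≡ oth-ratio i t ω * step t
    oth≡ t t<T with owner (history t ω)
    ... | true  = pB≡ t t<T
    ... | false = pA≡ t t<T

    oth>0 : ∀ t → 0ℚ < oth-ratio i t ω
    oth>0 t with owner (history t ω)
    ... | true  = r₂>0 i t
    ... | false = r₁>0 i t

    weights : ∀ d t → d ℕ.+ t ℕ.≤ T → D.path-weight (history t ω) (pathFrom t d ω) * Prod (downFrom t) (λ s → own-ratio i s ω * step s) ≡ Prod (downFrom (d ℕ.+ t)) (λ s → own-ratio i s ω * step s)
    weights zero    t le = *-identityˡ _
    weights (suc d) t le = trans (cong (λ z → z * D.path-weight (history (suc t) ω) (pathFrom (suc t) d ω) * Prod (downFrom t) f) (own≡ t (ℕ.≤-trans (s≤s (ℕ.m≤n+m t d)) le)))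
     (trans (solve 3 (λ a b c → a :* b :* c := b :* (a :* c)) refl (f t) _ _) (trans (weights d (suc t) (subst (ℕ._≤ T) (sym (ℕ.+-suc d t)) le)) (cong (λ s → Prod (downFrom s) f) (ℕ.+-suc d t))))
     where
     f : ℕ → ℚ
     f s = own-ratio i s ω * step s

    mark-sum : ∀ d t → d ℕ.+ t ℕ.≤ T → D.marks (history t ω) (pathFrom t d ω) + Sum (downFrom t) (λ s → divergence s ω) ≤ Sum (downFrom (d ℕ.+ t)) (λ s → divergence s ω)
    mark-sum zero    t le = ≤-reflexive (+-identityˡ _)
    mark-sum (suc d) t le = ≤-trans (+≤ʳ (Sum (downFrom t) (λ s → divergence s ω)) (+≤ʳ (D.marks (history (suc t) ω) (pathFrom (suc t) d ω)) one))
     (≡≤ (solve 3 (λ a b c → a :+ b :+ c := b :+ (a :+ c)) refl (divergence t ω) _ _) (≤≡ (mark-sum d (suc t) (subst (ℕ._≤ T) (sym (ℕ.+-suc d t)) le)) (cong (λ s → Sum (downFrom s) (λ s → divergence s ω)) (ℕ.+-suc d t))))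
     where
     t<T : t ℕ.< T
     t<T = ℕ.≤-trans (s≤s (ℕ.m≤n+m t d)) le
     one : D.mark (history t ω) (m t ω) ≤ divergence t ω
     one = ≡≤ (cong₂ (λ a b → pos (a - b) * inv a) (own≡ t t<T) (oth≡ t t<T)) (mark-bound (own>0 i t) (oth>0 t) (step>0 t))

    path-weight≡ : D.path-weight [] (pathFrom 0 T ω) ≡ path-ratio i ω * (k i T ω * inv (k i 0 ω))
    path-weight≡ = trans (sym (*-identityʳ _)) (trans (weights T 0 (ℕ.≤-reflexive (ℕ.+-identityʳ T))) (trans (cong (λ s → Prod (downFrom s) (λ s → own-ratio i s ω * step s)) (ℕ.+-identityʳ T))
     (trans (Prod-* (downFrom T)) (cong (path-ratio i ω *_) (Prod-telescope (k>0 i) T)))))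

    marks≤ : D.marks [] (pathFrom 0 T ω) ≤ divergences ω
    marks≤ = ≡≤ (sym (+-identityʳ _)) (≤≡ (mark-sum T 0 (ℕ.≤-reflexive (ℕ.+-identityʳ T))) (cong (λ s → Sum (downFrom s) (λ s → divergence s ω)) (ℕ.+-identityʳ T)))

    success≡ : D.success (leaf [] (pathFrom 0 T ω)) ≡ bits ω
    success≡ = trans (cong D.success (leaf-history₀ T ω)) (cong₂ (λ a b → ⟦ not ((a xor b) xor target (ξ ω) (η ω)) ⟧) (oA≡ {ω} {ζ} h) (oB≡ {ω} {ζ} h))

    good≤ψ : 0ℚ < nat R → good ω ≤ D.ψ R [] (pathFrom 0 T ω)
    good≤ψ R>0 = pos-lub (D.0≤ψ R [] (pathFrom 0 T ω)) (≤≡ (-≤ ≤-refl (≤*inv R>0 (≡≤ (*-comm _ (nat R)) (≡≤ (cong (λ z → nat R * (z - D.ψ R [] (pathFrom 0 T ω))) (sym success≡)) (≤-trans (D.few-marks R [] (pathFrom 0 T ω)) marks≤)))))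
     (solve 2 (λ s p → s :- (s :- p) := p) refl (bits ω) _))

   good≤1 : good ω ≤ 1ℚ
   good≤1 = pos-lub 0≤1 (≤≡ (-≤ (⟦⟧≤1 (not ((guessA ω xor guessB ω) xor target (ξ ω) (η ω)))) (0≤* div≥0 (0≤inv (0≤nat R)))) (solve 0 (:1 :- :0 := :1) refl))
    where
    div≥0 : 0ℚ ≤ divergences ω
    div≥0 = Sum-≥0 (downFrom T) (λ t → 0≤+ (0≤pos _) (0≤* (0≤pos _) (<⇒≤ (0<inv (own>0 i t)))))

   -- The density of the simulated law with respect to w is an agreement factor times the path
   -- ratio. Each is at least 1 up to its loss, and as `good ω` is at most 1 the losses can simply
   -- be subtracted.
   path-bound : bits ω - divergences ω * inv (nat R) - (lossZ ω + lossPath ω) ≤ inv (k i T ω) * (agree ω * (path-ratio i ω * (k i T ω * inv (k i 0 ω)) * good ω))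
   path-bound = ≤-trans (+≤ʳ (- ℓ) (≤pos _)) (≤-trans first (≤≡ (*≤ʳ (0≤pos _) (one-minus-loss r≥0 W≥0 (0≤lossZ ω) agree-bound)) (sym eq)))
    where
    ℓ = lossZ ω + lossPath ω
    r = inv (k i 0 ω) * agree ω
    W = path-ratio i ω
    W≥0 : 0ℚ ≤ W
    W≥0 = Prod-≥0 (downFrom T) (λ t → <⇒≤ (own>0 i t))
    r≥0 : 0ℚ ≤ r
    r≥0 = 0≤* (<⇒≤ (0<inv (k>0 i 0))) (0≤* (μ≥0 (ξ ω) (η ω)) (0≤keep (0≤* (0≤g i 0 ω) (<⇒≤ (0<inv (PX>0 i)))) (0≤* (0≤g (suc i) 0 ω) (<⇒≤ (0<inv (PY>0 i))))))
    first : good ω - ℓ ≤ (1ℚ - ℓ) * good ω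
    first = ≤-by (ℓ * (1ℚ - good ω)) (0≤* (0≤+ (0≤lossZ ω) (0≤pos _)) (0≤- good≤1)) (solve 2 (λ g l → g :- l :+ l :* (:1 :- g) := (:1 :- l) :* g) refl (good ω) ℓ)
    eq : inv (k i T ω) * (agree ω * (W * (k i T ω * inv (k i 0 ω)) * good ω)) ≡ r * W * good ω
    eq = trans (solve 6 (λ K a w κ j g → K :* (a :* (w :* (κ :* j) :* g)) := (κ :* K) :* (j :* a :* w :* g)) refl (inv (k i T ω)) (agree ω) W (k i T ω) (inv (k i 0 ω)) (good ω))
     (trans (cong (_* (r * W * good ω)) (*inv (k>0 i T))) (*-identityˡ _))

  private
   weighted : (X → Y → ℚ) → ℚ
   weighted f = Sum 𝕏.values (λ a → Sum 𝕐.values (λ b → μ a b * f a b))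

  agreement-total : 𝔼 (λ ω → 1ℚ - lossZ ω) ≤ weighted (λ a b → Sum Ωs (common a b))
  agreement-total = ≤-trans (𝔼-mono-if (λ ω p → At.agree-bound ω p)) (≤≡
   (Tuples.sum-over-tuples 0 (λ a b ζ p → μ a b * Post a b ζ) agree (λ a b ζ p → 0≤* (μ≥0 a b) (0≤Post a b ζ)) (λ ω p ζ h → ≤-reflexive (sym (Post≡ {ω} {ζ} h))))
   (Sum-cong 𝕏.values λ a → Sum-cong 𝕐.values λ b → trans (Sum-cong Ωs λ ζ → trans (+-identityʳ _) (trans (*-assoc (μ a b) (Post a b ζ) (share ζ)) (cong (μ a b *_) (sym (common≡ a b ζ))))) (Sum-*ˡ (μ a b) Ωs)))

  path-total : 0ℚ < nat R → 𝔼 (λ ω → bits ω - divergences ω * inv (nat R) - (lossZ ω + lossPath ω)) ≤ weighted (λ a b → Sum Ωs (λ ζ → common a b ζ * LBζ a b ζ))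
  path-total R>0 = ≤-trans (𝔼-mono-if (λ ω p → At.path-bound ω p)) (≤≡
   (Tuples.sum-over-tuples T (λ a b ζ p → μ a b * Post a b ζ * (C.path-weight a b ζ [] p * C.ψ a b ζ R [] p)) B
    (λ a b ζ p → 0≤* (0≤* (μ≥0 a b) (0≤Post a b ζ)) (0≤* (pw≥0 a b ζ [] p) (C.0≤ψ a b ζ R [] p))) bound)
   (Sum-cong 𝕏.values λ a → Sum-cong 𝕐.values λ b → trans (Sum-cong Ωs (collect a b)) (Sum-*ˡ (μ a b) Ωs)))
   where
   B : Ω → ℚ
   B ω = agree ω * (path-ratio i ω * (k i T ω * inv (k i 0 ω)) * good ω)
   pw≥0 : ∀ a b ζ {d} v (p : Vec Bool d) → 0ℚ ≤ C.path-weight a b ζ v p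
   pw≥0 a b ζ v [] = 0≤1
   pw≥0 a b ζ v (c ∷ p) = 0≤* (C.0≤own a b ζ v c) (pw≥0 a b ζ (c ∷ v) p)
   bound : ∀ ω → 0ℚ < w ω → ∀ ζ → zrel ω ζ ≡ true → B ω ≤ μ (ξ ω) (η ω) * Post (ξ ω) (η ω) ζ * (C.path-weight (ξ ω) (η ω) ζ [] (pathFrom 0 T ω) * C.ψ (ξ ω) (η ω) ζ R [] (pathFrom 0 T ω))
   bound ω p ζ h = ≡≤ (cong₂ (λ u v → u * (v * good ω)) (sym (Post≡ {ω} {ζ} h)) (sym (At.Class.path-weight≡ ω p ζ h)))
    (*≤ˡ (0≤* (μ≥0 (ξ ω) (η ω)) (0≤Post (ξ ω) (η ω) ζ)) (*≤ˡ (pw≥0 (ξ ω) (η ω) ζ [] (pathFrom 0 T ω)) (At.Class.good≤ψ ω p ζ h R>0)))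
   collect : ∀ a b ζ → Sum (allVecs T) (λ p → μ a b * Post a b ζ * (C.path-weight a b ζ [] p * C.ψ a b ζ R [] p) * share ζ) ≡ μ a b * (common a b ζ * LBζ a b ζ)
   collect a b ζ = trans (Sum-cong (allVecs T) (λ p → solve 4 (λ m q c s → m :* q :* c :* s := m :* (q :* s) :* c) refl (μ a b) (Post a b ζ) (C.path-weight a b ζ [] p * C.ψ a b ζ R [] p) (share ζ)))
    (trans (Sum-*ˡ (μ a b * (Post a b ζ * share ζ)) (allVecs T)) (trans (cong₂ (λ u v → μ a b * u * v) (sym (common≡ a b ζ)) (sym (C.LB-paths a b ζ R T []))) (*-assoc (μ a b) (common a b ζ) (LBζ a b ζ))))

  -- The bound for correlated sampling contains the common density twice, once with and once without
  -- the success of the simulation. For this reason `lossZ` is counted twice.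
  value : 0ℚ < nat R →
   𝔼 (λ ω → bits ω - divergences ω * inv (nat R) - (lossZ ω + lossPath ω)) + 𝔼 (λ ω → 1ℚ - lossZ ω) - 1ℚ - slack ≤ total 𝕏.values 𝕐.values μ (val protocol)
  value R>0 = begin
   𝔼 (λ ω → bits ω - divergences ω * inv (nat R) - (lossZ ω + lossPath ω)) + 𝔼 (λ ω → 1ℚ - lossZ ω) - 1ℚ - slack
    ≤⟨ +≤ʳ (- slack) (+≤ʳ (- 1ℚ) (+-mono-≤ (path-total R>0) agreement-total)) ⟩
   weighted (λ a b → Sum Ωs (λ ζ → common a b ζ * LBζ a b ζ)) + weighted (λ a b → Sum Ωs (common a b)) - 1ℚ - slack
    ≡⟨ distribute ⟩
   weighted (λ a b → Sum Ωs (λ ζ → common a b ζ * LBζ a b ζ) + Sum Ωs (common a b) - 1ℚ - slack)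
    ≤⟨ Sum-mono 𝕏.values (λ a → Sum-mono 𝕐.values (λ b → *≤ˡ (μ≥0 a b) (protocol-correct a b))) ⟩
   total 𝕏.values 𝕐.values μ (val protocol) ∎
   where
   open ≤-Reasoning
   weighted-+ : ∀ f g → weighted (λ a b → f a b + g a b) ≡ weighted f + weighted g
   weighted-+ f g = trans (Sum-cong 𝕏.values λ a → trans (Sum-cong 𝕐.values λ b → distribˡ (μ a b) (f a b) (g a b)) (Sum-+ 𝕐.values)) (Sum-+ 𝕏.values)
   weighted-const : ∀ c → weighted (λ _ _ → c) ≡ c
   weighted-const c = trans (Sum-cong 𝕏.values λ a → Sum-*ʳ c 𝕐.values) (trans (Sum-*ʳ c 𝕏.values) (trans (cong (_* c) μ-total) (*-identityˡ c)))
   distribute : weighted (λ a b → Sum Ωs (λ ζ → common a b ζ * LBζ a b ζ)) + weighted (λ a b → Sum Ωs (common a b)) - 1ℚ - slack ≡ weighted (λ a b → Sum Ωs (λ ζ → common a b ζ * LBζ a b ζ) + Sum Ωs (common a b) - 1ℚ - slack)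
   distribute = sym (trans (weighted-+ _ (λ _ _ → - slack)) (cong₂ _+_ (trans (weighted-+ _ (λ _ _ → - 1ℚ)) (cong₂ _+_ (weighted-+ _ _) (weighted-const (- 1ℚ)))) (weighted-const (- slack))))

-- Choosing the coordinate, and the numerical error budget.

module CoordinateSelection where

 open Arithmetic
 open LogBounds
 open Classes
 open InformationCost
 open Programs
 open NoisySearch
 open RoundByRound
 open CorrelatedSampling
 open CoordinateSimulation
 open import Defs using (Tree; depth; run)

 private
  variable
   A : Set

 sq-Sum≤ : ∀ (xs : List A) (f : A → ℚ) → Sum xs f * Sum xs f ≤ nat (length xs) * Sum xs (λ x → f x * f x)
 sq-Sum≤ [] f = ≤-reflexive (trans (zeroˡ 0ℚ) (sym (zeroʳ _)))
 sq-Sum≤ (x ∷ xs) f = begin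
  (a + s) * (a + s)
   ≡⟨ solve 2 (λ a s → (a :+ s) :* (a :+ s) := a :* a :+ (s :* s :+ :2 :* a :* s)) refl a s ⟩
  a * a + (s * s + two * a * s)
   ≤⟨ +≤ˡ (a * a) (+-mono-≤ (sq-Sum≤ xs f) cross) ⟩
  a * a + (n * q + (n * (a * a) + q))
   ≡⟨ solve 3 (λ a n q → a :* a :+ (n :* q :+ (n :* (a :* a) :+ q)) := (:1 :+ n) :* (a :* a :+ q)) refl a n q ⟩
  (1ℚ + n) * (a * a + q)
   ≡⟨ cong (_* (a * a + q)) (nat-suc (length xs)) ⟨
  nat (suc (length xs)) * (a * a + q) ∎
  where
  open ≤-Reasoning
  a = f x
  s = Sum xs f
  n = nat (length xs)
  q = Sum xs (λ x → f x * f x)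
  cross : two * a * s ≤ n * (a * a) + q
  cross = ≡≤ (trans (sym (Sum-*ˡ (two * a) xs)) refl)
   (≤≡ (Sum-mono xs (λ y → ≤-by ((a - f y) * (a - f y)) (0≤sq (a - f y)) (solve 2 (λ a b → :2 :* a :* b :+ (a :- b) :* (a :- b) := a :* a :+ b :* b) refl a (f y))))
    (trans (Sum-+ xs) (cong (_+ q) (Sum-const (a * a) xs))))

 least : ∀ (xs : List A) → 0ℚ < nat (length xs) → ∀ (f : A → ℚ) → ∃ λ x → x ∈ xs × nat (length xs) * f x ≤ Sum xs f
 least xs ne f with go xs
  where
  go : ∀ ys → (∃ λ x → x ∈ ys × nat (length xs) * f x ≤ Sum xs f) ⊎ (∀ y → y ∈ ys → Sum xs f < nat (length xs) * f y)
  go [] = inj₂ λ y ()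
  go (y ∷ ys) with nat (length xs) * f y ≤? Sum xs f | go ys
  ... | yes h | _ = inj₁ (y , here refl , h)
  ... | no h  | inj₁ (x , x∈ , k) = inj₁ (x , there x∈ , k)
  ... | no h  | inj₂ k = inj₂ λ { z (here refl) → ≰⇒> h ; z (there z∈) → k z z∈ }
 ... | inj₁ h = h
 ... | inj₂ h = ⊥-elim (<-irrefl (subst₂ _<_ (Sum-const (Sum xs f) xs) (Sum-*ˡ (nat (length xs)) xs) (lt xs ne h)))
  where
  lt : ∀ ys → 0ℚ < nat (length ys) → (∀ y → y ∈ ys → Sum xs f < nat (length xs) * f y) → Sum ys (λ _ → Sum xs f) < Sum ys (λ y → nat (length xs) * f y)
  lt [] p k = ⊥-elim (<-irrefl (subst (0ℚ <_) nat-0 p))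
  lt (y ∷ ys) p k = +-mono-<-≤ (k y (here refl)) (Sum-mono∈ ys (λ z z∈ → <⇒≤ (k z (there z∈))))

 -- By induction (1 - x)^J (1 + J x) ≤ 1, and J x can be made as large as desired.
 power-small : ∀ {x e} → 0ℚ < x → x ≤ 1ℚ → 0ℚ < e → ∃ λ J → (1ℚ - x) ^ J ≤ e
 power-small {x} {e} hx x≤1 he = J , ≤-trans (≤*inv (0<+ˡ 0<1 (0≤* (0≤nat J) (<⇒≤ hx))) (bernoulli J)) (*inv≤ (0<+ˡ 0<1 (0≤* (0≤nat J) (<⇒≤ hx))) big)
  where
  J = proj₁ (archimedean (inv e * inv x))
  bernoulli : ∀ J → (1ℚ - x) ^ J * (1ℚ + nat J * x) ≤ 1ℚ
  bernoulli zero = ≤-reflexive (trans (cong (λ z → 1ℚ * (1ℚ + z * x)) nat-0) (solve 1 (λ x → :1 :* (:1 :+ :0 :* x) := :1) refl x))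
  bernoulli (suc J) = ≡≤ (trans (cong (λ z → (1ℚ - x) * p * (1ℚ + z * x)) (nat-suc J)) refl)
   (≤-trans (≤-by (p * ((1ℚ + nat J) * (x * x))) (0≤* (^-nonneg (0≤- x≤1) J) (0≤* (0≤+ 0≤1 (0≤nat J)) (0≤sq x)))
    (solve 3 (λ p n x → (:1 :- x) :* p :* (:1 :+ (:1 :+ n) :* x) :+ p :* ((:1 :+ n) :* (x :* x)) := p :* (:1 :+ n :* x)) refl p (nat J) x)) (bernoulli J))
   where p = (1ℚ - x) ^ J
  big : 1ℚ ≤ e * (1ℚ + nat J * x)
  big = ≤-trans (≡≤ (sym (*inv he)) (*≤ˡ (<⇒≤ he) (≡≤ (sym (inv*-cancel hx)) (*≤ʳ (<⇒≤ hx) (proj₂ (archimedean (inv e * inv x)))))))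
   (*≤ˡ (<⇒≤ he) (≤-by 1ℚ 0≤1 (+-comm _ 1ℚ)))

 -- δ bounds each of ten errors: one for the guesses, one for the path, and four of sampling that
 -- count twice. Thus 10δ = 1/16, and the divergences with 1/32, the searches and the attempts at
 -- sampling with 1/64 each, take another 1/16, which leaves 7/8. η is a power of 2 with 16η ≤ δ².
 η δ 1/32 1/64 : ℚ
 η = inv (nat 524288)
 δ = inv (nat 160)
 1/32 = inv (nat 32)
 1/64 = inv (nat 64)

 7/8 : ℚ
 7/8 = 1ℚ - inv (nat 8)

 opaque
  unfolding _+_

  η-small : nat 16 * η ≤ δ * δ
  η-small = decide

  η-bits : nat 4 * η ≤ δ
  η-bits = decide

  errors : 7/8 ≤ (1ℚ - δ - 1/32 - (nat 4 * δ + δ)) + (1ℚ - nat 4 * δ) - 1ℚ - (1/64 + 1/64)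
  errors = decide

 0<η : 0ℚ < η
 0<η = 0<inv (0<nat 524287)

 0<δ : 0ℚ < δ
 0<δ = 0<inv (0<nat 159)

 module Selection (E : Experiment) (target : Experiment.X E → Experiment.Y E → Bool) (default : Experiment.Ω E)
  (guess : ℕ → Experiment.Ω E → Bool)
  (guess-inv : ∀ i {ω ω'} → Information.G E i (Experiment.T E) ω ω' ≡ true → guess i ω ≡ guess i ω')
  (β≤1 : ∀ i ω → Experiment.β E i ω ≤ 1ℚ)
  (bits-good : ∀ i → i ∈ downFrom (Experiment.n E) → 1ℚ - Information.β-loss E i ≤
   Information.𝔼 E (λ ω → ⟦ not ((guess i ω xor guess (suc i) ω) xor target (Experiment.x E i ω) (Experiment.y E i ω)) ⟧))
  (n>0 : 0ℚ < nat (Experiment.n E)) (lam≡ : Experiment.lam E ≡ nat (Experiment.n E) * η)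
  (R L S : ℕ) (R>0 : 0ℚ < nat R) (T<2^L : Experiment.T E ℕ.< 2 ℕ.^ L)
  (rounds-suffice : nat 32 * nat (Experiment.T E) * (nat (Experiment.n E) * η + nat (Experiment.T E)) ≤ nat (Experiment.n E) * ((1/32 * nat R) * (1/32 * nat R)))
  (search-reliable : nat R * ((1ℚ - ½' ^ 3) ^ S * two ^ L) ≤ 1/64) where

  open Experiment E
  open Information E hiding (L)

  private
   N : List ℕ
   N = downFrom n

   gapE : (Ω → ℚ) → ℚ
   gapE f = 𝔼 (λ ω → gap (f ω))

   TT : List ℕ
   TT = downFrom T

   toll steps : ℕ → ℚ
   toll i = (gapE (path-ratio i) + lossX i) + (gapE (path-ratio i) + lossY i)
   steps i = Sum TT (λ t → gapE (r₁ i t)) + Sum TT (λ t → gapE (r₂ i t))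

  path≥0 : ∀ i ω → 0ℚ ≤ path-ratio i ω
  path≥0 i ω = Prod-≥0 TT (λ t → own≥0 i t ω)

  sX≥0 : ∀ i ω → 0ℚ ≤ sX i ω
  sX≥0 i ω = 0≤* (μX≥0 _) (0≤* (0≤mass always ω) (0≤inv (0≤mass (always ∩ (Finite._==_ 𝕏 on x i)) ω)))

  sY≥0 : ∀ i ω → 0ℚ ≤ sY i ω
  sY≥0 i ω = 0≤* (μY≥0 _) (0≤* (0≤mass always ω) (0≤inv (0≤mass (always ∩ (Finite._==_ 𝕐 on y i)) ω)))

  vX≥0 : ∀ i ω → 0ℚ ≤ vX i ω
  vX≥0 i ω = 0≤* (0≤* (μ≥0 _ _) (0≤inv (μX≥0 _))) (0≤* (0≤g i 0 ω) (0≤inv (0≤k i 0 ω)))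

  vY≥0 : ∀ i ω → 0ℚ ≤ vY i ω
  vY≥0 i ω = 0≤* (0≤* (μ≥0 _ _) (0≤inv (μY≥0 _))) (0≤* (0≤g (suc i) 0 ω) (0≤inv (0≤k i 0 ω)))

  0≤β-loss : ∀ i → 0ℚ ≤ β-loss i
  0≤β-loss i = 𝔼-≥0 (λ ω → 0≤- (β≤1 i ω))

  private
   0≤lossX : ∀ i → 0ℚ ≤ lossX i
   0≤lossX i = 0≤+ (0≤+ (𝔼gap-nonneg (sX≥0 i)) (𝔼gap-nonneg (vX≥0 i))) (0≤β-loss i)

   0≤lossY : ∀ i → 0ℚ ≤ lossY i
   0≤lossY i = 0≤+ (0≤+ (𝔼gap-nonneg (sY≥0 i)) (𝔼gap-nonneg (vY≥0 i))) (0≤β-loss i)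

   0≤gapP : ∀ i → 0ℚ ≤ gapE (path-ratio i)
   0≤gapP i = 𝔼gap-nonneg (path≥0 i)

   0≤toll : ∀ i → 0ℚ ≤ toll i
   0≤toll i = 0≤+ (0≤+ (0≤gapP i) (0≤lossX i)) (0≤+ (0≤gapP i) (0≤lossY i))

   0≤steps : ∀ i → 0ℚ ≤ steps i
   0≤steps i = 0≤+ (Sum-≥0 TT (λ t → 𝔼gap-nonneg (r₁≥0 i t))) (Sum-≥0 TT (λ t → 𝔼gap-nonneg (r₂≥0 i t)))

   Sum-1 : ∀ t → Sum (downFrom t) (λ _ → 1ℚ) ≡ nat t
   Sum-1 t = trans (Sum-const 1ℚ (downFrom t)) (trans (*-identityʳ _) (cong nat (length-downFrom t)))

   toll-sum : Sum N toll ≤ lam + lam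
   toll-sum = ≡≤ (trans (Sum-+ N) (cong₂ _+_ (Sum-+ N) (Sum-+ N))) (+-mono-≤ budget-path-X budget-path-Y)

   steps-sum : Sum N steps ≤ (lam + nat T) + (lam + nat T)
   steps-sum = ≡≤ (Sum-+ N) (+-mono-≤ (≤-trans (≤-by+ˡ (Sum-≥0 N 0≤lossX)) (≤≡ budget-r₁ (cong (lam +_) (Sum-1 T))))
    (≤-trans (≤-by+ˡ (Sum-≥0 N 0≤lossY)) (≤≡ budget-r₂ (cong (lam +_) (Sum-1 T)))))

   b : ℚ
   b = lam + nat T

   lam>0 : 0ℚ < lam
   lam>0 = subst (0ℚ <_) (sym lam≡) (0<* n>0 0<η)

   b>0 : 0ℚ < b
   b>0 = 0<+ˡ lam>0 (0≤nat T)

   length-N : nat (length N) ≡ nat n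
   length-N = cong nat (length-downFrom n)

   module Coordinate (i : ℕ) (i∈ : i ∈ N)
    (least-i : nat (length N) * (toll i * b + steps i * lam) ≤ Sum N (λ i → toll i * b + steps i * lam))
    (J : ℕ) (small-decay : (1ℚ - ½' * inv (nat (length Ωs))) ^ J ≤ 1/64) where

    -- The sum of all `toll i` is at most 2 `lam` and that of all `steps i` at most 2b. Weighted
    -- crosswise by b and `lam` the two budgets are equal, so a coordinate that minimises the
    -- combination exceeds neither average bound by more than a factor of 2.
    chosen-bound : nat n * (toll i * b + steps i * lam) ≤ nat 4 * lam * b
    chosen-bound = ≤-trans (≡≤ (cong (_* (toll i * b + steps i * lam)) (sym length-N)) least-i)
     (≡≤ (trans (Sum-+ N) (cong₂ _+_ (Sum-*ʳ b N) (Sum-*ʳ lam N))) (≤≡ (+-mono-≤ (*≤ʳ (<⇒≤ b>0) toll-sum) (*≤ʳ (<⇒≤ lam>0) steps-sum))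
      (solve 2 (λ l b → (l :+ l) :* b :+ (b :+ b) :* l := con (ℤ.+ 4) :* l :* b) refl lam b)))

    toll-bound : toll i ≤ nat 4 * η
    toll-bound = *-cancel-≤ n>0 (*-cancel-≤ b>0 (≤-trans (≤-by (nat n * (steps i * lam)) (0≤* (<⇒≤ n>0) (0≤* (0≤steps i) (<⇒≤ lam>0)))
     (solve 5 (λ n c b s l → c :* n :* b :+ n :* (s :* l) := n :* (c :* b :+ s :* l)) refl (nat n) (toll i) b (steps i) lam))
     (≤≡ chosen-bound (cong (_* b) (trans (cong (nat 4 *_) lam≡) (solve 3 (λ f n e → f :* (n :* e) := f :* e :* n) refl (nat 4) (nat n) η))))))

    steps-bound : nat n * steps i ≤ nat 4 * b
    steps-bound = *-cancel-≤ lam>0 (≤-trans (≤-by (nat n * (toll i * b)) (0≤* (<⇒≤ n>0) (0≤* (0≤toll i) (<⇒≤ b>0)))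
     (solve 5 (λ n c b s l → n :* s :* l :+ n :* (c :* b) := n :* (c :* b :+ s :* l)) refl (nat n) (toll i) b (steps i) lam))
     (≤≡ chosen-bound (solve 3 (λ f l b → f :* l :* b := f :* b :* l) refl (nat 4) lam b)))

    jensen : ∀ f → 𝔼 f * 𝔼 f ≤ 𝔼 (λ ω → f ω * f ω)
    jensen f = -≥0 (subst (0ℚ ≤_) eq (𝔼-≥0 {λ ω → (f ω - c) * (f ω - c)} (λ ω → 0≤sq (f ω - c))))
     where
     c = 𝔼 f
     eq : 𝔼 (λ ω → (f ω - c) * (f ω - c)) ≡ 𝔼 (λ ω → f ω * f ω) - c * c
     eq = trans (𝔼-cong (λ ω → solve 2 (λ f c → (f :- c) :* (f :- c) := f :* f :- (:2 :* c :* f :- c :* c :* :1)) refl (f ω) c))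
      (trans 𝔼-- (cong (λ z → 𝔼 (λ ω → f ω * f ω) - z) (trans 𝔼-- (trans (cong₂ _-_ (𝔼-*ˡ (two * c)) (trans (𝔼-*ˡ (c * c)) (cong (c * c *_) 𝔼1))) (solve 1 (λ c → :2 :* c :* c :- c :* c :* :1 := c :* c) refl c)))))

    -- By Jensen's inequality and `gap-below` the square of the mean is at most 4 · 4η, the 16η of
    -- `η-small`.
    below : ∀ f → (∀ ω → 0ℚ ≤ f ω) → gapE f ≤ nat 4 * η → 𝔼 (λ ω → pos (1ℚ - f ω)) ≤ δ
    below f f≥0 h = sq-cancel-≤ (<⇒≤ 0<δ) (≤-trans (jensen _) (≤-trans (𝔼-mono (λ ω → gap-below (f≥0 ω))) (≡≤ (𝔼-*ˡ (nat 4))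
     (≤-trans (*≤ˡ (0≤nat 4) h) (≡≤ (trans (sym (*-assoc (nat 4) (nat 4) η)) (cong (_* η) (sym (nat-* 4 4)))) η-small)))))

    drop₁ : ∀ {p q r} → 0ℚ ≤ q → p + q ≤ r → p ≤ r
    drop₁ h k = ≤-trans (≤-by+ˡ h) k

    drop₂ : ∀ {p q r} → 0ℚ ≤ p → p + q ≤ r → q ≤ r
    drop₂ h k = ≤-trans (≤-by+ʳ h) k

    partX : gapE (path-ratio i) + lossX i ≤ nat 4 * η
    partX = drop₁ (0≤+ (0≤gapP i) (0≤lossY i)) toll-bound

    partY : gapE (path-ratio i) + lossY i ≤ nat 4 * η
    partY = drop₂ (0≤+ (0≤gapP i) (0≤lossX i)) toll-bound

    lossX≤ : lossX i ≤ nat 4 * η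
    lossX≤ = drop₂ (0≤gapP i) partX

    lossY≤ : lossY i ≤ nat 4 * η
    lossY≤ = drop₂ (0≤gapP i) partY

    gaps : ∀ {p q r c} → 0ℚ ≤ p → 0ℚ ≤ q → 0ℚ ≤ r → p + q + r ≤ c → p ≤ c × q ≤ c × r ≤ c
    gaps hp hq hr h = drop₁ hq (drop₁ hr h) , drop₂ hp (drop₁ hr h) , drop₂ (0≤+ hp hq) h

    gapsX = gaps (𝔼gap-nonneg (sX≥0 i)) (𝔼gap-nonneg (vX≥0 i)) (0≤β-loss i) lossX≤
    gapsY = gaps (𝔼gap-nonneg (sY≥0 i)) (𝔼gap-nonneg (vY≥0 i)) (0≤β-loss i) lossY≤

    module Sim = Simulation E i i∈ target (guess i) (guess (suc i)) (guess-inv i) (guess-inv (suc i)) default R J L S T<2^L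

    divergence-sq : ∀ t ω → 0ℚ < w ω → Sim.divergence t ω * Sim.divergence t ω ≤ nat 8 * (gap (r₁ i t ω) + gap (r₂ i t ω))
    divergence-sq t ω w>0 = either (speaker t ω)
     where
     a₁ = r₁ i t ω
     a₂ = r₂ i t ω
     p₁ : 0ℚ < a₁
     p₁ = Pointwise.r₁>0 ω w>0 i t
     p₂ : 0ℚ < a₂
     p₂ = Pointwise.r₂>0 ω w>0 i t
     both : ∀ p q {c d} → p * p ≤ nat 4 * c → q * q ≤ nat 4 * d → (p + q) * (p + q) ≤ nat 8 * (c + d)
     both p q {c} {d} hp hq = ≤-trans (≤-by ((p - q) * (p - q)) (0≤sq (p - q)) (solve 2 (λ p q → (p :+ q) :* (p :+ q) :+ (p :- q) :* (p :- q) := :2 :* (p :* p :+ q :* q)) refl p q))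
      (≤≡ (*≤ˡ (<⇒≤ 0<two) (+-mono-≤ hp hq)) (solve 2 (λ c d → :2 :* (con (ℤ.+ 4) :* c :+ con (ℤ.+ 4) :* d) := con (ℤ.+ 8) :* (c :+ d)) refl c d))
     Bound : Bool → Set
     Bound o = (pos (1ℚ - (if o then a₂ else a₁)) + pos ((if o then a₁ else a₂) - 1ℚ) * inv (if o then a₁ else a₂)) *
      (pos (1ℚ - (if o then a₂ else a₁)) + pos ((if o then a₁ else a₂) - 1ℚ) * inv (if o then a₁ else a₂)) ≤ nat 8 * (gap a₁ + gap a₂)
     either : ∀ o → Bound o
     either true  = ≤≡ (both _ _ (gap-below (<⇒≤ p₂)) (gap-above p₁)) (cong (nat 8 *_) (+-comm (gap a₂) (gap a₁)))
     either false = both _ _ (gap-below (<⇒≤ p₁)) (gap-above p₂)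

    -- Cauchy-Schwarz over the T bits. The square of a divergence is at most 8 times the gaps, and n
    -- `steps i` is at most 4b; together they give the 32 T b of `rounds-suffice`.
    div-mean : 𝔼 Sim.divergences ≤ 1/32 * nat R
    div-mean = sq-cancel-≤ (0≤* (<⇒≤ (0<inv (0<nat 31))) (<⇒≤ R>0)) (*-cancel-≤ n>0 (begin
     𝔼 Sim.divergences * 𝔼 Sim.divergences * nat n
      ≤⟨ *≤ʳ (<⇒≤ n>0) (≤-trans (jensen _) (Sim.𝔼-mono-if (λ ω p → ≤-trans (sq-Sum≤ TT _) (*≤ˡ (0≤nat (length TT)) (Sum-mono TT (λ t → divergence-sq t ω p)))))) ⟩
     𝔼 (λ ω → nat (length TT) * Sum TT (λ t → nat 8 * (gap (r₁ i t ω) + gap (r₂ i t ω)))) * nat n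
      ≡⟨ cong (_* nat n) (trans (𝔼-*ˡ (nat (length TT))) (cong₂ _*_ (cong nat (length-downFrom T)) (trans (𝔼-Sum TT) (trans (Sum-cong TT (λ t → trans (𝔼-*ˡ (nat 8)) (cong (nat 8 *_) 𝔼-+))) (trans (Sum-*ˡ (nat 8) TT) (cong (nat 8 *_) (Sum-+ TT))))))) ⟩
     nat T * (nat 8 * steps i) * nat n
      ≡⟨ solve 4 (λ t e s n → t :* (e :* s) :* n := t :* e :* (n :* s)) refl (nat T) (nat 8) (steps i) (nat n) ⟩
     nat T * nat 8 * (nat n * steps i)
      ≤⟨ *≤ˡ (0≤* (0≤nat T) (0≤nat 8)) steps-bound ⟩
     nat T * nat 8 * (nat 4 * b)
      ≡⟨ trans (solve 4 (λ t e f b → t :* e :* (f :* b) := e :* f :* t :* b) refl (nat T) (nat 8) (nat 4) b) (cong₂ (λ u v → u * nat T * (v + nat T)) (sym (nat-* 8 4)) lam≡) ⟩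
     nat 32 * nat T * (nat n * η + nat T)
      ≤⟨ rounds-suffice ⟩
     nat n * ((1/32 * nat R) * (1/32 * nat R))
      ≡⟨ *-comm _ _ ⟩
     (1/32 * nat R) * (1/32 * nat R) * nat n ∎))
     where open ≤-Reasoning

    𝔼-lossZ : 𝔼 Sim.lossZ ≤ nat 4 * δ
    𝔼-lossZ = ≡≤ (trans 𝔼-+ (cong₂ _+_ 𝔼-+ 𝔼-+)) (≤≡ (+-mono-≤
       (+-mono-≤ (below (vX i) (vX≥0 i) (proj₁ (proj₂ gapsX))) (below (sX i) (sX≥0 i) (proj₁ gapsX)))
       (+-mono-≤ (below (vY i) (vY≥0 i) (proj₁ (proj₂ gapsY))) (below (sY i) (sY≥0 i) (proj₁ gapsY))))
     (solve 1 (λ d → (d :+ d) :+ (d :+ d) := con (ℤ.+ 4) :* d) refl δ))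

    𝔼-lossPath : 𝔼 Sim.lossPath ≤ δ
    𝔼-lossPath = below (path-ratio i) (path≥0 i) (drop₁ (0≤lossX i) partX)

    𝔼-bits : 1ℚ - δ ≤ 𝔼 Sim.bits
    𝔼-bits = ≤-trans (-≤ ≤-refl (≤-trans (proj₂ (proj₂ gapsX)) η-bits)) (bits-good i i∈)

    protocol-value : 7/8 ≤ Protocols.total target (Finite.values 𝕏) (Finite.values 𝕐) μ (Protocols.val target Sim.protocol)
    protocol-value = ≤-trans errors (≤-trans (-≤ (+≤ʳ (- 1ℚ) (+-mono-≤ first second)) (+-mono-≤ search-reliable small-decay)) (Sim.value R>0))
     where
     first : 1ℚ - δ - 1/32 - (nat 4 * δ + δ) ≤ 𝔼 (λ ω → Sim.bits ω - Sim.divergences ω * inv (nat R) - (Sim.lossZ ω + Sim.lossPath ω))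
     first = ≤≡ (-≤ (-≤ 𝔼-bits (*inv≤ R>0 div-mean)) (+-mono-≤ 𝔼-lossZ 𝔼-lossPath))
      (sym (trans 𝔼-- (cong₂ _-_ (trans 𝔼-- (cong (λ z → 𝔼 Sim.bits - z) (trans (𝔼-cong (λ ω → *-comm _ _)) (trans (𝔼-*ˡ (inv (nat R))) (*-comm _ _))))) 𝔼-+)))
     second : 1ℚ - nat 4 * δ ≤ 𝔼 (λ ω → 1ℚ - Sim.lossZ ω)
     second = ≤≡ (-≤ ≤-refl 𝔼-lossZ) (sym (trans 𝔼-- (cong (λ z → z - 𝔼 Sim.lossZ) 𝔼1)))

    tree-at : ∃ λ (t : Tree X Y) → depth t ℕ.≤ R ℕ.* (S ℕ.* 18) ℕ.+ 2 ×
     7/8 ≤ Sum (Finite.values 𝕏) (λ a → Sum (Finite.values 𝕐) (λ b → μ a b * ⟦ not (run t a b xor target a b) ⟧))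
    tree-at = proj₁ found , proj₁ (proj₂ found) , ≤-trans protocol-value (proj₂ (proj₂ found))
     where
     found : ∃ λ (t : Tree X Y) → depth t ℕ.≤ R ℕ.* (S ℕ.* 18) ℕ.+ 2 ×
      Protocols.total target (Finite.values 𝕏) (Finite.values 𝕐) μ (Protocols.val target Sim.protocol) ≤
      Protocols.total target (Finite.values 𝕏) (Finite.values 𝕐) μ (λ a b → Protocols.hit target (run t a b) a b)
     found = Protocols.derandomise target (Finite.values 𝕏) (Finite.values 𝕐) Sim.protocol Sim.cost-protocol μ

   small-decay : ∃ λ J → (1ℚ - ½' * inv (nat (length Ωs))) ^ J ≤ 1/64
   small-decay = power-small (0<* (0<inv (0<nat 1)) (0<inv len>0)) (*≤1 0≤½' (≤-by ½' 0≤½' ½+½) (<⇒≤ (0<inv len>0)) (≤≡ (inv-anti 0<1 (1≤length Ωs len>0)) inv-1)) (0<inv (0<nat 63))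
    where
    nonempty : ∀ (xs : List Ω) → default ∈ xs → NonEmpty xs
    nonempty (x ∷ xs) h = 0<nat (length xs)
    len>0 : NonEmpty Ωs
    len>0 = nonempty Ωs (Ωs-all default)

  good-tree : ∃ λ (t : Tree X Y) → depth t ℕ.≤ R ℕ.* (S ℕ.* 18) ℕ.+ 2 ×
   7/8 ≤ Sum (Finite.values 𝕏) (λ a → Sum (Finite.values 𝕐) (λ b → μ a b * ⟦ not (run t a b xor target a b) ⟧))
  good-tree = Coordinate.tree-at (proj₁ chosen) (proj₁ (proj₂ chosen)) (proj₂ (proj₂ chosen)) (proj₁ small-decay) (proj₂ small-decay)
   where
   chosen : ∃ λ i → i ∈ N × nat (length N) * (toll i * b + steps i * lam) ≤ Sum N (λ i → toll i * b + steps i * lam)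
   chosen = least N (subst (0ℚ <_) (sym length-N) n>0) (λ i → toll i * b + steps i * lam)

-- Product measures on vectors as an instance of the abstract setting.

module ProductInstance where

 open Arithmetic
 open LogBounds
 open Classes
 open Tilting
 open InformationCost
 open Programs
 open NoisySearch
 open RoundByRound
 open CoordinateSimulation using (finite-∈)
 open CoordinateSelection
 open import Defs using (Tree; output; alice; bob; depth; run; xor-power)
 open import Data.Vec using (Vec; []; _∷_; replicate)
 open import Data.Bool.Properties using (∧-assoc; ∧-comm)

 Sum-map₂ : ∀ {A B C : Set} (h : A → B → C) (f : C → ℚ) xs ys → Sum (cartesianProductWith h xs ys) f ≡ Sum xs (λ x → Sum ys (λ y → f (h x y)))
 Sum-map₂ h f [] ys = refl
 Sum-map₂ h f (x ∷ xs) ys = trans (Sum-++ (map (h x) ys)) (cong₂ _+_ (Sum-map (h x) ys) (Sum-map₂ h f xs ys))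

 -- Beyond the end all vectors have the entry d, so that the recursions for `suffixV` and `prefixV`
 -- hold at every index.
 nth : ∀ {A : Set} {n} → A → Vec A n → ℕ → A
 nth d [] i = d
 nth d (x ∷ xs) zero    = x
 nth d (x ∷ xs) (suc i) = nth d xs i

 module Vectors {A : Set} (𝔸 : Finite A) (d : A) where

  open Finite 𝔸

  eqV : ∀ {n} → Vec A n → Vec A n → Bool
  eqV [] [] = true
  eqV (x ∷ xs) (y ∷ ys) = eqV xs ys ∧ (x == y)

  eqV-sound : ∀ {n} (xs ys : Vec A n) → eqV xs ys ≡ true → xs ≡ ys
  eqV-sound [] [] h = refl
  eqV-sound (x ∷ xs) (y ∷ ys) h with ∧-split (eqV xs ys) h
  ... | h₁ , h₂ = cong₂ _∷_ (==-sound h₂) (eqV-sound xs ys h₁)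

  suffixV : ∀ {n} → ℕ → Vec A n → Vec A n → Bool
  suffixV zero    xs ys = eqV xs ys
  suffixV (suc i) [] [] = true
  suffixV (suc i) (x ∷ xs) (y ∷ ys) = suffixV i xs ys

  prefixV : ∀ {n} → ℕ → Vec A n → Vec A n → Bool
  prefixV zero    xs ys = true
  prefixV (suc i) [] [] = true
  prefixV (suc i) (x ∷ xs) (y ∷ ys) = (x == y) ∧ prefixV i xs ys

  eqV-equiv : ∀ {n} → Equivalence (eqV {n})
  eqV-equiv = record { re = re' ; sy = sy' ; tr = λ {xs} {ys} zs h → cong (λ v → eqV v zs) (eqV-sound xs ys h) }
   where
   re' : ∀ {n} (xs : Vec A n) → eqV xs xs ≡ true
   re' [] = refl
   re' (x ∷ xs) = cong₂ _∧_ (re' xs) (re ==-equiv x)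
   sy' : ∀ {n} (xs ys : Vec A n) → eqV xs ys ≡ eqV ys xs
   sy' [] [] = refl
   sy' (x ∷ xs) (y ∷ ys) = cong₂ _∧_ (sy' xs ys) (sy ==-equiv x y)

  suffixV-equiv : ∀ {n} i → Equivalence (suffixV {n} i)
  suffixV-equiv zero    = eqV-equiv
  suffixV-equiv (suc i) = record { re = re' ; sy = sy' ; tr = λ {xs} {ys} zs → tr' xs ys zs }
   where
   re' : ∀ {n} (xs : Vec A n) → suffixV (suc i) xs xs ≡ true
   re' [] = refl
   re' (x ∷ xs) = re (suffixV-equiv i) xs
   sy' : ∀ {n} (xs ys : Vec A n) → suffixV (suc i) xs ys ≡ suffixV (suc i) ys xs
   sy' [] [] = refl
   sy' (x ∷ xs) (y ∷ ys) = sy (suffixV-equiv i) xs ys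
   tr' : ∀ {n} (xs ys zs : Vec A n) → suffixV (suc i) xs ys ≡ true → suffixV (suc i) xs zs ≡ suffixV (suc i) ys zs
   tr' [] [] [] h = refl
   tr' (x ∷ xs) (y ∷ ys) (z ∷ zs) h = tr (suffixV-equiv i) zs h

  prefixV-equiv : ∀ {n} i → Equivalence (prefixV {n} i)
  prefixV-equiv zero    = record { re = λ _ → refl ; sy = λ _ _ → refl ; tr = λ _ _ → refl }
  prefixV-equiv (suc i) = record { re = re' ; sy = sy' ; tr = λ {xs} {ys} zs → tr' xs ys zs }
   where
   re' : ∀ {n} (xs : Vec A n) → prefixV (suc i) xs xs ≡ true
   re' [] = refl
   re' (x ∷ xs) = cong₂ _∧_ (re ==-equiv x) (re (prefixV-equiv i) xs)
   sy' : ∀ {n} (xs ys : Vec A n) → prefixV (suc i) xs ys ≡ prefixV (suc i) ys xs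
   sy' [] [] = refl
   sy' (x ∷ xs) (y ∷ ys) = cong₂ _∧_ (sy ==-equiv x y) (sy (prefixV-equiv i) xs ys)
   tr' : ∀ {n} (xs ys zs : Vec A n) → prefixV (suc i) xs ys ≡ true → prefixV (suc i) xs zs ≡ prefixV (suc i) ys zs
   tr' [] [] [] h = refl
   tr' (x ∷ xs) (y ∷ ys) (z ∷ zs) h with ∧-split (x == y) h
   ... | h₁ , h₂ = cong₂ _∧_ (tr ==-equiv z h₁) (tr (prefixV-equiv i) zs h₂)

  suffixV-suc : ∀ {n} i (xs ys : Vec A n) → suffixV i xs ys ≡ suffixV (suc i) xs ys ∧ (nth d xs i == nth d ys i)
  suffixV-suc zero    [] [] = sym (re ==-equiv d)
  suffixV-suc zero    (x ∷ xs) (y ∷ ys) = refl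
  suffixV-suc (suc i) [] [] = sym (re ==-equiv d)
  suffixV-suc (suc i) (x ∷ xs) (y ∷ ys) = suffixV-suc i xs ys

  prefixV-suc : ∀ {n} i (xs ys : Vec A n) → prefixV (suc i) xs ys ≡ prefixV i xs ys ∧ (nth d xs i == nth d ys i)
  prefixV-suc zero    [] [] = sym (re ==-equiv d)
  prefixV-suc zero    (x ∷ xs) (y ∷ ys) = ∧-comm (x == y) true
  prefixV-suc (suc i) [] [] = sym (re ==-equiv d)
  prefixV-suc (suc i) (x ∷ xs) (y ∷ ys) = trans (cong ((x == y) ∧_) (prefixV-suc i xs ys)) (sym (∧-assoc (x == y) _ _))

  suffixV-full : ∀ {n} (xs ys : Vec A n) → suffixV n xs ys ≡ true
  suffixV-full [] [] = refl
  suffixV-full (x ∷ xs) (y ∷ ys) = suffixV-full xs ys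

  prefixV-sound : ∀ {n} (xs ys : Vec A n) → prefixV n xs ys ≡ true → xs ≡ ys
  prefixV-sound [] [] h = refl
  prefixV-sound (x ∷ xs) (y ∷ ys) h with ∧-split (x == y) h
  ... | h₁ , h₂ = cong₂ _∷_ (==-sound h₁) (prefixV-sound xs ys h₂)

  suffixV-nth : ∀ {n} i j (xs ys : Vec A n) → suffixV i xs ys ≡ true → i ℕ.≤ j → nth d xs j ≡ nth d ys j
  suffixV-nth zero    j xs ys h le = cong (λ v → nth d v j) (eqV-sound xs ys h)
  suffixV-nth (suc i) (suc j) [] [] h le = refl
  suffixV-nth (suc i) (suc j) (x ∷ xs) (y ∷ ys) h (s≤s le) = suffixV-nth i j xs ys h le

  prefixV-nth : ∀ {n} i j (xs ys : Vec A n) → prefixV i xs ys ≡ true → j ℕ.< i → nth d xs j ≡ nth d ys j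
  prefixV-nth (suc i) j [] [] h le = refl
  prefixV-nth (suc i) zero    (x ∷ xs) (y ∷ ys) h le = ==-sound (proj₁ (∧-split (x == y) h))
  prefixV-nth (suc i) (suc j) (x ∷ xs) (y ∷ ys) h (s≤s le) = prefixV-nth i j xs ys (proj₂ (∧-split (x == y) h)) le

  vectors : ∀ n → List (Vec A n)
  vectors zero    = [] ∷ []
  vectors (suc n) = cartesianProductWith _∷_ values (vectors n)

  vec-finite : ∀ n → Finite (Vec A n)
  vec-finite n = record { values = vectors n ; _==_ = eqV ; ==-equiv = eqV-equiv ; ==-sound = λ {xs} {ys} → eqV-sound xs ys ; once = once' n }
   where
   once' : ∀ n (xs : Vec A n) → Sum (vectors n) (λ ys → ⟦ eqV xs ys ⟧) ≡ 1ℚ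
   once' zero    [] = +-identityʳ 1ℚ
   once' (suc n) (x ∷ xs) = trans (Sum-map₂ _∷_ _ values (vectors n)) (trans (Sum-cong values (λ y → trans (Sum-cong (vectors n) (λ ys → ⟦∧⟧ (eqV xs ys) (x == y)))
    (trans (Sum-*ʳ ⟦ x == y ⟧ (vectors n)) (trans (cong (_* ⟦ x == y ⟧) (once' n xs)) (*-identityˡ _))))) (once x))

 module Trees {A B : Set} where

  -- A leaf is its own child, and `bitOf` is constant there, so all transcripts can be padded to the
  -- same length T.
  child : Tree A B → Bool → Tree A B
  child (output c)  b = output c
  child (alice m k) b = k b
  child (bob m k)   b = k b

  bitOf : Tree A B → A → B → Bool
  bitOf (output c)  x y = false
  bitOf (alice m k) x y = m x
  bitOf (bob m k)   x y = m y

  aliceOwns : Tree A B → Bool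
  aliceOwns (output c)  = true
  aliceOwns (alice m k) = true
  aliceOwns (bob m k)   = false

  outputOf : Tree A B → Bool
  outputOf (output c)  = c
  outputOf (alice m k) = false
  outputOf (bob m k)   = false

  run-child : ∀ t x y → run (child t (bitOf t x y)) x y ≡ run t x y
  run-child (output c)  x y = refl
  run-child (alice m k) x y = refl
  run-child (bob m k)   x y = refl

  depth-child : ∀ t b → depth (child t b) ℕ.≤ ℕ.pred (depth t)
  depth-child (output c)  b     = z≤n
  depth-child (alice m k) true  = ℕ.m≤n⊔m (depth (k false)) (depth (k true))
  depth-child (alice m k) false = ℕ.m≤m⊔n (depth (k false)) (depth (k true))
  depth-child (bob m k)   true  = ℕ.m≤n⊔m (depth (k false)) (depth (k true))
  depth-child (bob m k)   false = ℕ.m≤m⊔n (depth (k false)) (depth (k true))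

  depth-0 : ∀ t x y → depth t ≡ 0 → run t x y ≡ outputOf t
  depth-0 (output c) x y h = refl

  alice-bit : ∀ t {x} y y' → aliceOwns t ≡ true → bitOf t x y ≡ bitOf t x y'
  alice-bit (output c)  y y' h = refl
  alice-bit (alice m k) y y' h = refl

  bob-bit : ∀ t x x' {y} → aliceOwns t ≡ false → bitOf t x y ≡ bitOf t x' y
  bob-bit (bob m k) x x' h = refl

  mixed-bit : ∀ t {x y x' y'} → bitOf t x y ≡ bitOf t x' y' → bitOf t x y ≡ bitOf t x y'
  mixed-bit (output c)  h = refl
  mixed-bit (alice m k) h = refl
  mixed-bit (bob m k)   h = h

  module Transcript (tree : Tree A B) where

   current : ℕ → A × B → Tree A B
   current zero    ω = tree
   current (suc t) ω = child (current t ω) (bitOf (current t ω) (proj₁ ω) (proj₂ ω))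

   bitAt : ℕ → A × B → Bool
   bitAt t ω = bitOf (current t ω) (proj₁ ω) (proj₂ ω)

   nodeAt : List Bool → Tree A B
   nodeAt [] = tree
   nodeAt (b ∷ v) = child (nodeAt v) b

   ownerAt : List Bool → Bool
   ownerAt v = aliceOwns (nodeAt v)

   nodeAt-history : ∀ t ω → nodeAt (historyOf bitAt t ω) ≡ current t ω
   nodeAt-history zero    ω = refl
   nodeAt-history (suc t) ω = cong (λ z → child z (bitAt t ω)) (nodeAt-history t ω)

   same-node : ∀ t ω ω' → historyOf bitAt t ω ≡ historyOf bitAt t ω' → current t ω ≡ current t ω'
   same-node t ω ω' h = trans (sym (nodeAt-history t ω)) (trans (cong nodeAt h) (nodeAt-history t ω'))

   -- By induction the three points reach the same node. The next bit there is a function of x,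
   -- which the third point shares with the first, or of y', which it shares with the second.
   rectangle : ∀ t {x y x' y'} → historyOf bitAt t (x , y) ≡ historyOf bitAt t (x' , y') → historyOf bitAt t (x , y) ≡ historyOf bitAt t (x , y')
   rectangle zero    h = refl
   rectangle (suc t) {x} {y} {x'} {y'} h = cong₂ List._∷_ bits earlier
    where
    tails : historyOf bitAt t (x , y) ≡ historyOf bitAt t (x' , y')
    tails = List.∷-injectiveʳ h
    heads : bitAt t (x , y) ≡ bitAt t (x' , y')
    heads = List.∷-injectiveˡ h
    earlier : historyOf bitAt t (x , y) ≡ historyOf bitAt t (x , y')
    earlier = rectangle t tails
    n₁ : current t (x , y) ≡ current t (x' , y')
    n₁ = same-node t (x , y) (x' , y') tails
    n₂ : current t (x , y) ≡ current t (x , y')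
    n₂ = same-node t (x , y) (x , y') earlier
    bits : bitAt t (x , y) ≡ bitAt t (x , y')
    bits = trans (mixed-bit (current t (x , y)) (trans heads (cong (λ z → bitOf z x' y') (sym n₁)))) (cong (λ z → bitOf z x y') n₂)

   run-current : ∀ t ω → run (current t ω) (proj₁ ω) (proj₂ ω) ≡ run tree (proj₁ ω) (proj₂ ω)
   run-current zero    ω = refl
   run-current (suc t) ω = trans (run-child (current t ω) (proj₁ ω) (proj₂ ω)) (run-current t ω)

   depth-current : ∀ t ω → depth (current t ω) ℕ.≤ depth tree ℕ.∸ t
   depth-current zero    ω = ℕ.≤-refl
   depth-current (suc t) ω = ℕ.≤-trans (depth-child (current t ω) (bitAt t ω)) (≤≡ᴺ (ℕ.pred-mono-≤ (depth-current t ω)) (ℕ.pred[m∸n]≡m∸[1+n] (depth tree) t))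

   result : ℕ → A × B → Bool
   result T ω = outputOf (current T ω)

   result≡ : ∀ {T} → depth tree ℕ.≤ T → ∀ ω → run tree (proj₁ ω) (proj₂ ω) ≡ result T ω
   result≡ {T} h ω = trans (sym (run-current T ω)) (depth-0 (current T ω) (proj₁ ω) (proj₂ ω) (ℕ.n≤0⇒n≡0 (≤≡ᴺ (depth-current T ω) (ℕ.m≤n⇒m∸n≡0 h))))

 module Concrete {X Y : Set} (𝕏 : Finite X) (𝕐 : Finite Y) (x₀ : X) (y₀ : Y) (F : X × Y → Bool) (n : ℕ)
  (μ : X → Y → ℚ) (μ≥0 : ∀ a b → 0ℚ ≤ μ a b) (μ-total : Sum (Finite.values 𝕏) (λ a → Sum (Finite.values 𝕐) (μ a)) ≡ 1ℚ)
  (tree : Tree (Vec X n) (Vec Y n)) (T : ℕ) (depth≤T : depth tree ℕ.≤ T) where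

  private
   module VX = Vectors 𝕏 x₀
   module VY = Vectors 𝕐 y₀

  open Trees.Transcript tree
  open Trees using (bitOf; aliceOwns; outputOf; alice-bit; bob-bit)

  Xs : List (Vec X n)
  Xs = VX.vectors n

  Ys : List (Vec Y n)
  Ys = VY.vectors n

  value-at : ℕ → Vec X n × Vec Y n → Bool
  value-at i (xs , ys) = F (nth x₀ xs i , nth y₀ ys i)

  base : Vec X n × Vec Y n → ℚ
  base (xs , ys) = Prod (downFrom n) (λ i → μ (nth x₀ xs i) (nth y₀ ys i))

  transcript : Vec X n × Vec Y n → Vec X n × Vec Y n → Bool
  transcript = _==ᴸ_ on historyOf bitAt T

  -- In coordinate j the x's agree if j ≥ i, and the y's agree if j < i; in either case the exchange
  -- changes at most the order of the two factors.
  base-swap : ∀ i {x y x' y'} → VX.suffixV i x x' ≡ true → VY.prefixV i y y' ≡ true →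
   base (x , y) * base (x' , y') ≡ base (x , y') * base (x' , y)
  base-swap i {x} {y} {x'} {y'} h k = trans (sym (Prod-* (downFrom n))) (trans (Prod-cong (downFrom n) one) (Prod-* (downFrom n)))
   where
   one : ∀ j → μ (nth x₀ x j) (nth y₀ y j) * μ (nth x₀ x' j) (nth y₀ y' j) ≡ μ (nth x₀ x j) (nth y₀ y' j) * μ (nth x₀ x' j) (nth y₀ y j)
   one j with i ℕ.≤? j
   ... | yes le = trans (cong₂ (λ a b → μ a (nth y₀ y j) * μ b (nth y₀ y' j)) (VX.suffixV-nth i j x x' h le) (sym (VX.suffixV-nth i j x x' h le))) (*-comm _ _)
   ... | no ¬le = cong₂ (λ a b → μ (nth x₀ x j) a * μ (nth x₀ x' j) b) (VY.prefixV-nth i j y y' k (ℕ.≰⇒> ¬le)) (sym (VY.prefixV-nth i j y y' k (ℕ.≰⇒> ¬le)))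

  ≡⇒==ᴸ : ∀ {u v} → u ≡ v → (u ==ᴸ v) ≡ true
  ≡⇒==ᴸ {u} refl = re ==ᴸ-equiv u

  suffix-pred : ∀ i (x x' : Vec X n) → VX.suffixV i x x' ≡ true → VX.suffixV (suc i) x x' ≡ true
  suffix-pred i x x' h = proj₁ (∧-split (VX.suffixV (suc i) x x') (trans (sym (VX.suffixV-suc i x x')) h))

  prefix-pred : ∀ i (y y' : Vec Y n) → VY.prefixV (suc i) y y' ≡ true → VY.prefixV i y y' ≡ true
  prefix-pred i y y' h = proj₁ (∧-split (VY.prefixV i y y') (trans (sym (VY.prefixV-suc i y y')) h))

  transcript-rectangle : ∀ {x y x' y'} → transcript (x , y) (x' , y') ≡ true → transcript (x , y) (x , y') ≡ true
  transcript-rectangle {x} {y} {x'} {y'} h = ≡⇒==ᴸ (rectangle T (==ᴸ-sound (historyOf bitAt T (x , y)) (historyOf bitAt T (x' , y')) h))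

  base≥0 : ∀ ω → 0ℚ ≤ base ω
  base≥0 ω = Prod-≥0 (downFrom n) (λ i → μ≥0 _ _)

  value-x : ∀ i (x x' : Vec X n) y → VX.suffixV i x x' ≡ true → value-at i (x , y) ≡ value-at i (x' , y)
  value-x i x x' y h = cong (λ a → F (a , nth y₀ y i)) (VX.suffixV-nth i i x x' h ℕ.≤-refl)

  value-y : ∀ i (y y' : Vec Y n) x → VY.prefixV (suc i) y y' ≡ true → value-at i (x , y) ≡ value-at i (x , y')
  value-y i y y' x h = cong (λ b → F (nth x₀ x i , b)) (VY.prefixV-nth (suc i) i y y' h ℕ.≤-refl)

  module Tl = Tilt Xs Ys (finite-∈ (VX.vec-finite n)) (finite-∈ (VY.vec-finite n)) VX.suffixV VY.prefixV VX.suffixV-equiv VY.prefixV-equiv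
   suffix-pred prefix-pred transcript (on-equiv (historyOf bitAt T) ==ᴸ-equiv) transcript-rectangle
   base base≥0 base-swap value-at value-x value-y

  Z : ℚ
  Z = Sum Tl.Ωs (Tl.weight n)

  signs : ∀ {m} → ℕ → ℕ → Vec X m → Vec Y m → ℚ
  signs zero    i xs ys = 1ℚ
  signs (suc k) i xs ys = sg (F (nth x₀ xs i , nth y₀ ys i)) * signs k (suc i) xs ys

  rest≡signs : ∀ k i xs ys → Tl.rest k i (xs , ys) ≡ signs k i xs ys
  rest≡signs zero    i xs ys = refl
  rest≡signs (suc k) i xs ys = cong (sg (F (nth x₀ xs i , nth y₀ ys i)) *_) (rest≡signs k (suc i) xs ys)

  signs-shift : ∀ {m} k i x y (xs : Vec X m) (ys : Vec Y m) → signs k (suc i) (x ∷ xs) (y ∷ ys) ≡ signs k i xs ys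
  signs-shift zero    i x y xs ys = refl
  signs-shift (suc k) i x y xs ys = cong (sg (F (nth x₀ xs i , nth y₀ ys i)) *_) (signs-shift k (suc i) x y xs ys)

  signs-xor : ∀ {m} (xs : Vec X m) (ys : Vec Y m) → signs m 0 xs ys ≡ sg (xor-power m F (xs , ys))
  signs-xor [] [] = refl
  signs-xor {suc m} (x ∷ xs) (y ∷ ys) = trans (cong (sg (F (x , y)) *_) (trans (signs-shift m 0 x y xs ys) (signs-xor xs ys))) (sym (sg-xor (F (x , y)) (xor-power m F (xs , ys))))

  correlation : ℚ
  correlation = Sum Tl.Ωs (λ ω → base ω * (sg (xor-power n F ω) * sg (run tree (proj₁ ω) (proj₂ ω))))

  correlation≤Z : correlation ≤ Z
  correlation≤Z = ≡≤ (Sum-cong Tl.Ωs (λ ω → cong (base ω *_) (trans (sym (*-identityˡ _)) (cong (1ℚ *_) (cong₂ _*_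
     (sym (trans (rest≡signs n 0 (proj₁ ω) (proj₂ ω)) (signs-xor (proj₁ ω) (proj₂ ω)))) (cong sg (result≡ depth≤T ω)))))))
   (≤≡ (Tl.total (result T) (λ {ω} {ω'} h → cong outputOf (same-node T ω ω' (==ᴸ-sound (historyOf bitAt T ω) (historyOf bitAt T ω') h))) n 0)
    (cong (λ j → Sum Tl.Ωs (Tl.weight j)) (ℕ.+-identityʳ n)))

  module _ (large : 1ℚ ≤ correlation * (1ℚ + η) ^ n) where

   private
    B>0 : 0ℚ < (1ℚ + η) ^ n
    B>0 = go n
     where
     go : ∀ n → 0ℚ < (1ℚ + η) ^ n
     go zero    = 0<1
     go (suc n) = 0<* (0<1+ (<⇒≤ 0<η)) (go n)

    large' : 1ℚ ≤ Z * (1ℚ + η) ^ n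
    large' = ≤-trans large (*≤ʳ (<⇒≤ B>0) correlation≤Z)

   Z>0 : 0ℚ < Z
   Z>0 with 0ℚ <? Z
   ... | yes p = p
   ... | no ¬p = ⊥-elim (<-irrefl (<-≤-trans 0<1 (≤-trans large' (≤≡ (*≤ʳ (<⇒≤ B>0) (≮⇒≥ ¬p)) (zeroˡ _)))))

   power-log : ∀ n → LogLe ((1ℚ + η) ^ n) (nat n * η)
   power-log zero    = log-mono (≤-reflexive (sym (trans (cong (_* η) nat-0) (zeroˡ η)))) log-1
   power-log (suc n) = log-mono (≤-reflexive (trans (solve 2 (λ e s → :1 :+ e :- :1 :+ s :* e := (:1 :+ s) :* e) refl η (nat n)) (cong (_* η) (sym (nat-suc n)))))
    (log-* (log-linear (0<1+ (<⇒≤ 0<η))) (power-log n))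

   -- 1/Z is (1 + η)^n times a number c ≤ 1. The n equal factors contribute η each, and c - 1 is at
   -- most 0.
   Z-log : LogLe (inv Z) (nat n * η)
   Z-log = log-mono (≤≡ (+≤ˡ (nat n * η) (≤≡ (+≤ʳ (- 1ℚ) c≤1) (+-inverseʳ 1ℚ))) (+-identityʳ _))
    (subst (λ z → LogLe z (nat n * η + (c - 1ℚ))) eq (log-* (power-log n) (log-linear {c} (0<* (0<inv Z>0) (0<inv B>0)))))
    where
    P = (1ℚ + η) ^ n
    c = inv Z * inv P
    eq : P * c ≡ inv Z
    eq = trans (solve 3 (λ p z q → p :* (z :* q) := z :* p :* q) refl P (inv Z) (inv P)) (*inv-cancel B>0)
    c≤1 : c ≤ 1ℚ
    c≤1 = ≤≡ (≡≤ (sym (inv-* Z>0 B>0)) (inv-anti 0<1 large')) inv-1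

   w : Tl.Ω → ℚ
   w ω = inv Z * Tl.weight n ω

   experiment : Experiment
   experiment = record
    { Ω = Tl.Ω ; X = X ; Y = Y ; Ωs = Tl.Ωs
    ; w = w
    ; w≥0 = λ ω → 0≤* (<⇒≤ (0<inv Z>0)) (Tl.weight≥0 n ω)
    ; Ωs-all = Tl.Ωs-all
    ; w-total = trans (Sum-*ˡ (inv Z) Tl.Ωs) (trans (*-comm (inv Z) Z) (*inv Z>0))
    ; 𝕏 = 𝕏 ; 𝕐 = 𝕐 ; n = n ; T = T
    ; x = λ i ω → nth x₀ (proj₁ ω) i
    ; y = λ i ω → nth y₀ (proj₂ ω) i
    ; suffix = λ i → VX.suffixV i on proj₁
    ; prefix = λ i → VY.prefixV i on proj₂
    ; suffix-equiv = λ i → on-equiv proj₁ (VX.suffixV-equiv i)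
    ; prefix-equiv = λ i → on-equiv proj₂ (VY.prefixV-equiv i)
    ; suffix-suc = λ i ω ω' → VX.suffixV-suc i (proj₁ ω) (proj₁ ω')
    ; prefix-suc = λ i ω ω' → VY.prefixV-suc i (proj₂ ω) (proj₂ ω')
    ; suffix-n = λ ω ω' → VX.suffixV-full (proj₁ ω) (proj₁ ω')
    ; prefix-0 = λ ω ω' → refl
    ; m = bitAt
    ; owner = ownerAt
    ; alice-speaks = alice-speaks
    ; bob-speaks = bob-speaks
    ; point = point
    ; μ = μ ; μ≥0 = μ≥0 ; μ-total = μ-total
    ; β = λ i ω → abs (Tl.bias i ω)
    ; β≥0 = λ i ω → abs-0≤ (Tl.bias i ω)
    ; Z⁻¹ = inv Z ; lam = nat n * η
    ; Z⁻¹≥0 = <⇒≤ (0<inv Z>0)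
    ; Z-log = Z-log
    ; density = λ ω → cong (inv Z *_) (Tl.weight-Prod n ω)
    }
    where
    alice-speaks : ∀ t {ω ω'} → ownerAt (historyOf bitAt t ω) ≡ true → VX.suffixV 0 (proj₁ ω) (proj₁ ω') ≡ true → (historyOf bitAt t ω ==ᴸ historyOf bitAt t ω') ≡ true → bitAt t ω ≡ bitAt t ω'
    alice-speaks t {ω} {ω'} o h k = trans (alice-bit (current t ω) (proj₂ ω) (proj₂ ω') (trans (sym (cong aliceOwns (nodeAt-history t ω))) o))
     (cong₂ (λ N x → bitOf N x (proj₂ ω')) (same-node t ω ω' (==ᴸ-sound (historyOf bitAt t ω) (historyOf bitAt t ω') k)) (VX.eqV-sound (proj₁ ω) (proj₁ ω') h))
    bob-speaks : ∀ t {ω ω'} → ownerAt (historyOf bitAt t ω) ≡ false → VY.prefixV n (proj₂ ω) (proj₂ ω') ≡ true → (historyOf bitAt t ω ==ᴸ historyOf bitAt t ω') ≡ true → bitAt t ω ≡ bitAt t ω'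
    bob-speaks t {ω} {ω'} o h k = trans (bob-bit (current t ω) (proj₁ ω) (proj₁ ω') (trans (sym (cong aliceOwns (nodeAt-history t ω))) o))
     (cong₂ (λ N y → bitOf N (proj₁ ω') y) (same-node t ω ω' (==ᴸ-sound (historyOf bitAt t ω) (historyOf bitAt t ω') k)) (VY.prefixV-sound (proj₂ ω) (proj₂ ω') h))
    point : ∀ ω → Sum Tl.Ωs (λ ω' → w ω' * ⟦ VX.suffixV 0 (proj₁ ω) (proj₁ ω') ∧ VY.prefixV n (proj₂ ω) (proj₂ ω') ∧ (historyOf bitAt T ω ==ᴸ historyOf bitAt T ω') ⟧) ≡ w ω
    point (xs , ys) = trans (Sum-× Xs Ys) (trans (Sum-cong Xs (λ xs' → trans (Sum-cong Ys (λ ys' → trans (cong (λ b → w (xs' , ys') * ⟦ b ⟧) (same xs' ys')) (trans (cong (w (xs' , ys') *_) (⟦∧⟧ (VX.eqV xs xs') (VY.eqV ys ys')))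
       (solve 3 (λ a b c → a :* (b :* c) := b :* (c :* a)) refl (w (xs' , ys')) ⟦ VX.eqV xs xs' ⟧ ⟦ VY.eqV ys ys' ⟧)))) (trans (Sum-*ˡ ⟦ VX.eqV xs xs' ⟧ Ys) (cong (⟦ VX.eqV xs xs' ⟧ *_) (Finite-lemmas.pick (VY.vec-finite n) (λ ys' → w (xs' , ys')) ys)))))
     (Finite-lemmas.pick (VX.vec-finite n) (λ xs' → w (xs' , ys)) xs))
     where
     same : ∀ xs' ys' → (VX.eqV xs xs' ∧ VY.prefixV n ys ys' ∧ (historyOf bitAt T (xs , ys) ==ᴸ historyOf bitAt T (xs' , ys'))) ≡ VX.eqV xs xs' ∧ VY.eqV ys ys'
     same xs' ys' = bool-ext
      (λ h → let h₁ , h₂ = ∧-split (VX.eqV xs xs') h in cong₂ _∧_ h₁ (Finite-lemmas.==-≡ (VY.vec-finite n) (VY.prefixV-sound ys ys' (proj₁ (∧-split (VY.prefixV n ys ys') h₂)))))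
      (λ h → let h₁ , h₂ = ∧-split (VX.eqV xs xs') h in full (VX.eqV-sound xs xs' h₁) (VY.eqV-sound ys ys' h₂))
      where
      full : ∀ {xs' ys'} → xs ≡ xs' → ys ≡ ys' → (VX.eqV xs xs' ∧ VY.prefixV n ys ys' ∧ (historyOf bitAt T (xs , ys) ==ᴸ historyOf bitAt T (xs' , ys'))) ≡ true
      full refl refl = cong₂ _∧_ (re VX.eqV-equiv xs) (cong₂ _∧_ (re (VY.prefixV-equiv n) ys) (re ==ᴸ-equiv (historyOf bitAt T (xs , ys))))

   module I = Information experiment

   ⟦not⟧-sg : ∀ b → ⟦ not b ⟧ ≡ ½' * (1ℚ + sg b)
   ⟦not⟧-sg true  = sym (trans (cong (½' *_) (+-inverseʳ 1ℚ)) (zeroʳ _))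
   ⟦not⟧-sg false = sym (half-sum 1ℚ)

   -- By `agreement` the probability is (1 + A)/2 with A = 1 - `β-loss i`, that is, 1 minus half of
   -- the loss.
   bits-good : ∀ i → i ∈ downFrom n → 1ℚ - I.β-loss i ≤
    I.𝔼 (λ ω → ⟦ not ((Tl.guess i ω xor Tl.guess (suc i) ω) xor F (nth x₀ (proj₁ ω) i , nth y₀ (proj₂ ω) i)) ⟧)
   bits-good i i∈ = ≤≡ (≤≡ (-≤ ≤-refl (≤≡ (*≤ʳ 0≤loss ½≤1) (*-identityˡ _))) loss≡) (sym value≡)
    where
    0≤loss : 0ℚ ≤ I.β-loss i
    0≤loss = I.𝔼-≥0 (λ ω → 0≤- (Tl.abs-bias≤1 i ω))
    ½≤1 : ½' ≤ 1ℚ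
    ½≤1 = ≤-by ½' 0≤½' ½+½
    A : ℚ
    A = I.𝔼 (λ ω → abs (Tl.bias i ω))
    loss≡ : 1ℚ - ½' * I.β-loss i ≡ ½' * (1ℚ + A)
    loss≡ = trans (cong (λ z → 1ℚ - ½' * z) (trans I.𝔼-- (cong (λ z → z - A) I.𝔼1)))
     (trans (cong (λ z → z - ½' * (1ℚ - A)) (sym ½+½)) (solve 2 (λ h a → h :+ h :- h :* (:1 :- a) := h :* (:1 :+ a)) refl ½' A))
    i<n : ∀ m → i ∈ downFrom m → i ℕ.< m
    i<n (suc m) (here refl) = ℕ.≤-refl
    i<n (suc m) (there h)   = ℕ.m≤n⇒m≤1+n (i<n m h)
    k = n ℕ.∸ i
    n≡ : k ℕ.+ i ≡ n
    n≡ = ℕ.m∸n+n≡m (ℕ.<⇒≤ (i<n n i∈))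
    S : Tl.Ω → ℚ
    S ω = sg (value-at i ω) * sg (Tl.guess i ω) * sg (Tl.guess (suc i) ω)
    agree : I.𝔼 S ≡ A
    agree = trans (pull S) (trans (cong (inv Z *_) (subst (λ j → Sum Tl.Ωs (λ ω → Tl.weight j ω * S ω) ≡ Sum Tl.Ωs (λ ω → Tl.weight j ω * abs (Tl.bias i ω))) n≡ (Tl.agreement k i))) (sym (pull _)))
     where
     pull : ∀ f → I.𝔼 f ≡ inv Z * Sum Tl.Ωs (λ ω → Tl.weight n ω * f ω)
     pull f = trans (Sum-cong Tl.Ωs (λ ω → *-assoc (inv Z) (Tl.weight n ω) (f ω))) (Sum-*ˡ (inv Z) Tl.Ωs)
    value≡ : I.𝔼 (λ ω → ⟦ not ((Tl.guess i ω xor Tl.guess (suc i) ω) xor F (nth x₀ (proj₁ ω) i , nth y₀ (proj₂ ω) i)) ⟧) ≡ ½' * (1ℚ + A)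
    value≡ = trans (I.𝔼-cong (λ ω → trans (⟦not⟧-sg ((Tl.guess i ω xor Tl.guess (suc i) ω) xor value-at i ω)) (cong (λ z → ½' * (1ℚ + z)) (trans (sg-xor (Tl.guess i ω xor Tl.guess (suc i) ω) (value-at i ω)) (trans (cong (_* sg (value-at i ω)) (sg-xor (Tl.guess i ω) (Tl.guess (suc i) ω)))
       (solve 3 (λ a b c → a :* b :* c := c :* a :* b) refl (sg (Tl.guess i ω)) (sg (Tl.guess (suc i) ω)) (sg (value-at i ω))))))))
     (trans (I.𝔼-*ˡ ½') (cong (½' *_) (trans I.𝔼-+ (cong₂ _+_ I.𝔼1 agree))))

   simulation : 0ℚ < nat n → ∀ R L S → 0ℚ < nat R → T ℕ.< 2 ℕ.^ L →
    nat 32 * nat T * (nat n * η + nat T) ≤ nat n * ((1/32 * nat R) * (1/32 * nat R)) →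
    nat R * ((1ℚ - ½' ^ 3) ^ S * two ^ L) ≤ 1/64 →
    ∃ λ (t : Tree X Y) → depth t ℕ.≤ R ℕ.* (S ℕ.* 18) ℕ.+ 2 ×
     7/8 ≤ Sum (Finite.values 𝕏) (λ a → Sum (Finite.values 𝕐) (λ b → μ a b * ⟦ not (run t a b xor F (a , b)) ⟧))
   simulation n>0 R L S R>0 T<2^L h₁ h₂ = Selection.good-tree experiment (λ a b → F (a , b)) default Tl.guess
    (λ i h → Tl.guess-inv i h) Tl.abs-bias≤1 bits-good n>0 refl R L S R>0 T<2^L h₁ h₂
    where
    default : Tl.Ω
    default = replicate n x₀ , replicate n y₀

-- Replacing a short protocol by its best leaf.

module LeafSelection where

 open Arithmetic
 open LogBounds
 open Tilting
 open NoisySearch using (½'; half-sum)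
 open import Defs using (Tree; output; alice; bob; depth; run)

 private
  variable
   a b : ℚ

 ^-+ : ∀ a m n → a ^ (m ℕ.+ n) ≡ a ^ m * a ^ n
 ^-+ a zero    n = sym (*-identityˡ _)
 ^-+ a (suc m) n = trans (cong (a *_) (^-+ a m n)) (sym (*-assoc a _ _))

 ^-distrib-* : ∀ a b n → (a * b) ^ n ≡ a ^ n * b ^ n
 ^-distrib-* a b zero    = sym (*-identityˡ 1ℚ)
 ^-distrib-* a b (suc n) = trans (cong (a * b *_) (^-distrib-* a b n)) (solve 4 (λ a b p q → a :* b :* (p :* q) := a :* p :* (b :* q)) refl a b (a ^ n) (b ^ n))

 ^-^ : ∀ a m n → a ^ (m ℕ.* n) ≡ (a ^ n) ^ m
 ^-^ a zero    n = refl
 ^-^ a (suc m) n = trans (^-+ a n (m ℕ.* n)) (cong (a ^ n *_) (^-^ a m n))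

 ^-mono : 0ℚ ≤ a → a ≤ b → ∀ n → a ^ n ≤ b ^ n
 ^-mono h k zero    = ≤-refl
 ^-mono h k (suc n) = *≤ h k (^-nonneg h n) (^-mono h k n)

 1≤^ : 1ℚ ≤ a → ∀ n → 1ℚ ≤ a ^ n
 1≤^ h zero    = ≤-refl
 1≤^ h (suc n) = ≡≤ (sym (*-identityˡ 1ℚ)) (*≤ 0≤1 h 0≤1 (1≤^ h n))

 ^-expo : 1ℚ ≤ a → ∀ {m n} → m ℕ.≤ n → a ^ m ≤ a ^ n
 ^-expo {a} h {m} le with ℕ.m≤n⇒∃[o]m+o≡n le
 ... | o , refl = ≤≡ (≡≤ (sym (*-identityʳ _)) (*≤ˡ (^-nonneg (≤-trans 0≤1 h) m) (1≤^ h o))) (sym (^-+ a m o))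

 nat-2 : nat 2 ≡ two
 nat-2 = trans (nat-suc 1) (cong (1ℚ +_) nat-1)

 nat-2^ : ∀ n → nat (2 ℕ.^ n) ≡ two ^ n
 nat-2^ zero    = nat-1
 nat-2^ (suc n) = trans (nat-* 2 (2 ℕ.^ n)) (cong₂ _*_ nat-2 (nat-2^ n))

 ½*2 : ½' * two ≡ 1ℚ
 ½*2 = half-sum 1ℚ

 ½^*2^ : ∀ n → ½' ^ n * two ^ n ≡ 1ℚ
 ½^*2^ zero    = *-identityˡ 1ℚ
 ½^*2^ (suc n) = trans (solve 4 (λ a b c d → a :* b :* (c :* d) := a :* c :* (b :* d)) refl ½' (½' ^ n) two (two ^ n)) (trans (cong₂ _*_ ½*2 (½^*2^ n)) (*-identityˡ 1ℚ))

 bernoulli : ∀ {h} → 0ℚ ≤ h → ∀ n → 1ℚ + nat n * h ≤ (1ℚ + h) ^ n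
 bernoulli {h} h≥0 zero    = ≤-reflexive (trans (cong (λ z → 1ℚ + z * h) nat-0) (solve 1 (λ h → :1 :+ :0 :* h := :1) refl h))
 bernoulli {h} h≥0 (suc n) = ≤-trans (≤-by (nat n * h * h) (0≤* (0≤* (0≤nat n) h≥0) h≥0) (trans (cong (λ z → 1ℚ + z * h + nat n * h * h) (nat-suc n))
    (solve 2 (λ n h → :1 :+ (:1 :+ n) :* h :+ n :* h :* h := (:1 :+ h) :* (:1 :+ n :* h)) refl (nat n) h)))
  (*≤ˡ (0≤+ 0≤1 h≥0) (bernoulli h≥0 n))

 branch : ∀ s c (e : Bool → ℚ) → ⟦ s ⟧ * e c ≡ ⟦ s ∧ c ⟧ * e true + ⟦ s ∧ not c ⟧ * e false
 branch true  true  e = solve 2 (λ t f → :1 :* t := :1 :* t :+ :0 :* f) refl (e true) (e false)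
 branch true  false e = solve 2 (λ t f → :1 :* f := :0 :* t :+ :1 :* f) refl (e true) (e false)
 branch false c     e = trans (zeroˡ (e c)) (solve 2 (λ t f → :0 := :0 :* t :+ :0 :* f) refl (e true) (e false))

 ≤abs : ∀ a s → sg s * a ≤ abs a
 ≤abs a s with isNeg a in eq
 ≤abs a false | false = ≤-refl
 ≤abs a true  | true  = ≤-refl
 ≤abs a true  | false = ≤≡ (≤-by (a + a) (0≤+ 0≤a 0≤a) (solve 1 (λ a → (:- :1) :* a :+ (a :+ a) := a) refl a)) (sym (*-identityˡ a))
  where
  0≤a : 0ℚ ≤ a
  0≤a = subst (0ℚ ≤_) (trans (cong (λ s → sg s * a) eq) (*-identityˡ a)) (abs-0≤ a)
 ≤abs a false | true = ≤-by (c + c) (0≤+ 0≤c 0≤c) (solve 1 (λ a → :1 :* a :+ ((:- :1) :* a :+ (:- :1) :* a) := (:- :1) :* a) refl a)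
  where
  c = (- 1ℚ) * a
  0≤c : 0ℚ ≤ c
  0≤c = subst (0ℚ ≤_) (cong (λ s → sg s * a) eq) (abs-0≤ a)

 module BestLeaf {A B : Set} (Ωs : List (A × B)) (W : A × B → ℚ) where

  mass : (A × B → ℚ) → ℚ
  mass G = Sum Ωs (λ ω → W ω * G ω)

  rectangle : (A → Bool) → (B → Bool) → A × B → ℚ
  rectangle SA SB (a , b) = ⟦ SA a ⟧ * ⟦ SB b ⟧

  outcome : Tree A B → A × B → ℚ
  outcome t (a , b) = sg (run t a b)

  inside : Tree A B → (A → Bool) → (B → Bool) → ℚ
  inside t SA SB = mass (λ ω → rectangle SA SB ω * outcome t ω)

  mass-cong : ∀ {F G} → (∀ ω → F ω ≡ G ω) → mass F ≡ mass G
  mass-cong h = Sum-cong Ωs (λ ω → cong (W ω *_) (h ω))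

  mass-+ : ∀ {F G} → mass (λ ω → F ω + G ω) ≡ mass F + mass G
  mass-+ = trans (Sum-cong Ωs (λ ω → distribˡ (W ω) _ _)) (Sum-+ Ωs)

  mass-*ʳ : ∀ {F} c → mass (λ ω → F ω * c) ≡ mass F * c
  mass-*ʳ c = trans (Sum-cong Ωs (λ ω → sym (*-assoc (W ω) _ c))) (Sum-*ʳ c Ωs)

  larger : ∀ {p q b₁ b₂ c : ℚ} → 0ℚ ≤ c → p ≤ c * b₁ → q ≤ c * b₂ → p + q ≤ two * c * b₁ ⊎ p + q ≤ two * c * b₂
  larger {p} {q} {b₁} {b₂} {c} h k₁ k₂ with ≤-total b₁ b₂
  ... | inj₁ l = inj₂ (≤≡ (+-mono-≤ (≤-trans k₁ (*≤ˡ h l)) k₂) (solve 2 (λ c b → c :* b :+ c :* b := :2 :* c :* b) refl c b₂))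
  ... | inj₂ l = inj₁ (≤≡ (+-mono-≤ k₁ (≤-trans k₂ (*≤ˡ h l))) (solve 2 (λ c b → c :* b :+ c :* b := :2 :* c :* b) refl c b₁))

  -- The contribution of a node is the sum of those of its two children, so following the child with
  -- the larger bound loses a factor of 2 per level.
  heavy-leaf : ∀ d t → depth t ℕ.≤ d → ∀ SA SB → ∃ λ SA' → ∃ λ SB' → inside t SA SB ≤ two ^ d * abs (mass (rectangle SA' SB'))
  heavy-leaf d (output c) le SA SB = SA , SB , ≡≤ (trans (mass-*ʳ (sg c)) (*-comm _ (sg c)))
   (≤-trans (≤abs (mass (rectangle SA SB)) c) (≡≤ (sym (*-identityˡ _)) (*≤ʳ (abs-0≤ (mass (rectangle SA SB))) (1≤^ (≤-by-- 0≤1 (solve 0 (:2 :- :1 := :1) refl)) d))))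
  heavy-leaf (suc d) (alice m k) (s≤s le) SA SB = pick (heavy-leaf d (k true) (ℕ.≤-trans (ℕ.m≤n⊔m _ _) le) (λ a → SA a ∧ m a) SB) (heavy-leaf d (k false) (ℕ.≤-trans (ℕ.m≤m⊔n _ _) le) (λ a → SA a ∧ not (m a)) SB)
   where
   split : inside (alice m k) SA SB ≡ inside (k true) (λ a → SA a ∧ m a) SB + inside (k false) (λ a → SA a ∧ not (m a)) SB
   split = trans (mass-cong (λ { (a , b) → trans (solve 3 (λ s t e → s :* t :* e := t :* (s :* e)) refl ⟦ SA a ⟧ ⟦ SB b ⟧ (sg (run (k (m a)) a b)))
    (trans (cong (⟦ SB b ⟧ *_) (branch (SA a) (m a) (λ c → sg (run (k c) a b))))
     (solve 5 (λ t p x q y → t :* (p :* x :+ q :* y) := p :* t :* x :+ q :* t :* y) refl ⟦ SB b ⟧ ⟦ SA a ∧ m a ⟧ (sg (run (k true) a b)) ⟦ SA a ∧ not (m a) ⟧ (sg (run (k false) a b)))) })) mass-+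
   pick : _ → _ → _
   pick (A₁ , B₁ , h₁) (A₂ , B₂ , h₂) with larger (^-nonneg (<⇒≤ 0<two) d) h₁ h₂
   ... | inj₁ h = A₁ , B₁ , ≡≤ split h
   ... | inj₂ h = A₂ , B₂ , ≡≤ split h
  heavy-leaf (suc d) (bob m k) (s≤s le) SA SB = pick (heavy-leaf d (k true) (ℕ.≤-trans (ℕ.m≤n⊔m _ _) le) SA (λ b → SB b ∧ m b)) (heavy-leaf d (k false) (ℕ.≤-trans (ℕ.m≤m⊔n _ _) le) SA (λ b → SB b ∧ not (m b)))
   where
   split : inside (bob m k) SA SB ≡ inside (k true) SA (λ b → SB b ∧ m b) + inside (k false) SA (λ b → SB b ∧ not (m b))
   split = trans (mass-cong (λ { (a , b) → trans (*-assoc ⟦ SA a ⟧ ⟦ SB b ⟧ (sg (run (k (m b)) a b)))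
    (trans (cong (⟦ SA a ⟧ *_) (branch (SB b) (m b) (λ c → sg (run (k c) a b))))
     (solve 5 (λ t p x q y → t :* (p :* x :+ q :* y) := t :* p :* x :+ t :* q :* y) refl ⟦ SA a ⟧ ⟦ SB b ∧ m b ⟧ (sg (run (k true) a b)) ⟦ SB b ∧ not (m b) ⟧ (sg (run (k false) a b)))) })) mass-+
   pick : _ → _ → _
   pick (A₁ , B₁ , h₁) (A₂ , B₂ , h₂) with larger (^-nonneg (<⇒≤ 0<two) d) h₁ h₂
   ... | inj₁ h = A₁ , B₁ , ≡≤ split h
   ... | inj₂ h = A₂ , B₂ , ≡≤ split h

  module _ (SA : A → Bool) (SB : B → Bool) where

   G₁ G₂ G₃ : A × B → ℚ
   G₁ (a , b) = ⟦ not (SA a) ⟧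
   G₂ (a , b) = ⟦ SA a ⟧ * ⟦ not (SB b) ⟧
   G₃ = rectangle SA SB

   -- A constant output outside the rectangle could cancel what is gained inside. Each of the three
   -- pieces gets the sign of its own mass instead, so that all contributions are nonnegative.
   guess-tree : Tree A B
   guess-tree = alice SA (λ a → if a then bob SB (λ b → if b then output (isNeg (mass G₃)) else output (isNeg (mass G₂))) else output (isNeg (mass G₁)))

   guess-tree-mass : mass (outcome guess-tree) ≡ abs (mass G₃) + abs (mass G₂) + abs (mass G₁)
   guess-tree-mass = trans (mass-cong point) (trans mass-+ (cong₂ _+_ (trans mass-+ (cong₂ _+_ (signed G₃) (signed G₂))) (signed G₁)))
    where
    signed : ∀ G → mass (λ ω → G ω * sg (isNeg (mass G))) ≡ abs (mass G)
    signed G = trans (mass-*ʳ _) (sg*abs (mass G))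
    e₁ = isNeg (mass G₁)
    e₂ = isNeg (mass G₂)
    e₃ = isNeg (mass G₃)
    point : ∀ ω → outcome guess-tree ω ≡ G₃ ω * sg e₃ + G₂ ω * sg e₂ + G₁ ω * sg e₁
    point (a , b) with SA a
    ... | false = solve 5 (λ x y z p q → z := :0 :* p :* x :+ :0 :* q :* y :+ :1 :* z) refl (sg e₃) (sg e₂) (sg e₁) ⟦ SB b ⟧ ⟦ not (SB b) ⟧
    ... | true with SB b
    ...   | true  = solve 3 (λ x y z → x := :1 :* :1 :* x :+ :1 :* :0 :* y :+ :0 :* z) refl (sg e₃) (sg e₂) (sg e₁)
    ...   | false = solve 3 (λ x y z → y := :1 :* :0 :* x :+ :1 :* :1 :* y :+ :0 :* z) refl (sg e₃) (sg e₂) (sg e₁)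

  two-bits : ∀ {T} t → depth t ℕ.≤ T → ∃ λ t' → depth t' ≡ 2 × mass (outcome t) ≤ two ^ T * mass (outcome t')
  two-bits {T} t le = let SA , SB , h = heavy-leaf T t le (λ _ → true) (λ _ → true) in guess-tree SA SB , refl ,
    ≡≤ (mass-cong (λ { (a , b) → trans (sym (*-identityˡ _)) (cong (_* sg (run t a b)) (sym (*-identityˡ 1ℚ))) }))
    (≤-trans h (*≤ˡ (^-nonneg (<⇒≤ 0<two) T) (≤≡ (≤≡ (≤-by+ˡ (0≤+ (abs-0≤ (mass (G₂ SA SB))) (abs-0≤ (mass (G₁ SA SB))))) (sym (+-assoc _ _ _))) (sym (guess-tree-mass SA SB)))))

-- Numerical parameters for the two ranges of T.

module Parameters where

 open Arithmetic
 open LogBounds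
 open Classes
 open Tilting
 open NoisySearch using (½'; 0≤½'; ½+½)
 open CoordinateSelection using (η; 0<η; 1/32; 1/64; 7/8)
 open ProductInstance
 open LeafSelection
 open import Defs using (Tree; depth; run; xor-power)
 open import Data.Nat.Solver using (module +-*-Solver)
 open +-*-Solver using () renaming (solve to solveᴺ; con to conᴺ; _:*_ to _:×_; _:+_ to _:⊕_; _:=_ to _:≡_)
 open import Data.Vec using (Vec)

 threshold : ∀ {P : ℕ → Set} → (∀ j → Dec (P j)) → ¬ P 0 → ∀ m → P m → ∃ λ r → ¬ P r × P (suc r)
 threshold P? ¬P0 zero    Pm = ⊥-elim (¬P0 Pm)
 threshold P? ¬P0 (suc m) Pm with P? m
 ... | yes p = threshold P? ¬P0 m p
 ... | no ¬p = m , ¬p , Pm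

 positive : ∀ m {n k} → n ℕ.< m ℕ.* k → 1 ℕ.≤ m
 positive (suc m) h = s≤s z≤n

 sq-cancel-≤ᴺ : ∀ {m n} → m ℕ.* m ℕ.≤ n ℕ.* n → m ℕ.≤ n
 sq-cancel-≤ᴺ {m} {n} h with m ℕ.≤? n
 ... | yes p = p
 ... | no ¬p = ⊥-elim (ℕ.<-irrefl refl (ℕ.<-≤-trans (ℕ.*-mono-< (ℕ.≰⇒> ¬p) (ℕ.≰⇒> ¬p)) h))

 -- With K = 2 s q M, `short` is the square of T ℓ K ≤ q c √n, stated without roots. R will be about
 -- s T/√n, and M is the number of bits allowed per round and unit of ℓ.
 module _ (s q M T n ℓ c : ℕ) (s≥1 : 1 ℕ.≤ s) (q≥1 : 1 ℕ.≤ q) (n≥1 : 1 ℕ.≤ n)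
  (short : T ℕ.* T ℕ.* (ℓ ℕ.* ℓ) ℕ.* (2 ℕ.* s ℕ.* q ℕ.* M ℕ.* (2 ℕ.* s ℕ.* q ℕ.* M)) ℕ.≤ c ℕ.* c ℕ.* n ℕ.* (q ℕ.* q)) where

  -- R is where n R² first reaches (s T)². As n < (s T)², R exceeds 1 and is at most 2 (R - 1). The
  -- failure of the inequality at R - 1 combines with `short` to (R - 1) ℓ 2M ≤ c.
  rounds : n ℕ.< T ℕ.* T ℕ.* (s ℕ.* s) → ∃ λ R → 1 ℕ.≤ R × T ℕ.* T ℕ.* (s ℕ.* s) ℕ.≤ n ℕ.* (R ℕ.* R) × R ℕ.* ℓ ℕ.* M ℕ.≤ c
  rounds n< = finish (threshold {P = Enough} (λ j → _ ℕ.≤? _) not-0 (s ℕ.* T) at-sT)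
   where
   Enough : ℕ → Set
   Enough j = T ℕ.* T ℕ.* (s ℕ.* s) ℕ.≤ n ℕ.* (j ℕ.* j)
   not-0 : ¬ Enough 0
   not-0 h = ℕ.<-irrefl refl (ℕ.<-≤-trans n< (ℕ.≤-trans h (≡≤ᴺ (ℕ.*-zeroʳ n) z≤n)))
   at-sT : Enough (s ℕ.* T)
   at-sT = ≡≤ᴺ (solveᴺ 2 (λ s t → t :× t :× (s :× s) :≡ conᴺ 1 :× (s :× t :× (s :× t))) refl s T) (ℕ.*-monoˡ-≤ _ n≥1)
   finish : (∃ λ r → ¬ Enough r × Enough (suc r)) → _
   finish (zero , _ , h) = ⊥-elim (ℕ.<-irrefl refl (ℕ.<-≤-trans n< (≤≡ᴺ h (ℕ.*-identityʳ n))))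
   finish (suc r' , ¬h , h) = suc r , s≤s z≤n , h , ℕ.≤-trans (≤≡ᴺ (ℕ.*-monoˡ-≤ M (ℕ.*-monoˡ-≤ ℓ R≤2r)) (solveᴺ 3 (λ r l m → conᴺ 2 :× r :× l :× m :≡ r :× l :× (conᴺ 2 :× m)) refl r ℓ M)) r-bound
    where
    r = suc r'
    R≤2r : suc r ℕ.≤ 2 ℕ.* r
    R≤2r = ℕ.≤-trans (ℕ.+-monoˡ-≤ r (s≤s z≤n)) (ℕ.+-monoʳ-≤ r (ℕ.≤-reflexive (sym (ℕ.+-identityʳ r))))
    K = 2 ℕ.* s ℕ.* q ℕ.* M
    squares : (r ℕ.* ℓ ℕ.* K) ℕ.* (r ℕ.* ℓ ℕ.* K) ℕ.* n ℕ.≤ (s ℕ.* q ℕ.* c) ℕ.* (s ℕ.* q ℕ.* c) ℕ.* n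
    squares = ≡≤ᴺ (solveᴺ 4 (λ r l k n → (r :× l :× k) :× (r :× l :× k) :× n :≡ n :× (r :× r) :× (l :× l :× (k :× k))) refl r ℓ K n)
     (ℕ.≤-trans (ℕ.*-monoˡ-≤ (ℓ ℕ.* ℓ ℕ.* (K ℕ.* K)) (ℕ.<⇒≤ (ℕ.≰⇒> ¬h)))
     (≡≤ᴺ (solveᴺ 4 (λ s t l k → t :× t :× (s :× s) :× (l :× l :× (k :× k)) :≡ s :× s :× (t :× t :× (l :× l) :× (k :× k))) refl s T ℓ K)
     (≤≡ᴺ (ℕ.*-monoʳ-≤ (s ℕ.* s) short)
      (solveᴺ 4 (λ s q c n → s :× s :× (c :× c :× n :× (q :× q)) :≡ (s :× q :× c) :× (s :× q :× c) :× n) refl s q c n))))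
    r-bound : r ℕ.* ℓ ℕ.* (2 ℕ.* M) ℕ.≤ c
    r-bound = ℕ.*-cancelˡ-≤ (s ℕ.* q) {{ℕ.>-nonZero (ℕ.*-mono-≤ s≥1 q≥1)}} (ℕ.≤-trans (ℕ.≤-reflexive
       (solveᴺ 5 (λ s q r l m → s :× q :× (r :× l :× (conᴺ 2 :× m)) :≡ r :× l :× (conᴺ 2 :× s :× q :× m)) refl s q r ℓ M))
     (sq-cancel-≤ᴺ (ℕ.*-cancelʳ-≤ _ _ n {{ℕ.>-nonZero n≥1}} squares)))

  length-bound : 1 ℕ.≤ ℓ → 1 ℕ.≤ M → T ℕ.≤ c ℕ.* n
  length-bound ℓ≥1 M≥1 = ℕ.*-cancelʳ-≤ T (c ℕ.* n) q {{ℕ.>-nonZero q≥1}} (ℕ.≤-trans T*q≤ (sq-cancel-≤ᴺ squares))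
   where
   K = 2 ℕ.* s ℕ.* q ℕ.* M
   T*q≤ : T ℕ.* q ℕ.≤ T ℕ.* ℓ ℕ.* K
   T*q≤ = ℕ.*-mono-≤ (≡≤ᴺ (sym (ℕ.*-identityʳ T)) (ℕ.*-monoʳ-≤ T ℓ≥1))
    (≡≤ᴺ (solveᴺ 1 (λ q → q :≡ conᴺ 1 :× q :× conᴺ 1) refl q) (ℕ.*-mono-≤ (ℕ.*-monoˡ-≤ q {1} {2 ℕ.* s} (ℕ.≤-trans s≥1 (ℕ.m≤m+n s _))) M≥1))
   squares : (T ℕ.* ℓ ℕ.* K) ℕ.* (T ℕ.* ℓ ℕ.* K) ℕ.≤ (c ℕ.* n ℕ.* q) ℕ.* (c ℕ.* n ℕ.* q)
   squares = ≡≤ᴺ (solveᴺ 3 (λ t l k → (t :× l :× k) :× (t :× l :× k) :≡ t :× t :× (l :× l) :× (k :× k)) refl T ℓ K)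
    (ℕ.≤-trans short (≡≤ᴺ (solveᴺ 3 (λ q c n → c :× c :× n :× (q :× q) :≡ q :× q :× c :× c :× n :× conᴺ 1) refl q c n)
     (≤≡ᴺ (ℕ.*-monoʳ-≤ (q ℕ.* q ℕ.* c ℕ.* c ℕ.* n) n≥1)
      (solveᴺ 3 (λ q c n → q :× q :× c :× c :× n :× n :≡ (c :× n :× q) :× (c :× n :× q)) refl q c n))))

 opaque
  unfolding _+_

  decay-rate : (1ℚ - ½' ^ 3) ^ 6 ≤ ½'
  decay-rate = decide

  0≤base : 0ℚ ≤ 1ℚ - ½' ^ 3
  0≤base = decide

  ½^6 : ½' ^ 6 ≤ 1/64
  ½^6 = decide

  η-halves : (1ℚ + ½' * η) * (1ℚ + inv (nat 4194304)) ≤ 1ℚ + η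
  η-halves = decide

  η-nat : nat 4194304 * η ≤ nat 8
  η-nat = decide

  1/32² : nat 288 ≤ nat 4194304 * (1/32 * 1/32)
  1/32² = decide

  two-round : ∀ {n} → 1ℚ ≤ n → nat 32 * nat 2 * (n * η + nat 2) ≤ n * ((1/32 * nat 512) * (1/32 * nat 512))
  two-round {n} h = ≤-trans (*≤ˡ (0≤nat 64) (+≤ˡ (n * η) (≡≤ (sym (*-identityˡ _)) (*≤ʳ (0≤nat 2) h))))
   (≡≤ (solve 4 (λ a n e t → a :* (n :* e :+ n :* t) := n :* (a :* (e :+ t))) refl (nat 64) n η (nat 2))
    (*≤ˡ (≤-trans 0≤1 h) (decide {nat 64 * (η + nat 2)} {(1/32 * nat 512) * (1/32 * nat 512)})))

 -- Six search steps halve the bound, as (7/8)^6 ≤ 1/2. Of the L + r + 6 halvings L cancel 2^L, r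
 -- cancel R and six leave 1/64.
 decay : ∀ {R} r L → R ℕ.≤ 2 ℕ.^ r → nat R * ((1ℚ - ½' ^ 3) ^ ((L ℕ.+ (r ℕ.+ 6)) ℕ.* 6) * two ^ L) ≤ 1/64
 decay {R} r L h = ≤-trans (*≤ˡ (0≤nat R) (*≤ʳ (^-nonneg (<⇒≤ 0<two) L) (≡≤ (^-^ _ (L ℕ.+ (r ℕ.+ 6)) 6) (^-mono (^-nonneg 0≤base 6) decay-rate (L ℕ.+ (r ℕ.+ 6))))))
  (≡≤ (trans (cong (λ z → nat R * (z * two ^ L)) (trans (^-+ ½' L (r ℕ.+ 6)) (cong (½' ^ L *_) (^-+ ½' r 6))))
     (trans (solve 5 (λ a p q s t → a :* (p :* (q :* s) :* t) := p :* t :* (a :* q :* s)) refl (nat R) (½' ^ L) (½' ^ r) (½' ^ 6) (two ^ L))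
      (trans (cong (_* (nat R * ½' ^ r * ½' ^ 6)) (½^*2^ L)) (*-identityˡ _))))
   (≤≡ (*≤ (0≤* (0≤nat R) (^-nonneg 0≤½' r)) R½≤1 (^-nonneg 0≤½' 6) ½^6) (*-identityˡ _)))
  where
  R½≤1 : nat R * ½' ^ r ≤ 1ℚ
  R½≤1 = ≤≡ (*≤ʳ (^-nonneg 0≤½' r) (≤≡ (nat-mono h) (nat-2^ r))) (trans (*-comm _ _) (½^*2^ r))

 -- By Bernoulli's inequality 2 ≤ (1 + 1/m)^m.
 two-power : ∀ {m n} → 0ℚ < nat m → ∀ T → T ℕ.* m ℕ.≤ n → two ^ T ≤ (1ℚ + inv (nat m)) ^ n
 two-power {m} {n} 0<m T le = ≤-trans (^-mono (<⇒≤ 0<two) (≡≤ (cong (1ℚ +_) (sym (*inv 0<m))) (bernoulli 0≤h m)) T)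
  (≡≤ (sym (^-^ (1ℚ + inv (nat m)) T m)) (^-expo (≤-by+ˡ 0≤h) le))
  where
  0≤h : 0ℚ ≤ inv (nat m)
  0≤h = <⇒≤ (0<inv 0<m)

 module Core {X Y : Set} (𝕏 : Finite X) (𝕐 : Finite Y) (x₀ : X) (y₀ : Y) (F : X × Y → Bool) (n : ℕ) (n≥1 : 1 ℕ.≤ n)
  (μ : X → Y → ℚ) (μ≥0 : ∀ a b → 0ℚ ≤ μ a b) (μ-total : Sum (Finite.values 𝕏) (λ a → Sum (Finite.values 𝕐) (μ a)) ≡ 1ℚ) where

  private
   module C = Concrete 𝕏 𝕐 x₀ y₀ F n μ μ≥0 μ-total

  pairs : List (Vec X n × Vec Y n)
  pairs = cartesianProduct (Vectors.vectors 𝕏 x₀ n) (Vectors.vectors 𝕐 y₀ n)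

  measure : Vec X n × Vec Y n → ℚ
  measure (xs , ys) = Prod (downFrom n) (λ i → μ (nth x₀ xs i) (nth y₀ ys i))

  correlation : Tree (Vec X n) (Vec Y n) → ℚ
  correlation t = Sum pairs (λ ω → measure ω * (sg (xor-power n F ω) * sg (run t (proj₁ ω) (proj₂ ω))))

  success : Tree X Y → ℚ
  success t = Sum (Finite.values 𝕏) (λ a → Sum (Finite.values 𝕐) (λ b → μ a b * ⟦ not (run t a b xor F (a , b)) ⟧))

  module B = BestLeaf pairs (λ ω → measure ω * sg (xor-power n F ω))

  correlation≡ : ∀ t → correlation t ≡ B.mass (B.outcome t)
  correlation≡ t = Sum-cong pairs (λ ω → sym (*-assoc (measure ω) _ _))

  good-tree : ∀ t T ℓ c → depth t ℕ.≤ T → 1 ℕ.≤ ℓ → 1048576 ℕ.≤ c → c ℕ.* n ℕ.< 2 ℕ.^ suc ℓ →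
   T ℕ.* T ℕ.* (ℓ ℕ.* ℓ) ℕ.* (2 ℕ.* 2048 ℕ.* 32 ℕ.* 8192 ℕ.* (2 ℕ.* 2048 ℕ.* 32 ℕ.* 8192)) ℕ.≤ c ℕ.* c ℕ.* n ℕ.* (32 ℕ.* 32) →
   1ℚ ≤ correlation t * (1ℚ + ½' * η) ^ n →
   ∃ λ t' → depth t' ℕ.≤ c × 7/8 ≤ success t'
  good-tree t T ℓ c depth≤T ℓ≥1 c-big cn< short large with T ℕ.* 4194304 ℕ.≤? n
  -- The loss 2^T is at most (1 + 2^-22)^n, which the passage from η/2 to η absorbs. For the tree of
  -- two bits all parameters are constants: R = 512 = 2^9, L = 2 and 17 · 6 search steps, which
  -- makes 940034 bits, less than 2^20 ≤ c.
  ... | yes T-small = let t₂ , d₂ , h₂ = B.two-bits t depth≤T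
                          t' , d' , s = C.simulation t₂ 2 (ℕ.≤-reflexive d₂) (large₂ t₂ h₂) n>0 512 2 ((2 ℕ.+ (9 ℕ.+ 6)) ℕ.* 6) (0<nat 511) (ℕ.s≤s (ℕ.s≤s (ℕ.s≤s z≤n)))
                           (two-round (≡≤ (sym nat-1) (nat-mono n≥1))) (decay 9 2 ℕ.≤-refl)
                      in t' , ℕ.≤-trans d' (ℕ.≤-trans (ℕ.≤ᵇ⇒≤ 940034 1048576 tt) c-big) , s
    where
    n>0 : 0ℚ < nat n
    n>0 = <-≤-trans (0<nat 0) (nat-mono n≥1)
    h = inv (nat 4194304)
    0≤h : 0ℚ ≤ h
    0≤h = <⇒≤ (0<inv (0<nat 4194303))
    2^T≤ : two ^ T ≤ (1ℚ + h) ^ n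
    2^T≤ = two-power (0<nat 4194303) T T-small
    large₂ : ∀ t₂ → B.mass (B.outcome t) ≤ two ^ T * B.mass (B.outcome t₂) → 1ℚ ≤ correlation t₂ * (1ℚ + η) ^ n
    large₂ t₂ h₂ = ≤-trans large (≤-trans (*≤ʳ 0≤Q (≡≤ (correlation≡ t) (≤-trans h₂ (*≤ʳ 0≤corr 2^T≤))))
     (≡≤ (trans (solve 3 (λ p c q → p :* c :* q := c :* (q :* p)) refl ((1ℚ + h) ^ n) (B.mass (B.outcome t₂)) ((1ℚ + ½' * η) ^ n))
        (cong₂ _*_ (sym (correlation≡ t₂)) (sym (^-distrib-* (1ℚ + ½' * η) (1ℚ + h) n))))
      (*≤ˡ (≤≡ 0≤corr (sym (correlation≡ t₂))) (^-mono (0≤* 0≤q (0≤+ 0≤1 0≤h)) η-halves n))))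
     where
     0≤q : 0ℚ ≤ 1ℚ + ½' * η
     0≤q = 0≤+ 0≤1 (0≤* 0≤½' (<⇒≤ 0<η))
     0≤Q : 0ℚ ≤ (1ℚ + ½' * η) ^ n
     0≤Q = ^-nonneg 0≤q n
     0≤corr : 0ℚ ≤ B.mass (B.outcome t₂)
     0≤corr with 0ℚ ≤? B.mass (B.outcome t₂)
     ... | yes p = p
     ... | no ¬p = ⊥-elim (<-irrefl (<-≤-trans 0<1 (≤-trans large (≤≡ (*≤ʳ 0≤Q (≡≤ (correlation≡ t) (≤-trans h₂
      (≤≡ (*≤ˡ (^-nonneg (<⇒≤ 0<two) T) (<⇒≤ (≰⇒> ¬p))) (zeroʳ _))))) (zeroˡ _)))))
  -- Here T ≤ c n < 2^(ℓ+1), and R ≤ c obeys the same bound, so ℓ + 1 serves both as L and as the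
  -- exponent for R.
  ... | no T-large =
   let R , R≥1 , enough , cheap = rounds 2048 32 8192 T n ℓ c (s≤s z≤n) (s≤s z≤n) n≥1 short n<
       t' , d' , s = C.simulation t T depth≤T large₁ n>0 R (suc ℓ) ((suc ℓ ℕ.+ (suc ℓ ℕ.+ 6)) ℕ.* 6) (<-≤-trans (0<nat 0) (nat-mono R≥1))
        (ℕ.≤-<-trans (length-bound 2048 32 8192 T n ℓ c (s≤s z≤n) (s≤s z≤n) n≥1 short ℓ≥1 (s≤s z≤n)) cn<) (many-rounds R enough)
        (decay (suc ℓ) (suc ℓ) (R≤ R cheap))
   in t' , ℕ.≤-trans d' (depth-bound R cheap) , s
   where
   n>0 : 0ℚ < nat n
   n>0 = <-≤-trans (0<nat 0) (nat-mono n≥1)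
   n<Tm : n ℕ.< T ℕ.* 4194304
   n<Tm = ℕ.≰⇒> T-large
   1≤T : 1 ℕ.≤ T
   1≤T = positive T n<Tm
   n< : n ℕ.< T ℕ.* T ℕ.* (2048 ℕ.* 2048)
   n< = ℕ.<-≤-trans n<Tm (ℕ.*-monoˡ-≤ 4194304 (≡≤ᴺ (sym (ℕ.*-identityʳ T)) (ℕ.*-monoʳ-≤ T 1≤T)))
   large₁ : 1ℚ ≤ correlation t * (1ℚ + η) ^ n
   large₁ = ≤-trans large (*≤ˡ 0≤corr (^-mono 0≤q (+≤ˡ 1ℚ (≤≡ (*≤ʳ (<⇒≤ 0<η) ½≤1) (*-identityˡ η))) n))
    where
    ½≤1 : ½' ≤ 1ℚ
    ½≤1 = ≤-by ½' 0≤½' ½+½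
    0≤q : 0ℚ ≤ 1ℚ + ½' * η
    0≤q = 0≤+ 0≤1 (0≤* 0≤½' (<⇒≤ 0<η))
    0≤corr : 0ℚ ≤ correlation t
    0≤corr with 0ℚ ≤? correlation t
    ... | yes p = p
    ... | no ¬p = ⊥-elim (<-irrefl (<-≤-trans 0<1 (≤-trans large (≤≡ (*≤ʳ (^-nonneg 0≤q n) (<⇒≤ (≰⇒> ¬p))) (zeroˡ _)))))
   -- From n < 2^22 T follows nη ≤ 8T, hence 32 T (nη + T) ≤ 288 T². Since 2048² = 2^22, the bound n
   -- R² ≥ 2^22 T² gives n (R/32)² ≥ 4096 T².
   many-rounds : ∀ R → T ℕ.* T ℕ.* (2048 ℕ.* 2048) ℕ.≤ n ℕ.* (R ℕ.* R) → nat 32 * nat T * (nat n * η + nat T) ≤ nat n * ((1/32 * nat R) * (1/32 * nat R))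
   many-rounds R enough = ≤-trans (*≤ˡ (0≤* (0≤nat 32) (0≤nat T)) (+≤ʳ (nat T) nη≤))
    (≡≤ (trans (solve 3 (λ a t b → a :* t :* (b :* t :+ t) := a :* (:1 :+ b) :* (t :* t)) refl (nat 32) (nat T) (nat 8)) (cong (_* (nat T * nat T)) (trans (cong (nat 32 *_) (sym (nat-suc 8))) (sym (nat-* 32 9)))))
    (≤-trans (*≤ʳ (0≤* (0≤nat T) (0≤nat T)) 1/32²)
    (≡≤ (solve 3 (λ k r t → k :* r :* t := k :* t :* r) refl (nat 4194304) (1/32 * 1/32) (nat T * nat T))
    (≤≡ (*≤ʳ (0≤* (<⇒≤ (0<inv (0<nat 31))) (<⇒≤ (0<inv (0<nat 31)))) rational)
     (solve 3 (λ n r c → n :* (r :* r) :* (c :* c) := n :* (c :* r :* (c :* r))) refl (nat n) (nat R) 1/32)))))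
    where
    rational : nat 4194304 * (nat T * nat T) ≤ nat n * (nat R * nat R)
    rational = ≡≤ (trans (*-comm _ _) (trans (cong (_* nat 4194304) (sym (nat-* T T))) (sym (nat-* (T ℕ.* T) 4194304)))) (≤≡ (nat-mono enough) (trans (nat-* n (R ℕ.* R)) (cong (nat n *_) (nat-* R R))))
    nη≤ : nat n * η ≤ nat 8 * nat T
    nη≤ = ≤-trans (*≤ʳ (<⇒≤ 0<η) (≤≡ (nat-mono (ℕ.<⇒≤ n<Tm)) (nat-* T 4194304)))
     (≡≤ (*-assoc (nat T) (nat 4194304) η) (≤≡ (*≤ˡ (0≤nat T) η-nat) (*-comm (nat T) (nat 8))))
   R≤ : ∀ R → R ℕ.* ℓ ℕ.* 8192 ℕ.≤ c → R ℕ.≤ 2 ℕ.^ suc ℓ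
   R≤ R cheap = ℕ.≤-trans (≡≤ᴺ (trans (sym (ℕ.*-identityʳ R)) (sym (ℕ.*-identityʳ (R ℕ.* 1)))) (ℕ.≤-trans (ℕ.*-mono-≤ (ℕ.*-monoʳ-≤ R ℓ≥1) (s≤s z≤n)) cheap))
    (ℕ.<⇒≤ (ℕ.≤-<-trans (≡≤ᴺ (sym (ℕ.*-identityʳ c)) (ℕ.*-monoʳ-≤ c n≥1)) cn<))
   -- For ℓ ≥ 1 there are at most 60ℓ search steps of 18 bits per round, so twice the cost of the
   -- rounds is at most 2160 R ℓ ≤ 8192 R ℓ ≤ c. The other half of c covers the two final bits.
   depth-bound : ∀ R → R ℕ.* ℓ ℕ.* 8192 ℕ.≤ c → R ℕ.* ((suc ℓ ℕ.+ (suc ℓ ℕ.+ 6)) ℕ.* 6 ℕ.* 18) ℕ.+ 2 ℕ.≤ c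
   depth-bound R cheap = ℕ.*-cancelʳ-≤ _ c 2 (≡≤ᴺ (ℕ.*-distribʳ-+ 2 (R ℕ.* (S ℕ.* 18)) 2)
    (≤≡ᴺ (ℕ.+-mono-≤ main (ℕ.≤-trans (ℕ.≤ᵇ⇒≤ 4 1048576 tt) c-big)) (trans (cong (c ℕ.+_) (sym (ℕ.*-identityʳ c))) (sym (ℕ.*-suc c 1)))))
    where
    S = (suc ℓ ℕ.+ (suc ℓ ℕ.+ 6)) ℕ.* 6
    ℓ-bound : suc ℓ ℕ.+ (suc ℓ ℕ.+ 6) ℕ.≤ ℓ ℕ.* 10
    ℓ-bound = ≡≤ᴺ (solveᴺ 1 (λ l → conᴺ 1 :⊕ l :⊕ (conᴺ 1 :⊕ l :⊕ conᴺ 6) :≡ l :× conᴺ 2 :⊕ conᴺ 1 :× conᴺ 8) refl ℓ)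
     (≤≡ᴺ (ℕ.+-monoʳ-≤ (ℓ ℕ.* 2) (ℕ.*-monoˡ-≤ 8 ℓ≥1)) (sym (ℕ.*-distribˡ-+ ℓ 2 8)))
    main : R ℕ.* (S ℕ.* 18) ℕ.* 2 ℕ.≤ c
    main = ℕ.≤-trans (ℕ.*-monoˡ-≤ 2 (ℕ.*-monoʳ-≤ R (ℕ.*-monoˡ-≤ 18 (ℕ.*-monoˡ-≤ 6 ℓ-bound))))
     (≡≤ᴺ (trans (ℕ.*-assoc R _ 2) (trans (cong (R ℕ.*_) (trans (ℕ.*-assoc (ℓ ℕ.* 10 ℕ.* 6) 18 2) (trans (ℕ.*-assoc (ℓ ℕ.* 10) 6 36) (ℕ.*-assoc ℓ 10 216)))) (sym (ℕ.*-assoc R ℓ 2160))))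
     (ℕ.≤-trans (ℕ.*-monoʳ-≤ (R ℕ.* ℓ) (ℕ.≤ᵇ⇒≤ 2160 8192 tt)) cheap))

-- Boosting by an approachability argument.

module Boosting where

 open Arithmetic
 open Tilting
 open NoisySearch using (½')
 open CoordinateSelection using (7/8)
 open import Data.List.Relation.Unary.All using (All; []; _∷_)

 pos-sq : ∀ s d → pos (s + d) * pos (s + d) ≤ pos s * pos s + two * (pos s * d) + d * d
 pos-sq s d = ≤≡ bound (solve 2 (λ p d → (p :+ d) :* (p :+ d) := p :* p :+ :2 :* (p :* d) :+ d :* d) refl (pos s) d)
  where
  bound : pos (s + d) * pos (s + d) ≤ (pos s + d) * (pos s + d)
  bound with pos-cases (s + d)
  ... | inj₂ (_ , e) = ≡≤ (trans (cong (λ z → z * z) e) (zeroˡ 0ℚ)) (0≤sq (pos s + d))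
  ... | inj₁ (h , e) = ≡≤ (cong (λ z → z * z) e) (*≤ h le h le)
   where
   le : s + d ≤ pos s + d
   le = +≤ʳ d (≤pos s)

 -- Success 7/8 against a measure means mean advantage 3/4. The target 5/8 lies strictly between
 -- this and the advantage 1/2 wanted on every input.
 5/8 : ℚ
 5/8 = nat 5 * inv (nat 8)

 shortfall : Bool → ℚ
 shortfall b = 5/8 - sg b

 opaque
  unfolding _+_

  shortfall-sq : ∀ b → shortfall b * shortfall b ≤ nat 3
  shortfall-sq true  = decide
  shortfall-sq false = decide

  shortfall≤ : ∀ b → shortfall b ≤ 5/8 + 1ℚ - two * ⟦ not b ⟧
  shortfall≤ true  = decide
  shortfall≤ false = decide

  margin : 5/8 + 1ℚ - two * 7/8 ≤ 0ℚ
  margin = decide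

  scale : ½' * nat 192 + nat 24 ≤ nat 192 * 5/8
  scale = decide

  24² : nat 3 * nat 192 ≤ nat 24 * nat 24
  24² = decide

 -- If each measure has a good strategy, then playing against the positive parts of the accumulated
 -- shortfalls keeps the sum of their squares linear in the number of rounds.
 module Minimax {Ω S : Set} (Ωs : List Ω) (errs : S → Ω → Bool) (OK : S → Set) (s₀ : S) (s₀-OK : OK s₀)
  (best-response : ∀ (w : Ω → ℚ) → (∀ ω → 0ℚ ≤ w ω) → Sum Ωs w ≡ 1ℚ → ∃ λ s → OK s × 7/8 ≤ Sum Ωs (λ ω → w ω * ⟦ not (errs s ω) ⟧)) where

  deficit : List S → Ω → ℚ
  deficit ss ω = Sum ss (λ s → shortfall (errs s ω))

  potential : List S → ℚ
  potential ss = Sum Ωs (λ ω → pos (deficit ss ω) * pos (deficit ss ω))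

  N : ℚ
  N = nat (length Ωs)

  response : ∀ (v : Ω → ℚ) → (∀ ω → 0ℚ ≤ v ω) → ∃ λ s → OK s × Sum Ωs (λ ω → v ω * shortfall (errs s ω)) ≤ 0ℚ
  response v v≥0 with ≡0⊎0< (Sum-≥0 Ωs v≥0)
  -- If no input is behind, the weights vanish and any strategy will do.
  ... | inj₁ z = s₀ , s₀-OK , ≤≡ (Sum-mono Ωs (λ ω → *≤ˡ (v≥0 ω) (≤-trans (shortfall≤ (errs s₀ ω)) (-≤ ≤-refl (0≤* (<⇒≤ 0<two) (0≤⟦⟧ (not (errs s₀ ω))))))))
   (trans (Sum-*ʳ _ Ωs) (trans (cong (_* (5/8 + 1ℚ - 0ℚ)) z) (zeroˡ _)))
  ... | inj₂ q>0 = answer (best-response (λ ω → inv q * v ω) (λ ω → 0≤* (<⇒≤ (0<inv q>0)) (v≥0 ω)) (trans (Sum-*ˡ (inv q) Ωs) (trans (*-comm _ _) (*inv q>0))))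
   where
   q = Sum Ωs v
   answer : _ → _
   answer (s , ok , h) = s , ok , ≤-trans (Sum-mono Ωs (λ ω → *≤ˡ (v≥0 ω) (shortfall≤ (errs s ω))))
    (≡≤ (trans (Sum-cong Ωs (λ ω → trans (solve 4 (λ v a t c → v :* (a :- t :* c) := a :* v :- t :* (v :* c)) refl (v ω) (5/8 + 1ℚ) two ⟦ not (errs s ω) ⟧) refl))
       (trans (Sum-- Ωs) (cong₂ _-_ (Sum-*ˡ (5/8 + 1ℚ) Ωs) (Sum-*ˡ two Ωs))))
     (≤-trans (-≤ ≤-refl (*≤ˡ (<⇒≤ 0<two) enough)) (≡≤ (solve 4 (λ a q t e → a :* q :- t :* (q :* e) := q :* (a :- t :* e)) refl (5/8 + 1ℚ) q two 7/8)
      (≤≡ (*≤ˡ (<⇒≤ q>0) margin) (zeroʳ q)))))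
    where
    enough : q * 7/8 ≤ Sum Ωs (λ ω → v ω * ⟦ not (errs s ω) ⟧)
    enough = ≤≡ (*≤ˡ (<⇒≤ q>0) (≤≡ h (trans (Sum-cong Ωs (λ ω → *-assoc (inv q) (v ω) _)) (Sum-*ˡ (inv q) Ωs))))
     (trans (sym (*-assoc q (inv q) _)) (trans (cong (_* Sum Ωs (λ ω → v ω * ⟦ not (errs s ω) ⟧)) (*inv q>0)) (*-identityˡ _)))

  play : ∀ k → ∃ λ ss → length ss ≡ k × All OK ss × potential ss ≤ nat 3 * N * nat k
  play zero = [] , refl , [] , ≤-reflexive (trans (trans (Sum-cong Ωs (λ ω → trans (cong (λ z → z * z) (≤-antisym (pos-lub ≤-refl ≤-refl) (0≤pos 0ℚ))) (zeroˡ 0ℚ))) (Sum-0 Ωs)) (sym (trans (cong (nat 3 * N *_) nat-0) (zeroʳ _))))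
  play (suc k) with play k
  ... | ss , len , oks , h with response (λ ω → pos (deficit ss ω)) (λ ω → 0≤pos (deficit ss ω))
  ...   | s , ok , g = s ∷ ss , cong suc len , ok ∷ oks , (begin
   potential (s ∷ ss)
    ≤⟨ Sum-mono Ωs (λ ω → ≡≤ (cong (λ z → pos z * pos z) (+-comm (d ω) (D ω))) (pos-sq (D ω) (d ω))) ⟩
   Sum Ωs (λ ω → pos (D ω) * pos (D ω) + two * (pos (D ω) * d ω) + d ω * d ω)
    ≡⟨ trans (Sum-+ Ωs) (cong₂ _+_ (trans (Sum-+ Ωs) (cong (potential ss +_) (Sum-*ˡ two Ωs))) refl) ⟩
   potential ss + two * Sum Ωs (λ ω → pos (D ω) * d ω) + Sum Ωs (λ ω → d ω * d ω)
    ≤⟨ +-mono-≤ (+-mono-≤ h (*≤ˡ (<⇒≤ 0<two) g)) (≤≡ (Sum-mono Ωs (λ ω → shortfall-sq (errs s ω))) (Sum-const (nat 3) Ωs)) ⟩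
   nat 3 * N * nat k + two * 0ℚ + N * nat 3
    ≡⟨ trans (solve 3 (λ a n k → a :* n :* k :+ :2 :* :0 :+ n :* a := a :* n :* (:1 :+ k)) refl (nat 3) N (nat k)) (cong (nat 3 * N *_) (sym (nat-suc k))) ⟩
   nat 3 * N * nat (suc k) ∎)
   where
   open ≤-Reasoning
   D : Ω → ℚ
   D = deficit ss
   d : Ω → ℚ
   d ω = shortfall (errs s ω)

  -- After k = 192 N rounds the potential is at most 3N · 192N = (24N)², so every deficit is at most
  -- 24N = k/8, and 5/8 - 1/8 = 1/2.
  minimax : 0ℚ < N → ∃ λ ss → 0ℚ < nat (length ss) × All OK ss × (∀ ω → ω ∈ Ωs → ½' * nat (length ss) ≤ Sum ss (λ s → sg (errs s ω)))
  minimax N>0 = finish (play (length Ωs ℕ.* 192))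
   where
   finish : _ → _
   finish (ss , len , oks , h) = ss , subst (0ℚ <_) (sym len≡) (0<* N>0 (0<nat 191)) , oks , each
    where
    len≡ : nat (length ss) ≡ N * nat 192
    len≡ = trans (cong nat len) (nat-* (length Ωs) 192)
    small : ∀ ω → ω ∈ Ωs → deficit ss ω ≤ N * nat 24
    small ω ω∈ = ≤-trans (≤pos _) (sq-cancel-≤ (0≤* (<⇒≤ N>0) (0≤nat 24)) (≤-trans (Sum-∈ Ωs (λ ω → 0≤sq (pos (deficit ss ω))) ω∈) (≤-trans h
     (≡≤ (trans (cong (nat 3 * N *_) (nat-* (length Ωs) 192)) (solve 3 (λ a n b → a :* n :* (n :* b) := n :* n :* (a :* b)) refl (nat 3) N (nat 192)))
      (≤≡ (*≤ˡ (0≤sq N) 24²) (solve 2 (λ n a → n :* n :* (a :* a) := n :* a :* (n :* a)) refl N (nat 24)))))))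
    each : ∀ ω → ω ∈ Ωs → ½' * nat (length ss) ≤ Sum ss (λ s → sg (errs s ω))
    each ω ω∈ = ≤-by-- (0≤- total) eq
     where
     σ = Sum ss (λ s → sg (errs s ω))
     total : ½' * nat 192 * N + deficit ss ω ≤ nat 192 * 5/8 * N
     total = ≤-trans (+≤ˡ _ (≤≡ (small ω ω∈) (*-comm N (nat 24)))) (≡≤ (sym (distribʳ N _ _)) (*≤ʳ (<⇒≤ N>0) scale))
     deficit≡ : deficit ss ω ≡ nat 192 * 5/8 * N - σ
     deficit≡ = trans (Sum-- ss) (cong (λ z → z - σ) (trans (Sum-const 5/8 ss) (trans (cong (_* 5/8) len≡) (solve 3 (λ n a b → n :* a :* b := a :* b :* n) refl N (nat 192) 5/8))))
     eq : σ - ½' * nat (length ss) ≡ nat 192 * 5/8 * N - (½' * nat 192 * N + deficit ss ω)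
     eq = trans (cong (λ z → σ - ½' * z) len≡) (sym (trans (cong (λ z → nat 192 * 5/8 * N - (½' * nat 192 * N + z)) deficit≡)
      (solve 5 (λ a n h b s → b :- (h :* a :* n :+ (b :- s)) := s :- h :* (n :* a)) refl (nat 192) N ½' (nat 192 * 5/8 * N) σ)))

-- From a mixture of trees for the power to trees for f.

module FiniteTheorem where

 open Arithmetic
 open LogBounds
 open Classes
 open Tilting
 open NoisySearch using (½'; 0≤½')
 open CoordinateSimulation using (finite-∈)
 open CoordinateSelection using (η; 0<η; 7/8)
 open ProductInstance
 open LeafSelection
 open Parameters
 open Boosting
 open import Defs using (Tree; output; depth; run; xor-power)
 open import Data.Vec using (Vec; _∷_; [])
 open import Data.List.Relation.Unary.All using (All)
 open import Data.List.Membership.Propositional.Properties using (∈-cartesianProduct⁺)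

 Prod-shift : ∀ n (f : ℕ → ℚ) → Prod (downFrom (suc n)) f ≡ f 0 * Prod (downFrom n) (f ∘ suc)
 Prod-shift zero    f = refl
 Prod-shift (suc n) f = trans (cong (f (suc n) *_) (Prod-shift n f)) (solve 3 (λ a b c → a :* (b :* c) := b :* (a :* c)) refl (f (suc n)) (f 0) (Prod (downFrom n) (f ∘ suc)))

 -- If all values were at most q, the mean would be at most q, also for weights of total less than 1
 -- because q ≥ 0. The strict inequality q < p makes this a contradiction.
 heavy : ∀ {J : Set} (Js : List J) (a v : J → ℚ) → (∀ j → 0ℚ ≤ a j) → Sum Js a ≤ 1ℚ → ∀ {p q} → 0ℚ ≤ q → q < p → p ≤ Sum Js (λ j → a j * v j) → ∃ λ j → q ≤ v j
 heavy {J} Js a v a≥0 a≤1 {p} {q} q≥0 q<p h = go Js (λ k → ⊥-elim (<-irrefl (<-≤-trans q<p (≤-trans h (≤-trans (Sum-mono∈ Js (λ j j∈ → *≤ˡ (a≥0 j) (k j j∈)))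
    (≡≤ (Sum-*ʳ q Js) (≤≡ (*≤ʳ q≥0 a≤1) (*-identityˡ q))))))))
  where
  go : ∀ ks → ((∀ j → j ∈ ks → v j ≤ q) → ∃ λ j → q ≤ v j) → ∃ λ j → q ≤ v j
  go [] f = f (λ j ())
  go (k ∷ ks) f with q ≤? v k
  ... | yes le = k , le
  ... | no ¬le = go ks (λ g → f (λ { j (here refl) → <⇒≤ (≰⇒> ¬le) ; j (there j∈) → g j j∈ }))

 module ProductMeasure {X Y : Set} (𝕏 : Finite X) (𝕐 : Finite Y) (x₀ : X) (y₀ : Y)
  (μ : X → Y → ℚ) (μ≥0 : ∀ a b → 0ℚ ≤ μ a b) (μ-total : Sum (Finite.values 𝕏) (λ a → Sum (Finite.values 𝕐) (μ a)) ≡ 1ℚ) where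

  vectors-total : ∀ n → Sum (Vectors.vectors 𝕏 x₀ n) (λ xs → Sum (Vectors.vectors 𝕐 y₀ n) (λ ys → Prod (downFrom n) (λ i → μ (nth x₀ xs i) (nth y₀ ys i)))) ≡ 1ℚ
  vectors-total zero    = trans (+-identityʳ _) (+-identityʳ 1ℚ)
  vectors-total (suc n) = begin
   Sum (VX.vectors (suc n)) (λ xs → Sum (VY.vectors (suc n)) (P (suc n) xs))
    ≡⟨ Sum-map₂ _∷_ _ vx (VX.vectors n) ⟩
   Sum vx (λ x → Sum (VX.vectors n) (λ xs → Sum (VY.vectors (suc n)) (P (suc n) (x ∷ xs))))
    ≡⟨ Sum-cong vx (λ x → Sum-cong (VX.vectors n) (λ xs → trans (Sum-map₂ _∷_ _ vy (VY.vectors n)) (Sum-cong vy (λ y → trans (Sum-cong (VY.vectors n) (λ ys → Prod-shift n _)) (Sum-*ˡ (μ x y) (VY.vectors n)))))) ⟩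
   Sum vx (λ x → Sum (VX.vectors n) (λ xs → Sum vy (λ y → μ x y * Sum (VY.vectors n) (P n xs))))
    ≡⟨ Sum-cong vx (λ x → trans (Sum-swap (VX.vectors n) vy) (Sum-cong vy (λ y → trans (Sum-*ˡ (μ x y) (VX.vectors n)) (trans (cong (μ x y *_) (vectors-total n)) (*-identityʳ _))))) ⟩
   Sum vx (λ x → Sum vy (μ x))
    ≡⟨ μ-total ⟩
   1ℚ ∎
   where
   open ≡-Reasoning
   module VX = Vectors 𝕏 x₀
   module VY = Vectors 𝕐 y₀
   vx = Finite.values 𝕏
   vy = Finite.values 𝕐
   P : ∀ n → Vec X n → Vec Y n → ℚ
   P n xs ys = Prod (downFrom n) (λ i → μ (nth x₀ xs i) (nth y₀ ys i))

  module _ (F : X × Y → Bool) (n : ℕ) (n≥1 : 1 ℕ.≤ n) where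

   open Core 𝕏 𝕐 x₀ y₀ F n n≥1 μ μ≥0 μ-total using (pairs; measure; correlation) public

   measure-total : Sum pairs measure ≡ 1ℚ
   measure-total = trans (Sum-× (Vectors.vectors 𝕏 x₀ n) (Vectors.vectors 𝕐 y₀ n)) (vectors-total n)

   measure≥0 : ∀ ω → 0ℚ ≤ measure ω
   measure≥0 (xs , ys) = Prod-≥0 (downFrom n) (λ i → μ≥0 _ _)

   -- Averaging over the product measure and exchanging sums turns an advantage on every input into
   -- a weighted mean of the correlations of the single trees.
   derandomise : ∀ {J : Set} (Js : List J) (a : J → ℚ) (t : J → Tree (Vec X n) (Vec Y n)) → (∀ j → 0ℚ ≤ a j) → Sum Js a ≤ 1ℚ → ∀ {p q} → 0ℚ ≤ q → q < p →
    (∀ xs ys → p ≤ Sum Js (λ j → a j * sg (run (t j) xs ys xor xor-power n F (xs , ys)))) → ∃ λ j → q ≤ correlation (t j)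
   derandomise Js a t a≥0 a≤1 {p} q≥0 q<p h = heavy Js a (λ j → correlation (t j)) a≥0 a≤1 q≥0 q<p (begin
    p
     ≡⟨ trans (sym (*-identityˡ p)) (trans (cong (_* p) (sym measure-total)) (sym (Sum-*ʳ p pairs))) ⟩
    Sum pairs (λ ω → measure ω * p)
     ≤⟨ Sum-mono pairs (λ ω → *≤ˡ (measure≥0 ω) (h (proj₁ ω) (proj₂ ω))) ⟩
    Sum pairs (λ ω → measure ω * Sum Js (λ j → a j * sg (run (t j) (proj₁ ω) (proj₂ ω) xor xor-power n F ω)))
     ≡⟨ trans (Sum-cong pairs (λ ω → sym (Sum-*ˡ (measure ω) Js))) (Sum-swap pairs Js) ⟩
    Sum Js (λ j → Sum pairs (λ ω → measure ω * (a j * sg (run (t j) (proj₁ ω) (proj₂ ω) xor xor-power n F ω))))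
     ≡⟨ Sum-cong Js (λ j → trans (Sum-cong pairs (λ ω → trans (cong (λ z → measure ω * (a j * z)) (sg-xor (run (t j) (proj₁ ω) (proj₂ ω)) (xor-power n F ω)))
      (solve 4 (λ m a r x → m :* (a :* (r :* x)) := a :* (m :* (x :* r))) refl (measure ω) (a j) (sg (run (t j) (proj₁ ω) (proj₂ ω))) (sg (xor-power n F ω))))) (Sum-*ˡ (a j) pairs)) ⟩
    Sum Js (λ j → a j * correlation (t j)) ∎)
    where open ≤-Reasoning

 module _ {X Y : Set} (𝕏 : Finite X) (𝕐 : Finite Y) (x₀ : X) (y₀ : Y) (F : X × Y → Bool) (n : ℕ) (n≥1 : 1 ℕ.≤ n) (T ℓ c : ℕ)
  (ℓ≥1 : 1 ℕ.≤ ℓ) (c-big : 1048576 ℕ.≤ c) (cn< : c ℕ.* n ℕ.< 2 ℕ.^ suc ℓ)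
  (short : T ℕ.* T ℕ.* (ℓ ℕ.* ℓ) ℕ.* (2 ℕ.* 2048 ℕ.* 32 ℕ.* 8192 ℕ.* (2 ℕ.* 2048 ℕ.* 32 ℕ.* 8192)) ℕ.≤ c ℕ.* c ℕ.* n ℕ.* (32 ℕ.* 32))
  {J : Set} (Js : List J) (a : J → ℚ) (t : J → Tree (Vec X n) (Vec Y n)) (a≥0 : ∀ j → 0ℚ ≤ a j) (a≤1 : Sum Js a ≤ 1ℚ) (depth≤T : ∀ j → depth (t j) ℕ.≤ T)
  {p q : ℚ} (q≥0 : 0ℚ ≤ q) (q<p : q < p) (q-large : 1ℚ ≤ q * (1ℚ + ½' * η) ^ n)
  (advantage : ∀ xs ys → p ≤ Sum Js (λ j → a j * sg (run (t j) xs ys xor xor-power n F (xs , ys)))) where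

  -- The mixture has its advantage on every input, so for each measure on the inputs of f it is
  -- available against the n-th power of that measure. One tree of the mixture then yields a good
  -- response, and the game is played with these responses.
  randomised-trees : ∃ λ (ts : List (Tree X Y)) → 0ℚ < nat (length ts) × All (λ t → depth t ℕ.≤ c) ts × (∀ x y → ½' * nat (length ts) ≤ Sum ts (λ t → sg (run t x y xor F (x , y))))
  randomised-trees = let ts , len , depths , h = Game.minimax ne in ts , len , depths , λ x y → h (x , y) (∈-cartesianProduct⁺ (finite-∈ 𝕏 x) (finite-∈ 𝕐 y))
    where
    Ωs : List (X × Y)
    Ωs = cartesianProduct (Finite.values 𝕏) (Finite.values 𝕐)
    errs : Tree X Y → X × Y → Bool
    errs t (x , y) = run t x y xor F (x , y)
    response : ∀ (w : X × Y → ℚ) → (∀ ω → 0ℚ ≤ w ω) → Sum Ωs w ≡ 1ℚ → ∃ λ s → depth s ℕ.≤ c × 7/8 ≤ Sum Ωs (λ ω → w ω * ⟦ not (errs s ω) ⟧)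
    response w w≥0 w-total = t' , d , ≤≡ s (sym (Sum-× (Finite.values 𝕏) (Finite.values 𝕐)))
     where
     μ : X → Y → ℚ
     μ x y = w (x , y)
     μ-total : Sum (Finite.values 𝕏) (λ x → Sum (Finite.values 𝕐) (μ x)) ≡ 1ℚ
     μ-total = trans (sym (Sum-× (Finite.values 𝕏) (Finite.values 𝕐))) w-total
     found = ProductMeasure.derandomise 𝕏 𝕐 x₀ y₀ μ (λ x y → w≥0 (x , y)) μ-total F n n≥1 Js a t a≥0 a≤1 q≥0 q<p advantage
     j = proj₁ found
     good = Core.good-tree 𝕏 𝕐 x₀ y₀ F n n≥1 μ (λ x y → w≥0 (x , y)) μ-total (t j) T ℓ c (depth≤T j) ℓ≥1 c-big cn< short
      (≤-trans q-large (*≤ʳ (^-nonneg (0≤+ 0≤1 (0≤* 0≤½' (<⇒≤ 0<η))) n) (proj₂ found)))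
     t' = proj₁ good
     d = proj₁ (proj₂ good)
     s = proj₂ (proj₂ good)
    module Game = Minimax Ωs errs (λ t → depth t ℕ.≤ c) (output true) z≤n response
    ne : 0ℚ < nat (length Ωs)
    ne = nonempty Ωs (∈-cartesianProduct⁺ (finite-∈ 𝕏 x₀) (finite-∈ 𝕐 y₀))
     where
     nonempty : ∀ (xs : List (X × Y)) {z} → z ∈ xs → 0ℚ < nat (length xs)
     nonempty (x ∷ xs) h = 0<nat (length xs)

-- Enclosing reals by rationals.

module Reals where

 open Arithmetic
 open Tilting
 open R using (ℝ∞; below; down; closed; ι; ⨆; ⨅; ∑; ProbSpace; Outcome; weight; nonNegative; size; total; 𝔼; sign)
 open import Data.Fin using (Fin; zero; suc)
 open import Data.List using (allFin)
 open import Data.List.Properties using (map-tabulate; length-tabulate)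
 open import Level using (Level; 0ℓ)

 private
  variable
   a b c d q : ℚ
   x y : ℝ∞ 0ℓ
   ℓ : Level

 -- Rational upper bounds pass through the double negation in a supremum because the cut `ι b` is
 -- closed.
 sup-≤ : {B : ℚ → Set ℓ} → (∀ p → p < q → ¬ ¬ B p) → (∀ p → B p → p ≤ b) → q ≤ b
 sup-≤ {b = b} g h = closed (ι b) λ p p<q ¬b → g p p<q λ k → ¬b (h p k)

 +-below : below x a → below y c → below (x R.+ y) (a + c)
 +-below {a = a} {c = c} h k p p<q ¬∃ = ¬∃ (((a , h) , (c , k)) , ≤≡ (<⇒≤ p<q) (+≡ a c))

 ℚ-⊔≡pos : ∀ a → 0ℚ ℚ.⊔ a ≡ pos a
 ℚ-⊔≡pos a with pos-cases a
 ... | inj₁ (h , e) = trans (ℚ.p≤q⇒p⊔q≡q h) (sym e)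
 ... | inj₂ (h , e) = trans (ℚ.p≥q⇒p⊔q≡p h) (sym e)

 -- Interval arithmetic: real operations are accessed through rational enclosures, which need not be
 -- tight.
 record In (x : ℝ∞ 0ℓ) (a b : ℚ) : Set where
  constructor _,,_
  field
   lo : below x a
   hi : x R.≤ ι b

 open In public

 In-≤ : In x a b → a ≤ b
 In-≤ {a = a} h = hi h a (lo h)

 In-weaken : c ≤ a → b ≤ d → In x a b → In x c d
 In-weaken {x = x} h k i = down x h (lo i) ,, λ q g → ≤-trans (hi i q g) k

 In-ι : ∀ a → In (ι a) a a
 In-ι a = ≤-refl ,, λ q h → h

 In-+ : In x a b → In y c d → In (x R.+ y) (a + c) (b + d)
 In-+ {x} {a} {b} {y} {c} {d} i j = +-below {x} {a} {y} {c} (lo i) (lo j) ,,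
  λ z g → sup-≤ g λ r (((p , hp) , (q , hq)) , h) → ≤-trans h (≡≤ (sym (+≡ p q)) (+-mono-≤ (hi i p hp) (hi j q hq)))

 In-neg : In x a b → In (R.- x) (- b) (- a)
 In-neg {x} {a} {b} i = (λ (p , hp) → ≤≡ (neg≤ (hi i p hp)) (-≡ p)) ,, λ q h → ≤≡ (h (a , lo i)) (sym (-≡ a))

 In-⊗ : In x a b → In y c d → In (x R.⊗ y) (pos a * pos c) (pos b * pos d)
 In-⊗ {x} {a} {b} {y} {c} {d} i j = (λ p p<q ¬∃ → ¬∃ (((a , lo i) , (c , lo j)) , ≤≡ (<⇒≤ p<q) (bridge a c))) ,,
  λ z g → sup-≤ g λ r (((p , hp) , (q , hq)) , h) → ≤-trans h (≡≤ (sym (bridge p q)) (*≤ (0≤pos p) (pos-mono (hi i p hp)) (0≤pos q) (pos-mono (hi j q hq))))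
  where
  bridge : ∀ p q → pos p * pos q ≡ (0ℚ ℚ.⊔ p) ℚ.* (0ℚ ℚ.⊔ q)
  bridge p q = trans (cong₂ _*_ (sym (ℚ-⊔≡pos p)) (sym (ℚ-⊔≡pos q))) (*≡ _ _)

 In-* : In x a b → In y c d → In (x R.* y) (pos a * pos c + pos (- b) * pos (- d) - (pos b * pos (- c) + pos (- a) * pos d))
  (pos b * pos d + pos (- a) * pos (- c) - (pos a * pos (- d) + pos (- b) * pos c))
 In-* i j = In-+ (In-+ (In-⊗ i j) (In-⊗ (In-neg i) (In-neg j))) (In-neg (In-+ (In-⊗ i (In-neg j)) (In-⊗ (In-neg i) j)))

 pos-neg : ∀ a → pos a - pos (- a) ≡ a
 pos-neg a with pos-cases a | pos-cases (- a)
 ... | inj₁ (h , e) | inj₂ (k , g) = trans (cong₂ _-_ e g) (solve 1 (λ a → a :- :0 := a) refl a)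
 ... | inj₂ (h , e) | inj₁ (k , g) = trans (cong₂ _-_ e g) (solve 1 (λ a → :0 :- (:- a) := a) refl a)
 ... | inj₁ (h , e) | inj₁ (k , g) = trans (cong₂ _-_ e g) (trans (cong (λ z → z - (- z)) a≡0) (trans (solve 0 (:0 :- (:- :0) := :0) refl) (sym a≡0)))
  where
  a≡0 : a ≡ 0ℚ
  a≡0 = ≤-antisym (≤-trans (≤-by (- a) k (+-inverseʳ a)) ≤-refl) h
 ... | inj₂ (h , e) | inj₂ (k , g) = trans (cong₂ _-_ e g) (trans (solve 0 (:0 :- :0 := :0) refl) (sym a≡0))
  where
  a≡0 : a ≡ 0ℚ
  a≡0 = ≤-antisym h (-≥0 (≡≤ (sym neg0) (≤≡ (neg≤ k) (solve 1 (λ a → :- (:- a) := a :- :0) refl a))))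

 pos-id : 0ℚ ≤ a → pos a ≡ a
 pos-id h = ≤-antisym (pos-lub h ≤-refl) (≤pos _)

 pos-zero : 0ℚ ≤ a → pos (- a) ≡ 0ℚ
 pos-zero {a} h = ≤-antisym (pos-lub ≤-refl (≤≡ (neg≤ h) neg0)) (0≤pos (- a))

 In-*-exact : In x a a → In y c c → In (x R.* y) (a * c) (a * c)
 In-*-exact {x} {a} {y} {c} i j = subst (λ z → In (x R.* y) z z) eq (In-* i j)
  where
  eq : pos a * pos c + pos (- a) * pos (- c) - (pos a * pos (- c) + pos (- a) * pos c) ≡ a * c
  eq = trans (solve 4 (λ p q r s → p :* r :+ q :* s :- (p :* s :+ q :* r) := (p :- q) :* (r :- s)) refl (pos a) (pos (- a)) (pos c) (pos (- c))) (cong₂ _*_ (pos-neg a) (pos-neg c))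

 In-*⁺ : 0ℚ ≤ a → 0ℚ ≤ c → In x a b → In y c d → In (x R.* y) (a * c) (b * d)
 In-*⁺ {a} {c} {x} {b} {y} {d} a≥0 c≥0 i j = subst₂ (In (x R.* y)) lo≡ hi≡ (In-* i j)
  where
  b≥0 : 0ℚ ≤ b
  b≥0 = ≤-trans a≥0 (In-≤ i)
  d≥0 : 0ℚ ≤ d
  d≥0 = ≤-trans c≥0 (In-≤ j)
  lo≡ : pos a * pos c + pos (- b) * pos (- d) - (pos b * pos (- c) + pos (- a) * pos d) ≡ a * c
  lo≡ = trans (cong₂ (λ z w → z + w - (pos b * pos (- c) + pos (- a) * pos d)) (cong₂ _*_ (pos-id a≥0) (pos-id c≥0)) (cong₂ _*_ (pos-zero b≥0) (pos-zero d≥0)))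
   (trans (cong₂ (λ z w → a * c + 0ℚ * 0ℚ - (pos b * z + w * pos d)) (pos-zero c≥0) (pos-zero a≥0)) (solve 4 (λ a c b d → a :* c :+ :0 :* :0 :- (b :* :0 :+ :0 :* d) := a :* c) refl a c (pos b) (pos d)))
  hi≡ : pos b * pos d + pos (- a) * pos (- c) - (pos a * pos (- d) + pos (- b) * pos c) ≡ b * d
  hi≡ = trans (cong₂ (λ z w → z + w - (pos a * pos (- d) + pos (- b) * pos c)) (cong₂ _*_ (pos-id b≥0) (pos-id d≥0)) (cong₂ _*_ (pos-zero a≥0) (pos-zero c≥0)))
   (trans (cong₂ (λ z w → b * d + 0ℚ * 0ℚ - (pos a * z + w * pos c)) (pos-zero d≥0) (pos-zero b≥0)) (solve 4 (λ a c b d → b :* d :+ :0 :* :0 :- (a :* :0 :+ :0 :* c) := b :* d) refl (pos a) (pos c) b d))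

 -- Only the upper bound matters, for d of either sign. Some lower bound of y is carried along
 -- because the product is made of positive parts, and that of -y has to be bounded above.
 In-*-weight : ∀ {ε} → 0ℚ ≤ a → 0ℚ ≤ ε → In x a (a + ε) → In y c d → d ≤ two → ∃ λ l → In (x R.* y) l (a * d + ε * two)
 In-*-weight {a} {x} {y} {c} {d} {ε} a≥0 ε≥0 i j d≤2 = _ , In-weaken ≤-refl bound (In-* i j)
  where
  bound : pos (a + ε) * pos d + pos (- a) * pos (- c) - (pos a * pos (- d) + pos (- (a + ε)) * pos c) ≤ a * d + ε * two
  bound = ≡≤ (trans (cong₂ (λ z w → z * pos d + w * pos (- c) - (pos a * pos (- d) + pos (- (a + ε)) * pos c)) (pos-id (0≤+ a≥0 ε≥0)) (pos-zero a≥0))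
     (trans (cong₂ (λ z w → (a + ε) * pos d + 0ℚ * pos (- c) - (z * pos (- d) + w * pos c)) (pos-id a≥0) (pos-zero (0≤+ a≥0 ε≥0)))
      (trans (solve 6 (λ a e p n s t → (a :+ e) :* p :+ :0 :* s :- (a :* n :+ :0 :* t) := a :* (p :- n) :+ e :* p) refl a ε (pos d) (pos (- d)) (pos (- c)) (pos c))
       (cong (λ z → a * z + ε * pos d) (pos-neg d)))))
   (+≤ˡ (a * d) (*≤ˡ ε≥0 (pos-lub (<⇒≤ 0<two) d≤2)))

 Sum-allFin : ∀ {n} (f : Fin (suc n) → ℚ) → Sum (allFin (suc n)) f ≡ f zero + Sum (allFin n) (λ i → f (suc i))
 Sum-allFin {n} f = cong (f zero +_) (trans (cong (λ z → Sum z f) (sym (map-tabulate id suc))) (Sum-map suc (allFin n)))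

 In-∑ : ∀ {n} {x : Fin n → ℝ∞ 0ℓ} {a b : Fin n → ℚ} → (∀ i → In (x i) (a i) (b i)) → In (∑ x) (Sum (allFin n) a) (Sum (allFin n) b)
 In-∑ {zero}  h = In-ι 0ℚ
 In-∑ {suc n} {x} {a} {b} h = subst₂ (In (∑ x)) (sym (Sum-allFin a)) (sym (Sum-allFin b)) (In-+ (h zero) (In-∑ (λ i → h (suc i))))

 ∑-nonneg : ∀ {n} (x : Fin n → ℝ∞ 0ℓ) → (∀ i → below (x i) 0ℚ) → below (∑ x) 0ℚ
 ∑-nonneg {zero}  x h = ≤-refl
 ∑-nonneg {suc n} x h = subst (below (∑ x)) (+-identityʳ 0ℚ) (+-below {x zero} {0ℚ} {∑ (λ i → x (suc i))} {0ℚ} (h zero) (∑-nonneg (λ i → x (suc i)) (λ i → h (suc i))))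

 ∑-term : ∀ {n} (x : Fin n → ℝ∞ 0ℓ) → (∀ i → below (x i) 0ℚ) → ∀ i → below (x i) q → below (∑ x) q
 ∑-term {q} x nonneg zero    h = subst (below (∑ x)) (+-identityʳ q) (+-below {x zero} {q} {∑ (λ i → x (suc i))} {0ℚ} h (∑-nonneg (λ i → x (suc i)) (λ i → nonneg (suc i))))
 ∑-term {q} x nonneg (suc i) h = subst (below (∑ x)) (+-identityˡ q) (+-below {x zero} {0ℚ} {∑ (λ i → x (suc i))} {q} (nonneg zero) (∑-term (λ i → x (suc i)) (λ i → nonneg (suc i)) i h))

 In-sign : ∀ b → In (sign b) (sg b) (sg b)
 In-sign true  = subst (λ z → In (ι (ℚ.- 1ℚ)) z z) (sym (-≡ 1ℚ)) (In-ι _)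
 In-sign false = In-ι 1ℚ

 ¬¬-choice : ∀ {n} {B : Set} {P : Fin n → B → Set} → (∀ i → ¬ ¬ ∃ (P i)) → ¬ ¬ ∃ λ (f : Fin n → B) → ∀ i → P i (f i)
 ¬¬-choice {zero}  h k = k ((λ ()) , λ ())
 ¬¬-choice {suc n} h k = h zero λ (b , p) → ¬¬-choice (λ i → h (suc i)) λ (f , ps) → k ((λ { zero → b ; (suc i) → f i }) , λ { zero → p ; (suc i) → ps i })

 ¬¬-threshold : ∀ {P : ℕ → Set} → P 0 → ∀ m → ¬ P m → ¬ ¬ ∃ λ r → P r × ¬ P (suc r)
 ¬¬-threshold p0 zero    ¬p k = ¬p p0
 ¬¬-threshold p0 (suc m) ¬p k = ¬¬-threshold p0 m (λ pm → k (m , pm , ¬p)) k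

 ¬below⇒≤ : ¬ below x a → x R.≤ ι a
 ¬below⇒≤ {x} {a} ¬h q g with q ≤? a
 ... | yes p = p
 ... | no ¬p = ⊥-elim (¬h (down x (<⇒≤ (≰⇒> ¬p)) g))

 -- The last grid point below x begins the cell of x. As `below` is not decidable, this point is
 -- found only up to double negation.
 grid : ∀ {ε} → 0ℚ < ε → below x 0ℚ → x R.≤ ι b → ¬ ¬ ∃ λ k → In x (nat k * ε) (nat (suc k) * ε)
 grid {x} {b} {ε} ε>0 h k ¬∃ = ¬¬-threshold {P = λ j → below x (nat j * ε)} (subst (below x) (sym (trans (cong (_* ε) nat-0) (zeroˡ ε))) h) m
  (λ g → <-irrefl (<-≤-trans b<mε (k _ g))) λ (r , lo , ¬hi) → ¬∃ (r , (lo ,, ¬below⇒≤ {x} ¬hi))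
  where
  m₀ = proj₁ (archimedean (b * inv ε))
  m = suc m₀
  b<mε : b < nat m * ε
  b<mε = ≤-<-trans (≡≤ (sym (inv*-cancel ε>0)) (*≤ʳ (<⇒≤ ε>0) (proj₂ (archimedean (b * inv ε)))))
   (subst₂ _<_ (+-identityˡ _) (trans (solve 2 (λ e n → e :+ n :* e := (:1 :+ n) :* e) refl ε (nat m₀)) (cong (_* ε) (sym (nat-suc m₀)))) (+-mono-<-≤ ε>0 ≤-refl))

 -- Real weights are known up to an additive error only, and only up to double negation.
 module _ (P : ProbSpace) {e : ℚ} (e>0 : 0ℚ < e) where

  outcomes : List (Outcome P)
  outcomes = allFin (size P)

  Weights : (Outcome P → ℚ) → Set₁
  Weights w = (∀ ω → 0ℚ ≤ w ω) × Sum outcomes w ≤ 1ℚ ×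
   (∀ (F : Outcome P → ℝ∞ 0ℓ) (d : Outcome P → ℚ) → (∀ ω → ∃ λ l → In (F ω) l (d ω)) → (∀ ω → d ω ≤ two) → ∃ λ l → In (𝔼 P F) l (Sum outcomes (λ ω → w ω * d ω) + e))

  rational-weights : ¬ ¬ ∃ Weights
  rational-weights ¬∃ = ¬¬-choice (λ ω → grid ε>0 (nonNegative P ω 0ℚ ≤-refl) (weight≤1 ω)) λ (k , h) → ¬∃
   ((λ ω → nat (k ω) * ε) , (λ ω → 0≤* (0≤nat (k ω)) (<⇒≤ ε>0)) ,
    proj₁ (total P) _ (lo (In-∑ h)) ,
    λ F d i d≤2 → let l = λ ω → proj₁ (step k h F d i d≤2 ω) in Sum outcomes l , In-weaken ≤-refl (bound k d) (In-∑ (λ ω → proj₂ (step k h F d i d≤2 ω))))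
   where
   N = nat (suc (size P))
   N>0 : 0ℚ < N
   N>0 = 0<nat (size P)
   -- Fewer than N weights, each off by at most ε, with values of at most 2, cause an error of at
   -- most 2 N ε = e.
   ε = e * inv (N * two)
   ε>0 : 0ℚ < ε
   ε>0 = 0<* e>0 (0<inv (0<* N>0 0<two))
   weight≤1 : ∀ ω → weight P ω R.≤ ι 1ℚ
   weight≤1 ω q h = proj₁ (total P) q (∑-term (weight P) (λ ω → nonNegative P ω 0ℚ ≤-refl) ω h)
   step : ∀ k → (∀ ω → In (weight P ω) (nat (k ω) * ε) (nat (suc (k ω)) * ε)) → ∀ F d → (∀ ω → ∃ λ l → In (F ω) l (d ω)) → (∀ ω → d ω ≤ two) →
    ∀ ω → ∃ λ l → In (weight P ω R.* F ω) l (nat (k ω) * ε * d ω + ε * two)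
   step k h F d i d≤2 ω = In-*-weight (0≤* (0≤nat (k ω)) (<⇒≤ ε>0)) (<⇒≤ ε>0)
    (In-weaken ≤-refl (≤-reflexive (trans (cong (_* ε) (nat-suc (k ω))) (solve 2 (λ n e → (:1 :+ n) :* e := n :* e :+ e) refl (nat (k ω)) ε))) (h ω)) (proj₂ (i ω)) (d≤2 ω)
   bound : ∀ k d → Sum outcomes (λ ω → nat (k ω) * ε * d ω + ε * two) ≤ Sum outcomes (λ ω → nat (k ω) * ε * d ω) + e
   bound k d = ≡≤ (trans (Sum-+ outcomes) (cong (Sum outcomes (λ ω → nat (k ω) * ε * d ω) +_) (Sum-const (ε * two) outcomes)))
    (+≤ˡ _ (≤≡ (*≤ʳ (0≤* (<⇒≤ ε>0) (<⇒≤ 0<two)) (≡≤ (cong nat (length-tabulate id)) (nat-mono (ℕ.n≤1+n (size P)))))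
     (trans (solve 4 (λ n e i t → n :* (e :* i :* t) := e :* (n :* t :* i)) refl N e (inv (N * two)) two) (trans (cong (e *_) (*inv (0<* N>0 0<two))) (*-identityʳ e)))))

-- Bounds for the exponential series.

module ExponentialSeries where

 open Arithmetic
 open LogBounds
 open NoisySearch using (½'; ½+½; 0≤½')
 open CoordinateSelection using (power-small)
 open LeafSelection

 private
  variable
   a b d : ℚ

 opaque
  unfolding _+_

  nat*unit : ∀ k → nat (suc k) * (ℤ.+ 1 ℚ./ suc k) ≡ 1ℚ
  nat*unit k = ℚ.toℚᵘ-injective (begin
   ℚ.toℚᵘ (nat (suc k) * (ℤ.+ 1 ℚ./ suc k)) ≈⟨ ℚ.toℚᵘ-homo-* (nat (suc k)) (ℤ.+ 1 ℚ./ suc k) ⟩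
   ℚ.toℚᵘ (nat (suc k)) ℚᵘ.* ℚ.toℚᵘ (ℤ.+ 1 ℚ./ suc k) ≈⟨ ℚᵘ.*-cong (ℚ.toℚᵘ-fromℚᵘ (ℚᵘ.mkℚᵘ (ℤ.+ suc k) 0)) (ℚ.toℚᵘ-fromℚᵘ (ℚᵘ.mkℚᵘ (ℤ.+ 1) k)) ⟩
   ℚᵘ.mkℚᵘ (ℤ.+ suc k) 0 ℚᵘ.* ℚᵘ.mkℚᵘ (ℤ.+ 1) k ≈⟨ ℚᵘ.*≡* (trans (ℤ.*-identityʳ _) (trans (ℤ.*-identityʳ _) (cong ℤ.+_ (sym (trans (ℕ.*-identityˡ _) (ℕ.*-identityˡ _)))))) ⟩
   ℚᵘ.mkℚᵘ (ℤ.+ 1) 0 ∎)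
   where open ℚᵘ.≃-Reasoning

 unit≡inv : ∀ k → ℤ.+ 1 ℚ./ suc k ≡ inv (nat (suc k))
 unit≡inv k = ≡inv (0<nat k) (nat*unit k)

 term : ℚ → ℕ → ℚ
 term q zero    = 1ℚ
 term q (suc k) = term q k * (q * inv (nat (suc k)))

 partial : ℚ → ℕ → ℚ
 partial q zero    = 0ℚ
 partial q (suc k) = partial q k + term q k

 term≡ : ∀ q k → R.expTerm q k ≡ term q k
 term≡ q zero    = refl
 term≡ q (suc k) = trans (cong₂ (λ s u → s ℚ.* (q ℚ.* u)) (term≡ q k) (unit≡inv k)) (trans (cong (term q k ℚ.*_) (sym (*≡ q _))) (sym (*≡ (term q k) _)))

 partial≡ : ∀ q k → R.expSum q k ≡ partial q k
 partial≡ q zero    = refl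
 partial≡ q (suc k) = trans (cong₂ ℚ._+_ (partial≡ q k) (term≡ q k)) (sym (+≡ (partial q k) (term q k)))

 nat*term : ∀ q k → nat (suc k) * term q (suc k) ≡ q * term q k
 nat*term q k = trans (solve 4 (λ n t q i → n :* (t :* (q :* i)) := (n :* i) :* (q :* t)) refl (nat (suc k)) (term q k) q (inv (nat (suc k)))) (trans (cong (_* (q * term q k)) (*inv (0<nat k))) (*-identityˡ _))

 term-1 : ∀ q → term q 1 ≡ q
 term-1 q = trans (*-identityˡ _) (trans (cong (q *_) (trans (cong inv nat-1) inv-1)) (*-identityʳ q))

 0≤term : ∀ {x} → 0ℚ ≤ x → ∀ k → 0ℚ ≤ term x k
 0≤term h zero    = 0≤1
 0≤term h (suc k) = 0≤* (0≤term h k) (0≤* h (<⇒≤ (0<inv (0<nat k))))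

 -- The mean value inequality for the convex function xᵏ⁺¹/(k+1)!, with derivative xᵏ/k!.
 term-convex : ∀ {x h} → 0ℚ ≤ x → 0ℚ ≤ h → ∀ k → term (x + h) (suc k) ≤ term x (suc k) + h * term (x + h) k
 term-convex {x} {h} x≥0 h≥0 zero = ≤-reflexive (trans (term-1 (x + h)) (sym (cong₂ _+_ (term-1 x) (*-identityʳ h))))
 term-convex {x} {h} x≥0 h≥0 (suc k) = *-cancel-≤ (0<nat (suc k)) (begin
  term y (2 ℕ.+ k) * N
   ≡⟨ trans (*-comm _ N) (trans (nat*term y (suc k)) (distribʳ (term y (suc k)) x h)) ⟩
  x * term y (suc k) + h * term y (suc k)
   ≤⟨ +≤ʳ _ (≤≡ (*≤ˡ x≥0 (term-convex x≥0 h≥0 k)) (distribˡ x _ _)) ⟩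
  x * term x (suc k) + x * (h * term y k) + h * term y (suc k)
   ≤⟨ +≤ʳ _ (+≤ˡ _ (*≤ʳ (0≤* h≥0 (0≤term y≥0 k)) (≤-by h h≥0 refl))) ⟩
  x * term x (suc k) + y * (h * term y k) + h * term y (suc k)
   ≡⟨ cong₂ (λ z w → z + w + h * term y (suc k)) (sym (nat*term x (suc k))) (trans (solve 3 (λ y h t → y :* (h :* t) := h :* (y :* t)) refl y h (term y k)) (cong (h *_) (sym (nat*term y k)))) ⟩
  N * term x (2 ℕ.+ k) + h * (nat (suc k) * term y (suc k)) + h * term y (suc k)
   ≡⟨ trans (solve 5 (λ n t h m u → n :* t :+ h :* (m :* u) :+ h :* u := n :* t :+ h :* u :* (:1 :+ m)) refl N (term x (2 ℕ.+ k)) h (nat (suc k)) (term y (suc k)))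
    (trans (cong (λ z → N * term x (2 ℕ.+ k) + h * term y (suc k) * z) (sym (nat-suc (suc k)))) (solve 3 (λ n t v → n :* t :+ v :* n := (t :+ v) :* n) refl N (term x (2 ℕ.+ k)) (h * term y (suc k)))) ⟩
  (term x (2 ℕ.+ k) + h * term y (suc k)) * N ∎)
  where
  open ≤-Reasoning
  y = x + h
  N = nat (2 ℕ.+ k)
  y≥0 : 0ℚ ≤ y
  y≥0 = 0≤+ x≥0 h≥0

 partial-convex : ∀ {x h} → 0ℚ ≤ x → 0ℚ ≤ h → ∀ M → partial (x + h) (suc M) ≤ partial x (suc M) + h * partial (x + h) M
 partial-convex {x} {h} x≥0 h≥0 zero    = ≤-reflexive (solve 1 (λ h → :0 :+ :1 := :0 :+ :1 :+ h :* :0) refl h)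
 partial-convex {x} {h} x≥0 h≥0 (suc M) = ≤≡ (+-mono-≤ (partial-convex x≥0 h≥0 M) (term-convex x≥0 h≥0 M))
  (solve 5 (λ p q t h u → p :+ h :* q :+ (t :+ h :* u) := p :+ t :+ h :* (q :+ u)) refl (partial x (suc M)) (partial (x + h) M) (term x (suc M)) h (term (x + h) M))

 -- By `partial-convex` with h = 1/2 the increment is at most half of the left side. Iteration gives
 -- e^(ℓ/2) ≤ 2^ℓ, the crude comparison from which lower bounds for logarithms are derived.
 partial-half : ∀ {x} → 0ℚ ≤ x → ∀ M → partial (x + ½') M ≤ two * partial x M
 partial-half {x} x≥0 zero    = ≤-reflexive (sym (zeroʳ two))
 partial-half {x} x≥0 (suc M) = ≤-by-- (0≤* (<⇒≤ 0<two) (0≤- (≤-trans (partial-convex x≥0 0≤½' M) (+≤ˡ _ (*≤ˡ 0≤½' (≤-by+ˡ (0≤term y≥0 M)))))))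
  (trans (cong (λ z → two * p - z) (trans (sym (*-identityˡ q)) (cong (_* q) (sym ½*2)))) (trans (solve 3 (λ p q h → :2 :* p :- h :* :2 :* q := :2 :* (p :+ h :* q) :- h :* :2 :* :2 :* q) refl p q ½')
   (trans (cong (λ z → two * (p + ½' * q) - z * two * q) ½*2) (solve 2 (λ s q → :2 :* s :- :1 :* :2 :* q := :2 :* (s :- q)) refl (p + ½' * q) q))))
  where
  y≥0 : 0ℚ ≤ x + ½'
  y≥0 = 0≤+ x≥0 0≤½'
  p = partial x (suc M)
  q = partial (x + ½') (suc M)

 partial-0 : ∀ M → partial 0ℚ M ≤ 1ℚ
 partial-0 zero = 0≤1
 partial-0 (suc zero)    = ≤-reflexive (+-identityˡ 1ℚ)
 partial-0 (suc (suc M)) = ≡≤ (trans (cong (partial 0ℚ (suc M) +_) (trans (cong (term 0ℚ M *_) (zeroˡ _)) (zeroʳ _))) (+-identityʳ _)) (partial-0 (suc M))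

 partial-2^ : ∀ ℓ M → partial (nat ℓ * ½') M ≤ two ^ ℓ
 partial-2^ zero    M = subst (λ z → partial z M ≤ 1ℚ) (sym (trans (cong (_* ½') nat-0) (zeroˡ ½'))) (partial-0 M)
 partial-2^ (suc ℓ) M = subst (λ z → partial z M ≤ two ^ suc ℓ) (trans (solve 2 (λ n h → n :* h :+ h := (:1 :+ n) :* h) refl (nat ℓ) ½') (cong (_* ½') (sym (nat-suc ℓ))))
  (≤-trans (partial-half (0≤* (0≤nat ℓ) 0≤½') M) (*≤ˡ (<⇒≤ 0<two) (partial-2^ ℓ M)))

 1+≤partial : ∀ {x} → 0ℚ ≤ x → ∀ k → 1ℚ + x ≤ partial x (2 ℕ.+ k)
 1+≤partial {x} h zero    = ≤-reflexive (cong₂ _+_ (sym (+-identityˡ 1ℚ)) (sym (term-1 x)))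
 1+≤partial h (suc k) = ≤-trans (1+≤partial h k) (≤-by+ˡ (0≤term h (2 ℕ.+ k)))

 -- Up to k = m each new factor is at most 1 + x; from there on it is at most 1.
 term-bounded : ∀ {x} → 0ℚ ≤ x → ∀ {m} → x ≤ nat m → ∀ k → term x k ≤ (1ℚ + x) ^ m
 term-bounded {x} x≥0 {m} x≤m k with k ℕ.≤? m
 ... | yes le = ≤-trans (grow k) (^-expo (≤-by+ˡ x≥0) le)
  where
  grow : ∀ k → term x k ≤ (1ℚ + x) ^ k
  grow zero    = ≤-refl
  grow (suc k) = ≤≡ (*≤ (0≤term x≥0 k) (grow k) (0≤* x≥0 (<⇒≤ (0<inv (0<nat k)))) (*inv≤ (0<nat k)
   (≤-trans (≤-by+ʳ 0≤1) (≡≤ (sym (*-identityʳ _)) (*≤ˡ (0≤+ 0≤1 x≥0) (≤≡ (≤-by+ˡ (0≤nat k)) (sym (nat-suc k)))))))) (*-comm _ _)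
 term-bounded x≥0 x≤m zero | no ¬le = ⊥-elim (¬le z≤n)
 term-bounded {x} x≥0 {m} x≤m (suc k) | no ¬le = ≤-trans (≤≡ (*≤ˡ (0≤term x≥0 k) (*inv≤ (0<nat k) (≤-trans x≤m (≤≡ (nat-mono (ℕ.<⇒≤ (ℕ.≰⇒> ¬le))) (sym (*-identityˡ _)))))) (*-identityʳ _)) (term-bounded x≥0 x≤m k)

 term-scale : ∀ c x k → term (c * x) k ≡ c ^ k * term x k
 term-scale c x zero    = sym (*-identityˡ 1ℚ)
 term-scale c x (suc k) = trans (cong (_* (c * x * inv (nat (suc k)))) (term-scale c x k)) (solve 5 (λ p t c x i → p :* t :* (c :* x :* i) := c :* p :* (t :* (x :* i))) refl (c ^ k) (term x k) c x (inv (nat (suc k))))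

 module Bounded {r : ℚ} (r≥0 : 0ℚ ≤ r) where

  m : ℕ
  m = proj₁ (archimedean (two * r))

  2r≥0 : 0ℚ ≤ two * r
  2r≥0 = 0≤* (<⇒≤ 0<two) r≥0

  B : ℚ
  B = (1ℚ + two * r) ^ m

  1≤B : 1ℚ ≤ B
  1≤B = 1≤^ (≤-by+ˡ 2r≥0) m

  term≤ : ∀ k → term r k ≤ ½' ^ k * B
  term≤ k = ≡≤ (trans (cong (λ z → term z k) (trans (sym (*-identityˡ r)) (trans (cong (_* r) (sym ½*2)) (*-assoc ½' two r)))) (term-scale ½' (two * r) k))
   (*≤ˡ (^-nonneg 0≤½' k) (term-bounded 2r≥0 (proj₂ (archimedean (two * r))) k))

  partial≤ : ∀ M → partial r M ≤ two * B
  partial≤ M = ≤-trans (≤-by+ˡ (0≤* (0≤* (<⇒≤ 0<two) (≤-trans 0≤1 1≤B)) (^-nonneg 0≤½' M))) (go M)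
   where
   go : ∀ M → partial r M + two * B * ½' ^ M ≤ two * B
   go zero    = ≤-reflexive (solve 1 (λ b → :0 :+ :2 :* b :* :1 := :2 :* b) refl B)
   go (suc M) = ≤-trans (+-mono-≤ (+≤ˡ (partial r M) (term≤ M)) ≤-refl) (≡≤ (trans (solve 4 (λ p g b h → p :+ g :* b :+ :2 :* b :* (h :* g) := p :+ (:1 :+ h :* :2) :* (b :* g)) refl (partial r M) (½' ^ M) B ½')
    (trans (cong (λ z → partial r M + (1ℚ + z) * (B * ½' ^ M)) ½*2) (cong (partial r M +_) (sym (*-assoc two B _))))) (go M))

 record Abs≤ (x b : ℚ) : Set where
  constructor _,,_
  field
   below : - b ≤ x
   above : x ≤ b

 open Abs≤

 Abs≤-0≤ : ∀ {x} → Abs≤ x b → 0ℚ ≤ b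
 Abs≤-0≤ {b} {x} h = *-cancel-≤ 0<two (≡≤ (zeroˡ two) (≤-by-- (0≤+ (0≤- (below h)) (0≤- (above h))) (solve 2 (λ b x → b :* :2 :- :0 := x :- (:- b) :+ (b :- x)) refl b x)))

 Abs≤-* : ∀ {x y} → Abs≤ x b → Abs≤ y d → Abs≤ (x * y) (b * d)
 Abs≤-* {b = b} {d = d} {x} {y} i j = halve (≤-by-- (0≤+ (0≤* p₁ q₁) (0≤* p₂ q₂)) (solve 4 (λ x b y d → x :* y :* :2 :- (:- (b :* d)) :* :2 := (x :- (:- b)) :* (y :- (:- d)) :+ (b :- x) :* (d :- y)) refl x b y d))
  ,, halve (≤-by-- (0≤+ (0≤* p₁ q₂) (0≤* p₂ q₁)) (solve 4 (λ x b y d → b :* d :* :2 :- x :* y :* :2 := (x :- (:- b)) :* (d :- y) :+ (b :- x) :* (y :- (:- d))) refl x b y d))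
  where
  p₁ = 0≤- (below i)
  p₂ = 0≤- (above i)
  q₁ = 0≤- (below j)
  q₂ = 0≤- (above j)
  halve : ∀ {p q} → p * two ≤ q * two → p ≤ q
  halve = *-cancel-≤ 0<two

 Abs≤-+ : ∀ {x y} → Abs≤ x b → Abs≤ y d → Abs≤ (x + y) (b + d)
 Abs≤-+ {b = b} {d = d} i j = ≡≤ (solve 2 (λ b d → :- (b :+ d) := :- b :+ :- d) refl b d) (+-mono-≤ (below i) (below j)) ,, +-mono-≤ (above i) (above j)

 Abs≤-self : ∀ {x} → 0ℚ ≤ x → Abs≤ x x
 Abs≤-self {x} h = ≤-trans (neg≤ h) (≡≤ neg0 h) ,, ≤-refl

 Abs≤-mono : ∀ {x} → b ≤ d → Abs≤ x b → Abs≤ x d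
 Abs≤-mono h i = ≤-trans (neg≤ h) (below i) ,, ≤-trans (above i) h

 Abs≤-cancel : ∀ {x} → ∀ n → Abs≤ (nat (suc n) * x) (nat (suc n) * b) → Abs≤ x b
 Abs≤-cancel {b} {x} n i = *-cancel-≤ (0<nat n) (≡≤ (solve 2 (λ n b → (:- b) :* n := :- (n :* b)) refl (nat (suc n)) b) (≤≡ (below i) (*-comm _ x)))
  ,, *-cancel-≤ (0<nat n) (≡≤ (*-comm x _) (≤≡ (above i) (*-comm _ b)))

 Abs≤-term : ∀ {x} → Abs≤ x a → ∀ k → Abs≤ (term x k) (term a k)
 Abs≤-term i zero    = Abs≤-self 0≤1
 Abs≤-term i (suc k) = Abs≤-* (Abs≤-term i k) (Abs≤-* i (Abs≤-self (<⇒≤ (0<inv (0<nat k)))))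

 -- Second-order Taylor remainders of xᵏ/k!.
 module Step {x h a : ℚ} (h≥0 : 0ℚ ≤ h) (x≤a : Abs≤ x a) (x-h≤a : Abs≤ (x - h) a) where

  private
   u v A δ : ℕ → ℚ
   u = term x
   v = term (x - h)
   A = term a
   δ k = v (suc k) - u (suc k) + h * u k

   a≥0 : 0ℚ ≤ a
   a≥0 = Abs≤-0≤ x≤a

   h² : ℚ
   h² = h * h

   δ-0 : δ 0 ≡ 0ℚ
   δ-0 = trans (cong₂ (λ p q → p - q + h * 1ℚ) (term-1 (x - h)) (term-1 x)) (solve 2 (λ x h → x :- h :- x :+ h :* :1 := :0) refl x h)

   δ-suc : ∀ k → nat (2 ℕ.+ k) * δ (suc k) ≡ h² * u k + (x - h) * δ k
   δ-suc k = begin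
    N * (v (2 ℕ.+ k) - u (2 ℕ.+ k) + h * u (suc k))
     ≡⟨ solve 5 (λ n p q h r → n :* (p :- q :+ h :* r) := n :* p :- n :* q :+ h :* (n :* r)) refl N (v (2 ℕ.+ k)) (u (2 ℕ.+ k)) h (u (suc k)) ⟩
    N * v (2 ℕ.+ k) - N * u (2 ℕ.+ k) + h * (N * u (suc k))
     ≡⟨ cong₂ (λ p q → p - q + h * (N * u (suc k))) (nat*term (x - h) (suc k)) (nat*term x (suc k)) ⟩
    (x - h) * v (suc k) - x * u (suc k) + h * (N * u (suc k))
     ≡⟨ cong (λ z → (x - h) * v (suc k) - x * u (suc k) + h * z) (trans (cong (_* u (suc k)) (nat-suc (suc k))) (trans (distribʳ (u (suc k)) 1ℚ _) (cong₂ _+_ (*-identityˡ _) (nat*term x k)))) ⟩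
    (x - h) * v (suc k) - x * u (suc k) + h * (u (suc k) + x * u k)
     ≡⟨ solve 5 (λ x h p q r → (x :- h) :* p :- x :* q :+ h :* (q :+ x :* r) := h :* h :* r :+ (x :- h) :* (p :- q :+ h :* r)) refl x h (v (suc k)) (u (suc k)) (u k) ⟩
    h² * u k + (x - h) * δ k ∎
    where
    open ≡-Reasoning
    N = nat (2 ℕ.+ k)

   δ-small : ∀ k → Abs≤ (δ (suc k)) (h² * A k)
   δ-small zero = Abs≤-cancel 1 (subst (λ z → Abs≤ z (nat 2 * (h² * 1ℚ))) (sym (trans (δ-suc 0) (trans (cong (λ z → h² * 1ℚ + (x - h) * z) δ-0) (solve 2 (λ p q → p :* :1 :+ q :* :0 := p :* :1) refl h² (x - h)))))
    (Abs≤-mono (≡≤ (sym (*-identityˡ _)) (*≤ʳ (0≤* (0≤sq h) 0≤1) (≡≤ (sym nat-1) (nat-mono {1} {2} (s≤s z≤n))))) (Abs≤-self (0≤* (0≤sq h) 0≤1))))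
   δ-small (suc k) = Abs≤-cancel (2 ℕ.+ k) (subst (λ z → Abs≤ z (nat (3 ℕ.+ k) * (h² * A (suc k)))) (sym (δ-suc (suc k)))
    (Abs≤-mono bound (Abs≤-+ (Abs≤-* (Abs≤-self (0≤sq h)) (Abs≤-term x≤a (suc k))) (Abs≤-* x-h≤a (δ-small k)))))
    where
    bound : h² * A (suc k) + a * (h² * A k) ≤ nat (3 ℕ.+ k) * (h² * A (suc k))
    bound = ≡≤ (trans (cong (h² * A (suc k) +_) (trans (solve 3 (λ a h t → a :* (h :* t) := h :* (a :* t)) refl a h² (A k)) (cong (h² *_) (sym (nat*term a k)))))
       (trans (solve 3 (λ g t n → g :* t :+ g :* (n :* t) := (:1 :+ n) :* (g :* t)) refl h² (A (suc k)) (nat (suc k))) (cong (_* (h² * A (suc k))) (sym (nat-suc (suc k))))))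
     (*≤ʳ (0≤* (0≤sq h) (0≤term a≥0 (suc k))) (nat-mono (ℕ.n≤1+n (2 ℕ.+ k))))

  -- The remainders of `δ-small` are summed. In the limit this is e^(x-h) ≥ (1 - h) e^x - h² e^a.
  partial-step : ∀ M → partial x (2 ℕ.+ M) - h * partial x (suc M) - h * h * partial a M ≤ partial (x - h) (2 ℕ.+ M)
  partial-step zero    = ≤-reflexive (trans (cong (λ z → 0ℚ + 1ℚ + z - h * (0ℚ + 1ℚ) - h * h * 0ℚ) (term-1 x)) (trans (solve 2 (λ x h → :0 :+ :1 :+ x :- h :* (:0 :+ :1) :- h :* h :* :0 := :0 :+ :1 :+ (x :- h)) refl x h) (cong (0ℚ + 1ℚ +_) (sym (term-1 (x - h))))))
  partial-step (suc M) = ≤-trans (≤-by-- (0≤- (below (δ-small M)))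
     (solve 8 (λ p t h q s r w z → p :- h :* q :- h :* h :* r :+ z :- (p :+ t :- h :* (q :+ s) :- h :* h :* (r :+ w)) := z :- t :+ h :* s :- (:- (h :* h :* w))) refl
      (partial x (2 ℕ.+ M)) (u (2 ℕ.+ M)) h (partial x (suc M)) (u (suc M)) (partial a M) (A M) (v (2 ℕ.+ M))))
   (+≤ʳ (v (2 ℕ.+ M)) (partial-step M))

 bernoulli⁻ : ∀ {x} → 0ℚ ≤ x → x ≤ 1ℚ → ∀ s → 1ℚ - nat s * x ≤ (1ℚ - x) ^ s
 bernoulli⁻ {x} h k zero    = ≤-reflexive (trans (cong (λ z → 1ℚ - z * x) nat-0) (solve 1 (λ x → :1 :- :0 :* x := :1) refl x))
 bernoulli⁻ {x} h k (suc s) = ≤-trans (≤-by (nat s * x * x) (0≤* (0≤* (0≤nat s) h) h) (trans (cong (λ z → 1ℚ - z * x + nat s * x * x) (nat-suc s)) (solve 2 (λ s x → :1 :- (:1 :+ s) :* x :+ s :* x :* x := (:1 :- x) :* (:1 :- s :* x)) refl (nat s) x)))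
  (*≤ˡ (0≤- k) (bernoulli⁻ h k s))

 module Descent {r : ℚ} (r≥0 : 0ℚ ≤ r) where

  open Bounded r≥0

  D : ℚ
  D = 1ℚ + two * B

  0≤D : 0ℚ ≤ D
  0≤D = 0≤+ 0≤1 (0≤* (<⇒≤ 0<two) (≤-trans 0≤1 1≤B))

  module _ (h : ℚ) (h≥0 : 0ℚ ≤ h) (h≤1 : h ≤ 1ℚ) (M : ℕ) (tail : term r (suc M) ≤ h) where

   -- Euler's method from 0 down to -jh: a step multiplies by 1 - h with an error of at most h² D.
   -- Half of D, so to speak, is the series bound 2B; the summand 1 covers the last term, which
   -- `tail` bounds by h and which is cut off once per step.
   descend : ∀ j → nat j * h ≤ r → (1ℚ - h) ^ j - nat j * (h * h * D) ≤ partial (- (nat j * h)) (2 ℕ.+ M)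
   descend zero    le = subst (λ z → 1ℚ - nat 0 * (h * h * D) ≤ partial z (2 ℕ.+ M)) (sym (trans (cong (λ z → - (z * h)) nat-0) (solve 1 (λ h → :- (:0 :* h) := :0) refl h)))
    (≤-trans (-≤ ≤-refl (0≤* (0≤nat 0) (0≤* (0≤sq h) 0≤D))) (≡≤ (solve 0 (:1 :- :0 := :1 :+ :0) refl) (1+≤partial ≤-refl M)))
   descend (suc j) le = subst (λ z → (1ℚ - h) ^ suc j - nat (suc j) * (h * h * D) ≤ partial z (2 ℕ.+ M)) x-h≡ (begin
    (1ℚ - h) * P - nat (suc j) * (h * h * D)
     ≤⟨ ≤-by-- (0≤* h≥0 (0≤* (0≤nat j) (0≤* (0≤sq h) 0≤D))) (trans (cong (λ z → (1ℚ - h) * (P - nat j * (h * h * D)) - h * h * D - ((1ℚ - h) * P - z * (h * h * D))) (nat-suc j))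
      (solve 4 (λ h p n d → (:1 :- h) :* (p :- n :* (h :* h :* d)) :- h :* h :* d :- ((:1 :- h) :* p :- (:1 :+ n) :* (h :* h :* d)) := h :* (n :* (h :* h :* d))) refl h P (nat j) D)) ⟩
    (1ℚ - h) * (P - nat j * (h * h * D)) - h * h * D
     ≤⟨ +≤ʳ _ (*≤ˡ (0≤- h≤1) (descend j (≤-trans (≤-by h h≥0 (trans (solve 2 (λ n h → n :* h :+ h := (:1 :+ n) :* h) refl (nat j) h) (cong (_* h) (sym (nat-suc j))))) le))) ⟩
    (1ℚ - h) * Ex - h * h * D
     ≤⟨ ≤-by-- (0≤* h≥0 (0≤+ (0≤- (≤≡ (neg≤ (≤-trans (≤≡ (neg≤ (Abs≤.below (Abs≤-term abs-x (suc M)))) (solve 1 (λ t → :- (:- t) := t) refl (term r (suc M)))) tail)) (solve 1 (λ t → :- (:- t) := t) refl (term x (suc M)))))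
      (0≤* h≥0 (0≤- (partial≤ M)))))
      (solve 6 (λ h e t d p f → (e :+ t) :- h :* e :- h :* h :* p :- ((:1 :- h) :* (e :+ t) :- h :* h :* (:1 :+ d)) := h :* (t :- (:- h) :+ h :* (d :- p))) refl h (partial x (suc M)) (term x (suc M)) (two * B) (partial r M) 0ℚ) ⟩
    Ex - h * partial x (suc M) - h * h * partial r M
     ≤⟨ Step.partial-step h≥0 abs-x abs-x-h M ⟩
    partial (x - h) (2 ℕ.+ M) ∎)
    where
    open ≤-Reasoning
    P = (1ℚ - h) ^ j
    x = - (nat j * h)
    Ex = partial x (2 ℕ.+ M)
    x-h≡ : x - h ≡ - (nat (suc j) * h)
    x-h≡ = trans (solve 2 (λ n h → :- (n :* h) :- h := :- ((:1 :+ n) :* h)) refl (nat j) h) (cong (λ z → - (z * h)) (sym (nat-suc j)))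
    abs-neg : ∀ {z} → 0ℚ ≤ z → z ≤ r → Abs≤ (- z) r
    abs-neg z≥0 z≤r = neg≤ z≤r ,, ≤-trans (neg≤ z≥0) (≡≤ neg0 r≥0)
    abs-x : Abs≤ x r
    abs-x = abs-neg (0≤* (0≤nat j) h≥0) (≤-trans (*≤ʳ h≥0 (nat-mono (ℕ.n≤1+n j))) le)
    abs-x-h : Abs≤ (x - h) r
    abs-x-h = subst (λ z → Abs≤ z r) (sym x-h≡) (abs-neg (0≤* (0≤nat (suc j)) h≥0) le)

 -- This is e^(-n/K) ≥ (1 - 1/K)^n, obtained from the series. Each of the n steps of length 1/K is
 -- divided into s steps of length h; as (1 - h)^s ≥ 1 - 1/K, only the error of Euler's method has
 -- to be made small by a large s.
 exp-lower : ∀ {K} → 1ℚ ≤ K → ∀ n {p} → p < (1ℚ - inv K) ^ n → ∃ λ N → ∀ k → p ≤ partial (- (nat n * inv K)) (N ℕ.+ k)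
 exp-lower {K} K≥1 n {p} p<q = 2 ℕ.+ J , λ k → ≤-trans main (subst (λ z → (1ℚ - h) ^ (n ℕ.* s) - nat (n ℕ.* s) * (h * h * D) ≤ partial z (2 ℕ.+ J ℕ.+ k)) (cong (λ z → - z) steps)
    (Des.descend h h≥0 h≤1 (J ℕ.+ k) (≤-trans (B.term≤ (suc (J ℕ.+ k))) (tail-small k)) (n ℕ.* s) (≤-reflexive steps)))
  where
  K>0 : 0ℚ < K
  K>0 = <-≤-trans 0<1 K≥1
  r = nat n * inv K
  r≥0 : 0ℚ ≤ r
  r≥0 = 0≤* (0≤nat n) (<⇒≤ (0<inv K>0))
  module B = Bounded r≥0
  module Des = Descent r≥0
  D = Des.D
  q = (1ℚ - inv K) ^ n
  g = q - p
  g>0 : 0ℚ < g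
  g>0 = subst (_< g) (+-inverseʳ p) (subst₂ _<_ (+-comm (- p) p) (+-comm (- p) q) (+-mono-≤-< p<q))
   where
   +-mono-≤-< : ∀ {a b c} → a < b → c + a < c + b
   +-mono-≤-< {a} {b} {c} lt = subst₂ _<_ (+-comm a c) (+-comm b c) (+-mono-<-≤ lt (≤-refl {c}))
  -- The n s Euler steps have the total error n s h² D = r D h ≤ r D / s, which must not exceed g.
  s₀ = proj₁ (archimedean (r * D * inv g))
  s = suc s₀
  s>0 : 0ℚ < nat s
  s>0 = 0<nat s₀
  h = inv K * inv (nat s)
  h>0 : 0ℚ < h
  h>0 = 0<* (0<inv K>0) (0<inv s>0)
  h≥0 : 0ℚ ≤ h
  h≥0 = <⇒≤ h>0
  1/K≤1 : inv K ≤ 1ℚ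
  1/K≤1 = ≤≡ (inv-anti 0<1 K≥1) inv-1
  h≤1/s : h ≤ inv (nat s)
  h≤1/s = ≤≡ (*≤ʳ (<⇒≤ (0<inv s>0)) 1/K≤1) (*-identityˡ _)
  h≤1 : h ≤ 1ℚ
  h≤1 = ≤-trans h≤1/s (≤≡ (inv-anti 0<1 (≡≤ (sym nat-1) (nat-mono (s≤s z≤n)))) inv-1)
  sh : nat s * h ≡ inv K
  sh = trans (solve 3 (λ s k i → s :* (k :* i) := k :* (s :* i)) refl (nat s) (inv K) (inv (nat s))) (trans (cong (inv K *_) (*inv s>0)) (*-identityʳ _))
  steps : nat (n ℕ.* s) * h ≡ r
  steps = trans (cong (_* h) (nat-* n s)) (trans (*-assoc (nat n) (nat s) h) (cong (nat n *_) sh))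
  small = power-small (0<inv (0<nat 1)) (≤-by ½' 0≤½' ½+½) (0<* h>0 (0<inv (<-≤-trans 0<1 B.1≤B)))
  J = proj₁ small
  ½≤1 : ½' ≤ 1ℚ
  ½≤1 = ≤-by ½' 0≤½' ½+½
  tail-small : ∀ k → ½' ^ suc (J ℕ.+ k) * B.B ≤ h
  tail-small k = ≤≡ (*≤ʳ (≤-trans 0≤1 B.1≤B) (≤-trans (≤≡ (*≤ʳ (^-nonneg 0≤½' (J ℕ.+ k)) ½≤1) (trans (*-identityˡ _) (^-+ ½' J k)))
     (≤-trans (≤≡ (*≤ˡ (^-nonneg 0≤½' J) (^≤1 0≤½' ½≤1 k)) (trans (*-identityʳ _) (cong (_^ J) ½≡))) (proj₂ small))))
   (inv*-cancel (<-≤-trans 0<1 B.1≤B))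
   where
   ½≡ : ½' ≡ 1ℚ - ½'
   ½≡ = trans (solve 1 (λ h → h := h :+ h :- h) refl ½') (cong (λ z → z - ½') ½+½)
  main : p ≤ (1ℚ - h) ^ (n ℕ.* s) - nat (n ℕ.* s) * (h * h * D)
  main = ≡≤ (solve 2 (λ p q → p := q :- (q :- p)) refl p q) (-≤ power (≡≤ (trans (solve 3 (λ n h d → n :* (h :* h :* d) := n :* h :* d :* h) refl (nat (n ℕ.* s)) h D) (cong (λ z → z * D * h) steps))
     (≤-trans (*≤ˡ (0≤* r≥0 Des.0≤D) h≤1/s) (*inv≤ s>0 (≡≤ (sym (inv*-cancel g>0)) (≤≡ (*≤ʳ (<⇒≤ g>0) (≤-trans (proj₂ (archimedean (r * D * inv g))) (nat-mono (ℕ.n≤1+n s₀)))) (*-comm _ g)))))))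
   where
   power : q ≤ (1ℚ - h) ^ (n ℕ.* s)
   power = ≤≡ (^-mono (0≤- 1/K≤1) (≡≤ (cong (λ z → 1ℚ - z) (sym sh)) (bernoulli⁻ h≥0 h≤1 s)) n) (sym (^-^ (1ℚ - h) n s))

-- Trees as protocols, and protocols as mixtures of trees.

module Realisation where

 open Arithmetic
 open LogBounds
 open Classes
 open Tilting
 open NoisySearch using (½'; ½+½; 0≤½')
 open LeafSelection
 open FiniteTheorem
 open Reals
 open ExponentialSeries using (partial; partial≡; partial-2^; 1+≤partial; exp-lower)
 open R using (ℝ∞; below; down; closed; ι; fromℕ; expℚ; exp; ln; log₂; √_; ∑; ProbSpace; Outcome; weight; size; 𝔼; sign; Tree; output; alice; bob; run; depth; Protocol; public-coins; alice-coins; bob-coins; tree; ‖_‖; bias; adv; xor-power)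
 open import Data.Fin using (Fin; zero; suc)
 open import Data.Vec.Functional using (foldr)
 open import Data.List using (allFin; lookup)
 open import Data.List.Properties using (map-tabulate; length-tabulate; tabulate-lookup)
 open import Data.List.Relation.Unary.All using (All; _∷_)
 open import Function.Bundles using (_↔_; Inverse)
 open import Level using (0ℓ)

 In-fromℕ : ∀ n → In (fromℕ n) (nat n) (nat n)
 In-fromℕ n = subst (λ z → In (ι z) (nat n) (nat n)) (nat≡ n) (In-ι (nat n))

 exp≤ : ∀ {q b} → (∀ M → partial q M ≤ b) → expℚ q R.≤ ι b
 exp≤ {q} h z g = sup-≤ g λ p (N , k) → ≤-trans (k 0) (≡≤ (partial≡ q (N ℕ.+ 0)) (h (N ℕ.+ 0)))

 1+≤exp : ∀ {q} → 0ℚ ≤ q → below (expℚ q) (1ℚ + q)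
 1+≤exp {q} h p p<q ¬∃ = ¬∃ (2 , λ k → ≤-trans (<⇒≤ p<q) (≤≡ (1+≤partial h k) (sym (partial≡ q (2 ℕ.+ k)))))

 -- From e^q ≥ 1 + q. This crude bound suffices for ln 2 ≤ 1 and for the finiteness of the logarithm
 -- in the denominator.
 ln-≤ : ∀ {x b} → 1ℚ ≤ b → x R.≤ ι b → ln x R.≤ ι (b - 1ℚ)
 ln-≤ {x} {b} b≥1 h z g = sup-≤ g λ p ((q , e) , p≤q) → ≤-trans p≤q (small q e)
  where
  small : ∀ q → expℚ q R.≤ x → q ≤ b - 1ℚ
  small q e with 0ℚ ≤? q
  ... | no q<0 = ≤-trans (<⇒≤ (≰⇒> q<0)) (0≤- b≥1)
  ... | yes q≥0 = ≡≤ (solve 1 (λ q → q := :1 :+ q :- :1) refl q) (+≤ʳ _ (h _ (e _ (1+≤exp q≥0))))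

 ln-≥ : ∀ {x} ℓ → below x (two ^ ℓ) → below (ln x) (nat ℓ * ½')
 ln-≥ {x} ℓ h p p<q ¬∃ = ¬∃ ((nat ℓ * ½' , λ z g → down x (exp≤ (partial-2^ ℓ) z g) h) , <⇒≤ p<q)

 ÷-below : ∀ {x y a c} → 0ℚ ≤ a → 0ℚ ≤ c → In y c 1ℚ → below x a → below (x R.÷ y) a
 ÷-below {x} {y} {a} a≥0 c≥0 i h p p<a ¬∃ = ¬∃ ((a , λ z g → down x (≤≡ (hi (In-*⁺ a≥0 c≥0 (In-ι a) i) z g) (*-identityʳ a)) h) , <⇒≤ p<a)

 ÷-≤ : ∀ {x y b c d} → 0ℚ ≤ b → 0ℚ < c → In y c d → x R.≤ ι b → (x R.÷ y) R.≤ ι (b * inv c)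
 ÷-≤ {x} {y} {b} {c} b≥0 c>0 i h z g = sup-≤ g λ p ((q , e) , p≤q) → ≤-trans p≤q (small q e)
  where
  small : ∀ q → (ι q R.* y) R.≤ x → q ≤ b * inv c
  small q e with 0ℚ ≤? q
  ... | no q<0 = ≤-trans (<⇒≤ (≰⇒> q<0)) (0≤* b≥0 (<⇒≤ (0<inv c>0)))
  ... | yes q≥0 = ≤*inv c>0 (h _ (e _ (lo (In-*⁺ q≥0 (<⇒≤ c>0) (In-ι q) i))))

 In-√ : ∀ {n ρ} → n ℕ.≤ ρ ℕ.* ρ → In (√ fromℕ n) 0ℚ (nat ρ)
 In-√ {n} {ρ} h = (λ p p<0 ¬∃ → ¬∃ ((0ℚ , λ z g → down (fromℕ n) (≤-trans g (≡≤ (trans (sym (*≡ 0ℚ 0ℚ)) (zeroˡ 0ℚ)) (0≤nat n))) (lo (In-fromℕ n))) , <⇒≤ p<0)) ,,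
  λ z g → sup-≤ g λ p ((q , e) , p≤q) → ≤-trans p≤q (sq-cancel-≤ (0≤nat ρ) (≡≤ (*≡ q q) (≤-trans (hi (In-fromℕ n) _ (e _ ≤-refl)) (≤≡ (nat-mono h) (nat-* ρ ρ)))))

 In-ln2 : In (ln (fromℕ 2)) ½' 1ℚ
 In-ln2 = subst (below (ln (fromℕ 2))) (trans (cong (_* ½') nat-1) (*-identityˡ ½')) (ln-≥ {fromℕ 2} 1 (subst (below (fromℕ 2)) (trans nat-2 (sym (*-identityʳ two))) (lo (In-fromℕ 2)))) ,,
  λ z g → ≤≡ (ln-≤ {fromℕ 2} (≤≡ (≤-by+ˡ 0≤1) (sym nat-2)) (hi (In-fromℕ 2)) z g) (trans (cong (λ z → z - 1ℚ) nat-2) (solve 0 (:2 :- :1 := :1) refl))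

 0<½' : 0ℚ < ½'
 0<½' = 0<inv (0<nat 1)

 -- The lower bound is ℓ/2 instead of ℓ because of e^(ℓ/2) ≤ 2^ℓ and ln 2 ≤ 1; the factor 2 is
 -- absorbed by κ.
 In-log₂ : ∀ {x b} ℓ → below x (two ^ ℓ) → x R.≤ ι b → ∃ λ u → In (log₂ x) (nat ℓ * ½') u
 In-log₂ {x} {b} ℓ h k = _ , (÷-below {ln x} {ln (fromℕ 2)} (0≤* (0≤nat ℓ) 0≤½') 0≤½' In-ln2 (ln-≥ {x} ℓ h) ,, ÷-≤ {ln x} {ln (fromℕ 2)} (0≤- b≥1) 0<½' In-ln2 (ln-≤ {x} b≥1 k))
  where
  b≥1 : 1ℚ ≤ b
  b≥1 = ≤-trans (1≤^ (≤-by+ˡ 0≤1) ℓ) (k _ h)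

 exp-below : ∀ {x} {K} → 1ℚ ≤ K → ∀ n → below x (- (nat n * inv K)) → below (exp x) ((1ℚ - inv K) ^ n)
 exp-below {x} {K} K≥1 n h p p<q ¬∃ = ¬∃ ((_ , h) , λ p' p'<p ¬∃' → let N , g = exp-lower K≥1 n p<q in
   ¬∃' (N , λ k → ≤-trans (<⇒≤ p'<p) (≤≡ (g k) (sym (partial≡ (- (nat n * inv K)) (N ℕ.+ k))))))

 fin-eq : ∀ {k} → Fin k → Fin k → Bool
 fin-eq zero    zero    = true
 fin-eq zero    (suc j) = false
 fin-eq (suc i) zero    = false
 fin-eq (suc i) (suc j) = fin-eq i j

 fin-eq-sound : ∀ {k} (i j : Fin k) → fin-eq i j ≡ true → i ≡ j
 fin-eq-sound zero    zero    h = refl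
 fin-eq-sound (suc i) (suc j) h = cong suc (fin-eq-sound i j h)

 fin-eq-refl : ∀ {k} (i : Fin k) → fin-eq i i ≡ true
 fin-eq-refl zero    = refl
 fin-eq-refl (suc i) = fin-eq-refl i

 fin-eq-sym : ∀ {k} (i j : Fin k) → fin-eq i j ≡ fin-eq j i
 fin-eq-sym zero    zero    = refl
 fin-eq-sym zero    (suc j) = refl
 fin-eq-sym (suc i) zero    = refl
 fin-eq-sym (suc i) (suc j) = fin-eq-sym i j

 fin-once : ∀ {k} (i : Fin k) → Sum (allFin k) (λ j → ⟦ fin-eq i j ⟧) ≡ 1ℚ
 fin-once {suc k} zero    = trans (Sum-allFin {k} (λ j → ⟦ fin-eq zero j ⟧)) (trans (cong (1ℚ +_) (Sum-0 (allFin k))) (+-identityʳ 1ℚ))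
 fin-once {suc k} (suc i) = trans (Sum-allFin {k} (λ j → ⟦ fin-eq (suc i) j ⟧)) (trans (+-identityˡ _) (fin-once i))

 ↔-finite : ∀ {A : Set} {k} → A ↔ Fin k → Finite A
 ↔-finite {A} {k} i = record
  { values    = map from (allFin k)
  ; _==_ = λ a b → fin-eq (to a) (to b)
  ; ==-equiv  = record { re = λ a → fin-eq-refl (to a) ; sy = λ a b → fin-eq-sym (to a) (to b)
   ; tr = λ {a} {b} c h → cong (λ z → fin-eq z (to c)) (fin-eq-sound (to a) (to b) h) }
  ; ==-sound  = λ {a} {b} h → trans (sym (strictlyInverseʳ a)) (trans (cong from (fin-eq-sound (to a) (to b) h)) (strictlyInverseʳ b))
  ; once = λ a → trans (Sum-map from (allFin k)) (trans (Sum-cong (allFin k) (λ j → cong (λ z → ⟦ fin-eq (to a) z ⟧) (strictlyInverseˡ j))) (fin-once (to a)))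
  }
  where open Inverse i

 ⊔-bound : ∀ {n} (g : Fin n → ℕ) {c} → (∀ i → g i ℕ.≤ c) → foldr ℕ._⊔_ 0 g ℕ.≤ c
 ⊔-bound {zero}  g h = z≤n
 ⊔-bound {suc n} g h = ℕ.⊔-lub (h zero) (⊔-bound (λ i → g (suc i)) (λ i → h (suc i)))

 ≤⊔ : ∀ {n} (g : Fin n → ℕ) i → g i ℕ.≤ foldr ℕ._⊔_ 0 g
 ≤⊔ {suc n} g zero    = ℕ.m≤m⊔n (g zero) _
 ≤⊔ {suc n} g (suc i) = ℕ.≤-trans (≤⊔ (λ i → g (suc i)) i) (ℕ.m≤n⊔m (g zero) _)

 module _ {A B A' B' : Set} (φ : A → A') (ψ : B → B') where

  -- Serves in both directions: to fix the private coins of a protocol, and to let a deterministic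
  -- tree ignore them.
  pullback : Tree A' B' → Tree A B
  pullback (output c)  = output c
  pullback (alice m k) = alice (m ∘ φ) (λ b → pullback (k b))
  pullback (bob m k)   = bob (m ∘ ψ) (λ b → pullback (k b))

  run-pullback : ∀ t a b → run (pullback t) a b ≡ run t (φ a) (ψ b)
  run-pullback (output c)  a b = refl
  run-pullback (alice m k) a b = run-pullback (k (m (φ a))) a b
  run-pullback (bob m k)   a b = run-pullback (k (m (ψ b))) a b

  depth-pullback : ∀ t → depth (pullback t) ≡ depth t
  depth-pullback (output c)  = refl
  depth-pullback (alice m k) = cong₂ (λ u v → suc (u ℕ.⊔ v)) (depth-pullback (k false)) (depth-pullback (k true))
  depth-pullback (bob m k)   = cong₂ (λ u v → suc (u ℕ.⊔ v)) (depth-pullback (k false)) (depth-pullback (k true))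

 uniform : ∀ m → 0ℚ < nat m → ProbSpace
 uniform m m>0 = record
  { size = m
  ; weight = λ _ → ι (inv (nat m))
  ; nonNegative = λ _ q h → ≤-trans h (<⇒≤ (0<inv m>0))
  ; total = hi sums , λ q h → down (∑ {m} (λ _ → ι (inv (nat m)))) h (lo sums)
  }
  where
  sums : In (∑ {m} (λ _ → ι (inv (nat m)))) 1ℚ 1ℚ
  sums = subst (λ z → In (∑ {m} (λ _ → ι (inv (nat m)))) z z) (trans (Sum-const (inv (nat m)) (allFin m)) (trans (cong (λ z → nat z * inv (nat m)) (length-tabulate id)) (*inv m>0)))
   (In-∑ {m} (λ i → In-ι (inv (nat m))))

 In-uniform : ∀ m m>0 (F : Fin m → ℝ∞ 0ℓ) (v : Fin m → ℚ) → (∀ i → In (F i) (v i) (v i)) → In (𝔼 (uniform m m>0) F) (inv (nat m) * Sum (allFin m) v) (inv (nat m) * Sum (allFin m) v)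
 In-uniform m m>0 F v h = subst (λ z → In (𝔼 (uniform m m>0) F) z z) (Sum-*ˡ (inv (nat m)) (allFin m)) (In-∑ (λ i → In-*-exact (In-ι (inv (nat m))) (h i)))

 In-trivial : ∀ (F : Fin 1 → ℝ∞ 0ℓ) v → (∀ i → In (F i) v v) → In (𝔼 (uniform 1 (0<nat 0)) F) v v
 In-trivial F v h = subst (λ z → In (𝔼 (uniform 1 (0<nat 0)) F) z z) (trans (cong₂ _*_ (trans (cong inv nat-1) inv-1) (+-identityʳ v)) (*-identityˡ v)) (In-uniform 1 (0<nat 0) F (λ _ → v) h)

 module FromTrees {X Y : Set} (ts : List (Tree X Y)) (ne : 0ℚ < nat (length ts)) where

  protocol : Protocol X Y
  protocol = record
   { public-coins = uniform (length ts) ne ; alice-coins = uniform 1 (0<nat 0) ; bob-coins = uniform 1 (0<nat 0)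
   ; tree = λ ω → pullback proj₁ proj₁ (lookup ts ω) }

  protocol-depth : ∀ {c} → All (λ t → depth t ℕ.≤ c) ts → ‖ protocol ‖ ℕ.≤ c
  protocol-depth {c} h = ⊔-bound (λ ω → depth (tree protocol ω)) (λ ω → ≡≤ᴺ (depth-pullback proj₁ proj₁ (lookup ts ω)) (at h ω))
   where
   at : ∀ {us} → All (λ t → depth t ℕ.≤ c) us → ∀ i → depth (lookup us i) ℕ.≤ c
   at (p ∷ ps) zero    = p
   at (p ∷ ps) (suc i) = at ps i

  protocol-bias : ∀ (f : X × Y → Bool) x y → ½' * nat (length ts) ≤ Sum ts (λ t → sg (run t x y xor f (x , y))) → below (bias protocol f (x , y)) ½'
  protocol-bias f x y h = down (bias protocol f (x , y)) (≤≡ (≤*inv ne h) (trans (*-comm _ (inv (nat (length ts)))) (cong (inv (nat (length ts)) *_) (sym sum≡))))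
   (lo (In-uniform (length ts) ne _ v (λ ω → In-trivial _ (v ω) (λ α → In-trivial _ (v ω) (λ β →
    subst (λ z → In (sign (z xor f (x , y))) (v ω) (v ω)) (sym (run-pullback proj₁ proj₁ (lookup ts ω) (x , α) (y , β))) (In-sign (run (lookup ts ω) x y xor f (x , y))))))))
   where
   v : Fin (length ts) → ℚ
   v ω = sg (run (lookup ts ω) x y xor f (x , y))
   sum≡ : Sum (allFin (length ts)) v ≡ Sum ts (λ t → sg (run t x y xor f (x , y)))
   sum≡ = trans (sym (Sum-map (lookup ts) (allFin (length ts)))) (cong (λ us → Sum us (λ t → sg (run t x y xor f (x , y)))) (trans (map-tabulate id (lookup ts)) (tabulate-lookup ts)))

 module Mixture {X Y : Set} (π : Protocol X Y) {e : ℚ} (e>0 : 0ℚ < e) (e≤½ : e ≤ ½') where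

  Index : Set
  Index = Outcome (public-coins π) × Outcome (alice-coins π) × Outcome (bob-coins π)

  indices : List Index
  indices = cartesianProduct (outcomes (public-coins π) e>0) (cartesianProduct (outcomes (alice-coins π) e>0) (outcomes (bob-coins π) e>0))

  branchᵗ : Index → Tree X Y
  branchᵗ (ω , α , β) = pullback (_, α) (_, β) (tree π ω)

  branch-depth : ∀ j → depth (branchᵗ j) ℕ.≤ ‖ π ‖
  branch-depth (ω , α , β) = ≡≤ᴺ (depth-pullback (_, α) (_, β) (tree π ω)) (≤⊔ (λ ω → depth (tree π ω)) ω)

  -- Each of the three nested expectations contributes one error e.
  Mixed : (Index → ℚ) → Set
  Mixed w = (∀ j → 0ℚ ≤ w j) × Sum indices w ≤ 1ℚ ×
   (∀ g x y p → below (bias π g (x , y)) p → p ≤ Sum indices (λ j → w j * sg (run (branchᵗ j) x y xor g (x , y))) + (e + e + e))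

  mixed-weights : ¬ ¬ ∃ Mixed
  mixed-weights ¬∃ = rational-weights (public-coins π) e>0 λ (u , u≥0 , u≤1 , u-𝔼) → rational-weights (alice-coins π) e>0 λ (v , v≥0 , v≤1 , v-𝔼) →
   rational-weights (bob-coins π) e>0 λ (w , w≥0 , w≤1 , w-𝔼) → ¬∃ (_ , mixed u u≥0 u≤1 u-𝔼 v v≥0 v≤1 v-𝔼 w w≥0 w≤1 w-𝔼)
   where
   Ps = outcomes (public-coins π) e>0
   As = outcomes (alice-coins π) e>0
   Bs = outcomes (bob-coins π) e>0
   average≤ : ∀ {A : Set} (xs : List A) (w : A → ℚ) (F : A → ℚ) {b} → (∀ i → 0ℚ ≤ w i) → Sum xs w ≤ 1ℚ → 0ℚ ≤ b → (∀ i → F i ≤ b) → Sum xs (λ i → w i * F i) ≤ b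
   average≤ xs w F {b} w≥0 w≤1 b≥0 h = ≤-trans (Sum-mono xs (λ i → *≤ˡ (w≥0 i) (h i))) (≡≤ (Sum-*ʳ b xs) (≤≡ (*≤ʳ b≥0 w≤1) (*-identityˡ b)))
   shift : ∀ {A : Set} (xs : List A) (w : A → ℚ) (F : A → ℚ) {b} → Sum xs w ≤ 1ℚ → 0ℚ ≤ b → Sum xs (λ i → w i * (F i + b)) ≤ Sum xs (λ i → w i * F i) + b
   shift xs w F {b} w≤1 b≥0 = ≡≤ (trans (Sum-cong xs (λ i → distribˡ (w i) (F i) b)) (trans (Sum-+ xs) (cong (Sum xs (λ i → w i * F i) +_) (Sum-*ʳ b xs))))
    (+≤ˡ _ (≤≡ (*≤ʳ b≥0 w≤1) (*-identityˡ b)))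
   e≥0 : 0ℚ ≤ e
   e≥0 = <⇒≤ e>0
   mixed : ∀ u → _ → _ → _ → ∀ v → _ → _ → _ → ∀ w → _ → _ → _ → Mixed (λ (ω , α , β) → u ω * (v α * w β))
   mixed u u≥0 u≤1 u-𝔼 v v≥0 v≤1 v-𝔼 w w≥0 w≤1 w-𝔼 = (λ (ω , α , β) → 0≤* (u≥0 ω) (0≤* (v≥0 α) (w≥0 β))) ,
    ≡≤ (trans (Sum-× Ps _) (Sum-cong Ps (λ ω → trans (Sum-*ˡ (u ω) (cartesianProduct As Bs)) (cong (u ω *_) (trans (Sum-× As Bs) (Sum-cong As (λ α → Sum-*ˡ (v α) Bs)))))))
     (average≤ Ps u _ u≥0 u≤1 0≤1 (λ ω → average≤ As v _ v≥0 v≤1 0≤1 (λ α → w≤1))) ,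
    estimate
    where
    module _ (g : X × Y → Bool) (x : X) (y : Y) where
     s : Index → ℚ
     s j = sg (run (branchᵗ j) x y xor g (x , y))
     S₁ : Outcome (public-coins π) → Outcome (alice-coins π) → ℚ
     S₁ ω α = Sum Bs (λ β → w β * s (ω , α , β))
     S₂ : Outcome (public-coins π) → ℚ
     S₂ ω = Sum As (λ α → v α * (S₁ ω α + e))
     e≤1 : e ≤ 1ℚ
     e≤1 = ≤-trans e≤½ (≤-by ½' 0≤½' ½+½)
     S₁≤ : ∀ ω α → S₁ ω α ≤ 1ℚ
     S₁≤ ω α = average≤ Bs w _ w≥0 w≤1 0≤1 (λ β → sg≤1 (run (branchᵗ (ω , α , β)) x y xor g (x , y)))
     S₂≤ : ∀ ω → S₂ ω ≤ 1ℚ + e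
     S₂≤ ω = average≤ As v _ v≥0 v≤1 (0≤+ 0≤1 e≥0) (λ α → +≤ʳ e (S₁≤ ω α))
     inner : ∀ ω α → ∃ λ l → In (𝔼 (bob-coins π) λ β → sign (run (tree π ω) (x , α) (y , β) xor g (x , y))) l (S₁ ω α + e)
     inner ω α = w-𝔼 _ (λ β → s (ω , α , β)) (λ β → _ , subst (λ z → In (sign (z xor g (x , y))) (s (ω , α , β)) (s (ω , α , β))) (run-pullback (_, α) (_, β) (tree π ω) x y) (In-sign _))
      (λ β → ≤-trans (sg≤1 (run (branchᵗ (ω , α , β)) x y xor g (x , y))) (≤-by+ˡ 0≤1))
     middle : ∀ ω → ∃ λ l → In (𝔼 (alice-coins π) λ α → 𝔼 (bob-coins π) λ β → sign (run (tree π ω) (x , α) (y , β) xor g (x , y))) l (S₂ ω + e)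
     middle ω = v-𝔼 _ (λ α → S₁ ω α + e) (inner ω) (λ α → +-mono-≤ (S₁≤ ω α) e≤1)
     outer : ∃ λ l → In (bias π g (x , y)) l (Sum Ps (λ ω → u ω * (S₂ ω + e)) + e)
     -- The values are at most 1 + e + e, and e ≤ 1/2 keeps them within the bound 2 presupposed in
     -- `Weights`.
     outer = u-𝔼 _ (λ ω → S₂ ω + e) middle (λ ω → ≤-trans (+≤ʳ e (S₂≤ ω)) (≡≤ (+-assoc 1ℚ e e) (+≤ˡ 1ℚ (≤≡ (+-mono-≤ e≤½ e≤½) ½+½))))
     flat : Sum Ps (λ ω → u ω * Sum As (λ α → v α * S₁ ω α)) ≡ Sum indices (λ (ω , α , β) → u ω * (v α * w β) * s (ω , α , β))
     flat = sym (trans (Sum-× Ps _) (Sum-cong Ps (λ ω → trans (Sum-cong (cartesianProduct As Bs) (λ (α , β) → *-assoc (u ω) (v α * w β) (s (ω , α , β)))) (trans (Sum-*ˡ (u ω) (cartesianProduct As Bs)) (cong (u ω *_)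
      (trans (Sum-× As Bs) (Sum-cong As (λ α → trans (Sum-cong Bs (λ β → *-assoc (v α) (w β) (s (ω , α , β)))) (Sum-*ˡ (v α) Bs)))))))))
    estimate : ∀ g x y p → below (bias π g (x , y)) p → p ≤ Sum indices (λ (ω , α , β) → u ω * (v α * w β) * s g x y (ω , α , β)) + (e + e + e)
    estimate g x y p h = ≤-trans (hi (proj₂ (outer g x y)) p h) (≤≡ (+≤ʳ e (≤-trans (shift Ps u _ u≤1 e≥0) (+≤ʳ e (≤-trans (Sum-mono Ps (λ ω → *≤ˡ (u≥0 ω) (shift As v (S₁ g x y ω) v≤1 e≥0))) (shift Ps u _ u≤1 e≥0)))))
     (trans (solve 2 (λ q e → q :+ e :+ e :+ e := q :+ (e :+ e :+ e)) refl _ e) (cong (_+ (e + e + e)) (flat g x y))))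

-- The constant κ and the final contradiction.

module Conclusion where

 open Arithmetic
 open LogBounds
 open Classes
 open Tilting
 open NoisySearch using (½'; 0≤½')
 open CoordinateSelection using (η; 0<η)
 open LeafSelection
 open Parameters using (threshold)
 open FiniteTheorem
 open Reals
 open Realisation
 open R using (ℝ∞; below; down; ι; fromℕ; exp; ln; log₂; √_; Tree; output; depth; run; Protocol; ‖_‖; bias; adv; xor-power)
 open import Data.Nat.Solver using (module +-*-Solver)
 open +-*-Solver using () renaming (solve to solveᴺ; con to conᴺ; _:*_ to _:×_; _:+_ to _:⊕_; _:=_ to _:≡_)
 open import Data.Fin using (Fin; zero; suc)
 open import Data.List.Relation.Unary.All using (All; []; _∷_)
 open import Function.Bundles using (_↔_; Inverse)
 open import Level using (0ℓ)

 -- 2^30 = 2 · 2048 · 32 · 8192, the number K = 2 s q M of `rounds` for the parameters chosen in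
 -- `Core.good-tree`.
 Kᴺ : ℕ
 Kᴺ = 1073741824

 K s : ℚ
 K = nat Kᴺ
 s = inv (nat 2097152)

 κ : ℝ∞ 0ℓ
 κ = ι (inv K)

 0<K : 0ℚ < K
 0<K = 0<nat 1073741823

 0<s : 0ℚ < s
 0<s = 0<inv (0<nat 2097151)

 1≤K : 1ℚ ≤ K
 1≤K = ≡≤ (sym nat-1) (nat-mono (s≤s z≤n))

 opaque
  unfolding _+_

  -- (1 - 1/K)^n is the lower bound used for exp(-κn). Multiplied by the admissible factor (1 +
  -- η/2)^n it leaves at least 1 + s, and the surplus s pays for all approximations.
  gain : 1ℚ + s ≤ (1ℚ - inv K) * (1ℚ + ½' * η)
  gain = decide

  s≤½ : s ≤ ½'
  s≤½ = decide

  ½≤½' : ½ ≤ ½'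
  ½≤½' = decide

 κ-finite : R.Finite κ
 κ-finite = (inv K , λ q h → h) , (inv K , λ q h → h)

 0<κ : ι 0ℚ R.< κ
 0<κ h = <-irrefl (<-≤-trans (0<inv 0<K) (h (inv K) ≤-refl))

 n<2^n : ∀ n → n ℕ.< 2 ℕ.^ n
 n<2^n zero    = s≤s z≤n
 n<2^n (suc n) = ≤≡ᴺ (ℕ.+-mono-≤ (ℕ.≤-trans (s≤s z≤n) (n<2^n n)) (n<2^n n)) (cong (2 ℕ.^ n ℕ.+_) (sym (ℕ.+-identityʳ _)))

 -- For the first ρ with n ≤ ρ², either ρ = 1 or ρ ≤ 2 (ρ - 1), where (ρ - 1)² < n.
 square-root : ∀ n → 1 ℕ.≤ n → ∃ λ ρ → n ℕ.≤ ρ ℕ.* ρ × ρ ℕ.* ρ ℕ.≤ 4 ℕ.* n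
 square-root n n≥1 = finish (threshold {P = λ ρ → n ℕ.≤ ρ ℕ.* ρ} (λ ρ → n ℕ.≤? ρ ℕ.* ρ) (λ h → ℕ.<-irrefl refl (ℕ.≤-trans n≥1 h)) n
    (≡≤ᴺ (sym (ℕ.*-identityʳ n)) (ℕ.*-monoʳ-≤ n n≥1)))
  where
  finish : _ → _
  finish (zero , _ , h)  = 1 , h , ℕ.≤-trans n≥1 (ℕ.m≤m+n n _)
  finish (suc r , ¬h , h) = 2 ℕ.+ r , h , ℕ.≤-trans (ℕ.*-mono-≤ double double) (≡≤ᴺ (solveᴺ 1 (λ r → conᴺ 2 :× r :× (conᴺ 2 :× r) :≡ conᴺ 4 :× (r :× r)) refl (suc r)) (ℕ.*-monoʳ-≤ 4 (ℕ.<⇒≤ (ℕ.≰⇒> ¬h))))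
   where
   double : 2 ℕ.+ r ℕ.≤ 2 ℕ.* suc r
   double = ℕ.≤-trans (ℕ.+-monoˡ-≤ (suc r) (s≤s z≤n)) (ℕ.+-monoʳ-≤ (suc r) (ℕ.≤-reflexive (sym (ℕ.+-identityʳ (suc r)))))

 module Main {X Y : Set} {k l : ℕ} (X↔ : X ↔ Fin k) (Y↔ : Y ↔ Fin l) (f : X × Y → Bool) (n : ℕ) (n≥1 : 1 ℕ.≤ n)
  (C : ℝ∞ 0ℓ) (C-finite : R.Finite C) (C-large : (ι 1ℚ R.÷ κ) R.< C) (f-hard : adv C f R.< ι ½) where

  bound : ℝ∞ 0ℓ
  bound = (κ R.* C R.* (√ fromℕ n)) R.÷ log₂ (C R.* fromℕ n)

  K≤C : ¬ ¬ below C K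
  K≤C ¬h = C-large λ q g → λ p p<q ¬∃ → ¬∃ ((K , λ z k → ≤≡ (hi (In-*-exact (In-ι K) (In-ι (inv K))) z k) (*inv 0<K)) , ≤-trans (<⇒≤ p<q) (¬below⇒≤ {C} ¬h q g))

  -- A uniform public choice among the trees is a protocol of at most c ≤ C bits with advantage 1/2,
  -- against the hardness of f.
  trees-impossible : ∀ (ts : List (Tree X Y)) → 0ℚ < nat (length ts) → ∀ c → below C (nat c) → All (λ t → depth t ℕ.≤ c) ts →
   (∀ x y → ½' * nat (length ts) ≤ Sum ts (λ t → sg (run t x y xor f (x , y)))) → ⊥
  trees-impossible ts ne c c≤C depths good = f-hard λ q h p p<q ¬∃ → ¬∃ ((T.protocol , λ z g → down C (≤-trans (hi (In-fromℕ ‖ T.protocol ‖) z g) (nat-mono (T.protocol-depth depths))) c≤C) ,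
   λ (x , y) → down (bias T.protocol f (x , y)) (≤-trans (<⇒≤ p<q) (≤-trans h ½≤½')) (T.protocol-bias f x y (good x y)))
   where module T = FromTrees ts ne

  -- Without inputs the infimum in `adv` is +∞, so the hypothesis on f already fails.
  empty-impossible : ¬ (X × Y) → ⊥
  empty-impossible ¬xy = K≤C λ h → trees-impossible (output true ∷ []) (0<nat 0) Kᴺ h (z≤n ∷ []) (λ x y → ⊥-elim (¬xy (x , y)))

  module _ (x₀ : X) (y₀ : Y) (c : ℕ) (c≤C : below C (nat c)) (C≤c+1 : C R.≤ ι (nat (suc c))) (K≤C' : below C K) where

   K≤c+1 : Kᴺ ℕ.≤ suc c
   K≤c+1 = nat-cancel-≤ (C≤c+1 K K≤C')

   c-big : 1048576 ℕ.≤ c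
   c-big = ℕ.≤-pred (ℕ.≤-trans (ℕ.≤ᵇ⇒≤ 1048577 Kᴺ tt) K≤c+1)

   c≥1 : 1 ℕ.≤ c
   c≥1 = ℕ.≤-trans (s≤s z≤n) c-big

   cn≥2 : 2 ℕ.≤ c ℕ.* n
   cn≥2 = ℕ.≤-trans (ℕ.≤-trans (ℕ.≤ᵇ⇒≤ 2 1048576 tt) c-big) (≡≤ᴺ (sym (ℕ.*-identityʳ c)) (ℕ.*-monoʳ-≤ c n≥1))

   log : ∃ λ r → ¬ (c ℕ.* n ℕ.< 2 ℕ.^ r) × c ℕ.* n ℕ.< 2 ℕ.^ suc r
   log = threshold {P = λ r → c ℕ.* n ℕ.< 2 ℕ.^ r} (λ r → _ ℕ.<? _) (λ h → ℕ.<-irrefl refl (ℕ.<-≤-trans h (ℕ.≤-trans (s≤s z≤n) cn≥2))) (c ℕ.* n) (n<2^n (c ℕ.* n))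

   module _ (ℓ : ℕ) (2^ℓ≤ : 2 ℕ.^ ℓ ℕ.≤ c ℕ.* n) (cn< : c ℕ.* n ℕ.< 2 ℕ.^ suc ℓ) (ρ : ℕ) (n≤ρ² : n ℕ.≤ ρ ℕ.* ρ) (ρ²≤4n : ρ ℕ.* ρ ℕ.≤ 4 ℕ.* n) where

    ℓ≥1 : 1 ℕ.≤ ℓ
    ℓ≥1 = positive ℓ cn<
     where
     positive : ∀ j → c ℕ.* n ℕ.< 2 ℕ.^ suc j → 1 ℕ.≤ j
     positive (suc j) h = s≤s z≤n
     positive zero    h = ⊥-elim (ℕ.<-irrefl refl (ℕ.<-≤-trans h cn≥2))

    0<nℓ : 0ℚ < nat ℓ
    0<nℓ = <-≤-trans (0<nat 0) (nat-mono ℓ≥1)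

    In-C : In C (nat c) (nat (suc c))
    In-C = c≤C ,, C≤c+1

    In-Cn : In (C R.* fromℕ n) (nat c * nat n) (nat (suc c) * nat n)
    In-Cn = In-*⁺ (0≤nat c) (0≤nat n) In-C (In-fromℕ n)

    log-Cn : ∃ λ u → In (log₂ (C R.* fromℕ n)) (nat ℓ * ½') u
    log-Cn = In-log₂ {C R.* fromℕ n} ℓ (down (C R.* fromℕ n) (≡≤ (sym (nat-2^ ℓ)) (≤≡ (nat-mono 2^ℓ≤) (nat-* c n))) (lo In-Cn)) (hi In-Cn)

    bound≤ : bound R.≤ ι (inv K * nat (suc c) * nat ρ * inv (nat ℓ * ½'))
    bound≤ = ÷-≤ {κ R.* C R.* (√ fromℕ n)} {log₂ (C R.* fromℕ n)} (0≤* (0≤* 1/K≥0 (0≤nat (suc c))) (0≤nat ρ)) (0<* 0<nℓ 0<½') (proj₂ log-Cn)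
     (hi (In-*⁺ (0≤* 1/K≥0 (0≤nat c)) ≤-refl (In-*⁺ 1/K≥0 (0≤nat c) (In-ι (inv K)) In-C) (In-√ {n} {ρ} n≤ρ²)))
     where
     1/K≥0 : 0ℚ ≤ inv K
     1/K≥0 = <⇒≤ (0<inv 0<K)

    -- c + 1 ≤ 2c and the lower bound ℓ/2 for the logarithm give T ℓ K ≤ 4 c ρ. Squaring, with ρ² ≤
    -- 4n, leaves 64 c² n, within the allowed 32² c² n.
    short : ∀ T → fromℕ T R.≤ bound → T ℕ.* T ℕ.* (ℓ ℕ.* ℓ) ℕ.* (Kᴺ ℕ.* Kᴺ) ℕ.≤ c ℕ.* c ℕ.* n ℕ.* (32 ℕ.* 32)
    short T h = ≡≤ᴺ (solveᴺ 3 (λ t l k → t :× t :× (l :× l) :× k :≡ (t :× l) :× (t :× l) :× k) refl T ℓ (Kᴺ ℕ.* Kᴺ))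
     (≡≤ᴺ (squares (T ℕ.* ℓ) Kᴺ) (ℕ.≤-trans (ℕ.*-mono-≤ linear linear)
     (≡≤ᴺ (solveᴺ 2 (λ c r → c :× r :× conᴺ 4 :× (c :× r :× conᴺ 4) :≡ c :× c :× (r :× r) :× conᴺ 16) refl c ρ)
     (ℕ.≤-trans (ℕ.*-monoˡ-≤ 16 (ℕ.*-monoʳ-≤ (c ℕ.* c) ρ²≤4n))
     (≡≤ᴺ (solveᴺ 2 (λ c n → c :× (conᴺ 4 :× n) :× conᴺ 16 :≡ c :× n :× conᴺ 64) refl (c ℕ.* c) n)
      (ℕ.*-monoʳ-≤ (c ℕ.* c ℕ.* n) (ℕ.≤ᵇ⇒≤ 64 1024 tt)))))))
     where
     squares : ∀ a k → a ℕ.* a ℕ.* (k ℕ.* k) ≡ a ℕ.* k ℕ.* (a ℕ.* k)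
     squares = solveᴺ 2 (λ a k → a :× a :× (k :× k) :≡ a :× k :× (a :× k)) refl
     rational : nat T * (nat ℓ * ½') * K ≤ nat (suc c) * nat ρ
     rational = ≤≡ (*≤ʳ (<⇒≤ 0<K) (≤≡ (*≤ʳ (<⇒≤ (0<* 0<nℓ 0<½')) (bound≤ (nat T) (h (nat T) (lo (In-fromℕ T))))) (inv*-cancel (0<* 0<nℓ 0<½'))))
      (trans (solve 4 (λ i c r k → i :* c :* r :* k := c :* r :* (k :* i)) refl (inv K) (nat (suc c)) (nat ρ) K) (trans (cong (nat (suc c) * nat ρ *_) (*inv 0<K)) (*-identityʳ _)))
     doubled : nat (T ℕ.* ℓ ℕ.* Kᴺ) ≤ nat (suc c ℕ.* ρ ℕ.* 2)
     doubled = ≡≤ (trans (trans (nat-* (T ℕ.* ℓ) Kᴺ) (cong (_* K) (nat-* T ℓ))) (trans (trans (sym (*-identityʳ _)) (cong (nat T * nat ℓ * K *_) (sym ½*2))) (solve 5 (λ t l k h w → t :* l :* k :* (h :* w) := t :* (l :* h) :* k :* w) refl (nat T) (nat ℓ) K ½' two)))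
      (≤≡ (*≤ʳ (<⇒≤ 0<two) rational) (sym (trans (nat-* (suc c ℕ.* ρ) 2) (cong₂ _*_ (nat-* (suc c) ρ) nat-2))))
     linear : T ℕ.* ℓ ℕ.* Kᴺ ℕ.≤ c ℕ.* ρ ℕ.* 4
     linear = ℕ.≤-trans (nat-cancel-≤ doubled) (≤≡ᴺ (ℕ.*-monoˡ-≤ 2 (ℕ.*-monoˡ-≤ ρ (ℕ.+-monoˡ-≤ c c≥1)))
      (solveᴺ 2 (λ c r → (c :⊕ c) :× r :× conᴺ 2 :≡ c :× r :× conᴺ 4) refl c ρ))

    P q₀ e : ℚ
    P = (1ℚ + ½' * η) ^ n
    q₀ = (1ℚ - inv K) ^ n
    e = s * inv (nat 5 * P)

    1≤P : 1ℚ ≤ P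
    1≤P = 1≤^ (≤-by+ˡ (0≤* 0≤½' (<⇒≤ 0<η))) n

    0<5P : 0ℚ < nat 5 * P
    0<5P = 0<* (0<nat 4) (<-≤-trans 0<1 1≤P)

    e>0 : 0ℚ < e
    e>0 = 0<* 0<s (0<inv 0<5P)

    e≤½ : e ≤ ½'
    e≤½ = ≤-trans (*≤ˡ (<⇒≤ 0<s) (≤≡ (inv-anti 0<1 (≤-trans 1≤P (≡≤ (sym (*-identityˡ P)) (*≤ʳ (≤-trans 0≤1 1≤P) (≡≤ (sym nat-1) (nat-mono {1} {5} (s≤s z≤n))))))) inv-1)) (≡≤ (*-identityʳ s) s≤½)

    q₀-large : 1ℚ + s ≤ q₀ * P
    q₀-large = ≤-trans (≤-trans (+≤ˡ 1ℚ (≡≤ (sym (trans (cong (_* s) nat-1) (*-identityˡ s))) (*≤ʳ (<⇒≤ 0<s) (nat-mono n≥1)))) (bernoulli (<⇒≤ 0<s) n))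
     (≤≡ (^-mono (0≤+ 0≤1 (<⇒≤ 0<s)) gain n) (^-distrib-* (1ℚ - inv K) (1ℚ + ½' * η) n))

    -- Of the five errors e one is lost in the supremum of `adv`, three in the expectations over the
    -- coins, and one makes `q<` strict. Multiplied by P they amount to s.
    q : ℚ
    q = q₀ - nat 5 * e

    q-large : 1ℚ ≤ q * P
    q-large = ≤≡ (≡≤ (solve 1 (λ s → :1 := :1 :+ s :- s) refl s) (+≤ʳ (- s) q₀-large)) (sym (trans (solve 5 (λ z f s i p → (z :- f :* (s :* i)) :* p := z :* p :- s :* (f :* p :* i)) refl q₀ (nat 5) s (inv (nat 5 * P)) P)
     (cong (λ z → q₀ * P - z) (trans (cong (s *_) (*inv 0<5P)) (*-identityʳ s)))))

    q≥0 : 0ℚ ≤ q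
    q≥0 = *-cancel-≤ (<-≤-trans 0<1 1≤P) (≡≤ (zeroˡ P) (≤-trans 0≤1 q-large))

    impossible : exp (R.- (κ R.* fromℕ n)) R.≤ adv bound (xor-power n f) → ⊥
    impossible h = h q₀ (exp-below {R.- (κ R.* fromℕ n)} 1≤K n decay) (q₀ - e) below-q₀ λ ((π , π≤) , g) → Mixture.mixed-weights π e>0 e≤½ λ (w , w≥0 , w≤1 , estimate) →
     let module M = Mixture π e>0 e≤½
         ts , ne , depths , good = randomised-trees (↔-finite X↔) (↔-finite Y↔) x₀ y₀ f n n≥1 ‖ π ‖ ℓ c ℓ≥1 c-big cn< (short ‖ π ‖ π≤)
          M.indices w M.branchᵗ w≥0 w≤1 M.branch-depth q≥0 q< q-large (λ xs ys → subtract (estimate (xor-power n f) xs ys (q₀ - e) (g (xs , ys))))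
     in trees-impossible ts ne c c≤C depths good
     where
     decay : below (R.- (κ R.* fromℕ n)) (- (nat n * inv K))
     decay = subst (below (R.- (κ R.* fromℕ n))) (cong (λ z → - z) (*-comm (inv K) (nat n))) (lo (In-neg (In-*-exact (In-ι (inv K)) (In-fromℕ n))))
     drop-e : ∀ z → z - e < z
     drop-e z = subst₂ _<_ (+-comm (- e) z) (+-identityˡ z) (+-mono-<-≤ (subst (- e <_) (+-inverseʳ e) (subst (_< e - e) (+-identityˡ (- e)) (+-mono-<-≤ e>0 ≤-refl))) ≤-refl)
     below-q₀ : q₀ - e < q₀
     below-q₀ = drop-e q₀
     q< : q < q₀ - e - (e + e + e)
     q< = subst (_< q₀ - e - (e + e + e)) (trans (solve 2 (λ z e → z :- e :- (e :+ e :+ e) :- e := z :- (e :+ e :+ e :+ e :+ e)) refl q₀ e) (cong (λ z → q₀ - z) (sym five))) (drop-e _)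
      where
      five : nat 5 * e ≡ e + e + e + e + e
      five = trans (cong (_* e) (trans (nat-suc 4) (cong (1ℚ +_) (trans (nat-suc 3) (cong (1ℚ +_) (trans (nat-suc 2) (cong (1ℚ +_) nat-2))))))) (solve 1 (λ e → (:1 :+ (:1 :+ (:1 :+ :2))) :* e := e :+ e :+ e :+ e :+ e) refl e)
     subtract : ∀ {p z} → p ≤ z + (e + e + e) → p - (e + e + e) ≤ z
     subtract {p} {z} k = ≤≡ (+≤ʳ _ k) (solve 2 (λ z t → z :+ t :- t := z) refl z (e + e + e))

  theorem : adv bound (xor-power n f) R.< exp (R.- (κ R.* fromℕ n))
  theorem h = inhabited X↔ Y↔
   where
   nonempty : X → Y → ⊥
   -- A grid of mesh 1 yields an integer c with c ≤ C ≤ c + 1; the double negations vanish because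
   -- the goal is ⊥.
   nonempty x₀ y₀ = K≤C λ K≤ → grid {C} 0<1 (down C (<⇒≤ 0<K) K≤) (proj₂ (proj₂ C-finite)) λ (c , c≤ ,, ≤c) →
    let ℓ , ¬< , cn< = log x₀ y₀ c (subst (below C) (*-identityʳ _) c≤) (λ z g → ≤≡ (≤c z g) (*-identityʳ _)) K≤
        ρ , n≤ρ² , ρ²≤ = square-root n n≥1
    in impossible x₀ y₀ c (subst (below C) (*-identityʳ _) c≤) (λ z g → ≤≡ (≤c z g) (*-identityʳ _)) K≤ ℓ (ℕ.≮⇒≥ ¬<) cn< ρ n≤ρ² ρ²≤ h
   inhabited : ∀ {k l} → X ↔ Fin k → Y ↔ Fin l → ⊥
   inhabited {zero}  i j = empty-impossible λ (x , y) → case Inverse.to i x of λ ()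
   inhabited {suc k} {zero}  i j = empty-impossible λ (x , y) → case Inverse.to j y of λ ()
   inhabited {suc k} {suc l} i j = nonempty (Inverse.from i zero) (Inverse.from j zero)

open import Defs
open import Level using (0ℓ)
open import Data.Bool using (Bool)
open import Data.Fin using (Fin)
open import Data.Nat using (ℕ) renaming (_≤_ to _ℕ≤_)
open import Data.Product using (Σ; _×_; _,_)
open import Data.Rational using (0ℚ; 1ℚ; ½)
open import Function.Bundles using (_↔_)

theorem1 : Σ (ℝ∞ 0ℓ) λ κ → Finite κ × ι 0ℚ < κ ×
    (∀ {X Y : Set} {k l : ℕ} → X ↔ Fin k → Y ↔ Fin l →
    (f : X × Y → Bool) (n : ℕ) → 1 ℕ≤ n →
    (C : ℝ∞ 0ℓ) → Finite C → ι 1ℚ ÷ κ < C →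
    adv C f < ι ½ →
    adv ((κ * C * (√ fromℕ n)) ÷ log₂ (C * fromℕ n)) (xor-power n f) < exp (- (κ * fromℕ n)))
theorem1 = Conclusion.κ , Conclusion.κ-finite , Conclusion.0<κ , λ i j f n n≥1 C C-finite C-large f-hard →
  Conclusion.Main.theorem i j f n n≥1 C C-finite C-large f-hard
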